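{- Let $q$ be an odd prime power and, for $n\ge1$, let $P_n=P((q^2)^{3^n})$. Then $P=\{P_n\}_{n=1}^\infty$ is an induced universal graph series. Moreover: (1) For every $k$, letting $\mathcal{A}_k$ be the set of all simple graphs with at most $k$ vertices, $I_P(\mathcal{A}_k)\le\lceil\log_3\log_q((k-1)2^{k-2})\rceil$. (2) Let $m$ be a positive integer and let $k_1,k_2$ be integers with $q^{3^{m-1}}-1\le k_1\le k_2\le q^{3^m}-1$. (a) For every $G\in\{K_{k_1,k_2},C_{2k_1},P_{k_1+k_2-1}\}$, \[ i_P(G)\le\left\lceil\log_3\log_q\left((q^{3^m}-3)\binom{q^{3^m}-1}{\frac{q^{3^m}-1}{2}}+3\right)\right\rceil. \] (b) \[ i_P(C_{2k_1+1})\le\left\lceil\log_3\log_q\left(2^{q^{3^m}}(q^{3^m}-2)\binom{q^{3^m}-1}{\frac{q^{3^m}-1}{2}}+3\right)\right\rceil. \] (3) For every integer $k\ge3$, $\widetilde{i}_P(C_k)=\widetilde{i}_P(P_k)=\left\lceil\log_3\tfrac12(\log_q k)\right\rceil$.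
   Context: For a prime power $r\equiv1\pmod 4$, the Paley graph $P(r)$ has vertex set $\mathbb{F}_r$, with $u,v$ adjacent iff $u-v$ is a nonzero square in $\mathbb{F}_r$. A family $\{H_n\}_{n\in N}$ is a universal graph series if every finite simple graph is an induced subgraph of some $H_n$; it is induced universal if moreover $H_m$ is an induced subgraph of $H_n$ whenever $m\le n$. $K_{a,b}$ is the complete bipartite graph with parts of sizes $a,b$; $C_k$ and $P_k$ are the cycle and the path on $k$ vertices. For graphs $G,H$ and indeterminates $x_u$ ($u\in V(H)$), $X_H(G)=\sum_{\varphi\in\mathrm{Hom}(G,H)}\prod_{v\in V(G)}x_{\varphi(v)}$, where $\mathrm{Hom}(G,H)$ is the set of graph homomorphisms. For a class $\mathcal{A}$ of graphs, $I_P(\mathcal{A})=\min\{t\ge1 : \text{the family }(X_{P_n}(\bullet))_{n=1}^t\text{ is a complete invariant on }\mathcal{A}\}$, i.e. for $G,G'\in\mathcal{A}$, $X_{P_n}(G)=X_{P_n}(G')$ for all $n\le t$ iff $G\cong G'$. The Paley-induced index is $i_P(G)=\min\{n\ge1 : G\text{ is an induced subgraph of }P_n\}$ and the Paley index is $\widetilde{i}_P(G)=\min\{n\ge1 : G\text{ is a subgraph of }P_n\}$.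
   Formalization: Each ceiling is read as max(1, ⌈…⌉), the least n ≥ 1 that is admissible, since the indices are at least 1 while the literal ceiling can be ≤ 0 or undefined (e.g. q = 3, k = 3 in (3), or small k in (1)); where the ceiling is ≥ 1 nothing changes. -}

module Defs where

open import Data.Bool using (Bool; true; false; _∧_; _∨_; not; _xor_)
open import Data.Nat using (ℕ; zero; suc; _+_; _*_; _∸_; _^_; _≤_; _<_; _%_; _/_; _≡ᵇ_; _<ᵇ_)
open import Data.Nat.Primality using (Prime)
open import Data.Nat.Combinatorics using (_C_)
open import Data.Fin using (Fin; toℕ) renaming (zero to fz; suc to fs)
import Data.Fin as Fin
open import Data.List.Base using (List; []; _∷_; allFin; map; concatMap; length; filterᵇ)
open import Data.Bool.ListAction using (all; any)
open import Data.Product using (Σ; ∃; _×_; _,_)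
open import Function.Bundles using (_⇔_)
open import Relation.Nullary using (¬_; does)
open import Relation.Binary.PropositionalEquality using (_≡_; _≢_)
open import Algebra.Structures using (IsCommutativeRing)

record Graph : Set where
  field
    size : ℕ
    adj  : Fin size → Fin size → Bool
open Graph public

IsSimple : Graph → Set
IsSimple G = (∀ u → adj G u u ≡ false) × (∀ u v → adj G u v ≡ adj G v u)

Injective : ∀ {n m} → (Fin n → Fin m) → Set
Injective f = ∀ x y → f x ≡ f y → x ≡ y

_⊑ᵢ_ : Graph → Graph → Set
G ⊑ᵢ H = Σ (Fin (size G) → Fin (size H)) λ f →
  Injective f × (∀ u v → adj G u v ≡ adj H (f u) (f v))

_⊑_ : Graph → Graph → Set
G ⊑ H = Σ (Fin (size G) → Fin (size H)) λ f →
  Injective f × (∀ u v → adj G u v ≡ true → adj H (f u) (f v) ≡ true)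

_≅_ : Graph → Graph → Set
G ≅ H = Σ (Fin (size G) → Fin (size H)) λ f → Σ (Fin (size H) → Fin (size G)) λ g →
  (∀ x → g (f x) ≡ x) × (∀ y → f (g y) ≡ y) × (∀ u v → adj G u v ≡ adj H (f u) (f v))

_==_ : ℕ → ℕ → Bool
_==_ = _≡ᵇ_

K : ℕ → ℕ → Graph
K a b = record { size = a + b ; adj = λ i j → (toℕ i <ᵇ a) xor (toℕ j <ᵇ a) }

Path : ℕ → Graph
Path k = record { size = k ; adj = λ i j → (suc (toℕ i) == toℕ j) ∨ (suc (toℕ j) == toℕ i) }

-- cycle C_k on vertices 0..k-1 (intended for k ≥ 3): path plus edge {0,k-1}
Cycle : ℕ → Graph
Cycle k = record { size = k ; adj = λ i j →
  (suc (toℕ i) == toℕ j) ∨ (suc (toℕ j) == toℕ i)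
  ∨ ((toℕ i == 0) ∧ (toℕ j == (k ∸ 1)))
  ∨ ((toℕ j == 0) ∧ (toℕ i == (k ∸ 1))) }

-- Finite fields: a field structure on the finite set Fin r
-- (every finite field of order r is isomorphic to one of these).

record FieldOn (r : ℕ) : Set where
  field
    _+ᶠ_ _*ᶠ_ : Fin r → Fin r → Fin r
    -ᶠ_ : Fin r → Fin r
    0ᶠ 1ᶠ : Fin r
    isCommutativeRing : IsCommutativeRing _≡_ _+ᶠ_ _*ᶠ_ -ᶠ_ 0ᶠ 1ᶠ
    0≢1 : 0ᶠ ≢ 1ᶠ
    inverse : ∀ x → x ≢ 0ᶠ → ∃ λ y → x *ᶠ y ≡ 1ᶠ

Paley : ∀ {r} → FieldOn r → Graph
Paley {r} F = record { size = r ; adj = λ u v → nzSq (u +ᶠ (-ᶠ v)) }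
  where
  open FieldOn F
  nzSq : Fin r → Bool
  nzSq d = not (does (d Fin.≟ 0ᶠ)) ∧ any (λ w → does ((w *ᶠ w) Fin.≟ d)) (allFin r)

OddPrimePower : ℕ → Set
OddPrimePower q = Σ ℕ λ p → Prime p × (p % 2 ≡ 1) × Σ ℕ λ k → (1 ≤ k) × (q ≡ p ^ k)

-- The graph polynomial X_H(G), represented by its coefficient function:
-- the coefficient of the monomial ∏_u x_u^(a u) is the number of
-- homomorphisms φ : G → H with |φ⁻¹(u)| = a u for all u ∈ V(H).

allFuns : (n m : ℕ) → List (Fin n → Fin m)
allFuns zero m = (λ ()) ∷ []
allFuns (suc n) m = concatMap (λ f → map (λ x → cons x f) (allFin m)) (allFuns n m)
  where
  cons : ∀ {m} → Fin m → (Fin n → Fin m) → Fin (suc n) → Fin m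
  cons x f fz = x
  cons x f (fs i) = f i

isHom : (G H : Graph) → (Fin (size G) → Fin (size H)) → Bool
isHom G H f = all (λ u → all (λ v → not (adj G u v) ∨ adj H (f u) (f v)) (allFin (size G))) (allFin (size G))

fiber : ∀ {n m} → (Fin n → Fin m) → Fin m → ℕ
fiber {n} f u = length (filterᵇ (λ v → does (f v Fin.≟ u)) (allFin n))

X : (H G : Graph) → (Fin (size H) → ℕ) → ℕ
X H G a = length (filterᵇ (λ f → isHom G H f ∧ all (λ u → fiber f u == a u) (allFin (size H)))
                          (allFuns (size G) (size H)))

XEq : (H G G' : Graph) → Set
XEq H G G' = ∀ a → X H G a ≡ X H G' a

-- Notions relative to a graph series P : ℕ → Graph (indexed from 1)

IsMin : (ℕ → Set) → ℕ → Set
IsMin Q t = Q t × (∀ s → Q s → t ≤ s)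

InducedUniversal : (ℕ → Graph) → Set
InducedUniversal P =
  (∀ G → IsSimple G → Σ ℕ λ n → (1 ≤ n) × (G ⊑ᵢ P n))
  × (∀ m n → 1 ≤ m → m ≤ n → P m ⊑ᵢ P n)

CompleteInvariantOn≤ : (ℕ → Graph) → ℕ → ℕ → Set
CompleteInvariantOn≤ P k t = ∀ G G' → IsSimple G → IsSimple G' → size G ≤ k → size G' ≤ k →
  ((∀ n → 1 ≤ n → n ≤ t → XEq (P n) G G') ⇔ (G ≅ G'))

IP≤ : (ℕ → Graph) → ℕ → ℕ → Set
IP≤ P k s = Σ ℕ λ t → (t ≤ s) × IsMin (λ t → (1 ≤ t) × CompleteInvariantOn≤ P k t) t

InducedIndex : (ℕ → Graph) → Graph → ℕ → Set
InducedIndex P G = IsMin (λ n → (1 ≤ n) × (G ⊑ᵢ P n))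

Index : (ℕ → Graph) → Graph → ℕ → Set
Index P G = IsMin (λ n → (1 ≤ n) × (G ⊑ P n))

-- CeilLog3Logq q x s : s is the least integer s ≥ 1 with  log₃ log_q x ≤ s,
-- i.e. with x ≤ q^(3^s)   (this is max(1, ⌈log₃ log_q x⌉))
CeilLog3Logq : ℕ → ℕ → ℕ → Set
CeilLog3Logq q x = IsMin (λ s → (1 ≤ s) × (x ≤ q ^ (3 ^ s)))

-- CeilLog3HalfLogq q k s : s is the least integer s ≥ 1 with log₃ (½ log_q k) ≤ s,
-- i.e. with k ≤ q^(2·3^s)   (this is max(1, ⌈log₃ ½ log_q k⌉))
CeilLog3HalfLogq : ℕ → ℕ → ℕ → Set
CeilLog3HalfLogq q k = IsMin (λ s → (1 ≤ s) × (k ≤ q ^ (2 * 3 ^ s)))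

{-# OPTIONS --safe #-}
-- Write n = q^(3^s), so that P_s is the Paley graph of a field K with n² elements, χ for the quadratic character of K, and
-- F for the subfield with n elements, all of whose nonzero elements are squares in K.  No estimate for character sums is
-- needed beyond orthogonality.
-- * Every graph with at most log₂ n vertices is induced in P_s: choose the images one at a time, keeping a large set of
--   candidates for each remaining vertex; the second moment of x ↦ ∑_{y ∈ B} χ(x - y) shows that some choice roughly halves
--   all of them.  This gives universality, (1) and (2b).
-- * P_m is induced in P_n: the generator g of the small field and a root β of its minimal polynomial in the large one give
--   the embedding gⁱ ↦ βⁱ, and β is a nonsquare because the quotient of the orders of the unit groups is odd.
-- * X_{P_s} separates graphs that embed in P_s: the coefficient of the monomial of an embedding yields bijective
--   homomorphisms in both directions.
-- * (3): F + δF with δ a square outside F contains the n × n rook's graph, which is pancyclic.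
-- * (2a): between two independent lines in K the edges form a balanced design with small average pair correlations.
--   Bicliques come from the Kővári–Sós–Turán argument, applied after some vertices have been chosen greedily.  Even cycles:
--   for a random tuple of k points of one line, join two of them if some point of the other line sees exactly this pair; a
--   second moment argument in two stages verifies Pósa's degree condition, and a Hamilton cycle is an induced 2k-cycle.
module Submission where

open import Data.Bool.Base using (Bool; _xor_; _∧_; _∨_; false; if_then_else_; not; true)
open import Data.Empty using (⊥; ⊥-elim)
open import Data.Product using (_,_; _×_; proj₁; proj₂; Σ; ∃)
open import Data.Sum using ([_,_]′; _⊎_; inj₁; inj₂)
open import Data.Unit using (tt)
open import Function.Base using (_∘_; id)
open import Relation.Binary.PropositionalEquality hiding (J)
open import Relation.Nullary using (Dec; does; no; yes; ¬_)
open import Relation.Nullary.Decidable using (True; _×-dec_; _→-dec_; dec-false; dec-true; decidable-stable; map′; toWitness; ¬?)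
open import Data.Nat.Base using (ℕ; zero; suc; s≤s; z≤n)
open import Data.Fin.Base using (Fin; zero; suc; toℕ)
open import Data.Integer.Base using (ℤ; -[1+_]; 0ℤ; 1ℤ; -1ℤ; +≤+; +<+)
import Data.Fin.Properties as Fin
import Data.Integer.Base as ℤ
import Data.Integer.Properties as ℤ
import Data.Nat.Base as ℕ
import Data.Nat.Properties as ℕ
import Data.Nat.Divisibility as ℕ
import Data.Fin.Base as Fin
import Data.Integer.Tactic.RingSolver as ℤ
import Data.Nat.Tactic.RingSolver as ℕ
import Data.Bool.Properties as Bool

-- The hypothesis of (2a) makes a line only about √a times larger than 2ᵃ, where a = q^(3^m) - 1,
-- and this shapes both constructions there. A union bound over the k pairs of a 2k-cycle would cost
-- a factor k, so for large k some pairs have to be given up; Pósa's condition tolerates this. A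
-- vertex u of low degree must then be refuted through all its partners at once. On a single random
-- tuple the points that see u and exactly one more vertex have different patterns. Once the first k
-- - h vertices are fixed, those whose second vertex lies among them share one pattern on the last h
-- vertices, so one variance bound controls their union: hence two stages. For bicliques the same
-- shortage is met by leaving only h = O(log a) vertices to the averaging. For small a the constants
-- still exceed √a. There the double exponential growth helps: for q^(3^m) < 64000 no q^(3^s) lies
-- between 2ᵃ and 2^(a+16), so passing 2ᵃ already yields a factor 2^16.

module Sums where

 -- Finite sums of integers and averaging

 open import Data.Fin.Base using (inject₁; fromℕ)
 open import Data.Fin.Properties using (suc-injective)
 open import Data.Integer.Base using (+_; _+_; _*_; _-_; -_; _≤_; _<_)
 open import Data.Integer.Properties
 open import Data.Integer.Tactic.RingSolver using (solve-∀)
 import Algebra.Properties.CommutativeMonoid.Sum ℤ.+-0-commutativeMonoid as Sum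
 import Algebra.Properties.Semiring.Sum ℤ.+-*-semiring as SemiringSum

 -- Abstract, so that equality of sums is solved by comparing the summands.
 abstract
   sum : ∀ {n} → (Fin n → ℤ) → ℤ
   sum = Sum.sum

   ∑-[] : ∀ (f : Fin 0 → ℤ) → sum f ≡ 0ℤ
   ∑-[] f = refl

   ∑-∷ : ∀ {n} (f : Fin (suc n) → ℤ) → sum f ≡ f zero + sum (f ∘ suc)
   ∑-∷ f = refl

   ∑-snoc : ∀ {n} (f : Fin (suc n) → ℤ) → sum f ≡ sum (λ i → f (inject₁ i)) + f (fromℕ n)
   ∑-snoc = Sum.sum-init-last

   ∑-cong : ∀ {n} {f g : Fin n → ℤ} → (∀ i → f i ≡ g i) → sum f ≡ sum g
   ∑-cong = Sum.sum-cong-≗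

   ∑-+ : ∀ {n} (f g : Fin n → ℤ) → sum (λ i → f i + g i) ≡ sum f + sum g
   ∑-+ = Sum.∑-distrib-+

   ∑-comm : ∀ {m n} (f : Fin m → Fin n → ℤ) → sum (λ i → sum (λ j → f i j)) ≡ sum (λ j → sum (λ i → f i j))
   ∑-comm = Sum.∑-comm

   ∑-*ˡ : ∀ {n} c (f : Fin n → ℤ) → sum (λ i → c * f i) ≡ c * sum f
   ∑-*ˡ c f = sym (SemiringSum.*-distribˡ-sum c f)

   ∑-*ʳ : ∀ {n} c (f : Fin n → ℤ) → sum (λ i → f i * c) ≡ sum f * c
   ∑-*ʳ c f = sym (SemiringSum.*-distribʳ-sum c f)

 infixl 10 ∑-syntax
 ∑-syntax : ∀ n → (Fin n → ℤ) → ℤ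
 ∑-syntax n f = sum f
 syntax ∑-syntax n (λ i → x) = ∑[ i < n ] x

 *-0≤ : ∀ {a b} → 0ℤ ≤ a → 0ℤ ≤ b → 0ℤ ≤ a * b
 *-0≤ {+ a} {+ b} _ _ = subst (0ℤ ≤_) (ℤ.pos-* a b) (+≤+ ℕ.z≤n)

 *-monoˡ : ∀ {a b} c → 0ℤ ≤ c → a ≤ b → c * a ≤ c * b
 *-monoˡ (+ c) _ = ℤ.*-monoˡ-≤-nonNeg (+ c)

 *-monoʳ : ∀ {a b} c → 0ℤ ≤ c → a ≤ b → a * c ≤ b * c
 *-monoʳ (+ c) _ = ℤ.*-monoʳ-≤-nonNeg (+ c)

 *-mono : ∀ {a b c d} → 0ℤ ≤ a → 0ℤ ≤ d → a ≤ b → c ≤ d → a * c ≤ b * d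
 *-mono {a} {d = d} 0≤a 0≤d a≤b c≤d = ≤-trans (*-monoˡ a 0≤a c≤d) (*-monoʳ d 0≤d a≤b)

 *-cancelˡ : ∀ {a b} c → 0ℤ < c → c * a ≤ c * b → a ≤ b
 *-cancelˡ (+ suc c) _ = ℤ.*-cancelˡ-≤-pos _ _ (+ suc c)
 *-cancelˡ (+ 0) (+<+ ())

 0≤sq : ∀ a → 0ℤ ≤ a * a
 0≤sq (+ a) = *-0≤ {+ a} {+ a} (+≤+ ℕ.z≤n) (+≤+ ℕ.z≤n)
 0≤sq -[1+ a ] = +≤+ ℕ.z≤n

 0≤+ : ∀ {a b} → 0ℤ ≤ a → 0ℤ ≤ b → 0ℤ ≤ a + b
 0≤+ = ℤ.+-mono-≤

 ≤-cert : ∀ {a b} d → 0ℤ ≤ d → b ≡ a + d → a ≤ b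
 ≤-cert {a} d 0≤d refl = subst (_≤ a + d) (ℤ.+-identityʳ a) (ℤ.+-monoʳ-≤ a 0≤d)

 ≤-diff : ∀ {a b} → a ≤ b → 0ℤ ≤ b - a
 ≤-diff = ℤ.i≤j⇒0≤j-i

 +-cancelˡ : ∀ {a b} c → c + a ≤ c + b → a ≤ b
 +-cancelˡ {a} {b} c h = ≤-cert ((c + b) - (c + a)) (≤-diff h) (lem a b c)
   where
   lem : ∀ a b c → b ≡ a + ((c + b) - (c + a))
   lem = solve-∀

 sq-mono⁻¹ : ∀ a b → 0ℤ ≤ b → a * a ≤ b * b → a ≤ b
 sq-mono⁻¹ a b 0≤b h with ℤ.≤-total a b
 ... | inj₁ a≤b = a≤b
 ... | inj₂ b≤a with a ℤ.≟ b
 ...   | yes refl = ≤-refl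
 ...   | no a≢b = ⊥-elim (ℤ.<⇒≱ b*b<a*a h)
   where
   b<a : b < a
   b<a = ℤ.≤∧≢⇒< b≤a (a≢b ∘ sym)
   e : a * a ≡ b * b + ((a - b) * (a - b) + (b + b) * (a - b))
   e = lem a b
     where lem : ∀ a b → a * a ≡ b * b + ((a - b) * (a - b) + (b + b) * (a - b))
           lem = solve-∀
   0<d : 0ℤ < a - b
   0<d = subst (_< a - b) (ℤ.+-inverseʳ b) (ℤ.+-monoˡ-< (- b) b<a)
   pos-sq : ∀ d → 0ℤ < d → 0ℤ < d * d
   pos-sq (+ suc d) _ = +<+ (ℕ.s≤s ℕ.z≤n)
   pos-sq (+ 0) (+<+ ())
   b*b<a*a : b * b < a * a
   b*b<a*a = subst (b * b <_) (sym e) (subst (_< b * b + ((a - b) * (a - b) + (b + b) * (a - b))) (ℤ.+-identityʳ (b * b))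
     (ℤ.+-monoʳ-< (b * b) (ℤ.+-mono-<-≤ (pos-sq _ 0<d) (*-0≤ (0≤+ 0≤b 0≤b) (ℤ.<⇒≤ 0<d)))))

 abstract
   ∑-0 : ∀ n → sum {n} (λ _ → 0ℤ) ≡ 0ℤ
   ∑-0 zero = refl
   ∑-0 (suc n) = trans (ℤ.+-identityˡ _) (∑-0 n)

 abstract
   ∑-const : ∀ n c → sum {n} (λ _ → c) ≡ + n * c
   ∑-const zero c = refl
   ∑-const (suc n) c = trans (cong (λ z → c + z) (∑-const n c)) (sym (ℤ.suc-* (+ n) c))

 abstract
   ∑-neg : ∀ {n} (f : Fin n → ℤ) → sum (λ i → - f i) ≡ - sum f
   ∑-neg {zero} f = refl
   ∑-neg {suc n} f = trans (cong (λ z → - f zero + z) (∑-neg (f ∘ suc))) (sym (ℤ.neg-distrib-+ (f zero) _))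

 ∑-ones : ∀ n → sum {n} (λ _ → 1ℤ) ≡ + n
 ∑-ones n = trans (∑-const n 1ℤ) (ℤ.*-identityʳ (+ n))

 ∑-sub : ∀ {n} (f g : Fin n → ℤ) → sum (λ i → f i - g i) ≡ sum f - sum g
 ∑-sub f g = trans (∑-+ f (λ i → - g i)) (cong (λ z → sum f + z) (∑-neg g))

 abstract
   ∑-mono : ∀ {n} {f g : Fin n → ℤ} → (∀ i → f i ≤ g i) → sum f ≤ sum g
   ∑-mono {zero} h = ≤-refl
   ∑-mono {suc n} h = ℤ.+-mono-≤ (h zero) (∑-mono (h ∘ suc))

 abstract
   ∑-0≤ : ∀ {n} {f : Fin n → ℤ} → (∀ i → 0ℤ ≤ f i) → 0ℤ ≤ sum f
   ∑-0≤ {zero} h = ≤-refl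
   ∑-0≤ {suc n} h = 0≤+ (h zero) (∑-0≤ (h ∘ suc))

 abstract
   ∑-term : ∀ {n} {f : Fin n → ℤ} → (∀ i → 0ℤ ≤ f i) → ∀ i → f i ≤ sum f
   ∑-term {suc n} {f} h zero = subst (λ z → z ≤ f zero + sum (f ∘ suc)) (ℤ.+-identityʳ _) (ℤ.+-monoʳ-≤ (f zero) (∑-0≤ (h ∘ suc)))
   ∑-term {suc n} {f} h (suc i) =
     ≤-trans (∑-term (h ∘ suc) i) (subst (λ z → z ≤ f zero + sum (f ∘ suc)) (ℤ.+-identityˡ _) (ℤ.+-monoˡ-≤ (sum (f ∘ suc)) (h zero)))

 ∑-sq : ∀ {n} (f : Fin n → ℤ) → sum f * sum f ≡ ∑[ i < n ] (∑[ j < n ] (f i * f j))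
 ∑-sq f = trans (sym (∑-*ʳ (sum f) f)) (∑-cong λ i → sym (∑-*ˡ (f i) f))

 𝟙 : Bool → ℤ
 𝟙 true = 1ℤ
 𝟙 false = 0ℤ

 0≤𝟙 : ∀ b → 0ℤ ≤ 𝟙 b
 0≤𝟙 true = +≤+ ℕ.z≤n
 0≤𝟙 false = ≤-refl

 𝟙≤1 : ∀ b → 𝟙 b ≤ 1ℤ
 𝟙≤1 true = ≤-refl
 𝟙≤1 false = +≤+ ℕ.z≤n

 𝟙-∧ : ∀ a b → 𝟙 (a ∧ b) ≡ 𝟙 a * 𝟙 b
 𝟙-∧ true true = refl
 𝟙-∧ true false = refl
 𝟙-∧ false b = refl

 𝟙*≤ : ∀ b {x} → 0ℤ ≤ x → 𝟙 b * x ≤ x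
 𝟙*≤ true {x} _ = ℤ.≤-reflexive (ℤ.*-identityˡ x)
 𝟙*≤ false {x} 0≤x = subst (_≤ x) (sym (ℤ.*-zeroˡ x)) 0≤x

 0<𝟙* : ∀ b {x} → 0ℤ < 𝟙 b * x → b ≡ true
 0<𝟙* true _ = refl
 0<𝟙* false {x} h = ⊥-elim (ℤ.<-irrefl refl (subst (0ℤ <_) (ℤ.*-zeroˡ x) h))

 δ : ∀ {n} → Fin n → Fin n → ℤ
 δ i j = 𝟙 (does (i Fin.≟ j))

 δ-refl : ∀ {n} (i : Fin n) → δ i i ≡ 1ℤ
 δ-refl i = cong 𝟙 (dec-true (i Fin.≟ i) refl)

 δ-≢ : ∀ {n} {i j : Fin n} → i ≢ j → δ i j ≡ 0ℤ
 δ-≢ {i = i} {j} h = cong 𝟙 (dec-false (i Fin.≟ j) h)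

 δ-cases : ∀ {n} (i j : Fin n) → (i ≡ j × δ i j ≡ 1ℤ) ⊎ (i ≢ j × δ i j ≡ 0ℤ)
 δ-cases i j with i Fin.≟ j
 ... | yes p = inj₁ (p , refl)
 ... | no p = inj₂ (p , refl)

 δ-suc : ∀ {n} (i j : Fin n) → δ (suc i) (suc j) ≡ δ i j
 δ-suc i j with i Fin.≟ j
 ... | yes _ = refl
 ... | no _ = refl

 abstract
   ∑-δ : ∀ {n} (i : Fin n) (f : Fin n → ℤ) → ∑[ j < n ] (δ i j * f j) ≡ f i
   ∑-δ {suc n} zero f = trans (cong₂ _+_ (ℤ.*-identityˡ (f zero)) (trans (∑-cong λ j → ℤ.*-zeroˡ (f (suc j))) (∑-0 n))) (ℤ.+-identityʳ _)
   ∑-δ {suc n} (suc i) f = trans (cong₂ _+_ (ℤ.*-zeroˡ (f zero)) (trans (∑-cong λ j → cong (_* f (suc j)) (δ-suc i j)) (∑-δ i (f ∘ suc)))) (ℤ.+-identityˡ _)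

 ∑-δ1 : ∀ {n} (i : Fin n) → sum (δ i) ≡ 1ℤ
 ∑-δ1 i = trans (∑-cong λ j → sym (ℤ.*-identityʳ (δ i j))) (∑-δ i (λ _ → 1ℤ))

 δ-sym : ∀ {n} (i j : Fin n) → δ i j ≡ δ j i
 δ-sym i j with i Fin.≟ j
 ... | yes refl = sym (δ-refl i)
 ... | no h = sym (δ-≢ (h ∘ sym))

 abstract
   ∑-fiber≤1 : ∀ {m} (b : Fin m → Bool) →
     (∀ i j → b i ≡ true → b j ≡ true → i ≡ j) → ∑[ i < m ] 𝟙 (b i) ≤ 1ℤ
   ∑-fiber≤1 {zero} b h = +≤+ ℕ.z≤n
   ∑-fiber≤1 {suc m} b h with b zero in eq
   ... | false = subst (_≤ 1ℤ) (sym (ℤ.+-identityˡ _)) (∑-fiber≤1 (b ∘ suc) (λ i j p q → suc-injective (h _ _ p q)))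
   ... | true = subst (λ z → 1ℤ + z ≤ 1ℤ) (sym z) ≤-refl
     where
     none : ∀ i → 𝟙 (b (suc i)) ≡ 0ℤ
     none i with b (suc i) in eq'
     ... | false = refl
     ... | true with () ← h zero (suc i) eq eq'
     z : ∑[ i < m ] 𝟙 (b (suc i)) ≡ 0ℤ
     z = trans (∑-cong none) (∑-0 m)

 does-true : ∀ {n} {i j : Fin n} → does (i Fin.≟ j) ≡ true → i ≡ j
 does-true {i = i} {j} h with i Fin.≟ j
 ... | yes p = p

 -- Expanding f (σ i) through δ turns the left side into a sum over j weighted by the fibre sizes of
 -- σ, which injectivity bounds by 1.
 ∑-inj-≤ : ∀ {m n} (σ : Fin m → Fin n) → (∀ i j → σ i ≡ σ j → i ≡ j) →
   (f : Fin n → ℤ) → (∀ i → 0ℤ ≤ f i) → ∑[ i < m ] f (σ i) ≤ sum f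
 ∑-inj-≤ {m} {n} σ inj f 0≤f = subst (_≤ sum f) (sym step) (∑-mono bound)
   where
   step : ∑[ i < m ] f (σ i) ≡ ∑[ j < n ] ((∑[ i < m ] δ (σ i) j) * f j)
   step = trans (∑-cong λ i → sym (∑-δ (σ i) f)) (trans (∑-comm (λ i j → δ (σ i) j * f j)) (∑-cong λ j → ∑-*ʳ (f j) (λ i → δ (σ i) j)))
   bound : ∀ j → (∑[ i < m ] δ (σ i) j) * f j ≤ f j
   bound j = subst ((∑[ i < m ] δ (σ i) j) * f j ≤_) (ℤ.*-identityˡ _)
     (*-monoʳ (f j) (0≤f j) (∑-fiber≤1 (λ i → does (σ i Fin.≟ j)) (λ i i' p q → inj i i' (trans (does-true p) (sym (does-true q))))))

 abstract
   -- A missed value y would extend σ to an injection of `Fin (suc n)` into `Fin n`.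
   inj⇒surj : ∀ {n} (σ : Fin n → Fin n) → (∀ i j → σ i ≡ σ j → i ≡ j) → ∀ y → ∃ λ x → σ x ≡ y
   inj⇒surj {n} σ inj y with Fin.any? (λ x → σ x Fin.≟ y)
   ... | yes p = p
   ... | no ¬p = ⊥-elim (ℕ.<-irrefl refl (Fin.injective⇒≤ {f = τ} τ-inj))
     where
     τ : Fin (suc n) → Fin n
     τ zero = y
     τ (suc i) = σ i
     τ-inj : ∀ {i j} → τ i ≡ τ j → i ≡ j
     τ-inj {zero} {zero} _ = refl
     τ-inj {zero} {suc j} e = ⊥-elim (¬p (j , sym e))
     τ-inj {suc i} {zero} e = ⊥-elim (¬p (i , e))
     τ-inj {suc i} {suc j} e = cong suc (inj i j e)

 ∑-inj : ∀ {n} (σ : Fin n → Fin n) → (∀ i j → σ i ≡ σ j → i ≡ j) →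
   (f : Fin n → ℤ) → ∑[ i < n ] f (σ i) ≡ sum f
 ∑-inj {n} σ inj f = trans step (∑-cong λ j → trans (cong (_* f j) (one j)) (ℤ.*-identityˡ _))
   where
   step : ∑[ i < n ] f (σ i) ≡ ∑[ j < n ] ((∑[ i < n ] δ (σ i) j) * f j)
   step = trans (∑-cong λ i → sym (∑-δ (σ i) f)) (trans (∑-comm (λ i j → δ (σ i) j * f j)) (∑-cong λ j → ∑-*ʳ (f j) (λ i → δ (σ i) j)))
   one : ∀ j → ∑[ i < n ] δ (σ i) j ≡ 1ℤ
   one j with x , refl ← inj⇒surj σ inj j = trans (∑-cong λ i → conv i) (∑-δ1 x)
     where
     conv : ∀ i → δ (σ i) (σ x) ≡ δ x i
     conv i with x Fin.≟ i
     ... | yes refl = δ-refl (σ x)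
     ... | no h = δ-≢ (λ e → h (sym (inj i x e)))

 abstract
   ∑-pos : ∀ {n} (f : Fin n → ℤ) → 0ℤ < sum f → ∃ λ i → 0ℤ < f i
   ∑-pos {suc n} f h with 0ℤ ℤ.<? f zero
   ... | yes p = zero , p
   ... | no ¬p with i , q ← ∑-pos (f ∘ suc) (ℤ.<-≤-trans h (subst (f zero + sum (f ∘ suc) ≤_) (ℤ.+-identityˡ _) (ℤ.+-monoˡ-≤ (sum (f ∘ suc)) (ℤ.≮⇒≥ ¬p)))) = suc i , q
   ∑-pos {zero} f (+<+ ())

 abstract
   -- The selection principle of the averaging arguments: if f exceeded g wherever w is positive,
   -- the weighted sums would compare strictly the other way. All conditions are decidable, so the
   -- index is found by search.
   ∑-avg : ∀ {n} (w f g : Fin n → ℤ) → (∀ i → 0ℤ ≤ w i) → 0ℤ < sum w →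
     ∑[ i < n ] (w i * f i) ≤ ∑[ i < n ] (w i * g i) → ∃ λ i → 0ℤ < w i × f i ≤ g i
   ∑-avg {n} w f g 0≤w 0<w h with Fin.any? (λ i → (0ℤ ℤ.<? w i) ×-dec' (f i ℤ.≤? g i))
     where
     _×-dec'_ : ∀ {A B : Set} → Dec A → Dec B → Dec (A × B)
     yes a ×-dec' yes b = yes (a , b)
     yes a ×-dec' no b = no (b ∘ proj₂)
     no a ×-dec' _ = no (a ∘ proj₁)
   ... | yes p = p
   ... | no ¬p with i₀ , 0<wi₀ ← ∑-pos w 0<w = ⊥-elim (ℤ.<⇒≱ strict h)
     where
     g<f : ∀ i → 0ℤ < w i → g i < f i
     g<f i p = ℤ.≰⇒> (λ q → ¬p (i , p , q))
     d : ∀ i → 0ℤ ≤ w i * (f i - g i)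
     d i with 0ℤ ℤ.<? w i
     ... | yes p = *-0≤ (0≤w i) (≤-diff (ℤ.<⇒≤ (g<f i p)))
     ... | no q = subst (λ z → 0ℤ ≤ z * (f i - g i)) (ℤ.≤-antisym (0≤w i) (ℤ.≮⇒≥ q)) (subst (0ℤ ≤_) (sym (ℤ.*-zeroˡ (f i - g i))) ≤-refl)
     pos* : ∀ a b → 0ℤ < a → 0ℤ < b → 0ℤ < a * b
     pos* (+ suc a) (+ suc b) _ _ = +<+ (ℕ.s≤s ℕ.z≤n)
     pos* (+ 0) b (+<+ ()) _
     pos* a (+ 0) _ (+<+ ())
     pos* (+ suc a) -[1+ b ] _ ()
     d₀ : 0ℤ < sum (λ i → w i * (f i - g i))
     d₀ = ℤ.<-≤-trans (pos* (w i₀) (f i₀ - g i₀) 0<wi₀ (subst (_< f i₀ - g i₀) (ℤ.+-inverseʳ (g i₀)) (ℤ.+-monoˡ-< (- g i₀) (g<f i₀ 0<wi₀)))) (∑-term d i₀)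
     dist : ∀ a b c → a * (b - c) ≡ a * b - a * c
     dist = solve-∀
     e : sum (λ i → w i * (f i - g i)) ≡ (∑[ i < n ] (w i * f i)) - (∑[ i < n ] (w i * g i))
     e = trans (∑-cong λ i → dist (w i) (f i) (g i)) (∑-sub (λ i → w i * f i) (λ i → w i * g i))
     strict : ∑[ i < n ] (w i * g i) < ∑[ i < n ] (w i * f i)
     strict = subst₂ _<_ (ℤ.+-identityˡ _) (cancel (∑[ i < n ] (w i * f i)) (∑[ i < n ] (w i * g i))) (ℤ.+-monoˡ-< (∑[ i < n ] (w i * g i)) (subst (0ℤ <_) e d₀))
       where
       cancel : ∀ a b → (a - b) + b ≡ a
       cancel = solve-∀

-- Ring reasoning in a finite field with integer coefficients

module Rings where
 open import Defs using (FieldOn)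
 open import Algebra.Bundles using (CommutativeRing)
 open import Data.Integer.Base using (+_)
 open import Data.Maybe using (Maybe; just; nothing)
 open import Level using (0ℓ)

 module FieldRing {r} (F : FieldOn r) where
   open FieldOn F public renaming (_+ᶠ_ to infixl 6 _⊕_; _*ᶠ_ to infixl 7 _⊗_; -ᶠ_ to infix 8 ⊖_)

   commutativeRing : CommutativeRing 0ℓ 0ℓ
   commutativeRing = record { isCommutativeRing = isCommutativeRing }

   open CommutativeRing commutativeRing public using () renaming
     ( +-assoc to ⊕-assoc; +-comm to ⊕-comm; +-identityˡ to ⊕-identityˡ; +-identityʳ to ⊕-identityʳ
     ; -‿inverseʳ to ⊖-inverseʳ; -‿inverseˡ to ⊖-inverseˡ
     ; *-assoc to ⊗-assoc; *-comm to ⊗-comm; *-identityˡ to ⊗-identityˡ; *-identityʳ to ⊗-identityʳ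
     ; distribˡ to ⊗-distribˡ; distribʳ to ⊗-distribʳ; zeroˡ to ⊗-zeroˡ; zeroʳ to ⊗-zeroʳ )
   open import Algebra.Properties.Ring (CommutativeRing.ring commutativeRing) public using () renaming
     ( -‿distribˡ-* to ⊖-distribˡ; -‿distribʳ-* to ⊖-distribʳ; -‿involutive to ⊖-involutive
     ; -0#≈0# to ⊖-0; -‿+-comm to ⊖-⊕)

   nat : ℕ → Fin r
   nat zero = 0ᶠ
   nat (suc k) = 1ᶠ ⊕ nat k

   nat-+ : ∀ a b → nat (a ℕ.+ b) ≡ nat a ⊕ nat b
   nat-+ zero b = sym (⊕-identityˡ _)
   nat-+ (suc a) b = trans (cong (1ᶠ ⊕_) (nat-+ a b)) (sym (⊕-assoc _ _ _))

   nat-* : ∀ a b → nat (a ℕ.* b) ≡ nat a ⊗ nat b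
   nat-* zero b = sym (⊗-zeroˡ _)
   nat-* (suc a) b = trans (nat-+ b (a ℕ.* b)) (trans (cong₂ _⊕_ (sym (⊗-identityˡ _)) (nat-* a b)) (sym (⊗-distribʳ _ _ _)))

   -- The canonical homomorphism from the integers. As coefficient map it lets the ring solver
   -- normalise integer constants; later it evaluates one integer polynomial in two fields of the
   -- same characteristic.
   int : ℤ → Fin r
   int (+ k) = nat k
   int -[1+ k ] = ⊖ nat (suc k)

   int-⊖ : ∀ a b → int (a ℤ.⊖ b) ≡ nat a ⊕ ⊖ nat b
   int-⊖ a zero = sym (trans (cong (nat a ⊕_) ⊖-0) (⊕-identityʳ _))
   int-⊖ zero (suc b) = sym (⊕-identityˡ _)
   int-⊖ (suc a) (suc b) = trans (cong int (ℤ.[1+m]⊖[1+n]≡m⊖n a b)) (trans (int-⊖ a b) (sym e))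
     where
     e : (1ᶠ ⊕ nat a) ⊕ ⊖ (1ᶠ ⊕ nat b) ≡ nat a ⊕ ⊖ nat b
     e = trans (cong₂ _⊕_ (⊕-comm _ _) (sym (⊖-⊕ _ _))) (trans (⊕-assoc _ _ _) (cong (nat a ⊕_)
           (trans (sym (⊕-assoc _ _ _)) (trans (cong (_⊕ ⊖ nat b) (⊖-inverseʳ 1ᶠ)) (⊕-identityˡ _)))))

   int-neg : ∀ i → int (ℤ.- i) ≡ ⊖ int i
   int-neg (+ zero) = sym ⊖-0
   int-neg (+ suc k) = refl
   int-neg -[1+ k ] = sym (⊖-involutive _)

   int-+ : ∀ i j → int (i ℤ.+ j) ≡ int i ⊕ int j
   int-+ (+ a) (+ b) = nat-+ a b
   int-+ (+ a) -[1+ b ] = int-⊖ a (suc b)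
   int-+ -[1+ a ] (+ b) = trans (int-⊖ b (suc a)) (⊕-comm _ _)
   int-+ -[1+ a ] -[1+ b ] = trans (cong (λ z → ⊖ nat z) (sym (ℕ.+-suc (suc a) b))) (trans (cong ⊖_ (nat-+ (suc a) (suc b))) (sym (⊖-⊕ _ _)))

   int-* : ∀ i j → int (i ℤ.* j) ≡ int i ⊗ int j
   int-* (+ a) (+ b) = trans (cong int (sym (ℤ.pos-* a b))) (nat-* a b)
   int-* (+ a) -[1+ b ] = trans (cong int (sym (ℤ.neg-distribʳ-* (+ a) (+ suc b))))
     (trans (int-neg (+ a ℤ.* + suc b)) (trans (cong ⊖_ (int-* (+ a) (+ suc b))) (⊖-distribʳ _ _)))
   int-* -[1+ a ] (+ b) = trans (cong int (sym (ℤ.neg-distribˡ-* (+ suc a) (+ b))))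
     (trans (int-neg (+ suc a ℤ.* + b)) (trans (cong ⊖_ (int-* (+ suc a) (+ b))) (⊖-distribˡ _ _)))
   int-* -[1+ a ] -[1+ b ] = trans (nat-* (suc a) (suc b)) (sym (trans (sym (⊖-distribˡ _ _)) (trans (cong ⊖_ (sym (⊖-distribʳ _ _))) (⊖-involutive _))))

   open import Algebra.Solver.Ring.AlmostCommutativeRing using (fromCommutativeRing; _-Raw-AlmostCommutative⟶_)
   morphism : ℤ.+-*-rawRing -Raw-AlmostCommutative⟶ fromCommutativeRing commutativeRing
   morphism = record { ⟦_⟧ = int ; +-homo = int-+ ; *-homo = int-* ; -‿homo = int-neg ; 0-homo = refl ; 1-homo = ⊕-identityʳ 1ᶠ }

   int≟ : ∀ i j → Maybe (int i ≡ int j)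
   int≟ i j with i ℤ.≟ j
   ... | yes p = just (cong int p)
   ... | no _ = nothing

   open import Algebra.Solver.Ring ℤ.+-*-rawRing (fromCommutativeRing commutativeRing) morphism int≟
     public using (solve; _:=_; _:+_; _:*_; :-_; con)

-- Powers, Fermat's theorem and the number of roots of a polynomial

module Powers where
 open import Defs using (FieldOn)
 open Rings
 open import Algebra.Bundles using (CommutativeRing)
 open import Data.Fin.Base using (punchIn)
 open import Data.Fin.Properties using (_≟_; punchIn-injective; punchInᵢ≢i; suc-injective)
 open import Data.Fin.Permutation using (permutation)
 open import Data.List.Base using (List; []; _∷_; length; replicate)
 open import Data.List.Properties using (length-replicate)
 open import Data.List.Relation.Unary.All using ([]; _∷_)
 open import Data.Nat.Base using (pred; _≤_; _<_)
 open import Data.Nat.Divisibility using (_∣_; divides)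
 open import Data.Nat.GCD using (gcd; gcd-GCD; module Bézout)

 others : ∀ {n} (j : Fin n) → Σ (Fin (pred n) → Fin n) λ f → (∀ a b → f a ≡ f b → a ≡ b) × (∀ a → f a ≢ j)
 others {suc n} j = punchIn j , punchIn-injective j , punchInᵢ≢i j

 module FieldPow {r} (F : FieldOn r) where
   open FieldRing F public

   infixr 8 _^_
   _^_ : Fin r → ℕ → Fin r
   x ^ zero = 1ᶠ
   x ^ suc k = x ⊗ x ^ k

   ^-+ : ∀ x a b → x ^ (a ℕ.+ b) ≡ x ^ a ⊗ x ^ b
   ^-+ x zero b = sym (⊗-identityˡ _)
   ^-+ x (suc a) b = trans (cong (x ⊗_) (^-+ x a b)) (sym (⊗-assoc _ _ _))

   1^ : ∀ k → 1ᶠ ^ k ≡ 1ᶠ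
   1^ zero = refl
   1^ (suc k) = trans (⊗-identityˡ _) (1^ k)

   0^ : ∀ k → 0ᶠ ^ suc k ≡ 0ᶠ
   0^ k = ⊗-zeroˡ _

   ⊗-^ : ∀ x y k → (x ⊗ y) ^ k ≡ x ^ k ⊗ y ^ k
   ⊗-^ x y zero = sym (⊗-identityˡ _)
   ⊗-^ x y (suc k) = trans (cong ((x ⊗ y) ⊗_) (⊗-^ x y k))
     (solve 4 (λ a b c d → (a :* b) :* (c :* d) := (a :* c) :* (b :* d)) refl x y (x ^ k) (y ^ k))

   ^-* : ∀ x a b → x ^ (a ℕ.* b) ≡ (x ^ a) ^ b
   ^-* x zero b = sym (1^ b)
   ^-* x (suc a) b = trans (^-+ x b (a ℕ.* b)) (trans (cong (x ^ b ⊗_) (^-* x a b)) (sym (⊗-^ x (x ^ a) b)))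

   ^-*′ : ∀ x a b → x ^ (a ℕ.* b) ≡ (x ^ b) ^ a
   ^-*′ x a b = trans (cong (x ^_) (ℕ.*-comm a b)) (^-* x b a)

   -- Total, with default value 0 at 0, so that terms containing an inverse carry no proof of
   -- nonvanishing.
   inv : Fin r → Fin r
   inv x with x ≟ 0ᶠ
   ... | yes _ = 0ᶠ
   ... | no h = proj₁ (inverse x h)

   inv-r : ∀ {x} → x ≢ 0ᶠ → x ⊗ inv x ≡ 1ᶠ
   inv-r {x} h with x ≟ 0ᶠ
   ... | yes e = ⊥-elim (h e)
   ... | no h' = proj₂ (inverse x h')

   inv-l : ∀ {x} → x ≢ 0ᶠ → inv x ⊗ x ≡ 1ᶠ
   inv-l h = trans (⊗-comm _ _) (inv-r h)

   ⊗-cancelˡ : ∀ {x y z} → x ≢ 0ᶠ → x ⊗ y ≡ x ⊗ z → y ≡ z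
   ⊗-cancelˡ {x} {y} {z} h e = trans (sym (go y)) (trans (cong (inv x ⊗_) e) (go z))
     where
     go : ∀ w → inv x ⊗ (x ⊗ w) ≡ w
     go w = trans (sym (⊗-assoc _ _ _)) (trans (cong (_⊗ w) (inv-l h)) (⊗-identityˡ w))

   ⊗-≢0 : ∀ {x y} → x ≢ 0ᶠ → y ≢ 0ᶠ → x ⊗ y ≢ 0ᶠ
   ⊗-≢0 {x} hx hy e = hy (⊗-cancelˡ hx (trans e (sym (⊗-zeroʳ x))))

   ≢0-^ : ∀ {x} k → x ≢ 0ᶠ → x ^ k ≢ 0ᶠ
   ≢0-^ zero h e = 0≢1 (sym e)
   ≢0-^ (suc k) h = ⊗-≢0 h (≢0-^ k h)

   sub≡0⇒≡ : ∀ {x y} → x ⊕ ⊖ y ≡ 0ᶠ → x ≡ y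
   sub≡0⇒≡ {x} {y} e = trans (solve 2 (λ x y → x := (x :+ :- y) :+ y) refl x y) (trans (cong (_⊕ y) e) (⊕-identityˡ y))

   ≡⇒sub≡0 : ∀ {x y} → x ≡ y → x ⊕ ⊖ y ≡ 0ᶠ
   ≡⇒sub≡0 {x} refl = ⊖-inverseʳ x

   open import Algebra.Properties.CommutativeMonoid.Sum (CommutativeRing.*-commutativeMonoid commutativeRing)
     using () renaming (sum to prod; sum-cong-≗ to prod-cong; ∑-distrib-+ to prod-⊗; sum-permute to prod-permute)

   -- In the product over the whole field that proves Fermat's theorem the factor at 0 is replaced
   -- by 1, which leaves `pred r` factors x.
   prod-const-except : ∀ {n} (j : Fin n) x → prod (λ i → if does (i ≟ j) then 1ᶠ else x) ≡ x ^ pred n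
   prod-const-except {suc n} zero x = trans (⊗-identityˡ _) (all n)
     where
     all : ∀ n → prod {n} (λ _ → x) ≡ x ^ n
     all zero = refl
     all (suc n) = cong (x ⊗_) (all n)
   prod-const-except {suc (suc n)} (suc j) x =
     cong (x ⊗_) (trans (prod-cong (λ i → cong (if_then 1ᶠ else x) (does-suc i j))) (prod-const-except j x))
     where
     does-suc : ∀ {n} (i j : Fin n) → does (suc i ≟ suc j) ≡ does (i ≟ j)
     does-suc i j with i ≟ j
     ... | yes _ = refl
     ... | no _ = refl

   prod-≢0 : ∀ {n} (f : Fin n → Fin r) → (∀ i → f i ≢ 0ᶠ) → prod f ≢ 0ᶠ
   prod-≢0 {zero} f h e = 0≢1 (sym e)
   prod-≢0 {suc n} f h = ⊗-≢0 (h zero) (prod-≢0 (f ∘ suc) (h ∘ suc))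

   m : ℕ
   m = pred r

   -- Multiplication by x permutes the nonzero elements.
   fermat : ∀ {x} → x ≢ 0ᶠ → x ^ m ≡ 1ᶠ
   fermat {x} h = ⊗-cancelˡ (prod-≢0 f f≢0) (trans (⊗-comm _ _) (trans (sym e) (sym (⊗-identityʳ _))))
     where
     f : Fin r → Fin r
     f y = if does (y ≟ 0ᶠ) then 1ᶠ else y
     f≢0 : ∀ y → f y ≢ 0ᶠ
     f≢0 y with y ≟ 0ᶠ
     ... | yes _ = λ e → 0≢1 (sym e)
     ... | no h = h
     back : ∀ a b → a ⊗ b ≡ 1ᶠ → ∀ y → a ⊗ (b ⊗ y) ≡ y
     back a b e y = trans (sym (⊗-assoc _ _ _)) (trans (cong (_⊗ y) e) (⊗-identityˡ y))
     π = permutation (x ⊗_) (inv x ⊗_) (back _ _ (inv-r h)) (back _ _ (inv-l h))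
     split : ∀ y → f (x ⊗ y) ≡ (if does (y ≟ 0ᶠ) then 1ᶠ else x) ⊗ f y
     split y with y ≟ 0ᶠ
     ... | yes refl with (x ⊗ 0ᶠ) ≟ 0ᶠ
     ...   | yes _ = sym (⊗-identityˡ _)
     ...   | no q = ⊥-elim (q (⊗-zeroʳ x))
     split y | no p with (x ⊗ y) ≟ 0ᶠ
     ...   | yes q = ⊥-elim (⊗-≢0 h p q)
     ...   | no _ = refl
     e : prod f ≡ x ^ m ⊗ prod f
     e = trans (prod-permute f π) (trans (prod-cong split) (trans (prod-⊗ _ f) (cong (_⊗ prod f) (prod-const-except 0ᶠ x))))

   -- Monic polynomials, lowest coefficient first, leading coefficient omitted.
   monic : List (Fin r) → Fin r → Fin r
   monic [] x = 1ᶠ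
   monic (c ∷ cs) x = c ⊕ x ⊗ monic cs x

   -- Synthetic division. Subtracting the value at a makes the division by x - a exact, and the
   -- quotient is again monic, of degree one less.
   divide : ∀ c cs a → ∃ λ ds → length ds ≡ length cs ×
     (∀ x → monic (c ∷ cs) x ⊕ ⊖ monic (c ∷ cs) a ≡ (x ⊕ ⊖ a) ⊗ monic ds x)
   divide c [] a = [] , refl , λ x →
     solve 4 (λ c x a o → (c :+ x :* o) :+ :- (c :+ a :* o) := (x :+ :- a) :* o) refl c x a 1ᶠ
   divide c (c' ∷ cs) a with ds , len , eq ← divide c' cs a =
     P a ∷ ds , cong suc len , λ x → trans
       (solve 5 (λ c x a p q → (c :+ x :* p) :+ :- (c :+ a :* q) := (x :+ :- a) :* q :+ x :* (p :+ :- q)) refl c x a (P x) (P a))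
       (trans (cong ((x ⊕ ⊖ a) ⊗ P a ⊕_) (cong (x ⊗_) (eq x)))
       (solve 4 (λ x a q d → (x :+ :- a) :* q :+ x :* ((x :+ :- a) :* d) := (x :+ :- a) :* (q :+ x :* d)) refl x a (P a) (monic ds x)))
     where P = monic (c' ∷ cs)

   -- Once x - ρ 0 is divided off, the quotient still vanishes at the other roots, because x - ρ 0
   -- is nonzero there and can be cancelled.
   root-bound : ∀ cs {k} (ρ : Fin k → Fin r) → (∀ a b → ρ a ≡ ρ b → a ≡ b) → (∀ a → monic cs (ρ a) ≡ 0ᶠ) → k ≤ length cs
   root-bound cs {zero} ρ inj h = z≤n
   root-bound [] {suc k} ρ inj h = ⊥-elim (0≢1 (sym (h zero)))
   root-bound (c ∷ cs) {suc k} ρ inj h with ds , len , eq ← divide c cs (ρ zero) =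
     s≤s (subst (k ≤_) len (root-bound ds (ρ ∘ suc) (λ a b e → suc-injective (inj _ _ e)) roots))
     where
     roots : ∀ a → monic ds (ρ (suc a)) ≡ 0ᶠ
     roots a = ⊗-cancelˡ {ρ (suc a) ⊕ ⊖ ρ zero} (λ e → case (inj _ _ (sub≡0⇒≡ e)))
       (trans (sym (eq _)) (trans (cong₂ _⊕_ (h (suc a)) (cong ⊖_ (h zero))) (trans (⊖-inverseʳ 0ᶠ) (sym (⊗-zeroʳ _)))))
       where
       case : ∀ {n} {a : Fin n} → suc a ≡ zero → ⊥
       case ()

   monic-replicate : ∀ k x → monic (replicate k 0ᶠ) x ≡ x ^ k
   monic-replicate zero x = refl
   monic-replicate (suc k) x = trans (⊕-identityˡ _) (cong (x ⊗_) (monic-replicate k x))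

   x^e-1 : ∀ e → List (Fin r)
   x^e-1 e = ⊖ 1ᶠ ∷ replicate e 0ᶠ

   -- Otherwise all m nonzero elements would be roots of x^(e+1) - 1, more than its degree allows.
   -- This is the source of elements of large order.
   non-root : ∀ {e} → suc e < m → ∃ λ y → y ≢ 0ᶠ × y ^ suc e ≢ 1ᶠ
   non-root {e} e<m with Fin.any? (λ y → ¬? (y ≟ 0ᶠ) ×-dec ¬? (y ^ suc e ≟ 1ᶠ))
   ... | yes p = p
   ... | no ¬p = ⊥-elim (ℕ.<⇒≱ e<m (subst (m ≤_) (cong suc (length-replicate e)) (root-bound (x^e-1 e) nz nz-inj roots)))
     where
     nz = proj₁ (others 0ᶠ)
     nz-inj = proj₁ (proj₂ (others 0ᶠ))
     ≡1 : ∀ y → y ≢ 0ᶠ → y ^ suc e ≡ 1ᶠ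
     ≡1 y h with y ^ suc e ≟ 1ᶠ
     ... | yes q = q
     ... | no q = ⊥-elim (¬p (y , h , q))
     roots : ∀ a → monic (x^e-1 e) (nz a) ≡ 0ᶠ
     roots a = trans (cong (⊖ 1ᶠ ⊕_) (trans (cong (nz a ⊗_) (monic-replicate e (nz a))) (≡1 (nz a) (proj₂ (proj₂ (others 0ᶠ)) a)))) (⊖-inverseˡ 1ᶠ)

   HasOrder : Fin r → ℕ → Set
   HasOrder x D = x ^ D ≡ 1ᶠ × (∀ e → x ^ e ≡ 1ᶠ → D ∣ e)

   ^-∣ : ∀ {x D e} → x ^ D ≡ 1ᶠ → D ∣ e → x ^ e ≡ 1ᶠ
   ^-∣ {x} {D} h (divides q refl) = trans (^-*′ x q D) (trans (cong (_^ q) h) (1^ q))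

   ^-gcd : ∀ {x} a b → x ^ a ≡ 1ᶠ → x ^ b ≡ 1ᶠ → x ^ gcd a b ≡ 1ᶠ
   ^-gcd {x} a b ha hb with Bézout.identity (gcd-GCD a b)
   ... | Bézout.+- u v eq = trans (sym (⊗-identityʳ _)) (trans (cong (x ^ gcd a b ⊗_) (sym (^-∣ hb (divides v refl))))
         (trans (sym (^-+ x (gcd a b) (v ℕ.* b))) (trans (cong (x ^_) eq) (^-∣ ha (divides u refl)))))
   ... | Bézout.-+ u v eq = trans (sym (⊗-identityʳ _)) (trans (cong (x ^ gcd a b ⊗_) (sym (^-∣ ha (divides u refl))))
         (trans (sym (^-+ x (gcd a b) (u ℕ.* a))) (trans (cong (x ^_) eq) (^-∣ hb (divides v refl)))))

-- The multiplicative group of a finite field is cyclic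

module Generators where
 open import Defs using (FieldOn)
 open Rings
 open Powers
 open import Data.Fin.Properties using (_≟_; injective⇒≤; toℕ-injective; toℕ<n)
 open import Data.List.Base using ([]; _∷_)
 open import Data.Nat.ListAction using (product)
 open import Data.List.Relation.Unary.All using (All; []; _∷_)
 open import Data.Nat.Base using (pred; NonZero; _≤_; _<_; _*_; _+_)
 open import Data.Nat.Divisibility using (_∣_; divides; _∣?_)
 open import Data.Nat.GCD using (gcd; gcd[m,n]∣m; gcd[m,n]∣n)
 open import Data.Nat.Coprimality using (Coprime; coprime-divisor) renaming (sym to coprime-sym)
 open import Data.Nat.Induction using (<-wellFounded; Acc; acc)
 open import Data.Nat.Primality using (Prime; prime⇒nonZero; prime⇒nonTrivial; prime⇒irreducible)
 open import Data.Nat.Primality.Factorisation using (PrimeFactorisation; factorise)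

 prime-coprime : ∀ {ℓ k} → Prime ℓ → ¬ ℓ ∣ k → Coprime ℓ k
 prime-coprime pℓ h (d∣ℓ , d∣k) with prime⇒irreducible pℓ d∣ℓ
 ... | inj₁ d≡1 = d≡1
 ... | inj₂ refl = ⊥-elim (h d∣k)

 coprime-^ : ∀ {a k} v → Coprime a k → Coprime (a ℕ.^ v) k
 coprime-^ zero c (d∣1 , _) = ℕ.∣1⇒≡1 d∣1
 coprime-^ {a} {k} (suc v) c {d} (d∣ , d∣k) = coprime-^ v c (coprime-divisor d⊥a d∣ , d∣k)
   where
   d⊥a : Coprime d a
   d⊥a (e∣d , e∣a) = c (e∣a , ℕ.∣-trans e∣d d∣k)

 -- Write ℓ^(v+1) = k d. If ℓ does not divide k, then ℓ^(v+1) is coprime to k and divides d;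
 -- otherwise cancelling ℓ shows that d divides ℓ^v.
 prime-power-∣ : ∀ {ℓ d} v → Prime ℓ → d ∣ ℓ ℕ.^ suc v → ¬ d ∣ ℓ ℕ.^ v → ℓ ℕ.^ suc v ∣ d
 prime-power-∣ {ℓ} {d} v pℓ (divides k eq) h with ℓ ∣? k
 ... | no ℓ∤k = coprime-divisor (coprime-^ (suc v) (prime-coprime pℓ ℓ∤k)) (divides 1 (trans (sym eq) (sym (ℕ.*-identityˡ _))))
 ... | yes (divides k' refl) = ⊥-elim (h (divides k' (ℕ.*-cancelˡ-≡ _ _ ℓ {{prime⇒nonZero pℓ}} (trans eq (trans (cong (_* d) (ℕ.*-comm k' ℓ)) (ℕ.*-assoc ℓ k' d))))))

 split-power : ∀ {ℓ} → Prime ℓ → ∀ D → .{{NonZero D}} → ∃ λ u → ∃ λ D' → D ≡ ℓ ℕ.^ u * D' × ¬ ℓ ∣ D'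
 split-power {ℓ} pℓ D = go D (<-wellFounded D)
   where
   go : ∀ D → Acc _<_ D → .{{NonZero D}} → ∃ λ u → ∃ λ D' → D ≡ ℓ ℕ.^ u * D' × ¬ ℓ ∣ D'
   go D (acc rs) with ℓ ∣? D
   ... | no h = 0 , D , sym (ℕ.*-identityˡ D) , h
   ... | yes (divides (suc D₁) refl) with u , D' , eq , h ← go (suc D₁) (rs (ℕ.m<m*n (suc D₁) ℓ (ℕ.nonTrivial⇒n>1 ℓ {{prime⇒nonTrivial pℓ}}))) =
     suc u , D' , trans (ℕ.*-comm (suc D₁) ℓ) (trans (cong (ℓ *_) eq) (sym (ℕ.*-assoc ℓ (ℓ ℕ.^ u) D'))) , h

 module FieldGen {r} (F : FieldOn r) where
   open FieldPow F public

   2≤r : 2 ≤ r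
   2≤r = go 0ᶠ 1ᶠ 0≢1
     where
     go : ∀ {n} (a b : Fin n) → a ≢ b → 2 ≤ n
     go {1} zero zero h = ⊥-elim (h refl)
     go {suc (suc n)} _ _ _ = s≤s (s≤s z≤n)

   1+m : r ≡ suc m
   1+m = sym (ℕ.suc-pred r {{ℕ.>-nonZero (ℕ.≤-trans (s≤s z≤n) 2≤r)}})

   instance
     m≢0 : NonZero m
     m≢0 = ℕ.>-nonZero (ℕ.s≤s⁻¹ (subst (2 ≤_) 1+m 2≤r))

   -- Choose y with y^(m/ℓ) ≠ 1 and let z = y^(m/ℓ^(v+1)). If z^k = 1, then z^d = 1 for d = gcd(k,
   -- ℓ^(v+1)); were d a divisor of ℓ^v, this would give y^(m/ℓ) = 1. So d is all of ℓ^(v+1).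
   prime-power-order : ∀ {ℓ} v → Prime ℓ → ℓ ℕ.^ suc v ∣ m → ∃ λ z → HasOrder z (ℓ ℕ.^ suc v)
   prime-power-order {ℓ} v pℓ (divides c eq) = go (ℓ ℕ.^ v * c) refl
     where
     instance _ = prime⇒nonTrivial pℓ
     m≡ : m ≡ (ℓ ℕ.^ v * c) * ℓ
     m≡ = trans eq (trans (ℕ.*-comm c _) (trans (ℕ.*-assoc ℓ _ c) (ℕ.*-comm ℓ _)))
     go : ∀ k → k ≡ ℓ ℕ.^ v * c → ∃ λ z → HasOrder z (ℓ ℕ.^ suc v)
     go zero eqe = ⊥-elim (ℕ.≢-nonZero⁻¹ m (trans m≡ (cong (_* ℓ) (sym eqe))))
     go (suc e) eqe = y ^ c , z^ , ord
       where
       e<m : suc e < m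
       e<m = subst (suc e <_) (sym (trans m≡ (cong (_* ℓ) (sym eqe)))) (ℕ.m<m*n (suc e) ℓ (ℕ.nonTrivial⇒n>1 ℓ))
       y = proj₁ (non-root e<m)
       y≢0 = proj₁ (proj₂ (non-root e<m))
       hy = proj₂ (proj₂ (non-root e<m))
       z^ : (y ^ c) ^ (ℓ ℕ.^ suc v) ≡ 1ᶠ
       z^ = trans (sym (^-* y c _)) (trans (cong (y ^_) (sym eq)) (fermat y≢0))
       ord : ∀ k → (y ^ c) ^ k ≡ 1ᶠ → ℓ ℕ.^ suc v ∣ k
       ord k hk = ℕ.∣-trans (prime-power-∣ v pℓ (gcd[m,n]∣n k _) ¬d∣) (gcd[m,n]∣m k _)
         where
         d = gcd k (ℓ ℕ.^ suc v)
         ¬d∣ : ¬ d ∣ ℓ ℕ.^ v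
         ¬d∣ d∣ = hy (trans (cong (y ^_) (trans eqe (ℕ.*-comm (ℓ ℕ.^ v) c))) (trans (^-* y c (ℓ ℕ.^ v)) (^-∣ (^-gcd k (ℓ ℕ.^ suc v) hk z^) d∣)))

   -- Raising (x y)^e = 1 to the power A removes x, so B divides e A and therefore e; the same with
   -- the roles exchanged.
   coprime-order : ∀ {x y A B} → Coprime A B → HasOrder x A → HasOrder y B → HasOrder (x ⊗ y) (A * B)
   coprime-order {x} {y} {A} {B} c (hx , ox) (hy , oy) =
     trans (⊗-^ x y (A * B)) (trans (cong₂ _⊗_ (^-∣ hx (divides B (ℕ.*-comm A B))) (^-∣ hy (divides A refl))) (⊗-identityˡ 1ᶠ)) , ord
     where
     ord : ∀ e → (x ⊗ y) ^ e ≡ 1ᶠ → A * B ∣ e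
     ord e h = subst (_∣ e) (ℕ.*-comm B A) (mul B∣e A∣e)
       where
       x^y^ : x ^ e ⊗ y ^ e ≡ 1ᶠ
       x^y^ = trans (sym (⊗-^ x y e)) h
       kill : ∀ k → x ^ (e * k) ⊗ y ^ (e * k) ≡ 1ᶠ
       kill k = trans (cong₂ _⊗_ (^-* x e k) (^-* y e k)) (trans (sym (⊗-^ (x ^ e) (y ^ e) k)) (trans (cong (_^ k) x^y^) (1^ k)))
       B∣e : B ∣ e
       B∣e = coprime-divisor (coprime-sym c) (subst (B ∣_) (ℕ.*-comm e A) (oy (e * A) (trans (sym (⊗-identityˡ _)) (trans (cong (_⊗ y ^ (e * A)) (sym (^-∣ hx (divides e refl)))) (kill A)))))
       A∣e : A ∣ e
       A∣e = coprime-divisor c (subst (A ∣_) (ℕ.*-comm e B) (ox (e * B) (trans (sym (⊗-identityʳ _)) (trans (cong (x ^ (e * B) ⊗_) (sym (^-∣ hy (divides e refl)))) (kill B)))))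
       mul : B ∣ e → A ∣ e → B * A ∣ e
       mul (divides q refl) A∣ with divides q' refl ← coprime-divisor c (subst (A ∣_) (ℕ.*-comm q B) A∣) =
         divides q' (trans (ℕ.*-assoc q' A B) (cong (q' *_) (ℕ.*-comm A B)))

   -- The ℓ-part ℓ^u of the order is enlarged to ℓ^(u+1): passing to x^(ℓ^u) keeps the part D' prime
   -- to ℓ, and an element of order ℓ^(u+1) is multiplied in. Running through the prime factors of m
   -- gives a generator.
   order-step : ∀ {x D ℓ} → Prime ℓ → .{{NonZero D}} → ℓ * D ∣ m → HasOrder x D → ∃ λ z → HasOrder z (ℓ * D)
   order-step {x} {D} {ℓ} pℓ ℓD∣m (hx , ox) with u , D' , refl , ℓ∤D' ← split-power pℓ D
     with y , hy ← prime-power-order u pℓ (ℕ.∣-trans (divides D' (trans (sym (ℕ.*-assoc ℓ _ D')) (ℕ.*-comm _ D'))) ℓD∣m) =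
     y ⊗ x ^ (ℓ ℕ.^ u) , subst (HasOrder _) (ℕ.*-assoc ℓ _ D')
       (coprime-order (coprime-^ (suc u) (prime-coprime pℓ ℓ∤D')) hy
         ( trans (sym (^-* x (ℓ ℕ.^ u) D')) hx
         , λ e h → ℕ.*-cancelˡ-∣ (ℓ ℕ.^ u) {{ℕ.m^n≢0 ℓ u {{prime⇒nonZero pℓ}}}} (ox _ (trans (^-* x (ℓ ℕ.^ u) e) h))))

   abstract
     generator : ∃ λ g → HasOrder g m
     generator = subst (λ k → ∃ λ g → HasOrder g k) (sym (PrimeFactorisation.isFactorisation fac))
         (go (PrimeFactorisation.factors fac) (PrimeFactorisation.factorsPrime fac) (subst (_∣ m) (PrimeFactorisation.isFactorisation fac) ℕ.∣-refl))
       where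
       fac : PrimeFactorisation m
       fac = factorise m
       nz : ∀ ls → All Prime ls → NonZero (product ls)
       nz [] [] = _
       nz (ℓ ∷ ls) (p ∷ ps) = ℕ.m*n≢0 ℓ (product ls) {{prime⇒nonZero p}} {{nz ls ps}}
       go : ∀ ls → All Prime ls → product ls ∣ m → ∃ λ z → HasOrder z (product ls)
       go [] [] _ = 1ᶠ , ⊗-identityˡ 1ᶠ , λ e _ → ℕ.1∣ e
       go (ℓ ∷ ls) (p ∷ ps) d∣m with z , hz ← go ls ps (ℕ.∣-trans (divides ℓ refl) d∣m) = order-step p {{nz ls ps}} d∣m hz

   g : Fin r
   g = proj₁ generator

   g^m : g ^ m ≡ 1ᶠ
   g^m = proj₁ (proj₂ generator)

   g-order : ∀ e → g ^ e ≡ 1ᶠ → m ∣ e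
   g-order = proj₂ (proj₂ generator)

   g≢0 : g ≢ 0ᶠ
   g≢0 e = 0≢1 (trans (sym (trans (cong (_^ m) e) (trans (cong (0ᶠ ^_) (sym (ℕ.suc-pred m))) (0^ (pred m))))) g^m)

   g^-inj-≤ : ∀ {i j} → i ≤ j → j < m → g ^ i ≡ g ^ j → i ≡ j
   g^-inj-≤ {i} {j} i≤j j<m e with j ℕ.∸ i in eq
   ... | zero = ℕ.≤-antisym i≤j (ℕ.m∸n≡0⇒m≤n eq)
   ... | suc d = ⊥-elim (ℕ.<⇒≱ (ℕ.≤-<-trans (subst (_≤ j) eq (ℕ.m∸n≤m j i)) j<m) (ℕ.∣⇒≤ (g-order (suc d) (⊗-cancelˡ (≢0-^ i g≢0)
       (trans (sym (^-+ g i (suc d))) (trans (cong (g ^_) (trans (cong (i +_) (sym eq)) (ℕ.m+[n∸m]≡n i≤j))) (trans (sym e) (sym (⊗-identityʳ _)))))))))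

   g^-inj : ∀ {i j} → i < m → j < m → g ^ i ≡ g ^ j → i ≡ j
   g^-inj {i} {j} i<m j<m e with ℕ.≤-total i j
   ... | inj₁ h = g^-inj-≤ h j<m e
   ... | inj₂ h = sym (g^-inj-≤ h i<m (sym e))

   -- If x ≠ 0 were not a power of g, there would be m + 2 distinct elements.
   abstract
     log : ∀ x → x ≢ 0ᶠ → ∃ λ i → i < m × x ≡ g ^ i
     log x h with Fin.any? {n = m} (λ i → x ≟ g ^ toℕ i)
     ... | yes (i , e) = toℕ i , toℕ<n i , e
     ... | no ¬p = ⊥-elim (ℕ.<-irrefl refl (subst (suc (suc m) ≤_) 1+m (injective⇒≤ {f = τ} τ-inj)))
       where
       τ : Fin (suc (suc m)) → Fin r
       τ zero = 0ᶠ
       τ (suc zero) = x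
       τ (suc (suc i)) = g ^ toℕ i
       τ-inj : ∀ {i j} → τ i ≡ τ j → i ≡ j
       τ-inj {zero} {zero} e = refl
       τ-inj {zero} {suc zero} e = ⊥-elim (h (sym e))
       τ-inj {zero} {suc (suc j)} e = ⊥-elim (≢0-^ (toℕ j) g≢0 (sym e))
       τ-inj {suc zero} {zero} e = ⊥-elim (h e)
       τ-inj {suc zero} {suc zero} e = refl
       τ-inj {suc zero} {suc (suc j)} e = ⊥-elim (¬p (j , e))
       τ-inj {suc (suc i)} {zero} e = ⊥-elim (≢0-^ (toℕ i) g≢0 e)
       τ-inj {suc (suc i)} {suc zero} e = ⊥-elim (¬p (i , sym e))
       τ-inj {suc (suc i)} {suc (suc j)} e = cong (λ (z : Fin m) → Fin.suc (Fin.suc z)) (toℕ-injective (g^-inj (toℕ<n i) (toℕ<n j) e))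

-- The quadratic character and its orthogonality relations

module Characters where
 open import Defs using (FieldOn)
 open Sums hiding (*-mono)
 open Rings
 open Powers
 open Generators
 open import Data.Bool.Base using (T)
 open import Data.Bool.ListAction using (any)
 open import Data.Fin.Properties using (_≟_)
 open import Data.Integer.Base using (+_)
 open import Data.List.Base using (allFin)
 open import Data.List.Relation.Unary.Any as Any using (Any)
 import Data.List.Relation.Unary.Any.Properties as Any
 open import Data.List.Membership.Propositional.Properties using (∈-allFin)
 open import Data.Nat.Base using (_≤_; _<_; _*_; _+_)
 open import Data.Nat.Combinatorics using (_C_; nCk+nC[k+1]≡[n+1]C[k+1]; k>n⇒nCk≡0)
 open import Data.Nat.Divisibility using (_∣_; divides)
 open import Data.Nat.Primality using (Prime; euclidsLemma)
 open import Data.Nat.Tactic.RingSolver using (solve-∀)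

 -- The absorption identity. It yields the divisibility of C(p, k) by p as well as the recursion of
 -- the central binomial coefficients.
 C-absorb : ∀ n k → suc k * (suc n C suc k) ≡ suc n * (n C k)
 C-absorb zero zero = refl
 C-absorb zero (suc k) = trans (cong (suc (suc k) *_) (k>n⇒nCk≡0 {1} {suc (suc k)} (s≤s (s≤s z≤n)))) (trans (ℕ.*-zeroʳ (suc (suc k))) (sym (trans (cong (1 *_) (k>n⇒nCk≡0 {0} {suc k} (s≤s z≤n))) refl)))
 C-absorb (suc n) zero = trans (cong (1 *_) (sym (nCk+nC[k+1]≡[n+1]C[k+1] (suc n) 0))) (lem _ (C-absorb n 0))
   where
   lem : ∀ b → 1 * b ≡ suc n * 1 → 1 * (1 + b) ≡ suc (suc n) * 1
   lem b e = trans (ℕ.*-identityˡ _) (cong suc (trans (sym (ℕ.*-identityˡ b)) e))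
 C-absorb (suc n) (suc k) = trans (cong (suc (suc k) *_) (sym (nCk+nC[k+1]≡[n+1]C[k+1] (suc n) (suc k))))
     (lem (suc k) (suc n C suc k) (suc n C suc (suc k)) n (n C k) (n C suc k) (C-absorb n k) (C-absorb n (suc k)) (nCk+nC[k+1]≡[n+1]C[k+1] n k))
   where
   lem : ∀ k A B n a b → k * A ≡ suc n * a → suc k * B ≡ suc n * b → a + b ≡ A → suc k * (A + B) ≡ suc (suc n) * A
   lem k A B n a b e₁ e₂ refl = trans (ℕ.*-distribˡ-+ (suc k) (a + b) B) (trans (cong₂ _+_ (cong (λ z → (a + b) + z) e₁) e₂) (ar n a b))
     where
     ar : ∀ n a b → ((a + b) + suc n * a) + suc n * b ≡ suc (suc n) * (a + b)
     ar = solve-∀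

 prime∣C : ∀ {p} → Prime p → ∀ k → 0 < k → k < p → p ∣ p C k
 prime∣C {suc p} pp (suc k) _ k<p with euclidsLemma (suc k) (suc p C suc k) pp (divides (p C k) (trans (C-absorb p k) (ℕ.*-comm (suc p) _)))
 ... | inj₁ p∣k = ⊥-elim (ℕ.<⇒≱ k<p (ℕ.∣⇒≤ p∣k))
 ... | inj₂ h = h

 sgn : ℕ → ℤ
 sgn zero = 1ℤ
 sgn (suc k) = ℤ.- sgn k

 sgn-+ : ∀ a b → sgn (a + b) ≡ sgn a ℤ.* sgn b
 sgn-+ zero b = sym (ℤ.*-identityˡ _)
 sgn-+ (suc a) b = trans (cong ℤ.-_ (sgn-+ a b)) (ℤ.neg-distribˡ-* (sgn a) (sgn b))

 sgn-sq : ∀ a → sgn a ℤ.* sgn a ≡ 1ℤ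
 sgn-sq zero = refl
 sgn-sq (suc a) = trans (lem (sgn a)) (sgn-sq a)
   where
   lem : ∀ x → (ℤ.- x) ℤ.* (ℤ.- x) ≡ x ℤ.* x
   lem = ℤ.solve-∀

 sgn-2* : ∀ a → sgn (2 * a) ≡ 1ℤ
 sgn-2* a = trans (cong sgn (cong (λ z → a + z) (ℕ.+-identityʳ a))) (trans (sgn-+ a a) (sgn-sq a))

 T⇒≡ : ∀ {b} → T b → b ≡ true
 T⇒≡ {true} _ = refl

 ≡⇒T : ∀ {b} → b ≡ true → T b
 ≡⇒T refl = tt

 any-intro : ∀ {n} (f : Fin n → Bool) i → f i ≡ true → any f (allFin n) ≡ true
 any-intro f i h = T⇒≡ (Any.any⁺ f (Any.map (λ { refl → ≡⇒T h }) (∈-allFin i)))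

 any-elim : ∀ {n} (f : Fin n → Bool) → any f (allFin n) ≡ true → ∃ λ i → f i ≡ true
 any-elim {n} f h with Any.satisfied (Any.any⁻ f (allFin n) (≡⇒T h))
 ... | i , t = i , T⇒≡ t

 module FieldChar {r} (F : FieldOn r) where
   open FieldGen F public

   -- A copy of the local test in `Paley`, so that adjacency of u and v in the Paley graph is
   -- `sqr (u ⊕ ⊖ v)` by definition.
   sqr : Fin r → Bool
   sqr d = not (does (d ≟ 0ᶠ)) ∧ any (λ w → does ((w ⊗ w) ≟ d)) (allFin r)

   -- For n a power of the characteristic this is additivity of the Frobenius map. The modules on
   -- the subfield take it as a parameter and need not know the characteristic.
   AdditivePower : ℕ → Set
   AdditivePower n = ∀ x y → (x ⊕ y) ^ n ≡ x ^ n ⊕ y ^ n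

   χ : Fin r → ℤ
   χ d = if does (d ≟ 0ᶠ) then 0ℤ else (if sqr d then 1ℤ else ℤ.-1ℤ)

   0? : ∀ x → x ≡ 0ᶠ ⊎ x ≢ 0ᶠ
   0? x with x ≟ 0ᶠ
   ... | yes p = inj₁ p
   ... | no p = inj₂ p

   χ0 : χ 0ᶠ ≡ 0ℤ
   χ0 with 0ᶠ ≟ 0ᶠ
   ... | yes _ = refl
   ... | no h = ⊥-elim (h refl)

   χ-sqr : ∀ {d} → d ≢ 0ᶠ → χ d ≡ (if sqr d then 1ℤ else ℤ.-1ℤ)
   χ-sqr {d} h with d ≟ 0ᶠ
   ... | yes e = ⊥-elim (h e)
   ... | no _ = refl

   sqr-intro : ∀ {d} w → d ≢ 0ᶠ → w ⊗ w ≡ d → sqr d ≡ true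
   sqr-intro {d} w h e with d ≟ 0ᶠ
   ... | yes e' = ⊥-elim (h e')
   ... | no _ = any-intro (λ w → does ((w ⊗ w) ≟ d)) w lem
     where
     lem : does ((w ⊗ w) ≟ d) ≡ true
     lem with (w ⊗ w) ≟ d
     ... | yes _ = refl
     ... | no q = ⊥-elim (q e)

   sqr-elim : ∀ {d} → sqr d ≡ true → ∃ λ w → w ⊗ w ≡ d
   sqr-elim {d} h with d ≟ 0ᶠ
   ... | no _ with w , e ← any-elim (λ w → does ((w ⊗ w) ≟ d)) h = w , does-true e

   module Odd (h : ℕ) (m≡2h : m ≡ 2 * h) where

     g^h≢1 : g ^ h ≢ 1ᶠ
     g^h≢1 e = ℕ.<⇒≱ (subst (h <_) (sym m≡2h) (ℕ.m<m+n h (subst (0 <_) (sym (ℕ.+-identityʳ h)) 0<h))) (ℕ.∣⇒≤ {{ℕ.>-nonZero 0<h}} (g-order h e))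
       where
       0<h : 0 < h
       0<h = ℕ.n≢0⇒n>0 (λ h0 → ℕ.≢-nonZero⁻¹ m (trans m≡2h (cong (2 *_) h0)))

     g^h : g ^ h ≡ ⊖ 1ᶠ
     g^h = sub≡0⇒≡ (⊗-cancelˡ {g ^ h ⊕ ⊖ 1ᶠ} (λ e → g^h≢1 (sub≡0⇒≡ e)) (trans
       (solve 2 (λ x o → (x :+ :- o) :* (x :+ :- (:- o)) := x :* x :+ :- (o :* o)) refl (g ^ h) 1ᶠ)
       (trans (≡⇒sub≡0 (trans (sym (^-+ g h h)) (trans (cong (g ^_) (sym (trans m≡2h (cong (λ z → h + z) (ℕ.+-identityʳ h))))) (trans g^m (sym (⊗-identityˡ 1ᶠ)))))) (sym (⊗-zeroʳ _)))))

     -- Compare the h-th powers, where h is half the group order: a nonzero square gives 1 by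
     -- Fermat, an odd power of g gives g^h ≠ 1.
     odd-nonsquare : ∀ w j → w ⊗ w ≢ g ^ suc (2 * j)
     odd-nonsquare w j e with w ≟ 0ᶠ
     ... | yes refl = ≢0-^ (suc (2 * j)) g≢0 (trans (sym e) (⊗-zeroˡ 0ᶠ))
     ... | no w≢0 = g^h≢1 (trans (sym r') (trans (cong (_^ h) (sym e)) l'))
       where
       l' : (w ⊗ w) ^ h ≡ 1ᶠ
       l' = trans (⊗-^ w w h) (trans (sym (^-+ w h h)) (trans (cong (w ^_) (sym (trans m≡2h (cong (λ z → h + z) (ℕ.+-identityʳ h))))) (fermat w≢0)))
       r' : (g ^ suc (2 * j)) ^ h ≡ g ^ h
       r' = trans (sym (^-* g (suc (2 * j)) h)) (trans (^-+ g h (2 * j * h)) (trans (cong (g ^ h ⊗_)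
              (^-∣ g^m (divides j (trans (ar j h) (cong (j *_) (sym m≡2h)))))) (⊗-identityʳ _)))
         where
         ar : ∀ j h → 2 * j * h ≡ j * (2 * h)
         ar = solve-∀

     parity : ∀ i → (∃ λ j → i ≡ 2 * j) ⊎ (∃ λ j → i ≡ suc (2 * j))
     parity zero = inj₁ (0 , refl)
     parity (suc i) with parity i
     ... | inj₁ (j , refl) = inj₂ (j , refl)
     ... | inj₂ (j , refl) = inj₁ (suc j , cong suc (sym (ℕ.+-suc j (j + 0))))

     χ-g^ : ∀ i → χ (g ^ i) ≡ sgn i
     χ-g^ i with parity i
     ... | inj₁ (j , refl) = trans (χ-sqr (≢0-^ (2 * j) g≢0)) (trans (cong (if_then 1ℤ else ℤ.-1ℤ) (sqr-intro (g ^ j) (≢0-^ (2 * j) g≢0) (trans (sym (^-+ g j j)) (cong (g ^_) (sym (cong (λ z → j + z) (ℕ.+-identityʳ j))))))) (sym (sgn-2* j)))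
     ... | inj₂ (j , refl) = trans (χ-sqr (≢0-^ (suc (2 * j)) g≢0)) (trans (cong (if_then 1ℤ else ℤ.-1ℤ) nsq) (sym (cong ℤ.-_ (sgn-2* j))))
       where
       nsq : sqr (g ^ suc (2 * j)) ≡ false
       nsq with sqr (g ^ suc (2 * j)) in eq
       ... | false = refl
       ... | true with w , e ← sqr-elim eq = ⊥-elim (odd-nonsquare w j e)

     χ-⊗ : ∀ x y → χ (x ⊗ y) ≡ χ x ℤ.* χ y
     χ-⊗ x y with 0? x | 0? y
     ... | inj₁ refl | _ = trans (cong χ (⊗-zeroˡ y)) (trans χ0 (sym (trans (cong (ℤ._* χ y) χ0) (ℤ.*-zeroˡ (χ y)))))
     ... | inj₂ _ | inj₁ refl = trans (cong χ (⊗-zeroʳ x)) (trans χ0 (sym (trans (cong (χ x ℤ.*_) χ0) (ℤ.*-zeroʳ (χ x)))))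
     ... | inj₂ hx | inj₂ hy with i , _ , refl ← log x hx | j , _ , refl ← log y hy =
       trans (cong χ (sym (^-+ g i j))) (trans (χ-g^ (i + j)) (trans (sgn-+ i j) (sym (cong₂ ℤ._*_ (χ-g^ i) (χ-g^ j)))))

     χ-sq : ∀ {x} → x ≢ 0ᶠ → χ x ℤ.* χ x ≡ 1ℤ
     χ-sq {x} hx with i , _ , refl ← log x hx = trans (cong₂ ℤ._*_ (χ-g^ i) (χ-g^ i)) (sgn-sq i)

     χ-square : ∀ {w} → w ≢ 0ᶠ → χ (w ⊗ w) ≡ 1ℤ
     χ-square {w} h = trans (χ-⊗ w w) (χ-sq h)

     χ≡1⇒sqr : ∀ {d} → χ d ≡ 1ℤ → sqr d ≡ true
     χ≡1⇒sqr {d} e with d ≟ 0ᶠ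
     ... | no _ with any (λ w → does ((w ⊗ w) ≟ d)) (allFin r)
     ...   | true = refl
     χ≡1⇒sqr {d} () | no _ | false
     χ≡1⇒sqr {d} () | yes _

     χ≡-1⇒sqr : ∀ {d} → χ d ≡ ℤ.-1ℤ → sqr d ≡ false
     χ≡-1⇒sqr {d} e with d ≟ 0ᶠ
     ... | no _ with any (λ w → does ((w ⊗ w) ≟ d)) (allFin r)
     ...   | false = refl
     χ≡-1⇒sqr {d} () | no _ | true
     χ≡-1⇒sqr {d} () | yes _

     χ-cases : ∀ {x} → x ≢ 0ᶠ → χ x ≡ 1ℤ ⊎ χ x ≡ ℤ.-1ℤ
     χ-cases {x} h with χ-sqr h
     ... | e with sqr x
     ...   | true = inj₁ e
     ...   | false = inj₂ e

     χg : χ g ≡ ℤ.-1ℤ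
     χg = trans (cong χ (sym (⊗-identityʳ g))) (χ-g^ 1)

     -- Multiplication by g permutes the field and changes the sign of χ, so the sum equals its
     -- negative.
     ∑χ : sum χ ≡ 0ℤ
     ∑χ = dbl (sum χ) (trans (sym (∑-inj (g ⊗_) (λ i j → ⊗-cancelˡ g≢0) χ)) (trans (∑-cong λ x → trans (χ-⊗ g x) (trans (cong (ℤ._* χ x) χg) (ℤ.-1*i≡-i (χ x)))) (∑-neg χ)))
       where
       dbl : ∀ s → s ≡ ℤ.- s → s ≡ 0ℤ
       dbl (+ zero) e = refl
       dbl (+ suc _) ()
       dbl -[1+ _ ] ()

     ⊕-cancelʳ : ∀ a {x y} → x ⊕ a ≡ y ⊕ a → x ≡ y
     ⊕-cancelʳ a {x} {y} e = trans (go x) (trans (cong (_⊕ ⊖ a) e) (sym (go y)))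
       where
       go : ∀ z → z ≡ (z ⊕ a) ⊕ ⊖ a
       go z = solve 2 (λ z a → z := (z :+ a) :+ :- a) refl z a

     ∑-shift : ∀ a (f : Fin r → ℤ) → ∑[ x < r ] f (x ⊕ a) ≡ sum f
     ∑-shift a f = ∑-inj (_⊕ a) (λ i j → ⊕-cancelʳ a) f

     ∑χ-shift : ∀ a → ∑[ x < r ] χ (x ⊕ a) ≡ 0ℤ
     ∑χ-shift a = trans (∑-shift a χ) ∑χ

     J : Fin r → ℤ
     J c = ∑[ x < r ] (χ x ℤ.* χ (x ⊕ c))

     J0 : J 0ᶠ ≡ + r ℤ.- 1ℤ
     J0 = trans (∑-cong one) (trans (∑-sub (λ _ → 1ℤ) (δ 0ᶠ)) (cong₂ ℤ._-_ (trans (∑-const r 1ℤ) (ℤ.*-identityʳ (+ r))) (∑-δ1 0ᶠ)))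
       where
       one : ∀ x → χ x ℤ.* χ (x ⊕ 0ᶠ) ≡ 1ℤ ℤ.- δ 0ᶠ x
       one x with δ-cases 0ᶠ x
       ... | inj₁ (refl , d) = trans (cong (ℤ._* χ (0ᶠ ⊕ 0ᶠ)) χ0) (trans (ℤ.*-zeroˡ (χ (0ᶠ ⊕ 0ᶠ))) (sym (cong (λ z → 1ℤ ℤ.- z) d)))
       ... | inj₂ (h , d) = trans (cong (λ z → χ x ℤ.* χ z) (⊕-identityʳ x)) (trans (χ-sq (h ∘ sym)) (sym (cong (λ z → 1ℤ ℤ.- z) d)))

     -- Substituting c x for x multiplies each of the two factors by χ c, and χ c squares to 1.
     J-scale : ∀ {c} → c ≢ 0ᶠ → J c ≡ J 1ᶠ
     J-scale {c} h = trans (sym (∑-inj (c ⊗_) (λ i j → ⊗-cancelˡ h) (λ x → χ x ℤ.* χ (x ⊕ c)))) (∑-cong λ x →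
       trans (cong₂ ℤ._*_ (χ-⊗ c x) (trans (cong χ (solve 3 (λ c x o → c :* x :+ c := c :* x :+ c) refl c x 1ᶠ)) (trans (cong χ (fac x)) (χ-⊗ c (x ⊕ 1ᶠ)))))
         (trans (lem (χ c) (χ x) (χ (x ⊕ 1ᶠ))) (trans (cong (ℤ._* (χ x ℤ.* χ (x ⊕ 1ᶠ))) (χ-sq h)) (ℤ.*-identityˡ _))))
       where
       fac : ∀ x → c ⊗ x ⊕ c ≡ c ⊗ (x ⊕ 1ᶠ)
       fac x = trans (cong (c ⊗ x ⊕_) (sym (⊗-identityʳ c))) (sym (⊗-distribˡ c x 1ᶠ))
       lem : ∀ a b c → (a ℤ.* b) ℤ.* (a ℤ.* c) ≡ (a ℤ.* a) ℤ.* (b ℤ.* c)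
       lem = ℤ.solve-∀

     -- The autocorrelations J c, c ≠ 0, are all equal and J sums to (∑ χ)² = 0.
     J1 : J 1ᶠ ≡ ℤ.-1ℤ
     J1 = solveJ (+ r ℤ.- 1ℤ) (J 1ᶠ) r-1≢0 total
       where
       ∑J : sum J ≡ 0ℤ
       ∑J = trans (∑-comm (λ c x → χ x ℤ.* χ (x ⊕ c))) (trans (∑-cong λ x → trans (∑-*ˡ (χ x) (λ c → χ (x ⊕ c)))
              (trans (cong (χ x ℤ.*_) (trans (∑-cong λ c → cong χ (⊕-comm x c)) (∑χ-shift x))) (ℤ.*-zeroʳ (χ x)))) (∑-0 r))
       J-split : ∀ c → J c ≡ J 1ᶠ ℤ.+ δ 0ᶠ c ℤ.* (J 0ᶠ ℤ.- J 1ᶠ)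
       J-split c with δ-cases 0ᶠ c
       ... | inj₁ (refl , d) = trans (lem (J 0ᶠ) (J 1ᶠ)) (cong (λ z → J 1ᶠ ℤ.+ z ℤ.* (J 0ᶠ ℤ.- J 1ᶠ)) (sym d))
         where
         lem : ∀ a b → a ≡ b ℤ.+ 1ℤ ℤ.* (a ℤ.- b)
         lem = ℤ.solve-∀
       ... | inj₂ (h , d) = trans (J-scale (h ∘ sym)) (sym (trans (cong (λ z → J 1ᶠ ℤ.+ z ℤ.* (J 0ᶠ ℤ.- J 1ᶠ)) d) (trans (cong (λ z → J 1ᶠ ℤ.+ z) (ℤ.*-zeroˡ (J 0ᶠ ℤ.- J 1ᶠ))) (ℤ.+-identityʳ _))))
       total : (+ r ℤ.- 1ℤ) ℤ.* J 1ᶠ ℤ.+ (+ r ℤ.- 1ℤ) ≡ 0ℤ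
       total = trans (lem (+ r) (J 1ᶠ) (J 0ᶠ) J0) (trans (sym (trans (∑-cong J-split) (trans (∑-+ (λ _ → J 1ᶠ) (λ c → δ 0ᶠ c ℤ.* (J 0ᶠ ℤ.- J 1ᶠ)))
                 (cong₂ ℤ._+_ (∑-const r (J 1ᶠ)) (∑-δ 0ᶠ (λ _ → J 0ᶠ ℤ.- J 1ᶠ)))))) ∑J)
         where
         lem : ∀ r j j0 → j0 ≡ r ℤ.- 1ℤ → (r ℤ.- 1ℤ) ℤ.* j ℤ.+ (r ℤ.- 1ℤ) ≡ r ℤ.* j ℤ.+ (j0 ℤ.- j)
         lem r j _ refl = lem' r j
           where
           lem' : ∀ r j → (r ℤ.- 1ℤ) ℤ.* j ℤ.+ (r ℤ.- 1ℤ) ≡ r ℤ.* j ℤ.+ ((r ℤ.- 1ℤ) ℤ.- j)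
           lem' = ℤ.solve-∀
       r-1≢0 : + r ℤ.- 1ℤ ≢ 0ℤ
       r-1≢0 e = ℕ.<⇒≢ (subst (2 ≤_) refl 2≤r) (sym (ℤ.+-injective (ℤ.i-j≡0⇒i≡j (+ r) 1ℤ e)))
       solveJ : ∀ a j → a ≢ 0ℤ → a ℤ.* j ℤ.+ a ≡ 0ℤ → j ≡ ℤ.-1ℤ
       solveJ a j h e with ℤ.i*j≡0⇒i≡0∨j≡0 a {j ℤ.+ 1ℤ} (trans (lem a j) e)
         where
         lem : ∀ a j → a ℤ.* (j ℤ.+ 1ℤ) ≡ a ℤ.* j ℤ.+ a
         lem = ℤ.solve-∀
       ... | inj₁ a0 = ⊥-elim (h a0)
       ... | inj₂ j0 = ℤ.i-j≡0⇒i≡j j ℤ.-1ℤ j0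

     -- A translation reduces the sum to the autocorrelation J at a - b, which is r - 1 at 0 and -1
     -- elsewhere.
     orthogonality : ∀ a b → ∑[ x < r ] (χ (x ⊕ ⊖ a) ℤ.* χ (x ⊕ ⊖ b)) ≡ + r ℤ.* δ a b ℤ.- 1ℤ
     orthogonality a b = trans (sym (∑-shift a _)) (trans (∑-cong λ x → cong₂ (λ u v → χ u ℤ.* χ v)
         (solve 2 (λ x a → (x :+ a) :+ :- a := x) refl x a) (solve 3 (λ x a b → (x :+ a) :+ :- b := x :+ (a :+ :- b)) refl x a b)) fin)
       where
       fin : J (a ⊕ ⊖ b) ≡ + r ℤ.* δ a b ℤ.- 1ℤ
       fin with δ-cases a b
       ... | inj₁ (refl , d) = trans (cong J (⊖-inverseʳ a)) (trans J0 (cong (ℤ._- 1ℤ) (sym (trans (cong (+ r ℤ.*_) d) (ℤ.*-identityʳ (+ r))))))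
       ... | inj₂ (h , d) = trans (J-scale (h ∘ sub≡0⇒≡)) (trans J1 (cong (ℤ._- 1ℤ) (sym (trans (cong (+ r ℤ.*_) d) (ℤ.*-zeroʳ (+ r))))))

-- Greedy embedding of small graphs

module Universality where
 open import Defs using (FieldOn; Paley; size; adj; IsSimple; _⊑ᵢ_)
 open Sums
 open Characters
 open import Data.Fin.Properties using (_≟_)
 open import Data.Integer.Base using (+_; _+_; _*_; _-_; -_; _≤_; _<_)
 open import Data.Integer.Tactic.RingSolver using (solve-∀)

 count : ∀ {n} → (Fin n → Bool) → ℤ
 count B = sum (λ i → 𝟙 (B i))

 0≤count : ∀ {n} (B : Fin n → Bool) → 0ℤ ≤ count B
 0≤count B = ∑-0≤ (λ i → 0≤𝟙 (B i))

 _⊆_ : ∀ {n} → (Fin n → Bool) → (Fin n → Bool) → Set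
 A ⊆ B = ∀ i → A i ≡ true → B i ≡ true

 -- Candidate sets are cut to a common exact size, because `choose-vertex` compares moments of
 -- several sets with the size of another.
 trim : ∀ {n} (B : Fin n → Bool) b → + b ≤ count B → ∃ λ A → A ⊆ B × count A ≡ + b
 trim {n} B zero _ = (λ _ → false) , (λ _ ()) , ∑-0 n
 trim {zero} B (suc b) h with +≤+ () ← subst (+ suc b ≤_) (∑-[] _) h
 trim {suc n} B (suc b) h = go (B zero) refl (subst (+ suc b ≤_) (∑-∷ (λ i → 𝟙 (B i))) h)
   where
   go : ∀ b₀ → B zero ≡ b₀ → + suc b ≤ 𝟙 (B zero) + count (B ∘ suc) → ∃ λ A → A ⊆ B × count A ≡ + suc b
   go true eq h with A , A⊆ , cA ← trim (B ∘ suc) b (+-cancelˡ 1ℤ (subst (λ z → + suc b ≤ 𝟙 z + count (B ∘ suc)) eq h)) =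
     (λ { zero → true ; (suc i) → A i }) , (λ { zero _ → eq ; (suc i) → A⊆ i }) , trans (∑-∷ _) (cong (λ z → 1ℤ + z) cA)
   go false eq h with A , A⊆ , cA ← trim (B ∘ suc) (suc b) (subst (+ suc b ≤_) (ℤ.+-identityˡ _) (subst (λ z → + suc b ≤ 𝟙 z + count (B ∘ suc)) eq h)) =
     (λ { zero → false ; (suc i) → A i }) , (λ { zero () ; (suc i) → A⊆ i }) , trans (∑-∷ _) (trans (ℤ.+-identityˡ _) cA)

 sg : Bool → ℤ
 sg true = 1ℤ
 sg false = -1ℤ

 sg≢0 : ∀ b → sg b ≢ 0ℤ
 sg≢0 true ()
 sg≢0 false ()

 by-dec : ∀ {a b} {t : True (a ℤ.≤? b)} → a ≤ b
 by-dec {t = t} = toWitness t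

 -- The pointwise form of `refine-count`. The indicator d marks the chosen vertex itself, where the
 -- character value z is 0 and one candidate may be lost; elsewhere z is 1 or -1, and 1 + `sg e` z
 -- is 0 or 2.
 refine-point : ∀ b e z d → (d ≡ 1ℤ × z ≡ 0ℤ) ⊎ (d ≡ 0ℤ × (z ≡ 1ℤ ⊎ z ≡ -1ℤ)) →
   (𝟙 b + sg e * (𝟙 b * z)) - d ≤ + 2 * 𝟙 (b ∧ does (z ℤ.≟ sg e))
 refine-point true true _ _ (inj₁ (refl , refl)) = by-dec
 refine-point true false _ _ (inj₁ (refl , refl)) = by-dec
 refine-point false true _ _ (inj₁ (refl , refl)) = by-dec
 refine-point false false _ _ (inj₁ (refl , refl)) = by-dec
 refine-point true true _ _ (inj₂ (refl , inj₁ refl)) = by-dec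
 refine-point true true _ _ (inj₂ (refl , inj₂ refl)) = by-dec
 refine-point true false _ _ (inj₂ (refl , inj₁ refl)) = by-dec
 refine-point true false _ _ (inj₂ (refl , inj₂ refl)) = by-dec
 refine-point false true _ _ (inj₂ (refl , inj₁ refl)) = by-dec
 refine-point false true _ _ (inj₂ (refl , inj₂ refl)) = by-dec
 refine-point false false _ _ (inj₂ (refl , inj₁ refl)) = by-dec
 refine-point false false _ _ (inj₂ (refl , inj₂ refl)) = by-dec

 -- The number of candidates that every vertex must have when j vertices remain. Placing one of j +
 -- 1 vertices costs one candidate for the image itself and a deviation of j n, and halves what is
 -- left.
 β : ℕ → ℕ → ℕ
 β n zero = 0
 β n (suc j) = 2 ℕ.* β n j ℕ.+ j ℕ.* n ℕ.+ 1

 β-closed : ∀ n k → β n k ℕ.+ suc k ℕ.* n ℕ.+ 1 ≡ 2 ℕ.^ k ℕ.* (n ℕ.+ 1)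
 β-closed n zero = lem n
   where
   lem : ∀ n → 0 ℕ.+ 1 ℕ.* n ℕ.+ 1 ≡ 1 ℕ.* (n ℕ.+ 1)
   lem = ℕ.solve-∀
 β-closed n (suc k) = trans (lem (β n k) k n) (trans (cong (2 ℕ.*_) (β-closed n k)) (sym (ℕ.*-assoc 2 (2 ℕ.^ k) _)))
   where
   lem : ∀ b k n → 2 ℕ.* b ℕ.+ k ℕ.* n ℕ.+ 1 ℕ.+ suc (suc k) ℕ.* n ℕ.+ 1 ≡ 2 ℕ.* (b ℕ.+ suc k ℕ.* n ℕ.+ 1)
   lem = ℕ.solve-∀

 -- With 2^k ≤ n the closed form gives at most n (n + 1) - (k + 1) n - 1, and this is below n², the
 -- order of the field.
 β-bound : ∀ n k → 2 ℕ.^ k ℕ.≤ n → β n k ℕ.≤ n ℕ.* n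
 β-bound n k h = ℕ.+-cancelʳ-≤ (suc k ℕ.* n ℕ.+ 1) _ _ (ℕ.≤-trans (ℕ.≤-reflexive (trans (sym (ℕ.+-assoc (β n k) _ 1)) (β-closed n k)))
   (ℕ.≤-trans (ℕ.*-monoˡ-≤ (n ℕ.+ 1) h) (ℕ.≤-trans (ℕ.≤-reflexive (trans (ℕ.*-distribˡ-+ n n 1) (cong (n ℕ.* n ℕ.+_) (ℕ.*-identityʳ n)))) (ℕ.+-monoʳ-≤ (n ℕ.* n) (ℕ.≤-trans (ℕ.m≤m+n n (k ℕ.* n)) (ℕ.m≤m+n _ 1))))))

 module SquareField {r} (F : FieldOn r) (n c : ℕ) (n≡ : n ≡ suc (2 ℕ.* c)) (r≡ : r ≡ n ℕ.* n) where
   open FieldChar F public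

   -- Half of n² - 1. It is even, so -1 = g^half is a square; hence χ is an even function and the
   -- Paley relation is symmetric.
   half : ℕ
   half = 2 ℕ.* (c ℕ.* suc c)

   m≡ : m ≡ 2 ℕ.* half
   m≡ = ℕ.suc-injective (trans (sym 1+m) (trans r≡ (trans (cong₂ ℕ._*_ n≡ n≡) (lem c))))
     where
     lem : ∀ c → suc (2 ℕ.* c) ℕ.* suc (2 ℕ.* c) ≡ suc (2 ℕ.* (2 ℕ.* (c ℕ.* suc c)))
     lem = ℕ.solve-∀

   open Odd half m≡ public

   χ-neg : ∀ x → χ (⊖ x) ≡ χ x
   χ-neg x = trans (cong χ (trans (cong ⊖_ (sym (⊗-identityˡ x))) (⊖-distribˡ 1ᶠ x))) (trans (χ-⊗ (⊖ 1ᶠ) x)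
     (trans (cong (_* χ x) (trans (cong χ (sym g^h)) (trans (χ-g^ half) (sgn-2* (c ℕ.* suc c))))) (ℤ.*-identityˡ (χ x))))

   χ-swap : ∀ x y → χ (x ⊕ ⊖ y) ≡ χ (y ⊕ ⊖ x)
   χ-swap x y = trans (cong χ (solve 2 (λ x y → x :+ :- y := :- (y :+ :- x)) refl x y)) (χ-neg _)

   sqr-of-sg : ∀ {d} b → χ d ≡ sg b → sqr d ≡ b
   sqr-of-sg true = χ≡1⇒sqr
   sqr-of-sg false = χ≡-1⇒sqr

   sqr0 : sqr 0ᶠ ≡ false
   sqr0 with 0ᶠ ≟ 0ᶠ
   ... | yes _ = refl
   ... | no h = ⊥-elim (h refl)

   χ-diff : ∀ x → χ (x ⊕ ⊖ x) ≡ 0ℤ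
   χ-diff x = trans (cong χ (⊖-inverseʳ x)) χ0

   S : (Fin r → Bool) → Fin r → ℤ
   S B x = ∑[ y < r ] (𝟙 (B y) * χ (x ⊕ ⊖ y))

   -- Expand the square and apply orthogonality: each pair y, z in B contributes -1, and the
   -- diagonal contributes r in addition.
   second-moment : ∀ B → ∑[ x < r ] (S B x * S B x) ≡ + r * count B - count B * count B
   second-moment B = trans (∑-cong λ x → ∑-sq (λ y → 𝟙 (B y) * χ (x ⊕ ⊖ y)))
     (trans (∑-comm (λ x y → ∑[ z < r ] (b y * χ (x ⊕ ⊖ y) * (b z * χ (x ⊕ ⊖ z)))))
     (trans (∑-cong λ y → trans (∑-comm (λ x z → b y * χ (x ⊕ ⊖ y) * (b z * χ (x ⊕ ⊖ z)))) (trans (∑-cong λ z → inner y z) (row y)))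
     (trans (∑-sub (λ y → + r * b y) (λ y → b y * count B)) (cong₂ _-_ (∑-*ˡ (+ r) b) (∑-*ʳ (count B) b)))))
     where
     b = λ y → 𝟙 (B y)
     inner : ∀ y z → ∑[ x < r ] (b y * χ (x ⊕ ⊖ y) * (b z * χ (x ⊕ ⊖ z))) ≡ b y * b z * (+ r * δ y z - 1ℤ)
     inner y z = trans (∑-cong λ x → lem (b y) (χ (x ⊕ ⊖ y)) (b z) (χ (x ⊕ ⊖ z))) (trans (∑-*ˡ (b y * b z) (λ x → χ (x ⊕ ⊖ y) * χ (x ⊕ ⊖ z))) (cong (b y * b z *_) (orthogonality y z)))
       where
       lem : ∀ p q s t → p * q * (s * t) ≡ p * s * (q * t)
       lem = solve-∀
     idem : ∀ a → 𝟙 a * 𝟙 a ≡ 𝟙 a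
     idem true = refl
     idem false = refl
     row : ∀ y → ∑[ z < r ] (b y * b z * (+ r * δ y z - 1ℤ)) ≡ + r * b y - b y * count B
     row y = trans (∑-cong λ z → lem (b y) (b z) (+ r) (δ y z)) (trans (∑-sub (λ z → δ y z * (+ r * (b y * b z))) (λ z → b y * b z))
       (cong₂ _-_ (trans (∑-δ y (λ z → + r * (b y * b z))) (cong (+ r *_) (idem (B y)))) (∑-*ˡ (b y) b)))
       where
       lem : ∀ p q s t → p * q * (s * t - 1ℤ) ≡ t * (s * (p * q)) - p * q
       lem = solve-∀

   -- All sets have the same size s. Summed over the whole field, the squares of the j sums are at
   -- most j r s, so one of the s elements of B₀ has them summing to at most j r = j n². Each sum is
   -- then at most √j n ≤ j n in absolute value.
   choose-vertex : ∀ j b (B₀ : Fin r → Bool) (B : Fin j → Fin r → Bool) → count B₀ ≡ + suc b → (∀ l → count (B l) ≡ + suc b) →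
     ∃ λ x → B₀ x ≡ true × (∀ l → S (B l) x ≤ + (j ℕ.* n) × - S (B l) x ≤ + (j ℕ.* n))
   choose-vertex j b B₀ B c₀ cB = x , 0<𝟙* (B₀ x) (subst (0ℤ <_) (sym (ℤ.*-identityʳ _)) (proj₁ (proj₂ chosen))) , bound
     where
     E : Fin r → ℤ
     E x = ∑[ l < j ] (S (B l) x * S (B l) x)
     0≤E : ∀ x → 0ℤ ≤ E x
     0≤E x = ∑-0≤ (λ l → 0≤sq (S (B l) x))
     s = + suc b
     total : sum E ≡ + j * (+ r * s - s * s)
     total = trans (∑-comm (λ x l → S (B l) x * S (B l) x)) (trans (∑-cong λ l → trans (second-moment (B l)) (cong (λ z → + r * z - z * z) (cB l))) (∑-const j _))
     avg : ∑[ x < r ] (𝟙 (B₀ x) * E x) ≤ ∑[ x < r ] (𝟙 (B₀ x) * (+ j * + r))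
     avg = ℤ.≤-trans (∑-mono λ x → subst (𝟙 (B₀ x) * E x ≤_) (ℤ.*-identityˡ (E x)) (*-monoʳ (E x) (0≤E x) (𝟙≤1 (B₀ x))))
       (subst₂ _≤_ (sym total) (sym (trans (∑-*ʳ (+ j * + r) (λ x → 𝟙 (B₀ x))) (cong (_* (+ j * + r)) c₀)))
         (≤-cert (+ j * (s * s)) (*-0≤ {+ j} (+≤+ z≤n) (0≤sq s)) (lem (+ j) (+ r) s)))
       where
       lem : ∀ j r s → s * (j * r) ≡ j * (r * s - s * s) + j * (s * s)
       lem = solve-∀
     chosen : ∃ λ x → 0ℤ < 𝟙 (B₀ x) × E x ≤ + j * + r
     chosen = ∑-avg (λ x → 𝟙 (B₀ x)) E (λ _ → + j * + r) (λ x → 0≤𝟙 (B₀ x)) (subst (0ℤ <_) (sym c₀) (+<+ (s≤s z≤n))) avg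
     x = proj₁ chosen
     bound : ∀ l → S (B l) x ≤ + (j ℕ.* n) × - S (B l) x ≤ + (j ℕ.* n)
     bound l = sq-mono⁻¹ _ _ (+≤+ z≤n) sq≤ , sq-mono⁻¹ _ _ (+≤+ z≤n) (subst (_≤ + (j ℕ.* n) * + (j ℕ.* n)) (neg-sq (S (B l) x)) sq≤)
       where
       neg-sq : ∀ a → a * a ≡ (- a) * (- a)
       neg-sq = solve-∀
       sq≤ : S (B l) x * S (B l) x ≤ + (j ℕ.* n) * + (j ℕ.* n)
       sq≤ = ℤ.≤-trans (∑-term (λ l → 0≤sq (S (B l) x)) l) (ℤ.≤-trans (proj₂ (proj₂ chosen)) (subst₂ _≤_ (ℤ.pos-* j r) (ℤ.pos-* (j ℕ.* n) (j ℕ.* n)) (+≤+ (jr≤ j l))))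
         where
         jr≤ : ∀ j → Fin j → j ℕ.* r ℕ.≤ j ℕ.* n ℕ.* (j ℕ.* n)
         jr≤ (suc j) _ = subst (λ z → suc j ℕ.* z ℕ.≤ _) (sym r≡) (ℕ.≤-trans (ℕ.≤-reflexive (sym (ℕ.*-assoc (suc j) n n))) (ℕ.*-monoʳ-≤ (suc j ℕ.* n) (ℕ.m≤n*m n (suc j))))

   refine : (Fin r → Bool) → Fin r → Bool → Fin r → Bool
   refine B x e y = B y ∧ does (χ (x ⊕ ⊖ y) ℤ.≟ sg e)

   refine-count : ∀ B x e → count B + sg e * S B x - 1ℤ ≤ + 2 * count (refine B x e)
   refine-count B x e = subst₂ _≤_ lhs (∑-*ˡ (+ 2) (λ y → 𝟙 (refine B x e y))) (∑-mono point)
     where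
     lhs : sum (λ y → (𝟙 (B y) + sg e * (𝟙 (B y) * χ (x ⊕ ⊖ y))) - δ x y) ≡ count B + sg e * S B x - 1ℤ
     lhs = trans (∑-sub (λ y → 𝟙 (B y) + sg e * (𝟙 (B y) * χ (x ⊕ ⊖ y))) (δ x)) (cong₂ _-_ (trans (∑-+ (λ y → 𝟙 (B y)) (λ y → sg e * (𝟙 (B y) * χ (x ⊕ ⊖ y)))) (cong (λ z → count B + z) (∑-*ˡ (sg e) (λ y → 𝟙 (B y) * χ (x ⊕ ⊖ y))))) (∑-δ1 x))
     point : ∀ y → (𝟙 (B y) + sg e * (𝟙 (B y) * χ (x ⊕ ⊖ y))) - δ x y ≤ + 2 * 𝟙 (refine B x e y)
     point y = refine-point (B y) e (χ (x ⊕ ⊖ y)) (δ x y) cases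
       where
       cases : (δ x y ≡ 1ℤ × χ (x ⊕ ⊖ y) ≡ 0ℤ) ⊎ (δ x y ≡ 0ℤ × (χ (x ⊕ ⊖ y) ≡ 1ℤ ⊎ χ (x ⊕ ⊖ y) ≡ -1ℤ))
       cases with δ-cases x y
       ... | inj₁ (refl , d) = inj₁ (d , χ-diff x)
       ... | inj₂ (x≢y , d) = inj₂ (d , χ-cases (x≢y ∘ sub≡0⇒≡))

   embed : ∀ k (a : Fin k → Fin k → Bool) → (∀ u v → a u v ≡ a v u) → (B : Fin k → Fin r → Bool) → (∀ i → + β n k ≤ count (B i)) →
     Σ (Fin k → Fin r) λ f → (∀ i → B i (f i) ≡ true) × (∀ u v → u ≢ v → χ (f u ⊕ ⊖ f v) ≡ sg (a u v))
   embed zero a sa B h = (λ ()) , (λ ()) , (λ ())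
   embed (suc j) a sa B h = f , f∈ , fχ
     where
     b = 2 ℕ.* β n j ℕ.+ j ℕ.* n
     β≡ : β n (suc j) ≡ suc b
     β≡ = ℕ.+-comm b 1
     A : Fin (suc j) → Fin r → Bool
     A i = proj₁ (trim (B i) (suc b) (subst (λ z → + z ≤ count (B i)) β≡ (h i)))
     A⊆ : ∀ i → A i ⊆ B i
     A⊆ i = proj₁ (proj₂ (trim (B i) (suc b) (subst (λ z → + z ≤ count (B i)) β≡ (h i))))
     cA : ∀ i → count (A i) ≡ + suc b
     cA i = proj₂ (proj₂ (trim (B i) (suc b) (subst (λ z → + z ≤ count (B i)) β≡ (h i))))
     chosen = choose-vertex j b (A zero) (A ∘ suc) (cA zero) (cA ∘ suc)
     x = proj₁ chosen
     B' : Fin j → Fin r → Bool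
     B' l = refine (A (suc l)) x (a zero (suc l))
     cB' : ∀ l → + β n j ≤ count (B' l)
     cB' l = *-cancelˡ (+ 2) (+<+ (s≤s z≤n)) (ℤ.≤-trans low (refine-count (A (suc l)) x (a zero (suc l))))
       where
       sgS : ∀ e s → s ≤ + (j ℕ.* n) → - s ≤ + (j ℕ.* n) → 0ℤ ≤ sg e * s + + (j ℕ.* n)
       sgS true s _ q = subst (0ℤ ≤_) (lem s (+ (j ℕ.* n))) (≤-diff q)
         where
         lem : ∀ s t → t - - s ≡ 1ℤ * s + t
         lem = solve-∀
       sgS false s p _ = subst (0ℤ ≤_) (lem s (+ (j ℕ.* n))) (≤-diff p)
         where
         lem : ∀ s t → t - s ≡ -1ℤ * s + t
         lem = solve-∀
       low : + 2 * + β n j ≤ count (A (suc l)) + sg (a zero (suc l)) * S (A (suc l)) x - 1ℤ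
       low = ≤-cert _ (sgS (a zero (suc l)) (S (A (suc l)) x) (proj₁ (proj₂ (proj₂ chosen) l)) (proj₂ (proj₂ (proj₂ chosen) l)))
         (trans (cong (λ z → z + sg (a zero (suc l)) * S (A (suc l)) x - 1ℤ) (trans (cA (suc l)) eq)) (lem (+ β n j) (+ (j ℕ.* n)) (sg (a zero (suc l)) * S (A (suc l)) x)))
         where
         eq : + suc b ≡ 1ℤ + (+ 2 * + β n j + + (j ℕ.* n))
         eq = cong (λ z → 1ℤ + (z + + (j ℕ.* n))) (ℤ.pos-* 2 (β n j))
         lem : ∀ p q s → 1ℤ + (+ 2 * p + q) + s - 1ℤ ≡ + 2 * p + (s + q)
         lem = solve-∀
     rec = embed j (λ u v → a (suc u) (suc v)) (λ u v → sa (suc u) (suc v)) B' cB'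
     f : Fin (suc j) → Fin r
     f zero = x
     f (suc i) = proj₁ rec i
     ∧-l : ∀ {p q} → p ∧ q ≡ true → p ≡ true
     ∧-l {true} _ = refl
     ∧-r : ∀ {p q} → p ∧ q ≡ true → q ≡ true
     ∧-r {true} e = e
     f∈ : ∀ i → B i (f i) ≡ true
     f∈ zero = A⊆ zero x (proj₁ (proj₂ chosen))
     f∈ (suc i) = A⊆ (suc i) _ (∧-l (proj₁ (proj₂ rec) i))
     χ0l : ∀ l → χ (x ⊕ ⊖ proj₁ rec l) ≡ sg (a zero (suc l))
     χ0l l = decide (χ (x ⊕ ⊖ proj₁ rec l)) (∧-r {A (suc l) (proj₁ rec l)} (proj₁ (proj₂ rec) l))
       where
       decide : ∀ z {e} → does (z ℤ.≟ e) ≡ true → z ≡ e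
       decide z {e} h with z ℤ.≟ e
       ... | yes p = p
     fχ : ∀ u v → u ≢ v → χ (f u ⊕ ⊖ f v) ≡ sg (a u v)
     fχ zero zero h = ⊥-elim (h refl)
     fχ zero (suc l) _ = χ0l l
     fχ (suc l) zero _ = trans (χ-swap _ _) (trans (χ0l l) (cong sg (sa zero (suc l))))
     fχ (suc u) (suc v) h = proj₂ (proj₂ rec) u v (h ∘ cong suc)

   -- Values 1 and -1 off the diagonal already force f to be injective, because χ vanishes at 0.
   paley-embed : ∀ {k} (a : Fin k → Fin k → Bool) → (∀ u → a u u ≡ false) → (f : Fin k → Fin r) →
     (∀ u v → u ≢ v → χ (f u ⊕ ⊖ f v) ≡ sg (a u v)) → record { size = k ; adj = a } ⊑ᵢ Paley F
   paley-embed a irr f h = f , inj , pres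
     where
     inj : ∀ u v → f u ≡ f v → u ≡ v
     inj u v e with u ≟ v
     ... | yes p = p
     ... | no q = ⊥-elim (sg≢0 (a u v) (trans (sym (h u v q)) (trans (cong χ (≡⇒sub≡0 e)) χ0)))
     pres : ∀ u v → a u v ≡ adj (Paley F) (f u) (f v)
     pres u v with u ≟ v
     ... | yes refl = trans (irr u) (sym (trans (cong sqr (⊖-inverseʳ (f u))) sqr0))
     ... | no q = sym (sqr-of-sg (a u v) (h u v q))

   universal : ∀ G → IsSimple G → 2 ℕ.^ size G ℕ.≤ n → G ⊑ᵢ Paley F
   universal G (irr , sy) h = paley-embed (adj G) irr (proj₁ e) (proj₂ (proj₂ e))
     where
     full : + β n (size G) ≤ count {r} (λ _ → true)
     full = subst (+ β n (size G) ≤_) (sym (trans (∑-const r 1ℤ) (ℤ.*-identityʳ (+ r)))) (+≤+ (subst (β n (size G) ℕ.≤_) (sym r≡) (β-bound n (size G) h)))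
     e = embed (size G) (adj G) sy (λ _ _ → true) (λ _ → full)

-- Balanced designs with small average correlations

module Designs where
 open Sums
 open import Data.Integer.Base using (+_; _*_; _≤_)

 -- An edge has sign -1, so that the signs are values of the quadratic character before scaling by a nonsquare.
 ε : Bool → ℤ
 ε true = -1ℤ
 ε false = 1ℤ

 ε² : ∀ b → ε b * ε b ≡ 1ℤ
 ε² true = refl
 ε² false = refl

 -- The interface through which the patterns for cycles and bicliques are found without further
 -- reference to the field. Each column has as many edges as non-edges. Its correlation with itself
 -- is N, so the bound 4 N² leaves 3 N² for all other columns together.
 record Design (N l : ℕ) : Set where
   field
     edge : Fin N → Fin l → Bool

   corr : Fin l → Fin l → ℤ
   corr y y' = ∑[ t < N ] (ε (edge t y) * ε (edge t y'))

   field
     balanced : ∀ y → ∑[ t < N ] ε (edge t y) ≡ 0ℤ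
     energy : ∀ y → ∑[ y' < l ] (corr y y' * corr y y') ≤ + 4 * (+ N * + N)

-- Frobenius and the subfield of order n

module Subfields where
 open import Defs using (FieldOn)
 open Sums
 open Characters
 open Universality
 open import Algebra.Bundles using (CommutativeRing; Semiring)
 open import Data.Fin.Base using (fromℕ<; inject₁; fromℕ)
 open import Data.Fin.Properties using (_≟_; toℕ<n; toℕ-injective; toℕ-fromℕ<; toℕ-inject₁; toℕ-fromℕ)
 open import Data.Fin.Permutation using (permutation)
 open import Data.Integer.Base using (+_; _+_; _*_; _-_; -_; _≤_; _<_)
 open import Data.Integer.Tactic.RingSolver using (solve-∀)
 open import Data.Nat.Base using (pred; NonZero)
 open import Data.Nat.Combinatorics using (_C_; nCn≡1)
 open import Data.Nat.Divisibility using (_∣_; divides)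
 open import Data.Nat.Primality using (Prime; prime⇒nonZero)

 module Frobenius {r} (F : FieldOn r) {p} (pp : Prime p) (E : ℕ) (r≡p^E : r ≡ p ℕ.^ E) where
   open FieldChar F

   open import Algebra.Properties.CommutativeMonoid.Sum (CommutativeRing.+-commutativeMonoid commutativeRing)
     using () renaming (sum to add; sum-cong-≗ to add-cong; ∑-distrib-+ to add-⊕; sum-permute to add-permute; sum-init-last to add-init-last; sum-replicate to add-replicate; sum-replicate-zero to add-zero)
   import Algebra.Properties.CommutativeSemiring.Binomial (CommutativeRing.commutativeSemiring commutativeRing) as Binom
   open import Algebra.Definitions.RawSemiring (Semiring.rawSemiring (CommutativeRing.semiring commutativeRing)) using () renaming (_×_ to _·_; _^_ to _^′_)

   ·-nat : ∀ k x → k · x ≡ nat k ⊗ x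
   ·-nat zero x = sym (⊗-zeroˡ x)
   ·-nat (suc k) x = trans (cong₂ _⊕_ (sym (⊗-identityˡ x)) (·-nat k x)) (sym (⊗-distribʳ x 1ᶠ (nat k)))

   ·-1 : ∀ x → 1 · x ≡ x
   ·-1 x = ⊕-identityʳ x

   ·-0 : ∀ {k} x → nat k ≡ 0ᶠ → k · x ≡ 0ᶠ
   ·-0 {k} x h = trans (·-nat k x) (trans (cong (_⊗ x) h) (⊗-zeroˡ x))

   ^′≡^ : ∀ x k → x ^′ k ≡ x ^ k
   ^′≡^ x zero = refl
   ^′≡^ x (suc k) = cong (x ⊗_) (^′≡^ x k)

   -- Translation by 1 permutes the field, so r · 1 = 0.
   nat-r : nat r ≡ 0ᶠ
   nat-r = trans (sym (⊗-identityʳ _)) (trans (sym (·-nat r 1ᶠ)) (trans (sym (add-replicate r)) (cancel e)))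
     where
     π = permutation (1ᶠ ⊕_) (⊖ 1ᶠ ⊕_) (λ x → solve 2 (λ o x → o :+ (:- o :+ x) := x) refl 1ᶠ x) (λ x → solve 2 (λ o x → :- o :+ (o :+ x) := x) refl 1ᶠ x)
     e : add (λ x → x) ≡ add {r} (λ _ → 1ᶠ) ⊕ add (λ x → x)
     e = trans (add-permute (λ x → x) π) (add-⊕ (λ _ → 1ᶠ) (λ x → x))
     cancel : ∀ {a b} → b ≡ a ⊕ b → a ≡ 0ᶠ
     cancel {a} {b} h = trans (solve 2 (λ a b → a := (a :+ b) :+ :- b) refl a b) (≡⇒sub≡0 (sym h))

   nat-^ : ∀ a k → nat (a ℕ.^ k) ≡ nat a ^ k
   nat-^ a zero = ⊕-identityʳ 1ᶠ
   nat-^ a (suc k) = trans (nat-* a (a ℕ.^ k)) (cong (nat a ⊗_) (nat-^ a k))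

   nat-p : nat p ≡ 0ᶠ
   nat-p with 0? (nat p)
   ... | inj₁ e = e
   ... | inj₂ h = ⊥-elim (≢0-^ E h (trans (sym (nat-^ p E)) (trans (cong nat (sym r≡p^E)) nat-r)))

   nat-∣ : ∀ {k} → p ∣ k → nat k ≡ 0ᶠ
   nat-∣ (divides q refl) = trans (nat-* q p) (trans (cong (nat q ⊗_) nat-p) (⊗-zeroʳ _))

   -- The binomial theorem: all inner coefficients are divisible by p and vanish in the field.
   frob-p : ∀ x y → (x ⊕ y) ^ p ≡ x ^ p ⊕ y ^ p
   frob-p x y = go p refl
     where
     go : ∀ k → k ≡ p → (x ⊕ y) ^ k ≡ x ^ k ⊕ y ^ k
     go zero e = ⊥-elim (ℕ.≢-nonZero⁻¹ p {{prime⇒nonZero pp}} (sym e))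
     go (suc k) e = trans (sym (^′≡^ _ (suc k))) (trans (Binom.theorem (suc k) x y) (trans (cong₂ _⊕_ first (trans (add-init-last (λ i → t (suc i))) (cong₂ _⊕_ middle last))) (trans (cong (y ^ suc k ⊕_) (⊕-identityˡ _)) (⊕-comm _ _))))
       where
       t = Binom.binomialTerm x y (suc k)
       first : t zero ≡ y ^ suc k
       first = trans (·-1 _) (trans (⊗-identityˡ _) (^′≡^ y (suc k)))
       middle : add {k} (λ i → t (suc (inject₁ i))) ≡ 0ᶠ
       middle = trans (add-cong λ i → ·-0 {suc k C suc (toℕ (inject₁ i))} _ (nat-∣ (subst (λ z → z ∣ suc k C suc (toℕ (inject₁ i))) e (prime∣C (subst Prime (sym e) pp) _ (s≤s z≤n) (s≤s (subst (ℕ._< k) (sym (toℕ-inject₁ i)) (toℕ<n i))))))) (add-zero k)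
       last : t (suc (fromℕ k)) ≡ x ^ suc k
       last = trans (cong (λ j → (suc k C suc j) · ((x ^′ suc j) ⊗ (y ^′ (k ℕ.∸ j)))) (toℕ-fromℕ k))
         (trans (cong₂ (λ a b → a · ((x ^′ suc k) ⊗ (y ^′ b))) (nCn≡1 (suc k)) (ℕ.n∸n≡0 k)) (trans (·-1 _) (trans (⊗-identityʳ _) (^′≡^ x (suc k)))))

   frob : ∀ e x y → (x ⊕ y) ^ (p ℕ.^ e) ≡ x ^ (p ℕ.^ e) ⊕ y ^ (p ℕ.^ e)
   frob zero x y = trans (⊗-identityʳ _) (sym (cong₂ _⊕_ (⊗-identityʳ x) (⊗-identityʳ y)))
   frob (suc e) x y = trans (^-* (x ⊕ y) p (p ℕ.^ e)) (trans (cong (_^ (p ℕ.^ e)) (frob-p x y)) (trans (frob e (x ^ p) (y ^ p)) (sym (cong₂ _⊕_ (^-* x p _) (^-* y p _)))))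

 -- The subfield of order n inside a field of order n².
 module Subfield {r} (F : FieldOn r) (n c : ℕ) (n≡ : n ≡ suc (2 ℕ.* c)) (r≡ : r ≡ n ℕ.* n)
     (frob-n : FieldChar.AdditivePower F n) where
   open SquareField F n c n≡ r≡ public

   -- The subfield as the fixed points of x ↦ xⁿ; closure under the field operations then follows
   -- from additivity and multiplicativity of this map.
   Sub : Fin r → Set
   Sub x = x ^ n ≡ x

   n-suc : n ≡ suc (pred n)
   n-suc = trans n≡ (cong suc (sym (cong pred n≡)))

   Sub-0 : Sub 0ᶠ
   Sub-0 = trans (cong (0ᶠ ^_) n-suc) (0^ (pred n))

   Sub-1 : Sub 1ᶠ
   Sub-1 = 1^ n

   Sub-⊕ : ∀ {x y} → Sub x → Sub y → Sub (x ⊕ y)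
   Sub-⊕ hx hy = trans (frob-n _ _) (cong₂ _⊕_ hx hy)

   Sub-⊗ : ∀ {x y} → Sub x → Sub y → Sub (x ⊗ y)
   Sub-⊗ {x} {y} hx hy = trans (⊗-^ x y n) (cong₂ _⊗_ hx hy)

   Sub-⊖ : ∀ {x} → Sub x → Sub (⊖ x)
   Sub-⊖ {x} hx = sub≡0⇒≡ (trans (cong ((⊖ x) ^ n ⊕_) (⊖-involutive x)) (trans (cong ((⊖ x) ^ n ⊕_) (sym hx))
     (trans (sym (frob-n (⊖ x) x)) (trans (cong (_^ n) (⊖-inverseˡ x)) Sub-0))))

   Sub-sub : ∀ {x y} → Sub x → Sub y → Sub (x ⊕ ⊖ y)
   Sub-sub hx hy = Sub-⊕ hx (Sub-⊖ hy)

   Sub-inv : ∀ {x} → x ≢ 0ᶠ → Sub x → Sub (inv x)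
   Sub-inv {x} h hx = ⊗-cancelˡ h (trans (cong (_⊗ inv x ^ n) (sym hx)) (trans (sym (⊗-^ x (inv x) n)) (trans (cong (_^ n) (inv-r h)) (trans (1^ n) (sym (inv-r h))))))

   m≡n : m ≡ suc n ℕ.* (2 ℕ.* c)
   m≡n = ℕ.suc-injective (trans (sym 1+m) (trans r≡ (trans (cong (ℕ._* n) n≡) (trans (cong (suc (2 ℕ.* c) ℕ.*_) n≡) (trans (lem (2 ℕ.* c)) (cong (λ z → suc (suc z ℕ.* (2 ℕ.* c))) (sym n≡)))))))
     where
     lem : ∀ a → suc a ℕ.* suc a ≡ suc (suc (suc a) ℕ.* a)
     lem = ℕ.solve-∀

   -- Since m = (n + 1)(n - 1), the powers of g^(n+1) are the n - 1 nonzero elements of the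
   -- subfield. As n + 1 is even, this form shows at once that they are squares in the large field.
   κ : Fin (2 ℕ.* c) → Fin r
   κ i = g ^ (suc n ℕ.* toℕ i)

   κ≢0 : ∀ i → κ i ≢ 0ᶠ
   κ≢0 i = ≢0-^ (suc n ℕ.* toℕ i) g≢0

   κ-inj : ∀ i j → κ i ≡ κ j → i ≡ j
   κ-inj i j e = toℕ-injective (ℕ.*-cancelˡ-≡ _ _ (suc n) (g^-inj (lt i) (lt j) e))
     where
     lt : ∀ i → suc n ℕ.* toℕ i ℕ.< m
     lt i = subst (suc n ℕ.* toℕ i ℕ.<_) (sym m≡n) (ℕ.*-monoʳ-< (suc n) (toℕ<n i))

   κ-Sub : ∀ i → Sub (κ i)
   κ-Sub i = trans (sym (^-* g (suc n ℕ.* toℕ i) n)) (trans (cong (g ^_) e) (trans (^-+ g (suc n ℕ.* toℕ i) (m ℕ.* toℕ i)) (trans (cong (κ i ⊗_) (^-∣ g^m (divides (toℕ i) (ℕ.*-comm m (toℕ i))))) (⊗-identityʳ _))))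
     where
     lem : ∀ n a t → suc n ℕ.* t ℕ.* suc a ≡ suc n ℕ.* t ℕ.+ suc n ℕ.* a ℕ.* t
     lem = ℕ.solve-∀
     e : suc n ℕ.* toℕ i ℕ.* n ≡ suc n ℕ.* toℕ i ℕ.+ m ℕ.* toℕ i
     e = trans (cong (suc n ℕ.* toℕ i ℕ.*_) n≡) (trans (lem n (2 ℕ.* c) (toℕ i)) (cong (λ z → suc n ℕ.* toℕ i ℕ.+ z ℕ.* toℕ i) (sym m≡n)))

   κ-surj : ∀ x → x ≢ 0ᶠ → Sub x → ∃ λ i → κ i ≡ x
   κ-surj x h hx with i , i<m , refl ← log x h = fin (divs)
     where
     instance
       nz : NonZero (2 ℕ.* c)
       nz = ℕ.m*n≢0⇒n≢0 (suc n) {{subst NonZero m≡n m≢0}}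
     -- g^(i n) = g^i forces m ∣ i (n ∸ 1), i.e. n + 1 ∣ i
     g^ : g ^ (i ℕ.* (2 ℕ.* c)) ≡ 1ᶠ
     g^ = ⊗-cancelˡ (≢0-^ i g≢0) (trans (sym (^-+ g i _)) (trans (cong (g ^_) (sym (trans (cong (i ℕ.*_) n≡) (ℕ.*-suc i (2 ℕ.* c))))) (trans (^-* g i n) (trans hx (sym (⊗-identityʳ _))))))
     divs : suc n ∣ i
     divs = ℕ.*-cancelʳ-∣ (2 ℕ.* c) (subst (_∣ i ℕ.* (2 ℕ.* c)) m≡n (g-order _ g^))
     fin : suc n ∣ i → ∃ λ j → κ j ≡ g ^ i
     fin (divides q refl) = fromℕ< q< , cong (g ^_) (trans (cong (suc n ℕ.*_) (toℕ-fromℕ< q<)) (ℕ.*-comm (suc n) q))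
       where
       q< : q ℕ.< 2 ℕ.* c
       q< = ℕ.*-cancelˡ-< (suc n) _ _ (subst₂ ℕ._<_ (ℕ.*-comm q (suc n)) m≡n i<m)

   Sub-χ : ∀ {x} → x ≢ 0ᶠ → Sub x → χ x ≡ 1ℤ
   Sub-χ {x} h hx with i , refl ← κ-surj x h hx = trans (cong χ e) (χ-square {g ^ (suc c ℕ.* toℕ i)} (≢0-^ (suc c ℕ.* toℕ i) g≢0))
     where
     lem : ∀ c t → suc (suc (2 ℕ.* c)) ℕ.* t ≡ suc c ℕ.* t ℕ.+ suc c ℕ.* t
     lem = ℕ.solve-∀
     e : g ^ (suc n ℕ.* toℕ i) ≡ g ^ (suc c ℕ.* toℕ i) ⊗ g ^ (suc c ℕ.* toℕ i)
     e = trans (cong (g ^_) (trans (cong (λ z → suc z ℕ.* toℕ i) n≡) (lem c (toℕ i)))) (^-+ g (suc c ℕ.* toℕ i) (suc c ℕ.* toℕ i))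

   ι : Fin (suc (2 ℕ.* c)) → Fin r
   ι zero = 0ᶠ
   ι (suc i) = κ i

   ι-inj : ∀ i j → ι i ≡ ι j → i ≡ j
   ι-inj zero zero e = refl
   ι-inj zero (suc j) e = ⊥-elim (κ≢0 j (sym e))
   ι-inj (suc i) zero e = ⊥-elim (κ≢0 i e)
   ι-inj (suc i) (suc j) e = cong suc (κ-inj i j e)

   ι-Sub : ∀ i → Sub (ι i)
   ι-Sub zero = Sub-0
   ι-Sub (suc i) = κ-Sub i

   ι-surj : ∀ x → Sub x → ∃ λ i → ι i ≡ x
   ι-surj x hx with 0? x
   ... | inj₁ refl = zero , refl
   ... | inj₂ h with i , e ← κ-surj x h hx = suc i , e

   σ : Fin r → Bool
   σ x = does (x ^ n ≟ x)

   σ-true : ∀ {x} → Sub x → σ x ≡ true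
   σ-true {x} h = dec-true (x ^ n ≟ x) h

   σ-false : ∀ {x} → ¬ Sub x → σ x ≡ false
   σ-false {x} h = dec-false (x ^ n ≟ x) h

   Sub? : ∀ x → (Sub x × σ x ≡ true) ⊎ (¬ Sub x × σ x ≡ false)
   Sub? x with x ^ n ≟ x
   ... | yes p = inj₁ (p , refl)
   ... | no p = inj₂ (p , refl)

   ∑-enum : ∀ {k} (e : Fin k → Fin r) → (∀ i j → e i ≡ e j → i ≡ j) → (b : Fin r → Bool) → (∀ i → b (e i) ≡ true) →
     (∀ x → b x ≡ true → ∃ λ i → e i ≡ x) → (f : Fin r → ℤ) → ∑[ i < k ] f (e i) ≡ ∑[ x < r ] (𝟙 (b x) * f x)
   ∑-enum {k} e inj b eb sur f = trans (∑-cong λ i → sym (∑-δ (e i) f)) (trans (∑-comm (λ i x → δ (e i) x * f x)) (∑-cong λ x → trans (∑-*ʳ (f x) (λ i → δ (e i) x)) (cong (_* f x) (fib x))))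
     where
     fib : ∀ x → ∑[ i < k ] δ (e i) x ≡ 𝟙 (b x)
     fib x with b x in eq
     ... | true with j , refl ← sur x eq = trans (∑-cong λ i → conv i) (∑-δ1 j)
       where
       conv : ∀ i → δ (e i) (e j) ≡ δ j i
       conv i with δ-cases j i
       ... | inj₁ (refl , d) = trans (δ-refl (e j)) (sym d)
       ... | inj₂ (h , d) = trans (δ-≢ (λ q → h (sym (inj i j q)))) (sym d)
     fib x | false = trans (∑-cong λ i → δ-≢ (λ q → true≢false (trans (sym (eb i)) (trans (cong b q) eq)))) (∑-0 k)
       where
       true≢false : true ≢ false
       true≢false ()

   ∑-Sub : ∀ f → ∑[ i < suc (2 ℕ.* c) ] f (ι i) ≡ ∑[ x < r ] (𝟙 (σ x) * f x)
   ∑-Sub = ∑-enum ι ι-inj σ (σ-true ∘ ι-Sub) (λ x e → ι-surj x (does-Sub x e))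
     where
     does-Sub : ∀ x → σ x ≡ true → Sub x
     does-Sub x e = does-true e

   count-σ : count σ ≡ + n
   count-σ = trans (∑-cong λ x → sym (ℤ.*-identityʳ (𝟙 (σ x)))) (trans (sym (∑-Sub (λ _ → 1ℤ))) (trans (∑-const (suc (2 ℕ.* c)) 1ℤ) (trans (ℤ.*-identityʳ _) (cong +_ (sym n≡)))))

   S-inside : ∀ {x} → Sub x → S σ x ≡ + n - 1ℤ
   S-inside {x} hx = trans (∑-cong point) (trans (∑-sub (λ t → 𝟙 (σ t)) (δ x)) (cong₂ _-_ count-σ (∑-δ1 x)))
     where
     point : ∀ t → 𝟙 (σ t) * χ (x ⊕ ⊖ t) ≡ 𝟙 (σ t) - δ x t
     point t with δ-cases x t
     ... | inj₁ (refl , d) = trans (cong₂ (λ a b → 𝟙 a * b) (σ-true hx) (χ-diff x)) (sym (cong₂ (λ a b → 𝟙 a - b) (σ-true hx) d))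
     ... | inj₂ (h , d) with Sub? t
     ...   | inj₁ (ht , e) = trans (cong₂ (λ a b → 𝟙 a * b) e (Sub-χ (h ∘ sub≡0⇒≡) (Sub-sub hx ht))) (sym (cong₂ (λ a b → 𝟙 a - b) e d))
     ...   | inj₂ (ht , e) = trans (cong (λ a → 𝟙 a * χ (x ⊕ ⊖ t)) e) (trans (ℤ.*-zeroˡ (χ (x ⊕ ⊖ t))) (sym (cong₂ (λ a b → 𝟙 a - b) e d)))

   ∑S : ∀ B → sum (S B) ≡ 0ℤ
   ∑S B = trans (∑-comm (λ x y → 𝟙 (B y) * χ (x ⊕ ⊖ y))) (trans (∑-cong λ y → trans (∑-*ˡ (𝟙 (B y)) (λ x → χ (x ⊕ ⊖ y))) (trans (cong (𝟙 (B y) *_) (∑χ-shift (⊖ y))) (ℤ.*-zeroʳ (𝟙 (B y))))) (∑-0 r))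

   +r≡ : + r ≡ + n * + n
   +r≡ = trans (cong +_ r≡) (ℤ.pos-* n n)

   -- First and second moments of S σ show that (S σ + 1)² vanishes on average outside the subfield.
   S-outside : ∀ {x} → ¬ Sub x → S σ x ≡ -1ℤ
   S-outside {x} hx = sqz (S σ x) (ℤ.≤-antisym (subst₂ _≤_ (term) total0 (∑-term 0≤f x)) (0≤sq (S σ x + 1ℤ)))
     where
     f : Fin r → ℤ
     f x = (1ℤ - 𝟙 (σ x)) * ((S σ x + 1ℤ) * (S σ x + 1ℤ))
     0≤f : ∀ x → 0ℤ ≤ f x
     0≤f x = *-0≤ (≤-diff (𝟙≤1 (σ x))) (0≤sq (S σ x + 1ℤ))
     term : f x ≡ (S σ x + 1ℤ) * (S σ x + 1ℤ)
     term = trans (cong (λ a → (1ℤ - 𝟙 a) * ((S σ x + 1ℤ) * (S σ x + 1ℤ))) (σ-false hx)) (ℤ.*-identityˡ _)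
     split : ∀ x → f x ≡ ((S σ x * S σ x + + 2 * S σ x) + 1ℤ) - 𝟙 (σ x) * (+ n * + n)
     split x with Sub? x
     ... | inj₁ (h , e) = trans (cong (λ a → (1ℤ - 𝟙 a) * ((S σ x + 1ℤ) * (S σ x + 1ℤ))) e) (sym (trans (cong₂ (λ a b → ((b * b + + 2 * b) + 1ℤ) - 𝟙 a * (+ n * + n)) e (S-inside h)) (lem (+ n))))
       where
       lem : ∀ n → (((n - 1ℤ) * (n - 1ℤ) + + 2 * (n - 1ℤ)) + 1ℤ) - 1ℤ * (n * n) ≡ 0ℤ
       lem = solve-∀
     ... | inj₂ (h , e) = trans (cong (λ a → (1ℤ - 𝟙 a) * ((S σ x + 1ℤ) * (S σ x + 1ℤ))) e) (trans (lem (S σ x) (+ n)) (cong (λ a → ((S σ x * S σ x + + 2 * S σ x) + 1ℤ) - 𝟙 a * (+ n * + n)) (sym e)))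
       where
       lem : ∀ s n → 1ℤ * ((s + 1ℤ) * (s + 1ℤ)) ≡ ((s * s + + 2 * s) + 1ℤ) - 0ℤ * (n * n)
       lem = solve-∀
     total0 : sum f ≡ 0ℤ
     total0 = trans (∑-cong split) (trans (∑-sub (λ x → (S σ x * S σ x + + 2 * S σ x) + 1ℤ) (λ x → 𝟙 (σ x) * (+ n * + n)))
       (trans (cong₂ _-_ (trans (∑-+ (λ x → S σ x * S σ x + + 2 * S σ x) (λ _ → 1ℤ)) (cong₂ _+_ (trans (∑-+ (λ x → S σ x * S σ x) (λ x → + 2 * S σ x)) (cong₂ _+_ (second-moment σ) (trans (∑-*ˡ (+ 2) (S σ)) (cong (+ 2 *_) (∑S σ))))) (∑-const r 1ℤ)))
         (trans (∑-*ʳ (+ n * + n) (λ x → 𝟙 (σ x))) refl)) fin))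
       where
       fin : ((+ r * count σ - count σ * count σ) + + 2 * 0ℤ + + r * 1ℤ) - count σ * (+ n * + n) ≡ 0ℤ
       fin = trans (cong₂ (λ a b → ((a * b - b * b) + + 2 * 0ℤ + a * 1ℤ) - b * (+ n * + n)) +r≡ count-σ) (lem (+ n))
         where
         lem : ∀ n → (((n * n) * n - n * n) + + 2 * 0ℤ + (n * n) * 1ℤ) - n * (n * n) ≡ 0ℤ
         lem = solve-∀
     sqz : ∀ s → (s + 1ℤ) * (s + 1ℤ) ≡ 0ℤ → s ≡ -1ℤ
     sqz s e with ℤ.i*j≡0⇒i≡0∨j≡0 (s + 1ℤ) e
     ... | inj₁ q = ℤ.i-j≡0⇒i≡j s -1ℤ q
     ... | inj₂ q = ℤ.i-j≡0⇒i≡j s -1ℤ q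

-- A direction with small correlations

module Directions where
 open import Defs using (FieldOn)
 open Sums
 open Characters
 open Universality
 open Subfields
 open import Data.Fin.Properties using (_≟_; any?)
 open import Data.Integer.Base using (+_; _+_; _*_; _-_; -_; _≤_; _<_)
 open import Data.Integer.Tactic.RingSolver using (solve-∀)

 -- The form of `∑-inj-≤` with two parameters, where injectivity is asked only on the pairs selected
 -- by w.
 ∑∑-inj-≤ : ∀ {a b r} (w : Fin a → Fin b → Bool) (τ : Fin a → Fin b → Fin r) →
   (∀ i j i' j' → w i j ≡ true → w i' j' ≡ true → τ i j ≡ τ i' j' → i ≡ i' × j ≡ j') →
   (f : Fin r → ℤ) → (∀ x → 0ℤ ≤ f x) → ∑[ i < a ] (∑[ j < b ] (𝟙 (w i j) * f (τ i j))) ≤ sum f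
 ∑∑-inj-≤ {a} {b} {r} w τ inj f 0≤f = subst (_≤ sum f) (sym step) (∑-mono λ x → subst (fib x * f x ≤_) (ℤ.*-identityˡ (f x)) (*-monoʳ (f x) (0≤f x) (fib≤1 x)))
   where
   fib : Fin r → ℤ
   fib x = ∑[ i < a ] (∑[ j < b ] (𝟙 (w i j) * δ (τ i j) x))
   step : ∑[ i < a ] (∑[ j < b ] (𝟙 (w i j) * f (τ i j))) ≡ ∑[ x < r ] (fib x * f x)
   step = trans (∑-cong λ i → ∑-cong λ j → trans (cong (𝟙 (w i j) *_) (sym (∑-δ (τ i j) f))) (trans (sym (∑-*ˡ (𝟙 (w i j)) (λ x → δ (τ i j) x * f x))) (∑-cong λ x → sym (ℤ.*-assoc (𝟙 (w i j)) (δ (τ i j) x) (f x)))))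
     (trans (∑-cong λ i → ∑-comm (λ j x → 𝟙 (w i j) * δ (τ i j) x * f x)) (trans (∑-comm (λ i x → ∑[ j < b ] (𝟙 (w i j) * δ (τ i j) x * f x)))
       (∑-cong λ x → trans (∑-cong λ i → ∑-*ʳ (f x) (λ j → 𝟙 (w i j) * δ (τ i j) x)) (∑-*ʳ (f x) (λ i → ∑[ j < b ] (𝟙 (w i j) * δ (τ i j) x))))))
   hit : Fin r → Fin a → Fin b → Bool
   hit x i j = w i j ∧ does (τ i j ≟ x)
   fib≡ : ∀ x → fib x ≡ ∑[ i < a ] (∑[ j < b ] 𝟙 (hit x i j))
   fib≡ x = ∑-cong λ i → ∑-cong λ j → sym (𝟙-∧ (w i j) _)
   ∧-l : ∀ {p q} → p ∧ q ≡ true → p ≡ true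
   ∧-l {true} _ = refl
   ∧-r : ∀ {p q} → p ∧ q ≡ true → q ≡ true
   ∧-r {true} e = e
   fib≤1 : ∀ x → fib x ≤ 1ℤ
   fib≤1 x with any? (λ i → any? (λ j → hit x i j Bool.≟ true))
   ... | yes (i₀ , j₀ , h₀) = subst (_≤ 1ℤ) (sym (fib≡ x)) (subst (_ ≤_) one (∑-mono λ i → ∑-mono λ j → le i j))
     where
     one : ∑[ i < a ] (∑[ j < b ] (δ i₀ i * δ j₀ j)) ≡ 1ℤ
     one = trans (∑-cong λ i → trans (∑-*ˡ (δ i₀ i) (δ j₀)) (trans (cong (δ i₀ i *_) (∑-δ1 j₀)) (ℤ.*-identityʳ _))) (∑-δ1 i₀)
     le : ∀ i j → 𝟙 (hit x i j) ≤ δ i₀ i * δ j₀ j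
     le i j with hit x i j in eq
     ... | false = *-0≤ (0≤𝟙 (does (i₀ ≟ i))) (0≤𝟙 (does (j₀ ≟ j)))
     ... | true with refl , refl ← inj i j i₀ j₀ (∧-l eq) (∧-l h₀) (trans (does-true (∧-r {w i j} eq)) (sym (does-true (∧-r {w i₀ j₀} h₀)))) =
       subst (1ℤ ≤_) (sym (cong₂ _*_ (δ-refl i) (δ-refl j))) ℤ.≤-refl
   ... | no ¬h = subst (_≤ 1ℤ) (sym (trans (fib≡ x) (trans (∑-cong λ i → trans (∑-cong λ j → zero' i j) (∑-0 b)) (∑-0 a)))) (+≤+ z≤n)
     where
     zero' : ∀ i j → 𝟙 (hit x i j) ≡ 0ℤ
     zero' i j with hit x i j in eq
     ... | false = refl
     ... | true = ⊥-elim (¬h (i , j , eq))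

 -- Here w = (n - 1)²/2 is the number of candidate directions. The average of n P is at most (n² -
 -- n)(n² + n³ - 1)/w, about 2 n³, and the constant 3 suffices from n = 3 on: after n = 3 + u all
 -- coefficients of the difference are nonnegative.
 direction-ineq : ∀ n u w → n ≡ + 3 + u → 0ℤ ≤ u → + 2 * w ≡ (n - 1ℤ) * (n - 1ℤ) →
   (n * n - n) * (n * n + n * n * n - 1ℤ) ≤ w * (+ 3 * (n * ((n + 1ℤ) * (n + 1ℤ))))
 direction-ineq _ u w refl 0≤u hw = *-cancelˡ (+ 2) (+<+ (s≤s z≤n)) (subst (_ ≤_) (trans (cong (_* (+ 3 * ((+ 3 + u) * ((+ 3 + u + 1ℤ) * (+ 3 + u + 1ℤ))))) (sym hw)) (ℤ.*-assoc (+ 2) w _))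
     (≤-cert ((+ 3 + u) * ((+ 2 + u) * (+ 26 + + 30 * u + + 10 * (u * u) + u * (u * u)))) cert (ineq u)))
   where
   cert : 0ℤ ≤ (+ 3 + u) * ((+ 2 + u) * (+ 26 + + 30 * u + + 10 * (u * u) + u * (u * u)))
   cert = *-0≤ (0≤+ {+ 3} (+≤+ z≤n) 0≤u) (*-0≤ (0≤+ {+ 2} (+≤+ z≤n) 0≤u) (0≤+ (0≤+ (0≤+ {+ 26} (+≤+ z≤n) (*-0≤ {+ 30} (+≤+ z≤n) 0≤u)) (*-0≤ {+ 10} (+≤+ z≤n) (0≤sq u))) (*-0≤ 0≤u (0≤sq u))))
   ineq : ∀ u → (+ 3 + u - 1ℤ) * (+ 3 + u - 1ℤ) * (+ 3 * ((+ 3 + u) * ((+ 3 + u + 1ℤ) * (+ 3 + u + 1ℤ)))) ≡ + 2 * (((+ 3 + u) * (+ 3 + u) - (+ 3 + u)) * ((+ 3 + u) * (+ 3 + u) + (+ 3 + u) * (+ 3 + u) * (+ 3 + u) - 1ℤ)) + (+ 3 + u) * ((+ 2 + u) * (+ 26 + + 30 * u + + 10 * (u * u) + u * (u * u)))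
   ineq = solve-∀

 direction-pos : ∀ n u w → n ≡ + 3 + u → 0ℤ ≤ u → + 2 * w ≡ (n - 1ℤ) * (n - 1ℤ) → 0ℤ < w
 direction-pos _ u w refl 0≤u hw with 0ℤ ℤ.<? w
 ... | yes p = p
 ... | no q = ⊥-elim (ℤ.<⇒≱ {0ℤ} {+ 4} (+<+ (s≤s z≤n)) (ℤ.≤-trans (≤-cert (+ 4 * u + u * u) (0≤+ (*-0≤ {+ 4} (+≤+ z≤n) 0≤u) (0≤sq u)) (trans hw (l u))) (*-monoˡ (+ 2) (+≤+ z≤n) (ℤ.≮⇒≥ q))))
   where
   l : ∀ u → (+ 3 + u - 1ℤ) * (+ 3 + u - 1ℤ) ≡ + 4 + (+ 4 * u + u * u)
   l = solve-∀

 module LineDesign {r} (F : FieldOn r) (n c : ℕ) (1≤c : 1 ℕ.≤ c) (n≡ : n ≡ suc (2 ℕ.* c)) (r≡ : r ≡ n ℕ.* n)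
     (frob-n : FieldChar.AdditivePower F n) where
   open Subfield F n c n≡ r≡ frob-n public

   N : ℤ
   N = + n + 1ℤ

   -- The correlation of two columns of the design to be built; the summand 1 comes from its point
   -- at infinity.
   sK : Fin r → Fin r → ℤ
   sK y y' = 1ℤ + ∑[ t < r ] (𝟙 (σ t) * (χ (y ⊕ ⊖ t) * χ (y' ⊕ ⊖ t)))

   sq : ℤ → ℤ
   sq a = a * a

   ¬Sub-≢ : ∀ {y t} → ¬ Sub y → Sub t → y ⊕ ⊖ t ≢ 0ᶠ
   ¬Sub-≢ hy ht e = hy (subst Sub (sym (sub≡0⇒≡ e)) ht)

   -- Expand (1 + X)². The linear term sums to 0. Orthogonality turns the sum of X² into r n minus
   -- the square of ∑ a, and ∑ a = -1 by `S-outside`.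
   sK-energy : ∀ {y} → ¬ Sub y → ∑[ y' < r ] sq (sK y y') ≡ + r + + r * + n - 1ℤ
   sK-energy {y} hy = trans (∑-cong λ y' → expand (X y')) (trans (∑-+ (λ y' → 1ℤ + + 2 * X y') (λ y' → X y' * X y'))
       (trans (cong₂ _+_ (trans (∑-+ (λ _ → 1ℤ) (λ y' → + 2 * X y')) (cong₂ _+_ (∑-const r 1ℤ) (trans (∑-*ˡ (+ 2) X) (cong (+ 2 *_) ∑X)))) ∑X²) (lem (+ r) (+ n))))
     where
     a : Fin r → ℤ
     a t = 𝟙 (σ t) * χ (y ⊕ ⊖ t)
     X : Fin r → ℤ
     X y' = ∑[ t < r ] (𝟙 (σ t) * (χ (y ⊕ ⊖ t) * χ (y' ⊕ ⊖ t)))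
     X≡ : ∀ y' → X y' ≡ ∑[ t < r ] (a t * χ (y' ⊕ ⊖ t))
     X≡ y' = ∑-cong λ t → sym (ℤ.*-assoc (𝟙 (σ t)) _ _)
     expand : ∀ x → (1ℤ + x) * (1ℤ + x) ≡ (1ℤ + + 2 * x) + x * x
     expand = solve-∀
     lem : ∀ r n → (r * 1ℤ + + 2 * 0ℤ) + (r * n - 1ℤ) ≡ r + r * n - 1ℤ
     lem = solve-∀
     ∑X : sum X ≡ 0ℤ
     ∑X = trans (∑-cong X≡) (trans (∑-comm (λ y' t → a t * χ (y' ⊕ ⊖ t))) (trans (∑-cong λ t → trans (∑-*ˡ (a t) (λ y' → χ (y' ⊕ ⊖ t))) (trans (cong (a t *_) (∑χ-shift (⊖ t))) (ℤ.*-zeroʳ (a t)))) (∑-0 r)))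
     a² : ∀ t → a t * a t ≡ 𝟙 (σ t)
     a² t with Sub? t
     ... | inj₁ (ht , e) = trans (cong (λ b → (𝟙 b * χ (y ⊕ ⊖ t)) * (𝟙 b * χ (y ⊕ ⊖ t))) e) (trans (cong₂ _*_ (ℤ.*-identityˡ (χ (y ⊕ ⊖ t))) (ℤ.*-identityˡ (χ (y ⊕ ⊖ t)))) (trans (χ-sq (¬Sub-≢ hy ht)) (sym (cong 𝟙 e))))
     ... | inj₂ (ht , e) = trans (cong (λ b → (𝟙 b * χ (y ⊕ ⊖ t)) * (𝟙 b * χ (y ⊕ ⊖ t))) e) (trans (cong₂ _*_ (ℤ.*-zeroˡ (χ (y ⊕ ⊖ t))) (ℤ.*-zeroˡ (χ (y ⊕ ⊖ t)))) (sym (cong 𝟙 e)))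
     row : ∀ t → ∑[ u < r ] (a t * a u * (+ r * δ t u - 1ℤ)) ≡ + r * 𝟙 (σ t) - a t * -1ℤ
     row t = trans (∑-cong λ u → l (a t) (a u) (+ r) (δ t u)) (trans (∑-sub (λ u → δ t u * (+ r * (a t * a u))) (λ u → a t * a u))
         (cong₂ _-_ (trans (∑-δ t (λ u → + r * (a t * a u))) (cong (+ r *_) (a² t))) (trans (∑-*ˡ (a t) a) (cong (a t *_) (S-outside hy)))))
       where
       l : ∀ p q s t → p * q * (s * t - 1ℤ) ≡ t * (s * (p * q)) - p * q
       l = solve-∀
     ∑X² : ∑[ y' < r ] (X y' * X y') ≡ + r * + n - 1ℤ
     ∑X² = trans (∑-cong λ y' → trans (cong (λ z → z * z) (X≡ y')) (∑-sq (λ t → a t * χ (y' ⊕ ⊖ t))))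
       (trans (∑-comm (λ y' t → ∑[ u < r ] (a t * χ (y' ⊕ ⊖ t) * (a u * χ (y' ⊕ ⊖ u)))))
       (trans (∑-cong λ t → trans (∑-comm (λ y' u → a t * χ (y' ⊕ ⊖ t) * (a u * χ (y' ⊕ ⊖ u)))) (trans (∑-cong λ u → inner t u) (row t)))
       (trans (∑-sub (λ t → + r * 𝟙 (σ t)) (λ t → a t * -1ℤ)) (cong₂ _-_ (trans (∑-*ˡ (+ r) (λ t → 𝟙 (σ t))) (cong (+ r *_) count-σ)) (trans (∑-*ʳ -1ℤ a) (cong (_* -1ℤ) (S-outside hy)))))))
       where
       inner : ∀ t u → ∑[ y' < r ] (a t * χ (y' ⊕ ⊖ t) * (a u * χ (y' ⊕ ⊖ u))) ≡ a t * a u * (+ r * δ t u - 1ℤ)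
       inner t u = trans (∑-cong λ y' → l (a t) (χ (y' ⊕ ⊖ t)) (a u) (χ (y' ⊕ ⊖ u))) (trans (∑-*ˡ (a t * a u) (λ y' → χ (y' ⊕ ⊖ t) * χ (y' ⊕ ⊖ u))) (cong (a t * a u *_) (orthogonality t u)))
         where
         l : ∀ p q s t → p * q * (s * t) ≡ p * s * (q * t)
         l = solve-∀

   σ-shift : ∀ {z} → Sub z → ∀ t → σ (t ⊕ z) ≡ σ t
   σ-shift {z} hz t with Sub? t
   ... | inj₁ (ht , e) = trans (σ-true (Sub-⊕ ht hz)) (sym e)
   ... | inj₂ (ht , e) = trans (σ-false (λ q → ht (subst Sub (solve 2 (λ t z → (t :+ z) :+ :- z := t) refl t z) (Sub-sub q hz)))) (sym e)

   sK-shift : ∀ {z} → Sub z → ∀ y y' → sK (y ⊕ z) (y' ⊕ z) ≡ sK y y'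
   sK-shift {z} hz y y' = cong (λ w → 1ℤ + w) (trans (sym (∑-shift z (λ t → 𝟙 (σ t) * (χ ((y ⊕ z) ⊕ ⊖ t) * χ ((y' ⊕ z) ⊕ ⊖ t)))))
     (∑-cong λ t → cong₂ (λ a b → 𝟙 a * b) (σ-shift hz t) (cong₂ (λ u v → χ u * χ v) (l y t) (l y' t))))
     where
     l : ∀ y t → (y ⊕ z) ⊕ ⊖ (t ⊕ z) ≡ y ⊕ ⊖ t
     l y t = solve 3 (λ y t z → (y :+ z) :+ :- (t :+ z) := y :+ :- t) refl y t z

   σ-scale : ∀ {x} → x ≢ 0ᶠ → Sub x → ∀ t → σ (x ⊗ t) ≡ σ t
   σ-scale {x} h hx t with Sub? t
   ... | inj₁ (ht , e) = trans (σ-true (Sub-⊗ hx ht)) (sym e)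
   ... | inj₂ (ht , e) = trans (σ-false (λ q → ht (subst Sub (trans (sym (⊗-assoc _ _ _)) (trans (cong (_⊗ t) (inv-l h)) (⊗-identityˡ t))) (Sub-⊗ (Sub-inv h hx) q)))) (sym e)

   -- Scaling by x permutes the subfield and multiplies every difference by a square. Hence all
   -- columns on a line through 0 have the same energy.
   sK-scale : ∀ {x} → x ≢ 0ᶠ → Sub x → ∀ y y' → sK (x ⊗ y) (x ⊗ y') ≡ sK y y'
   sK-scale {x} h hx y y' = cong (λ w → 1ℤ + w) (trans (sym (∑-inj (x ⊗_) (λ i j → ⊗-cancelˡ h) (λ t → 𝟙 (σ t) * (χ ((x ⊗ y) ⊕ ⊖ t) * χ ((x ⊗ y') ⊕ ⊖ t)))))
     (∑-cong λ t → cong₂ (λ a b → 𝟙 a * b) (σ-scale h hx t) (cong₂ _*_ (l y t) (l y' t))))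
     where
     l : ∀ y t → χ ((x ⊗ y) ⊕ ⊖ (x ⊗ t)) ≡ χ (y ⊕ ⊖ t)
     l y t = trans (cong χ (solve 3 (λ x y t → x :* y :+ :- (x :* t) := x :* (y :+ :- t)) refl x y t)) (trans (χ-⊗ x (y ⊕ ⊖ t)) (trans (cong (_* χ (y ⊕ ⊖ t)) (Sub-χ h hx)) (ℤ.*-identityˡ _)))

   -- `W` holds the candidates for the direction d, and `ρ` the ratios of the other columns on its
   -- line to the column d.
   σ* ρ W : Fin r → Bool
   σ* x = σ x ∧ not (does (x ≟ 0ᶠ))
   ρ x = σ* x ∧ not (does (x ≟ 1ᶠ))
   W x = not (σ x) ∧ sqr x

   not-does : ∀ {x y : Fin r} → not (does (x ≟ y)) ≡ true → x ≢ y
   not-does {x} {y} h with x ≟ y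
   ... | no q = q

   does-not : ∀ {x y : Fin r} → x ≢ y → not (does (x ≟ y)) ≡ true
   does-not {x} {y} h = cong not (dec-false (x ≟ y) h)

   ∧-l : ∀ {p q} → p ∧ q ≡ true → p ≡ true
   ∧-l {true} _ = refl
   ∧-r : ∀ p {q} → p ∧ q ≡ true → q ≡ true
   ∧-r true e = e

   -- The point x (y - z) + z is the image of y under the homothety with centre z and ratio x. As y
   -- lies outside the subfield, comparing the coefficients of y gives x = x', and then x ≠ 1 gives
   -- z = z'.
   collinear-inj : ∀ {y z z' x x'} → ¬ Sub y → Sub z → Sub z' → Sub x → Sub x' → x ≢ 1ᶠ →
     x ⊗ (y ⊕ ⊖ z) ⊕ z ≡ x' ⊗ (y ⊕ ⊖ z') ⊕ z' → z ≡ z' × x ≡ x'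
   collinear-inj {y} {z} {z'} {x} {x'} hy hz hz' hx hx' x≢1 e = z≡ , x≡
     where
     lin : (x ⊕ ⊖ x') ⊗ y ≡ (x' ⊗ ⊖ z' ⊕ z') ⊕ ⊖ (x ⊗ ⊖ z ⊕ z)
     lin = trans (solve 5 (λ x x' y z z' → (x :+ :- x') :* y := ((x :* (y :+ :- z) :+ z) :+ :- (x' :* (y :+ :- z') :+ z')) :+ ((x' :* (:- z') :+ z') :+ :- (x :* (:- z) :+ z))) refl x x' y z z')
       (trans (cong (_⊕ ((x' ⊗ ⊖ z' ⊕ z') ⊕ ⊖ (x ⊗ ⊖ z ⊕ z))) (≡⇒sub≡0 e)) (⊕-identityˡ _))
     x≡ : x ≡ x'
     x≡ with 0? (x ⊕ ⊖ x')
     ... | inj₁ q = sub≡0⇒≡ q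
     ... | inj₂ q = ⊥-elim (hy (subst Sub (trans (cong (inv (x ⊕ ⊖ x') ⊗_) (sym lin)) (trans (sym (⊗-assoc _ _ _)) (trans (cong (_⊗ y) (inv-l q)) (⊗-identityˡ y))))
             (Sub-⊗ (Sub-inv q (Sub-sub hx hx')) (Sub-sub (Sub-⊕ (Sub-⊗ hx' (Sub-⊖ hz')) hz') (Sub-⊕ (Sub-⊗ hx (Sub-⊖ hz)) hz)))))
     z≡ : z ≡ z'
     z≡ = sub≡0⇒≡ (⊗-cancelˡ {x ⊕ ⊖ 1ᶠ} (x≢1 ∘ sub≡0⇒≡) (trans
       (solve 5 (λ x y z z' o → (x :+ :- o) :* (z :+ :- z') := ((x :* (y :+ :- z') :+ z') :+ :- (x :* (y :+ :- z) :+ z)) :+ ((z :+ :- z') :+ :- (o :* (z :+ :- z')))) refl x y z z' 1ᶠ)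
       (trans (cong₂ _⊕_ (≡⇒sub≡0 (sym (trans e (cong (λ w → w ⊗ (y ⊕ ⊖ z') ⊕ z') (sym x≡))))) (≡⇒sub≡0 (sym (⊗-identityˡ _)))) (trans (⊕-identityˡ 0ᶠ) (sym (⊗-zeroʳ _))))))

   -- The energy of the column d with the diagonal term left out.
   P : Fin r → ℤ
   P d = ∑[ x < r ] (𝟙 (ρ x) * sq (sK d (x ⊗ d)))

   -- With y = d + z fixed, the parameters z and x name distinct second points, so their energies
   -- are part of `sK-energy`. If y lies in the subfield, so does every y - z, and no candidate
   -- direction remains.
   fixed-y : ∀ y → ∑[ z < r ] (∑[ x < r ] (𝟙 (W (y ⊕ ⊖ z)) * (𝟙 (σ z ∧ ρ x) * sq (sK y (x ⊗ (y ⊕ ⊖ z) ⊕ z))))) ≤ 𝟙 (not (σ y)) * (+ r + + r * + n - 1ℤ)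
   fixed-y y with Sub? y
   ... | inj₁ (hy , e) = subst₂ _≤_ (sym (trans (∑-cong λ z → trans (∑-cong λ x → zer z x) (∑-0 r)) (∑-0 r))) (sym (trans (cong (λ b → 𝟙 (not b) * (+ r + + r * + n - 1ℤ)) e) (ℤ.*-zeroˡ (+ r + + r * + n - 1ℤ)))) ℤ.≤-refl
     where
     zer : ∀ z x → 𝟙 (W (y ⊕ ⊖ z)) * (𝟙 (σ z ∧ ρ x) * sq (sK y (x ⊗ (y ⊕ ⊖ z) ⊕ z))) ≡ 0ℤ
     zer z x with Sub? z
     ... | inj₁ (hz , ez) = trans (cong (λ b → 𝟙 (not b ∧ sqr (y ⊕ ⊖ z)) * (𝟙 (σ z ∧ ρ x) * sq (sK y (x ⊗ (y ⊕ ⊖ z) ⊕ z)))) (σ-true (Sub-sub hy hz))) (ℤ.*-zeroˡ (𝟙 (σ z ∧ ρ x) * sq (sK y (x ⊗ (y ⊕ ⊖ z) ⊕ z))))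
     ... | inj₂ (hz , ez) = trans (cong (λ b → 𝟙 (W (y ⊕ ⊖ z)) * (𝟙 (b ∧ ρ x) * sq (sK y (x ⊗ (y ⊕ ⊖ z) ⊕ z)))) ez) (trans (cong (𝟙 (W (y ⊕ ⊖ z)) *_) (ℤ.*-zeroˡ (sq (sK y (x ⊗ (y ⊕ ⊖ z) ⊕ z))))) (ℤ.*-zeroʳ (𝟙 (W (y ⊕ ⊖ z)))))
   ... | inj₂ (hy , e) = ℤ.≤-trans (∑-mono λ z → ∑-mono λ x → 𝟙*≤ (W (y ⊕ ⊖ z)) (*-0≤ (0≤𝟙 (σ z ∧ ρ x)) (0≤sq (sK y (x ⊗ (y ⊕ ⊖ z) ⊕ z)))))
       (ℤ.≤-trans (∑∑-inj-≤ (λ z x → σ z ∧ ρ x) (λ z x → x ⊗ (y ⊕ ⊖ z) ⊕ z) inj (λ y' → sq (sK y y')) (λ y' → 0≤sq (sK y y')))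
         (ℤ.≤-reflexive (trans (sK-energy hy) (sym (trans (cong (λ b → 𝟙 (not b) * (+ r + + r * + n - 1ℤ)) e) (ℤ.*-identityˡ _))))))
     where
     inj : ∀ z x z' x' → σ z ∧ ρ x ≡ true → σ z' ∧ ρ x' ≡ true → x ⊗ (y ⊕ ⊖ z) ⊕ z ≡ x' ⊗ (y ⊕ ⊖ z') ⊕ z' → z ≡ z' × x ≡ x'
     inj z x z' x' h h' eq = collinear-inj hy (does-true (∧-l {σ z} h)) (does-true (∧-l {σ z'} h'))
       (does-true (∧-l {σ x} (∧-l {σ* x} (∧-r (σ z) h)))) (does-true (∧-l {σ x'} (∧-l {σ* x'} (∧-r (σ z') h')))) (not-does (∧-r (σ* x) (∧-r (σ z) h))) eq

   -- ∑ over d, λ, z of s(d, λd)² counted through the pairs (d + z, λd + z), which are distinct.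
   total : ∑[ d < r ] (𝟙 (W d) * (+ n * P d)) ≤ (+ r - + n) * (+ r + + r * + n - 1ℤ)
   total = subst₂ _≤_ (sym rewr) (trans (∑-*ʳ (+ r + + r * + n - 1ℤ) (λ y → 𝟙 (not (σ y)))) (cong (_* (+ r + + r * + n - 1ℤ)) cnt)) (∑-mono fixed-y)
     where
     cnt : ∑[ y < r ] 𝟙 (not (σ y)) ≡ + r - + n
     cnt = trans (∑-cong λ y → neg (σ y)) (trans (∑-sub (λ _ → 1ℤ) (λ y → 𝟙 (σ y))) (cong₂ _-_ (trans (∑-const r 1ℤ) (ℤ.*-identityʳ (+ r))) count-σ))
       where
       neg : ∀ b → 𝟙 (not b) ≡ 1ℤ - 𝟙 b
       neg true = refl
       neg false = refl
     G : Fin r → Fin r → Fin r → ℤ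
     G d z x = 𝟙 (W d) * (𝟙 (σ z ∧ ρ x) * sq (sK (d ⊕ z) (x ⊗ d ⊕ z)))
     unshift : ∀ d z x → 𝟙 (σ z) * (𝟙 (W d) * (𝟙 (ρ x) * sq (sK d (x ⊗ d)))) ≡ G d z x
     unshift d z x with Sub? z
     ... | inj₁ (hz , e) = trans (cong (λ b → 𝟙 b * (𝟙 (W d) * (𝟙 (ρ x) * sq (sK d (x ⊗ d))))) e) (trans (ℤ.*-identityˡ _)
         (sym (cong₂ (λ b s → 𝟙 (W d) * (𝟙 (b ∧ ρ x) * sq s)) e (sK-shift hz d (x ⊗ d)))))
     ... | inj₂ (hz , e) = trans (cong (λ b → 𝟙 b * (𝟙 (W d) * (𝟙 (ρ x) * sq (sK d (x ⊗ d))))) e) (trans (ℤ.*-zeroˡ (𝟙 (W d) * (𝟙 (ρ x) * sq (sK d (x ⊗ d)))))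
         (sym (trans (cong (λ b → 𝟙 (W d) * (𝟙 (b ∧ ρ x) * sq (sK (d ⊕ z) (x ⊗ d ⊕ z)))) e) (trans (cong (𝟙 (W d) *_) (ℤ.*-zeroˡ (sq (sK (d ⊕ z) (x ⊗ d ⊕ z))))) (ℤ.*-zeroʳ (𝟙 (W d)))))))
     per-d : ∀ d → 𝟙 (W d) * (+ n * P d) ≡ ∑[ z < r ] (∑[ x < r ] G d z x)
     per-d d = trans (sym (l (𝟙 (W d)) (P d))) (trans (cong (_* (𝟙 (W d) * P d)) (sym count-σ)) (trans (sym (∑-*ʳ (𝟙 (W d) * P d) (λ z → 𝟙 (σ z))))
       (∑-cong λ z → trans (cong (𝟙 (σ z) *_) (sym (∑-*ˡ (𝟙 (W d)) (λ x → 𝟙 (ρ x) * sq (sK d (x ⊗ d)))))) (trans (sym (∑-*ˡ (𝟙 (σ z)) (λ x → 𝟙 (W d) * (𝟙 (ρ x) * sq (sK d (x ⊗ d)))))) (∑-cong λ x → unshift d z x)))))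
       where
       l : ∀ w p → + n * (w * p) ≡ w * (+ n * p)
       l w p = l' (+ n) w p
         where
         l' : ∀ n w p → n * (w * p) ≡ w * (n * p)
         l' = solve-∀
     rewr : ∑[ d < r ] (𝟙 (W d) * (+ n * P d)) ≡ ∑[ y < r ] (∑[ z < r ] (∑[ x < r ] (𝟙 (W (y ⊕ ⊖ z)) * (𝟙 (σ z ∧ ρ x) * sq (sK y (x ⊗ (y ⊕ ⊖ z) ⊕ z))))))
     rewr = trans (∑-cong per-d) (trans (∑-comm (λ d z → ∑[ x < r ] G d z x)) (trans (∑-cong λ z → trans (sym (∑-shift (⊖ z) (λ d → ∑[ x < r ] G d z x)))
       (∑-cong λ y → ∑-cong λ x → cong (λ w → 𝟙 (W (y ⊕ ⊖ z)) * (𝟙 (σ z ∧ ρ x) * sq (sK w (x ⊗ (y ⊕ ⊖ z) ⊕ z)))) (solve 2 (λ y z → (y :+ :- z) :+ z := y) refl y z)))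
       (∑-comm (λ z y → ∑[ x < r ] (𝟙 (W (y ⊕ ⊖ z)) * (𝟙 (σ z ∧ ρ x) * sq (sK y (x ⊗ (y ⊕ ⊖ z) ⊕ z))))))))

   -- Half of the n² - 1 nonzero elements are squares, and n - 1 of these squares lie in the
   -- subfield.
   ∑W : + 2 * count W ≡ (+ n - 1ℤ) * (+ n - 1ℤ)
   ∑W = trans (sym (∑-*ˡ (+ 2) (λ d → 𝟙 (W d)))) (trans (∑-cong point) (trans (∑-sub (λ d → (1ℤ + χ d) - δ 0ᶠ d) (λ d → 𝟙 (σ d) + (𝟙 (σ d) * χ d - δ 0ᶠ d)))
     (trans (cong₂ _-_ (trans (∑-sub (λ d → 1ℤ + χ d) (δ 0ᶠ)) (cong₂ _-_ (trans (∑-+ (λ _ → 1ℤ) χ) (cong₂ _+_ (trans (∑-const r 1ℤ) (ℤ.*-identityʳ (+ r))) ∑χ)) (∑-δ1 0ᶠ)))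
         (trans (∑-+ (λ d → 𝟙 (σ d)) (λ d → 𝟙 (σ d) * χ d - δ 0ᶠ d)) (cong₂ _+_ count-σ (trans (∑-sub (λ d → 𝟙 (σ d) * χ d) (δ 0ᶠ)) (cong₂ _-_ Sσ0 (∑-δ1 0ᶠ))))))
       (trans (cong (λ z → (z + 0ℤ - 1ℤ) - (+ n + ((+ n - 1ℤ) - 1ℤ))) +r≡) (lem (+ n))))))
     where
     lem : ∀ n → (n * n + 0ℤ - 1ℤ) - (n + ((n - 1ℤ) - 1ℤ)) ≡ (n - 1ℤ) * (n - 1ℤ)
     lem = solve-∀
     Sσ0 : ∑[ d < r ] (𝟙 (σ d) * χ d) ≡ + n - 1ℤ
     Sσ0 = trans (∑-cong λ d → cong (𝟙 (σ d) *_) (trans (sym (χ-neg d)) (cong χ (sym (⊕-identityˡ _))))) (S-inside Sub-0)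
     point : ∀ d → + 2 * 𝟙 (W d) ≡ ((1ℤ + χ d) - δ 0ᶠ d) - (𝟙 (σ d) + (𝟙 (σ d) * χ d - δ 0ᶠ d))
     point d with δ-cases 0ᶠ d
     ... | inj₁ (refl , e) = trans (cong (λ b → + 2 * 𝟙 (not b ∧ sqr 0ᶠ)) (σ-true Sub-0)) (sym (cong₂ (λ b z → ((1ℤ + z) - δ 0ᶠ 0ᶠ) - (𝟙 b + (𝟙 b * z - δ 0ᶠ 0ᶠ))) (σ-true Sub-0) χ0) ⟨trans⟩ l (δ 0ᶠ 0ᶠ))
       where
       l : ∀ z → ((1ℤ + 0ℤ) - z) - (1ℤ + (1ℤ * 0ℤ - z)) ≡ 0ℤ
       l = solve-∀
       _⟨trans⟩_ : ∀ {a b c : ℤ} → b ≡ a → b ≡ c → c ≡ a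
       p ⟨trans⟩ q = trans (sym q) p
     ... | inj₂ (h , e) with Sub? d
     ...   | inj₁ (hd , s) = trans (cong (λ b → + 2 * 𝟙 (not b ∧ sqr d)) s) (sym (trans (cong₂ (λ b z → ((1ℤ + z) - δ 0ᶠ d) - (𝟙 b + (𝟙 b * z - δ 0ᶠ d))) s (Sub-χ (h ∘ sym) hd)) (l (δ 0ᶠ d))))
       where
       l : ∀ z → ((1ℤ + 1ℤ) - z) - (1ℤ + (1ℤ * 1ℤ - z)) ≡ 0ℤ
       l = solve-∀
     ...   | inj₂ (hd , s) = trans (cong (λ b → + 2 * 𝟙 (not b ∧ sqr d)) s) (sym (trans (cong₂ (λ b z → ((1ℤ + χ d) - z) - (𝟙 b + (𝟙 b * χ d - z))) s e) (trans (l (χ d)) (fin (sqr d) (χ-sqr (h ∘ sym))))))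
       where
       l : ∀ x → ((1ℤ + x) - 0ℤ) - (0ℤ + (0ℤ * x - 0ℤ)) ≡ 1ℤ + x
       l = solve-∀
       fin : ∀ b → χ d ≡ (if b then 1ℤ else -1ℤ) → 1ℤ + χ d ≡ + 2 * 𝟙 b
       fin true q = cong (λ z → 1ℤ + z) q
       fin false q = cong (λ z → 1ℤ + z) q

   abstract
     direction : ∃ λ d → ¬ Sub d × χ d ≡ 1ℤ × P d ≤ + 3 * (N * N)
     direction = d , ¬Sd , χd , *-cancelˡ (+ n) 0<n (subst (+ n * P d ≤_) (l (+ n) (N * N)) (proj₂ (proj₂ chosen)))
       where
       u : ℕ
       u = 2 ℕ.* (c ℕ.∸ 1)
       n≡3+u : + n ≡ + 3 + + u
       n≡3+u = cong +_ (trans n≡ (trans (cong (λ z → suc (2 ℕ.* z)) (sym (ℕ.m+[n∸m]≡n 1≤c))) (cong suc (ℕ.*-distribˡ-+ 2 1 (c ℕ.∸ 1)))))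
       avg : ∑[ d < r ] (𝟙 (W d) * (+ n * P d)) ≤ ∑[ d < r ] (𝟙 (W d) * (+ 3 * (+ n * (N * N))))
       avg = ℤ.≤-trans total (subst₂ _≤_ (cong (λ z → (z - + n) * (z + z * + n - 1ℤ)) (sym +r≡)) (sym (∑-*ʳ (+ 3 * (+ n * (N * N))) (λ d → 𝟙 (W d))))
         (direction-ineq (+ n) (+ u) (count W) n≡3+u (+≤+ z≤n) ∑W))
       chosen : ∃ λ d → 0ℤ < 𝟙 (W d) × + n * P d ≤ + 3 * (+ n * (N * N))
       chosen = ∑-avg (λ d → 𝟙 (W d)) (λ d → + n * P d) (λ _ → + 3 * (+ n * (N * N))) (λ d → 0≤𝟙 (W d)) (direction-pos (+ n) (+ u) (count W) n≡3+u (+≤+ z≤n) ∑W) avg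
       d : Fin r
       d = proj₁ chosen
       Wd : W d ≡ true
       Wd = 0<𝟙* (W d) (subst (0ℤ <_) (sym (ℤ.*-identityʳ _)) (proj₁ (proj₂ chosen)))
       ¬Sd : ¬ Sub d
       ¬Sd h = true≢false (trans (sym (∧-l Wd)) (cong not (σ-true h)))
         where
         true≢false : true ≢ false
         true≢false ()
       χd : χ d ≡ 1ℤ
       χd = trans (χ-sqr (λ e → ¬Sd (subst Sub (sym e) Sub-0))) (cong (if_then 1ℤ else -1ℤ) (∧-r (not (σ d)) Wd))
       0<n : 0ℤ < + n
       0<n = subst (λ z → 0ℤ < + z) (sym n≡) (+<+ (s≤s z≤n))
       l : ∀ n m → + 3 * (n * m) ≡ n * (+ 3 * m)
       l = solve-∀

-- Two independent lines in a Paley graph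

module LineModels where
 open import Defs using (FieldOn; Paley)
 open Sums
 open Characters
 open Universality
 open Subfields
 open Directions
 open Designs
 open import Data.Fin.Properties using (_≟_)
 open import Data.Integer.Base using (+_; _+_; _*_; _-_; -_; _≤_; _<_)
 open import Data.Integer.Tactic.RingSolver using (solve-∀)

 -- Two independent lines in a Paley graph; the vertex `inf` is only there to balance the design.
 record LineModel {r} (F : FieldOn r) (N l : ℕ) : Set where
   open FieldChar F
   field
     design : Design N l
   open Design design public
   field
     inf : Fin N
     edge-inf : ∀ y → edge inf y ≡ false
     vT : Fin N → Fin r
     vL : Fin l → Fin r
     vTT : ∀ {t t'} → t ≢ inf → t' ≢ inf → t ≢ t' → χ (vT t ⊕ ⊖ vT t') ≡ -1ℤ
     vLL : ∀ {y y'} → y ≢ y' → χ (vL y ⊕ ⊖ vL y') ≡ -1ℤ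
     vLT : ∀ {y t} → t ≢ inf → χ (vL y ⊕ ⊖ vT t) ≡ sg (edge t y)

 module Lines {r} (F : FieldOn r) (n c : ℕ) (1≤c : 1 ℕ.≤ c) (n≡ : n ≡ suc (2 ℕ.* c)) (r≡ : r ≡ n ℕ.* n)
     (frob-n : FieldChar.AdditivePower F n) where
   open LineDesign F n c 1≤c n≡ r≡ frob-n

   d : Fin r
   d = proj₁ direction

   ¬Sd : ¬ Sub d
   ¬Sd = proj₁ (proj₂ direction)

   χd : χ d ≡ 1ℤ
   χd = proj₁ (proj₂ (proj₂ direction))

   l : ℕ
   l = 2 ℕ.* c

   y : Fin l → Fin r
   y j = κ j ⊗ d

   ¬Sy : ∀ j → ¬ Sub (y j)
   ¬Sy j h = ¬Sd (subst Sub (trans (sym (⊗-assoc _ _ _)) (trans (cong (_⊗ d) (inv-l (κ≢0 j))) (⊗-identityˡ d))) (Sub-⊗ (Sub-inv (κ≢0 j) (κ-Sub j)) h))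

   -- The vertices are finally multiplied by the nonsquare g. This makes both lines independent and
   -- reverses the relation between them, so an edge is a nonsquare difference before scaling. Row
   -- `zero` is the point at infinity, with sign 1 in every column.
   edge : Fin (suc (suc l)) → Fin l → Bool
   edge zero j = false
   edge (suc i) j = not (sqr (y j ⊕ ⊖ ι i))

   ε-edge : ∀ i j → ε (edge (suc i) j) ≡ χ (y j ⊕ ⊖ ι i)
   ε-edge i j = trans (lem (sqr (y j ⊕ ⊖ ι i))) (sym (χ-sqr (¬Sub-≢ (¬Sy j) (ι-Sub i))))
     where
     lem : ∀ b → ε (not b) ≡ (if b then 1ℤ else -1ℤ)
     lem true = refl
     lem false = refl

   -- The subfield contributes -1 by `S-outside`, and the point at infinity compensates for it.
   balanced : ∀ j → ∑[ t < suc (suc l) ] ε (edge t j) ≡ 0ℤ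
   balanced j = trans (∑-∷ (λ t → ε (edge t j))) (cong (λ z → 1ℤ + z) (trans (∑-cong λ i → ε-edge i j) (trans (∑-Sub (λ t → χ (y j ⊕ ⊖ t))) (S-outside (¬Sy j)))))

   corr≡ : ∀ j j' → ∑[ t < suc (suc l) ] (ε (edge t j) * ε (edge t j')) ≡ sK (y j) (y j')
   corr≡ j j' = trans (∑-∷ (λ t → ε (edge t j) * ε (edge t j'))) (cong (λ z → 1ℤ + z) (trans (∑-cong λ i → cong₂ _*_ (ε-edge i j) (ε-edge i j')) (∑-Sub (λ t → χ (y j ⊕ ⊖ t) * χ (y j' ⊕ ⊖ t)))))

   sK-diag : sK d (1ᶠ ⊗ d) ≡ N
   sK-diag = trans (cong (sK d) (⊗-identityˡ d)) (trans (cong (λ z → 1ℤ + z) (trans (∑-cong point) count-σ)) (ℤ.+-comm 1ℤ (+ n)))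
     where
     point : ∀ t → 𝟙 (σ t) * (χ (d ⊕ ⊖ t) * χ (d ⊕ ⊖ t)) ≡ 𝟙 (σ t)
     point t with Sub? t
     ... | inj₁ (ht , e) = trans (cong (𝟙 (σ t) *_) (χ-sq (¬Sub-≢ ¬Sd ht))) (ℤ.*-identityʳ _)
     ... | inj₂ (ht , e) = trans (cong (λ b → 𝟙 b * (χ (d ⊕ ⊖ t) * χ (d ⊕ ⊖ t))) e) (trans (ℤ.*-zeroˡ (χ (d ⊕ ⊖ t) * χ (d ⊕ ⊖ t))) (sym (cong 𝟙 e)))

   σ*-split : ∀ x → 𝟙 (σ* x) ≡ 𝟙 (ρ x) + δ 1ᶠ x
   σ*-split x with δ-cases 1ᶠ x
   ... | inj₁ (refl , e) = trans (cong₂ (λ a b → 𝟙 (a ∧ not b)) (σ-true Sub-1) (dec-false (1ᶠ ≟ 0ᶠ) (0≢1 ∘ sym)))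
       (sym (cong₂ (λ b z → 𝟙 (σ* 1ᶠ ∧ not b) + z) (dec-true (1ᶠ ≟ 1ᶠ) refl) e ▸ cong (λ b → 𝟙 b + 1ℤ) (∧-f (σ* 1ᶠ))))
     where
     ∧-f : ∀ b → b ∧ false ≡ false
     ∧-f true = refl
     ∧-f false = refl
     _▸_ : ∀ {a b c : ℤ} → a ≡ b → b ≡ c → a ≡ c
     _▸_ = trans
   ... | inj₂ (h , e) = sym (trans (cong₂ (λ b z → 𝟙 (σ* x ∧ b) + z) (does-not (h ∘ sym)) e) (trans (ℤ.+-identityʳ _) (cong 𝟙 (∧-t (σ* x)))))
     where
     ∧-t : ∀ b → b ∧ true ≡ b
     ∧-t true = refl
     ∧-t false = refl

   base-energy : ∑[ x < r ] (𝟙 (σ* x) * sq (sK d (x ⊗ d))) ≤ + 4 * (N * N)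
   base-energy = subst₂ _≤_ (sym e) (lem (N * N)) (ℤ.+-monoˡ-≤ (N * N) (proj₂ (proj₂ (proj₂ direction))))
     where
     lem : ∀ a → + 3 * a + a ≡ + 4 * a
     lem = solve-∀
     e : ∑[ x < r ] (𝟙 (σ* x) * sq (sK d (x ⊗ d))) ≡ P d + N * N
     e = trans (∑-cong λ x → trans (cong (_* sq (sK d (x ⊗ d))) (σ*-split x)) (ℤ.*-distribʳ-+ (sq (sK d (x ⊗ d))) (𝟙 (ρ x)) (δ 1ᶠ x)))
       (trans (∑-+ (λ x → 𝟙 (ρ x) * sq (sK d (x ⊗ d))) (λ x → δ 1ᶠ x * sq (sK d (x ⊗ d)))) (cong (λ z → P d + z) (trans (∑-δ 1ᶠ (λ x → sq (sK d (x ⊗ d)))) (cong sq sK-diag))))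

   σ*-true : ∀ {x} → x ≢ 0ᶠ → Sub x → σ* x ≡ true
   σ*-true {x} h hx = trans (cong (λ b → b ∧ not (does (x ≟ 0ᶠ))) (σ-true hx)) (does-not h)

   σ*-scale : ∀ j x → σ* (κ j ⊗ x) ≡ σ* x
   σ*-scale j x = cong₂ (λ a b → a ∧ not b) (σ-scale (κ≢0 j) (κ-Sub j) x) (eqz x)
     where
     eqz : ∀ x → does (κ j ⊗ x ≟ 0ᶠ) ≡ does (x ≟ 0ᶠ)
     eqz x with x ≟ 0ᶠ
     ... | yes refl = dec-true (κ j ⊗ 0ᶠ ≟ 0ᶠ) (⊗-zeroʳ (κ j))
     ... | no h = dec-false (κ j ⊗ x ≟ 0ᶠ) (⊗-≢0 (κ≢0 j) h)

   -- By `sK-scale` every column has the energy of the column d, where the bound 3 N² for the chosen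
   -- direction and the diagonal term N² add up.
   energy : ∀ j → ∑[ j' < l ] sq (sK (y j) (y j')) ≤ + 4 * (N * N)
   energy j = subst (_≤ + 4 * (N * N)) (sym e) base-energy
     where
     f : Fin r → ℤ
     f x = sq (sK (κ j ⊗ d) (x ⊗ d))
     e : ∑[ j' < l ] sq (sK (y j) (y j')) ≡ ∑[ x < r ] (𝟙 (σ* x) * sq (sK d (x ⊗ d)))
     e = trans (∑-enum κ κ-inj σ* (λ i → σ*-true (κ≢0 i) (κ-Sub i)) (λ x h → κ-surj x (not-does (∧-r (σ x) h)) (does-true (∧-l h))) f)
       (trans (sym (∑-inj (κ j ⊗_) (λ a b → ⊗-cancelˡ (κ≢0 j)) (λ x → 𝟙 (σ* x) * f x)))
         (∑-cong λ x → cong₂ (λ a b → 𝟙 a * sq b) (σ*-scale j x) (trans (cong (sK (κ j ⊗ d)) (⊗-assoc (κ j) x d)) (sK-scale (κ≢0 j) (κ-Sub j) d (x ⊗ d)))))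

   N≡ : N ≡ + suc (suc l)
   N≡ = trans (cong (λ z → + z + 1ℤ) n≡) (cong +_ (ℕ.+-comm (suc l) 1))

   lineDesign : Design (suc (suc l)) l
   lineDesign = record { edge = edge ; balanced = balanced ; energy = λ j → subst₂ _≤_ (∑-cong λ j' → cong (λ z → z * z) (sym (corr≡ j j'))) (cong (λ z → + 4 * (z * z)) N≡) (energy j) }

   χ-g⊗ : ∀ a b → χ (g ⊗ a ⊕ ⊖ (g ⊗ b)) ≡ - χ (a ⊕ ⊖ b)
   χ-g⊗ a b = trans (cong χ (solve 3 (λ g a b → g :* a :+ :- (g :* b) := g :* (a :+ :- b)) refl g a b)) (trans (χ-⊗ g _) (trans (cong (_* χ (a ⊕ ⊖ b)) χg) (ℤ.-1*i≡-i _)))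

   vT : Fin (suc (suc l)) → Fin r
   vT zero = 0ᶠ
   vT (suc i) = g ⊗ ι i

   lineModel : LineModel F (suc (suc l)) l
   lineModel = record
     { design = lineDesign ; inf = zero ; edge-inf = λ _ → refl ; vT = vT ; vL = λ j → g ⊗ y j
     ; vTT = λ { {zero} h _ _ → ⊥-elim (h refl) ; {suc i} {zero} _ h _ → ⊥-elim (h refl) ; {suc i} {suc i'} _ _ h → trans (χ-g⊗ _ _) (cong -_ (Sub-χ (h ∘ cong suc ∘ ι-inj i i' ∘ sub≡0⇒≡) (Sub-sub (ι-Sub i) (ι-Sub i')))) }
     ; vLL = λ {j} {j'} h → trans (χ-g⊗ _ _) (cong -_ (trans (cong χ (solve 3 (λ a b d → a :* d :+ :- (b :* d) := (a :+ :- b) :* d) refl (κ j) (κ j') d))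
         (trans (χ-⊗ _ d) (cong₂ _*_ (Sub-χ (h ∘ κ-inj j j' ∘ sub≡0⇒≡) (Sub-sub (κ-Sub j) (κ-Sub j'))) χd))))
     ; vLT = λ { {_} {zero} h → ⊥-elim (h refl) ; {j} {suc i} _ → trans (χ-g⊗ _ _) (trans (cong -_ (sym (ε-edge i j))) (neg (edge (suc i) j))) } }
     where
     neg : ∀ b → - ε b ≡ sg b
     neg true = refl
     neg false = refl

-- Second moments of pattern counts over random tuples

module Variances where
 open Sums
 open Designs
 open import Data.Integer.Base using (+_; _+_; _*_; _-_; -_; _^_; _≤_; _<_)
 open import Data.Integer.Tactic.RingSolver using (solve-∀)
 open import Data.Vec.Base using (Vec; []; _∷_; lookup)

 0≤^ : ∀ {a} k → 0ℤ ≤ a → 0ℤ ≤ a ^ k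
 0≤^ zero h = +≤+ z≤n
 0≤^ (suc k) h = *-0≤ h (0≤^ k h)

 0<^ : ∀ {a} k → 0ℤ < a → 0ℤ < a ^ k
 0<^ zero h = +<+ (s≤s z≤n)
 0<^ {a} (suc k) h = pos a (a ^ k) h (0<^ k h)
   where
   pos : ∀ a b → 0ℤ < a → 0ℤ < b → 0ℤ < a * b
   pos (+ suc a) (+ suc b) _ _ = +<+ (s≤s z≤n)
   pos (+ 0) b (+<+ ()) _
   pos (+ suc a) (+ 0) _ (+<+ ())
   pos (+ suc a) -[1+ b ] _ ()

 -- E k = 2^k - 1 - k, the sum of the binomial coefficients C(k, i) with i ≥ 2.
 E : ℕ → ℤ
 E zero = 0ℤ
 E (suc k) = + 2 * E k + + k

 0≤E : ∀ k → 0ℤ ≤ E k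
 0≤E zero = ℤ.≤-refl
 0≤E (suc k) = 0≤+ (*-0≤ {+ 2} (+≤+ z≤n) (0≤E k)) (+≤+ z≤n)

 E-closed : ∀ k → (+ 2) ^ k ≡ E k + (1ℤ + + k)
 E-closed zero = refl
 E-closed (suc k) = trans (cong (+ 2 *_) (E-closed k)) (lem (E k) (+ k))
   where
   lem : ∀ e k → + 2 * (e + (1ℤ + k)) ≡ + 2 * e + k + (1ℤ + (1ℤ + k))
   lem = solve-∀

 E≤2^ : ∀ k → E k ≤ (+ 2) ^ k
 E≤2^ k = ≤-cert (1ℤ + + k) (+≤+ z≤n) (E-closed k)

 -- (1 + c)ᵏ ≤ 1 + k c + (2ᵏ ∸ 1 ∸ k) c² for |c| ≤ 1, homogenised with c = s / N.
 power-bound : ∀ N s k → 0ℤ ≤ N → 0ℤ ≤ N + s → s ≤ N → (N * N) * (N + s) ^ k ≤ N ^ k * (N * N + + k * (N * s) + E k * (s * s))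
 power-bound N s zero _ _ _ = ℤ.≤-reflexive (lem N s)
   where
   lem : ∀ N s → (N * N) * 1ℤ ≡ 1ℤ * (N * N + 0ℤ * (N * s) + 0ℤ * (s * s))
   lem = solve-∀
 power-bound N s (suc k) 0≤N 0≤N+s s≤N = ℤ.≤-trans
     (subst (_≤ (N + s) * (N ^ k * (N * N + + k * (N * s) + E k * (s * s)))) (lem₁ (N * N) (N + s) ((N + s) ^ k)) (*-monoˡ (N + s) 0≤N+s (power-bound N s k 0≤N 0≤N+s s≤N)))
     (≤-cert (N ^ k * (E k * ((s * s) * (N - s)))) (*-0≤ (0≤^ k 0≤N) (*-0≤ (0≤E k) (*-0≤ (0≤sq s) (≤-diff s≤N)))) (lem₂ N s (N ^ k) (+ k) (E k)))
   where
   lem₁ : ∀ a b c → b * (a * c) ≡ a * (b * c)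
   lem₁ = solve-∀
   lem₂ : ∀ N s p k e → N * p * (N * N + (1ℤ + k) * (N * s) + (+ 2 * e + k) * (s * s)) ≡ (N + s) * (p * (N * N + k * (N * s) + e * (s * s))) + p * (e * ((s * s) * (N - s)))
   lem₂ = solve-∀

 -- The linear term is absorbed by AM-GM.
 pair-bound : ∀ N s k → 0ℤ ≤ N → 0ℤ ≤ N + s → s ≤ N →
   + 4 * (+ 2) ^ k * ((N * N) * (N + s) ^ k) ≤ N ^ k * (+ 4 * (+ 2) ^ k * (N * N) + + 5 * ((+ 2) ^ k * (+ 2) ^ k) * (s * s) + + 4 * (+ k * + k) * (N * N))
 pair-bound N s k 0≤N h₁ h₂ = ℤ.≤-trans (*-monoˡ (+ 4 * T) (*-0≤ {+ 4} (+≤+ z≤n) 0≤T) (power-bound N s k 0≤N h₁ h₂))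
     (≤-cert (N ^ k * ((T * s - + 2 * + k * N) * (T * s - + 2 * + k * N) + + 4 * T * ((T - E k) * (s * s)))) cert (lem N s (N ^ k) (+ k) (E k) T))
   where
   T = (+ 2) ^ k
   0≤T : 0ℤ ≤ T
   0≤T = 0≤^ {+ 2} k (+≤+ z≤n)
   cert : 0ℤ ≤ N ^ k * ((T * s - + 2 * + k * N) * (T * s - + 2 * + k * N) + + 4 * T * ((T - E k) * (s * s)))
   cert = *-0≤ (0≤^ k 0≤N) (0≤+ (0≤sq (T * s - + 2 * + k * N)) (*-0≤ (*-0≤ {+ 4} (+≤+ z≤n) 0≤T) (*-0≤ (≤-diff (E≤2^ k)) (0≤sq s))))
   lem : ∀ N s p k e T → p * (+ 4 * T * (N * N) + + 5 * (T * T) * (s * s) + + 4 * (k * k) * (N * N)) ≡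
     + 4 * T * (p * (N * N + k * (N * s) + e * (s * s))) + p * ((T * s - + 2 * k * N) * (T * s - + 2 * k * N) + + 4 * T * ((T - e) * (s * s)))
   lem = solve-∀

 combine : ∀ A B p x V Q R → A * (V + p * x) ≤ p * ((A + B) * x + Q) → p * Q ≤ p * R → A * V ≤ p * (R + B * x)
 combine A B p x V Q R h₁ h₂ = +-cancelˡ (A * (p * x)) (subst₂ _≤_ (l₁ A V p x) (l₂ A B p x R) (ℤ.≤-trans h₁ (subst₂ _≤_ (l₃ p (A + B) x Q) (l₃ p (A + B) x R) (ℤ.+-monoʳ-≤ (p * ((A + B) * x)) h₂))))
   where
   l₁ : ∀ A V p x → A * (V + p * x) ≡ A * (p * x) + A * V
   l₁ = solve-∀
   l₂ : ∀ A B p x R → p * ((A + B) * x + R) ≡ A * (p * x) + p * (R + B * x)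
   l₂ = solve-∀
   l₃ : ∀ p c x q → p * (c * x) + p * q ≡ p * (c * x + q)
   l₃ = solve-∀

 lhs-form : ∀ T M V → + 4 * T * M * V ≡ + 4 * M * (T * V)
 lhs-form = solve-∀

 rhs-form : ∀ M p T w k x → p * (+ 5 * (T * T) * (+ 4 * M * w) + + 4 * k * M * x) ≡ + 4 * M * (p * (+ 5 * (T * T) * w + k * x))
 rhs-form = solve-∀

 -- Sum the pair bounds with weights w y w y'. The main term cancels the square of the mean, and the
 -- quadratic term is at most 4 N² ∑ w by the energy bound. The numbers s and pw are kept abstract,
 -- so that all identities are polynomial.
 variance-algebra : ∀ {L} (w : Fin L → ℤ) (s pw : Fin L → Fin L → ℤ) (T N p K V : ℤ) → 0ℤ < N → 0ℤ ≤ p → (∀ y → 0ℤ ≤ w y) → (∀ y → w y ≤ 1ℤ) →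
   (∀ y y' → + 4 * T * ((N * N) * pw y y') ≤ p * (+ 4 * T * (N * N) + + 5 * (T * T) * (s y y' * s y y') + + 4 * (K * K) * (N * N))) →
   (∀ y → ∑[ y' < L ] (s y y' * s y y') ≤ + 4 * (N * N)) →
   V + p * (sum w * sum w) ≡ ∑[ y < L ] (∑[ y' < L ] ((w y * w y') * pw y y')) →
   T * V ≤ p * (+ 5 * (T * T) * sum w + K * K * (sum w * sum w))
 variance-algebra {L} w s pw T N p K V 0<N 0≤p 0≤w w≤1 pair en tot =
     *-cancelˡ (+ 4 * (N * N)) (pos N 0<N) (fin T N p K (sum w) V (∑[ y < L ] (∑[ y' < L ] ((w y * w y') * pw y y'))) (∑[ y < L ] (∑[ y' < L ] ((w y * w y') * (s y y' * s y y')))) tot summed (*-monoˡ (p * (+ 5 * (T * T))) (*-0≤ 0≤p (*-0≤ {+ 5} (+≤+ z≤n) (0≤sq T))) Q≤))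
   where
   pos : ∀ N → 0ℤ < N → 0ℤ < + 4 * (N * N)
   pos (+ suc N) _ = +<+ (s≤s z≤n)
   pos (+ zero) (+<+ ())
   Q≤ : (∑[ y < L ] (∑[ y' < L ] ((w y * w y') * (s y y' * s y y')))) ≤ + 4 * (N * N) * (sum w)
   Q≤ = subst ((∑[ y < L ] (∑[ y' < L ] ((w y * w y') * (s y y' * s y y')))) ≤_) (trans (∑-*ʳ (+ 4 * (N * N)) w) (ℤ.*-comm (sum w) (+ 4 * (N * N)))) (∑-mono λ y → ℤ.≤-trans
       (ℤ.≤-reflexive (trans (∑-cong λ y' → ℤ.*-assoc (w y) (w y') (s y y' * s y y')) (∑-*ˡ (w y) (λ y' → w y' * (s y y' * s y y')))))
       (*-monoˡ (w y) (0≤w y) (ℤ.≤-trans (∑-mono λ y' → subst (w y' * (s y y' * s y y') ≤_) (ℤ.*-identityˡ (s y y' * s y y')) (*-monoʳ (s y y' * s y y') (0≤sq (s y y')) (w≤1 y'))) (en y))))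
   summed : + 4 * T * ((N * N) * (∑[ y < L ] (∑[ y' < L ] ((w y * w y') * pw y y')))) ≤ p * ((+ 4 * T * (N * N) + + 4 * (K * K) * (N * N)) * ((sum w) * (sum w)) + (+ 5 * (T * T)) * (∑[ y < L ] (∑[ y' < L ] ((w y * w y') * (s y y' * s y y')))))
   summed = subst₂ _≤_ lhs≡ rhs≡ (∑-mono λ y → ∑-mono λ y' → *-monoˡ (w y * w y') (*-0≤ (0≤w y) (0≤w y')) (pair y y'))
     where
     l₁ : ∀ a b c d → a * (b * (c * d)) ≡ b * c * (a * d)
     l₁ = solve-∀
     lhs≡ : (∑[ y < L ] (∑[ y' < L ] ((w y * w y') * (+ 4 * T * ((N * N) * pw y y'))))) ≡ + 4 * T * ((N * N) * (∑[ y < L ] (∑[ y' < L ] ((w y * w y') * pw y y'))))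
     lhs≡ = trans (∑-cong λ y → trans (∑-cong λ y' → l₁ (w y * w y') (+ 4 * T) (N * N) (pw y y')) (∑-*ˡ (+ 4 * T * (N * N)) (λ y' → (w y * w y') * pw y y')))
         (trans (∑-*ˡ (+ 4 * T * (N * N)) (λ y → ∑[ y' < L ] ((w y * w y') * pw y y'))) (ℤ.*-assoc (+ 4 * T) (N * N) (∑[ y < L ] (∑[ y' < L ] ((w y * w y') * pw y y')))))
     l₂ : ∀ a p t f s k → a * (p * (t + f * (s * s) + k)) ≡ p * (t + k) * a + p * f * (a * (s * s))
     l₂ = solve-∀
     l₃ : ∀ p a w f q → p * a * w + p * f * q ≡ p * (a * w + f * q)
     l₃ = solve-∀
     rhs≡ : (∑[ y < L ] (∑[ y' < L ] ((w y * w y') * (p * (+ 4 * T * (N * N) + (+ 5 * (T * T)) * (s y y' * s y y') + + 4 * (K * K) * (N * N)))))) ≡ p * ((+ 4 * T * (N * N) + + 4 * (K * K) * (N * N)) * ((sum w) * (sum w)) + (+ 5 * (T * T)) * (∑[ y < L ] (∑[ y' < L ] ((w y * w y') * (s y y' * s y y')))))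
     rhs≡ = trans (∑-cong λ y → trans (∑-cong λ y' → l₂ (w y * w y') p (+ 4 * T * (N * N)) (+ 5 * (T * T)) (s y y') (+ 4 * (K * K) * (N * N))) (trans (∑-+ (λ y' → p * (+ 4 * T * (N * N) + + 4 * (K * K) * (N * N)) * (w y * w y')) (λ y' → p * (+ 5 * (T * T)) * ((w y * w y') * (s y y' * s y y'))))
           (cong₂ _+_ (∑-*ˡ (p * (+ 4 * T * (N * N) + + 4 * (K * K) * (N * N))) (λ y' → w y * w y')) (∑-*ˡ (p * (+ 5 * (T * T))) (λ y' → (w y * w y') * (s y y' * s y y'))))))
         (trans (∑-+ (λ y → p * (+ 4 * T * (N * N) + + 4 * (K * K) * (N * N)) * (∑[ y' < L ] (w y * w y'))) (λ y → p * (+ 5 * (T * T)) * (∑[ y' < L ] ((w y * w y') * (s y y' * s y y')))))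
           (trans (cong₂ _+_ (trans (∑-*ˡ (p * (+ 4 * T * (N * N) + + 4 * (K * K) * (N * N))) (λ y → ∑[ y' < L ] (w y * w y'))) (cong (p * (+ 4 * T * (N * N) + + 4 * (K * K) * (N * N)) *_) (sym (∑-sq w)))) (∑-*ˡ (p * (+ 5 * (T * T))) (λ y → ∑[ y' < L ] ((w y * w y') * (s y y' * s y y'))))) (l₃ p (+ 4 * T * (N * N) + + 4 * (K * K) * (N * N)) ((sum w) * (sum w)) (+ 5 * (T * T)) (∑[ y < L ] (∑[ y' < L ] ((w y * w y') * (s y y' * s y y')))))))
   fin : ∀ T N p K w V S Q → V + p * (w * w) ≡ S → + 4 * T * ((N * N) * S) ≤ p * ((+ 4 * T * (N * N) + + 4 * (K * K) * (N * N)) * (w * w) + + 5 * (T * T) * Q) →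
     p * (+ 5 * (T * T)) * Q ≤ p * (+ 5 * (T * T)) * (+ 4 * (N * N) * w) →
     + 4 * (N * N) * (T * V) ≤ + 4 * (N * N) * (p * (+ 5 * (T * T) * w + K * K * (w * w)))
   fin T N p K w V _ Q refl h₁ h₂ = subst₂ _≤_ (lhs-form T (N * N) V) (rhs-form (N * N) p T w (K * K) (w * w))
     (combine (+ 4 * T * (N * N)) (+ 4 * (K * K) * (N * N)) p (w * w) V (+ 5 * (T * T) * Q) (+ 5 * (T * T) * (+ 4 * (N * N) * w))
       (subst (_≤ p * ((+ 4 * T * (N * N) + + 4 * (K * K) * (N * N)) * (w * w) + + 5 * (T * T) * Q)) (sym (ℤ.*-assoc (+ 4 * T) (N * N) (V + p * (w * w)))) h₁)
       (subst₂ _≤_ (ℤ.*-assoc p (+ 5 * (T * T)) Q) (ℤ.*-assoc p (+ 5 * (T * T)) (+ 4 * (N * N) * w)) h₂))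

 eqb : Bool → Bool → Bool
 eqb true b = b
 eqb false b = not b

 eqb⇒≡ : ∀ {a b} → eqb a b ≡ true → a ≡ b
 eqb⇒≡ {true} {true} _ = refl
 eqb⇒≡ {false} {false} _ = refl

 eqb-ε : ∀ a b → + 2 * 𝟙 (eqb a b) ≡ 1ℤ + ε a * ε b
 eqb-ε true true = refl
 eqb-ε true false = refl
 eqb-ε false true = refl
 eqb-ε false false = refl

 module Tuples (N : ℕ) where

   -- Divided by N^k this is the expectation over a uniformly random k-tuple.
   ∑T : ∀ {k} → (Vec (Fin N) k → ℤ) → ℤ
   ∑T {zero} f = f []
   ∑T {suc k} f = ∑[ t < N ] ∑T (λ v → f (t ∷ v))

   ∑T-cong : ∀ {k} {f g : Vec (Fin N) k → ℤ} → (∀ v → f v ≡ g v) → ∑T f ≡ ∑T g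
   ∑T-cong {zero} h = h []
   ∑T-cong {suc k} h = ∑-cong λ t → ∑T-cong λ v → h (t ∷ v)

   ∑T-mono : ∀ {k} {f g : Vec (Fin N) k → ℤ} → (∀ v → f v ≤ g v) → ∑T f ≤ ∑T g
   ∑T-mono {zero} h = h []
   ∑T-mono {suc k} h = ∑-mono λ t → ∑T-mono λ v → h (t ∷ v)

   ∑T-+ : ∀ {k} (f g : Vec (Fin N) k → ℤ) → ∑T (λ v → f v + g v) ≡ ∑T f + ∑T g
   ∑T-+ {zero} f g = refl
   ∑T-+ {suc k} f g = trans (∑-cong λ t → ∑T-+ (λ v → f (t ∷ v)) (λ v → g (t ∷ v))) (∑-+ _ _)

   ∑T-*ˡ : ∀ {k} c (f : Vec (Fin N) k → ℤ) → ∑T (λ v → c * f v) ≡ c * ∑T f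
   ∑T-*ˡ {zero} c f = refl
   ∑T-*ˡ {suc k} c f = trans (∑-cong λ t → ∑T-*ˡ c (λ v → f (t ∷ v))) (∑-*ˡ c _)

   ∑T-const : ∀ k c → ∑T {k} (λ _ → c) ≡ (+ N) ^ k * c
   ∑T-const zero c = sym (ℤ.*-identityˡ c)
   ∑T-const (suc k) c = trans (∑-cong λ t → ∑T-const k c) (trans (∑-const N _) (sym (ℤ.*-assoc (+ N) _ c)))

   ∑T-∑ : ∀ {k m} (f : Vec (Fin N) k → Fin m → ℤ) → ∑T (λ v → ∑[ y < m ] f v y) ≡ ∑[ y < m ] ∑T (λ v → f v y)
   ∑T-∑ {zero} f = refl
   ∑T-∑ {suc k} f = trans (∑-cong λ t → ∑T-∑ (λ v → f (t ∷ v))) (∑-comm (λ t y → ∑T (λ v → f (t ∷ v) y)))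

   abstract
     ∑T-avg : ∀ {k} (f : Vec (Fin N) k → ℤ) B → 0ℤ < + N → ∑T f ≤ (+ N) ^ k * B → ∃ λ v → f v ≤ B
     ∑T-avg {zero} f B _ h = [] , subst (f [] ≤_) (ℤ.*-identityˡ B) h
     ∑T-avg {suc k} f B 0<N h = let t , _ , ht = ∑-avg {N} (λ _ → 1ℤ) (λ t → ∑T (λ v → f (t ∷ v))) (λ _ → (+ N) ^ k * B) (λ _ → +≤+ z≤n)
                                       (subst (0ℤ <_) (sym (∑-ones N)) 0<N) (subst₂ _≤_ (∑-cong λ t → sym (ℤ.*-identityˡ _)) (sym (trans (∑-cong λ t → ℤ.*-identityˡ ((+ N) ^ k * B)) (trans (∑-const N _) (sym (ℤ.*-assoc (+ N) _ B))))) h)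
                                    v , hv = ∑T-avg (λ v → f (t ∷ v)) B 0<N ht
                                in t ∷ v , hv

 module Variance {N L} (D : Design N L) (0<N : 0ℤ < + N) where
   open Design D
   open Tuples N public

   matches : ∀ {k} → Vec (Fin N) k → Vec Bool k → Fin L → Bool
   matches [] [] y = true
   matches (t ∷ v) (b ∷ e) y = eqb (edge t y) b ∧ matches v e y

   matches⇒ : ∀ {k} (v : Vec (Fin N) k) e y → matches v e y ≡ true → ∀ i → edge (lookup v i) y ≡ lookup e i
   matches⇒ (t ∷ v) (b ∷ e) y h i with eqb (edge t y) b in eq
   matches⇒ (t ∷ v) (b ∷ e) y h zero | true = eqb⇒≡ eq
   matches⇒ (t ∷ v) (b ∷ e) y h (suc i) | true = matches⇒ v e y h i

   one-point : ∀ b y → + 2 * (∑[ t < N ] 𝟙 (eqb (edge t y) b)) ≡ + N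
   one-point b y = trans (sym (∑-*ˡ (+ 2) (λ t → 𝟙 (eqb (edge t y) b)))) (trans (∑-cong λ t → eqb-ε (edge t y) b) (trans (∑-+ (λ _ → 1ℤ) (λ t → ε (edge t y) * ε b))
     (trans (cong₂ _+_ (∑-ones N) (trans (∑-*ʳ (ε b) (λ t → ε (edge t y))) (trans (cong (_* ε b) (balanced y)) (ℤ.*-zeroˡ (ε b))))) (ℤ.+-identityʳ (+ N)))))

   two-point : ∀ b y y' → + 4 * (∑[ t < N ] (𝟙 (eqb (edge t y) b) * 𝟙 (eqb (edge t y') b))) ≡ + N + corr y y'
   two-point b y y' = trans (sym (∑-*ˡ (+ 4) (λ t → 𝟙 (eqb (edge t y) b) * 𝟙 (eqb (edge t y') b)))) (trans (∑-cong point) (trans (∑-+ (λ t → 1ℤ + (ε (edge t y) * ε b + ε (edge t y') * ε b)) (λ t → ε (edge t y) * ε (edge t y')))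
       (cong (_+ corr y y') (trans (∑-+ (λ _ → 1ℤ) (λ t → ε (edge t y) * ε b + ε (edge t y') * ε b)) (trans (cong₂ _+_ (∑-ones N)
         (trans (∑-+ (λ t → ε (edge t y) * ε b) (λ t → ε (edge t y') * ε b)) (cong₂ _+_ (bal y) (bal y')))) (ℤ.+-identityʳ (+ N)))))))
     where
     bal : ∀ y → ∑[ t < N ] (ε (edge t y) * ε b) ≡ 0ℤ
     bal y = trans (∑-*ʳ (ε b) (λ t → ε (edge t y))) (trans (cong (_* ε b) (balanced y)) (ℤ.*-zeroˡ (ε b)))
     point : ∀ t → + 4 * (𝟙 (eqb (edge t y) b) * 𝟙 (eqb (edge t y') b)) ≡ (1ℤ + (ε (edge t y) * ε b + ε (edge t y') * ε b)) + ε (edge t y) * ε (edge t y')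
     point t = trans (l₁ (𝟙 (eqb (edge t y) b)) (𝟙 (eqb (edge t y') b))) (trans (cong₂ _*_ (eqb-ε (edge t y) b) (eqb-ε (edge t y') b))
         (trans (l₂ (ε (edge t y)) (ε (edge t y')) (ε b)) (cong (λ z → (1ℤ + (ε (edge t y) * ε b + ε (edge t y') * ε b)) + ε (edge t y) * ε (edge t y') * z) (ε² b) ▹ λ q → trans q (l₃ (ε (edge t y)) (ε (edge t y')) (ε b)))))
       where
       l₁ : ∀ a b → + 4 * (a * b) ≡ (+ 2 * a) * (+ 2 * b)
       l₁ = solve-∀
       l₂ : ∀ a a' b → (1ℤ + a * b) * (1ℤ + a' * b) ≡ (1ℤ + (a * b + a' * b)) + a * a' * (b * b)
       l₂ = solve-∀
       l₃ : ∀ a a' b → (1ℤ + (a * b + a' * b)) + a * a' * 1ℤ ≡ (1ℤ + (a * b + a' * b)) + a * a'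
       l₃ = solve-∀
       _▹_ : ∀ {A B : Set} → A → (A → B) → B
       x ▹ f = f x

   -- By balance each coordinate agrees with the prescribed bit with probability 1/2, and the
   -- coordinates are independent.
   first-moment : ∀ {k} (e : Vec Bool k) y → (+ 2) ^ k * ∑T (λ v → 𝟙 (matches v e y)) ≡ (+ N) ^ k
   first-moment [] y = refl
   first-moment {suc k} (b ∷ e) y = trans (cong ((+ 2) ^ suc k *_) (trans (∑-cong λ t → trans (∑T-cong λ v → 𝟙-∧ (eqb (edge t y) b) (matches v e y)) (∑T-*ˡ (𝟙 (eqb (edge t y) b)) (λ v → 𝟙 (matches v e y)))) (∑-*ʳ (∑T (λ v → 𝟙 (matches v e y))) (λ t → 𝟙 (eqb (edge t y) b)))))
     (trans (l (+ 2) ((+ 2) ^ k) (∑[ t < N ] 𝟙 (eqb (edge t y) b)) (∑T (λ v → 𝟙 (matches v e y)))) (cong₂ _*_ (one-point b y) (first-moment e y)))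
     where
     l : ∀ a b c d → a * b * (c * d) ≡ (a * c) * (b * d)
     l = solve-∀

   -- In one coordinate two columns both show a given bit with probability (1 + corr/N)/4, whichever
   -- bit it is; the coordinates are independent.
   pair-moment : ∀ {k} (e : Vec Bool k) y y' → (+ 4) ^ k * ∑T (λ v → 𝟙 (matches v e y) * 𝟙 (matches v e y')) ≡ (+ N + corr y y') ^ k
   pair-moment [] y y' = refl
   pair-moment {suc k} (b ∷ e) y y' = trans (cong ((+ 4) ^ suc k *_) (trans (∑-cong λ t → trans (∑T-cong λ v → trans (cong₂ _*_ (𝟙-∧ (eqb (edge t y) b) (matches v e y)) (𝟙-∧ (eqb (edge t y') b) (matches v e y'))) (l₁ (𝟙 (eqb (edge t y) b)) (𝟙 (matches v e y)) (𝟙 (eqb (edge t y') b)) (𝟙 (matches v e y'))))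
         (∑T-*ˡ (𝟙 (eqb (edge t y) b) * 𝟙 (eqb (edge t y') b)) (λ v → 𝟙 (matches v e y) * 𝟙 (matches v e y')))) (∑-*ʳ (∑T (λ v → 𝟙 (matches v e y) * 𝟙 (matches v e y'))) (λ t → 𝟙 (eqb (edge t y) b) * 𝟙 (eqb (edge t y') b)))))
     (trans (l (+ 4) ((+ 4) ^ k) (∑[ t < N ] (𝟙 (eqb (edge t y) b) * 𝟙 (eqb (edge t y') b))) (∑T (λ v → 𝟙 (matches v e y) * 𝟙 (matches v e y')))) (cong₂ _*_ (two-point b y y') (pair-moment e y y')))
     where
     l₁ : ∀ a b c d → (a * b) * (c * d) ≡ (a * c) * (b * d)
     l₁ = solve-∀
     l : ∀ a b c d → a * b * (c * d) ≡ (a * c) * (b * d)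
     l = solve-∀

   corr≤N : ∀ y y' → corr y y' ≤ + N
   corr≤N y y' = subst (corr y y' ≤_) (∑-ones N) (∑-mono λ t → le (edge t y) (edge t y'))
     where
     le : ∀ a b → ε a * ε b ≤ 1ℤ
     le true true = ℤ.≤-refl
     le true false = ℤ.-≤+
     le false true = ℤ.-≤+
     le false false = ℤ.≤-refl

   0≤N+corr : ∀ y y' → 0ℤ ≤ + N + corr y y'
   0≤N+corr y y' = subst (0ℤ ≤_) (two-point true y y') (*-0≤ {+ 4} (+≤+ z≤n) (∑-0≤ λ t → *-0≤ (0≤𝟙 (eqb (edge t y) true)) (0≤𝟙 (eqb (edge t y') true))))

   Z : ∀ {k} → (Fin L → ℤ) → Vec Bool k → Vec (Fin N) k → ℤ
   Z w e v = ∑[ y < L ] (w y * 𝟙 (matches v e y))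

   -- `Z` is the weighted number of columns that show the pattern e on the tuple v. Its mean is ∑ w
   -- / 2^k, so this is the squared deviation from the mean, scaled by 4^k.
   dev : ∀ {k} → (Fin L → ℤ) → Vec Bool k → Vec (Fin N) k → ℤ
   dev {k} w e v = ((+ 2) ^ k * Z w e v - sum w) * ((+ 2) ^ k * Z w e v - sum w)

   4^≡ : ∀ k → (+ 4) ^ k ≡ (+ 2) ^ k * (+ 2) ^ k
   4^≡ zero = refl
   4^≡ (suc k) = trans (cong (+ 4 *_) (4^≡ k)) (l ((+ 2) ^ k))
     where
     l : ∀ t → + 4 * (t * t) ≡ (+ 2 * t) * (+ 2 * t)
     l = solve-∀

   -- The mean of 2^k Z is ∑ w, so adding the square of the mean to the variance leaves the raw
   -- second moment, which `pair-moment` evaluates.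
   dev-total : ∀ {k} w (e : Vec Bool k) → ∑T (dev w e) + (+ N) ^ k * (sum w * sum w) ≡ ∑[ y < L ] (∑[ y' < L ] ((w y * w y') * (+ N + corr y y') ^ k))
   dev-total {k} w e = trans (cong (_+ (+ N) ^ k * (w̄ * w̄)) (trans (∑T-cong λ v → expand T (Z w e v) w̄) (trans (∑T-+ (λ v → T * T * (Z w e v * Z w e v)) (λ v → (- + 2 * w̄) * (T * Z w e v) + w̄ * w̄))
       (cong (λ z → ∑T (λ v → T * T * (Z w e v * Z w e v)) + z) (trans (∑T-+ (λ v → (- + 2 * w̄) * (T * Z w e v)) (λ _ → w̄ * w̄)) (cong₂ _+_ (trans (∑T-*ˡ (- + 2 * w̄) (λ v → T * Z w e v)) (cong (- + 2 * w̄ *_) lin)) (∑T-const k (w̄ * w̄))))))))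
     (trans (collect (∑T (λ v → T * T * (Z w e v * Z w e v))) w̄ ((+ N) ^ k)) quad)
     where
     T = (+ 2) ^ k
     w̄ = sum w
     expand : ∀ T z w → (T * z - w) * (T * z - w) ≡ T * T * (z * z) + ((- + 2 * w) * (T * z) + w * w)
     expand = solve-∀
     collect : ∀ q w n → (q + ((- + 2 * w) * (n * w) + n * (w * w))) + n * (w * w) ≡ q
     collect = solve-∀
     lin : ∑T (λ v → T * Z w e v) ≡ (+ N) ^ k * w̄
     lin = trans (∑T-*ˡ T (Z w e)) (trans (cong (T *_) (trans (∑T-∑ (λ v y → w y * 𝟙 (matches v e y))) (∑-cong λ y → ∑T-*ˡ (w y) (λ v → 𝟙 (matches v e y))))) (trans (sym (∑-*ˡ T _))
       (trans (∑-cong λ y → trans (l₁ T (w y) _) (cong (w y *_) (first-moment e y))) (trans (∑-*ʳ ((+ N) ^ k) w) (ℤ.*-comm w̄ _)))))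
       where
       l₁ : ∀ a b c → a * (b * c) ≡ b * (a * c)
       l₁ = solve-∀
     quad : ∑T (λ v → T * T * (Z w e v * Z w e v)) ≡ ∑[ y < L ] (∑[ y' < L ] ((w y * w y') * (+ N + corr y y') ^ k))
     quad = trans (∑T-*ˡ (T * T) (λ v → Z w e v * Z w e v)) (trans (cong (T * T *_) (trans (∑T-cong λ v → ∑-sq (λ y → w y * 𝟙 (matches v e y)))
         (trans (∑T-∑ (λ v y → ∑[ y' < L ] (w y * 𝟙 (matches v e y) * (w y' * 𝟙 (matches v e y'))))) (∑-cong λ y → ∑T-∑ (λ v y' → w y * 𝟙 (matches v e y) * (w y' * 𝟙 (matches v e y')))))))
       (trans (sym (∑-*ˡ (T * T) _)) (∑-cong λ y → trans (sym (∑-*ˡ (T * T) _)) (∑-cong λ y' → trans (cong (T * T *_) (trans (∑T-cong λ v → l₁ (w y) (𝟙 (matches v e y)) (w y') (𝟙 (matches v e y'))) (∑T-*ˡ (w y * w y') (λ v → 𝟙 (matches v e y) * 𝟙 (matches v e y')))))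
         (trans (l₂ (T * T) (w y * w y') _) (cong (w y * w y' *_) (trans (cong (_* ∑T (λ v → 𝟙 (matches v e y) * 𝟙 (matches v e y'))) (sym (4^≡ k))) (pair-moment e y y'))))))))
       where
       l₁ : ∀ a b c d → (a * b) * (c * d) ≡ (a * c) * (b * d)
       l₁ = solve-∀
       l₂ : ∀ a b c → a * (b * c) ≡ b * (a * c)
       l₂ = solve-∀

   -- Per tuple this reads 5 · 2^k ∑ w + k² (∑ w)² / 2^k. The 5 collects 4 from the quadratic part
   -- of the power bound and 1 from AM-GM; the term with k² is the price of the part linear in the
   -- correlations.
   variance : ∀ {k} w (e : Vec Bool k) → (∀ y → 0ℤ ≤ w y) → (∀ y → w y ≤ 1ℤ) →
     (+ 2) ^ k * ∑T (dev w e) ≤ (+ N) ^ k * (+ 5 * ((+ 2) ^ k * (+ 2) ^ k) * sum w + + k * + k * (sum w * sum w))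
   variance {k} w e 0≤w w≤1 = variance-algebra w corr (λ y y' → (+ N + corr y y') ^ k) ((+ 2) ^ k) (+ N) ((+ N) ^ k) (+ k) (∑T (dev w e))
     0<N (0≤^ k (+≤+ z≤n)) 0≤w w≤1 (λ y y' → pair-bound (+ N) (corr y y') k (+≤+ z≤n) (0≤N+corr y y') (corr≤N y y')) energy (dev-total w e)

-- Hamilton cycles under Pósa's degree condition

module HamiltonCycles where
 open Sums
 open Universality using (count)
 open import Data.Fin.Base using (fromℕ; fromℕ<; inject₁)
 open import Data.Fin.Properties using (_≟_; any?; toℕ-injective; toℕ<n; toℕ-fromℕ; toℕ-fromℕ<; toℕ-inject₁; toℕ≤pred[n])
 open import Data.Integer.Base using (+_; _+_; _*_; _-_; -_; _≤_; _<_)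
 open import Data.Integer.Tactic.RingSolver using (solve-∀)
 open import Data.Nat.Base using (_∸_)
 open import Relation.Binary.Definitions using (tri<; tri≈; tri>)

 next : ∀ {m} → Fin (suc m) → Fin (suc m)
 next {m} i with toℕ i ℕ.<? m
 ... | yes h = fromℕ< (s≤s h)
 ... | no _ = zero

 next-< : ∀ {m} (i : Fin (suc m)) → toℕ i ℕ.< m → toℕ (next i) ≡ suc (toℕ i)
 next-< {m} i h with toℕ i ℕ.<? m
 ... | yes h' = toℕ-fromℕ< (s≤s h')
 ... | no q = ⊥-elim (q h)

 next-last : ∀ {m} (i : Fin (suc m)) → toℕ i ≡ m → next i ≡ zero
 next-last {m} i h with toℕ i ℕ.<? m
 ... | yes h' = ⊥-elim (ℕ.<⇒≢ h' h)
 ... | no _ = refl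

 last-or-< : ∀ {m} (i : Fin (suc m)) → toℕ i ≡ m ⊎ toℕ i ℕ.< m
 last-or-< {m} i with toℕ i ℕ.<? m
 ... | yes h = inj₂ h
 ... | no h = inj₁ (ℕ.≤-antisym (toℕ≤pred[n] i) (ℕ.≮⇒≥ h))

 next-inj : ∀ {m} (i j : Fin (suc m)) → next i ≡ next j → i ≡ j
 next-inj i j e with last-or-< i | last-or-< j
 ... | inj₁ a | inj₁ b = toℕ-injective (trans a (sym b))
 ... | inj₁ a | inj₂ b with () ← trans (sym (cong toℕ (next-last i a))) (trans (cong toℕ e) (next-< j b))
 ... | inj₂ a | inj₁ b with () ← trans (sym (next-< i a)) (trans (cong toℕ e) (cong toℕ (next-last j b)))
 ... | inj₂ a | inj₂ b = toℕ-injective (ℕ.suc-injective (trans (sym (next-< i a)) (trans (cong toℕ e) (next-< j b))))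

 next^ : ∀ {m} → ℕ → Fin (suc m) → Fin (suc m)
 next^ zero i = i
 next^ (suc r) i = next^ r (next i)

 next^-next : ∀ {m} r (i : Fin (suc m)) → next^ r (next i) ≡ next (next^ r i)
 next^-next zero i = refl
 next^-next (suc r) i = next^-next r (next i)

 next^-inj : ∀ {m} r (i j : Fin (suc m)) → next^ r i ≡ next^ r j → i ≡ j
 next^-inj zero i j e = e
 next^-inj (suc r) i j e = next-inj i j (next^-inj r _ _ e)

 -- Every position is an iterate of `next` applied to the last one, so a cyclic order can be turned
 -- until a prescribed edge becomes the closing one.
 reach : ∀ {m} t (i : Fin (suc m)) → toℕ i ≡ t → ∃ λ r → next^ r (fromℕ m) ≡ i
 reach {m} zero zero _ = 1 , next-last (fromℕ m) (toℕ-fromℕ m)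
 reach {m} (suc t) (suc i) e with r , h ← reach t (inject₁ i) (trans (toℕ-inject₁ i) (ℕ.suc-injective e)) =
   suc r , trans (next^-next r (fromℕ m)) (trans (cong next h) (toℕ-injective (trans (next-< (inject₁ i) (subst (ℕ._< m) (sym (toℕ-inject₁ i)) (toℕ<n i))) (cong suc (toℕ-inject₁ i)))))

 Rel : ℕ → Set
 Rel k = Fin k → Fin k → Bool

 Ham : ∀ {m} → Rel (suc m) → Set
 Ham {m} E = Σ (Fin (suc m) → Fin (suc m)) λ p → (∀ i j → p i ≡ p j → i ≡ j) × (∀ i → E (p i) (p (next i)) ≡ true)

 deg : ∀ {k} → Rel k → Fin k → ℤ
 deg E u = sum λ v → 𝟙 (E u v)

 Symmetric : ∀ {k} → Rel k → Set
 Symmetric E = ∀ u v → E u v ≡ E v u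

 Irreflexive : ∀ {k} → Rel k → Set
 Irreflexive E = ∀ u → E u u ≡ false

 -- Rotate the Hamilton path p₀ … p_m at an index i with p₀ ~ p_{i+1} and p_i ~ p_m.
 module Rotation {m} (E : Rel (suc m)) (sym-E : Symmetric E) (p : Fin (suc m) → Fin (suc m)) (inj : ∀ i j → p i ≡ p j → i ≡ j)
     (path : ∀ i → toℕ i ℕ.< m → E (p i) (p (next i)) ≡ true) (i : Fin m)
     (e₀ : E (p zero) (p (suc i)) ≡ true) (e₁ : E (p (inject₁ i)) (p (fromℕ m)) ≡ true) where

   t : ℕ
   t = toℕ i

   t<m : t ℕ.< m
   t<m = toℕ<n i

   ρℕ : ℕ → ℕ
   ρℕ a with a ℕ.≤? t
   ... | yes _ = a
   ... | no _ = suc (t ℕ.+ m) ∸ a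

   ρ-low : ∀ a → a ℕ.≤ t → ρℕ a ≡ a
   ρ-low a h with a ℕ.≤? t
   ... | yes _ = refl
   ... | no q = ⊥-elim (q h)

   ρ-high : ∀ a → t ℕ.< a → ρℕ a ≡ suc (t ℕ.+ m) ∸ a
   ρ-high a h with a ℕ.≤? t
   ... | yes q = ⊥-elim (ℕ.<⇒≱ h q)
   ... | no _ = refl

   low-high : ∀ a → a ℕ.≤ t ⊎ t ℕ.< a
   low-high a with a ℕ.≤? t
   ... | yes q = inj₁ q
   ... | no q = inj₂ (ℕ.≰⇒> q)

   ρ≤m : ∀ a → a ℕ.≤ m → ρℕ a ℕ.≤ m
   ρ≤m a h with low-high a
   ... | inj₁ q = subst (ℕ._≤ m) (sym (ρ-low a q)) h
   ... | inj₂ q = subst (ℕ._≤ m) (sym (ρ-high a q)) (ℕ.≤-trans (ℕ.∸-monoʳ-≤ (suc (t ℕ.+ m)) q) (ℕ.≤-reflexive (ℕ.m+n∸m≡n (suc t) m)))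

   a≤ : ∀ a → a ℕ.≤ m → a ℕ.≤ suc (t ℕ.+ m)
   a≤ a h = ℕ.≤-trans h (ℕ.≤-trans (ℕ.m≤n+m m t) (ℕ.n≤1+n _))

   ρ-high> : ∀ a → a ℕ.≤ m → t ℕ.< a → t ℕ.< ρℕ a
   ρ-high> a h q = subst (t ℕ.<_) (sym (ρ-high a q)) (subst (ℕ._≤ suc (t ℕ.+ m) ∸ a) (ℕ.m+n∸n≡m (suc t) m) (ℕ.∸-monoʳ-≤ (suc (t ℕ.+ m)) h))

   ρ-inj : ∀ a b → a ℕ.≤ m → b ℕ.≤ m → ρℕ a ≡ ρℕ b → a ≡ b
   ρ-inj a b ha hb e with low-high a | low-high b
   ... | inj₁ x | inj₁ y = trans (sym (ρ-low a x)) (trans e (ρ-low b y))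
   ... | inj₁ x | inj₂ y = ⊥-elim (ℕ.<⇒≱ (ρ-high> b hb y) (subst (ℕ._≤ t) (trans (sym (ρ-low a x)) e) x))
   ... | inj₂ x | inj₁ y = ⊥-elim (ℕ.<⇒≱ (ρ-high> a ha x) (subst (ℕ._≤ t) (trans (sym (ρ-low b y)) (sym e)) y))
   ... | inj₂ x | inj₂ y = ℕ.∸-cancelˡ-≡ (a≤ a ha) (a≤ b hb) (trans (sym (ρ-high a x)) (trans e (ρ-high b y)))

   ρ : Fin (suc m) → Fin (suc m)
   ρ a = fromℕ< (s≤s (ρ≤m (toℕ a) (toℕ≤pred[n] a)))

   toℕ-ρ : ∀ a → toℕ (ρ a) ≡ ρℕ (toℕ a)
   toℕ-ρ a = toℕ-fromℕ< (s≤s (ρ≤m (toℕ a) (toℕ≤pred[n] a)))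

   q : Fin (suc m) → Fin (suc m)
   q a = p (ρ a)

   q-inj : ∀ a b → q a ≡ q b → a ≡ b
   q-inj a b e = toℕ-injective (ρ-inj _ _ (toℕ≤pred[n] a) (toℕ≤pred[n] b) (trans (sym (toℕ-ρ a)) (trans (cong toℕ (inj _ _ e)) (toℕ-ρ b))))

   E-at : ∀ {x y x' y'} → toℕ x ≡ toℕ x' → toℕ y ≡ toℕ y' → E (p x') (p y') ≡ true → E (p x) (p y) ≡ true
   E-at ex ey h with refl ← toℕ-injective ex | refl ← toℕ-injective ey = h

   q-edge : ∀ a → E (q a) (q (next a)) ≡ true
   q-edge a with last-or-< a
   ... | inj₁ a≡m = E-at {x' = suc i} {y' = zero} (trans (toℕ-ρ a) (trans (cong ρℕ a≡m) (trans (ρ-high m t<m) (ℕ.m+n∸n≡m (suc t) m))))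
         (trans (toℕ-ρ (next a)) (trans (cong (ρℕ ∘ toℕ) (next-last a a≡m)) (ρ-low 0 z≤n))) (trans (sym-E _ _) e₀)
   ... | inj₂ a<m with ℕ.<-cmp (toℕ a) t
   ...   | tri< a<t _ _ = E-at {x' = a} {y' = next a} (trans (toℕ-ρ a) (ρ-low _ (ℕ.<⇒≤ a<t)))
             (trans (toℕ-ρ (next a)) (ρ-low _ (subst (ℕ._≤ t) (sym (next-< a a<m)) a<t))) (path a a<m)
   ...   | tri≈ _ a≡t _ = E-at {x' = inject₁ i} {y' = fromℕ m} (trans (toℕ-ρ a) (trans (ρ-low _ (ℕ.≤-reflexive a≡t)) (trans a≡t (sym (toℕ-inject₁ i)))))
             (trans (toℕ-ρ (next a)) (trans (cong ρℕ (trans (next-< a a<m) (cong suc a≡t))) (trans (ρ-high (suc t) ℕ.≤-refl) (trans (ℕ.m+n∸m≡n t m) (sym (toℕ-fromℕ m)))))) e₁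
   ...   | tri> _ _ t<a = trans (sym-E _ _) (E-at {x' = ρ (next a)} {y' = next (ρ (next a))} refl
             (trans (toℕ-ρ a) (trans (ρ-high _ t<a) (sym (trans (next-< (ρ (next a)) lt) (trans (cong suc nx) (sym (ℕ.+-∸-assoc 1 (ℕ.≤-trans (ℕ.<⇒≤ a<m) (ℕ.m≤n+m m t)))))))))
             (path (ρ (next a)) lt))
     where
     nx : toℕ (ρ (next a)) ≡ t ℕ.+ m ∸ toℕ a
     nx = trans (toℕ-ρ (next a)) (trans (cong ρℕ (next-< a a<m)) (ρ-high _ (ℕ.m<n⇒m<1+n t<a)))
     lt : toℕ (ρ (next a)) ℕ.< m
     lt = subst (ℕ._< m) (sym nx) (ℕ.<-≤-trans (ℕ.∸-monoʳ-< t<a (ℕ.≤-trans (ℕ.<⇒≤ a<m) (ℕ.m≤n+m m t))) (ℕ.≤-reflexive (ℕ.m+n∸m≡n t m)))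

   ham : Ham E
   ham = q , q-inj , q-edge

 add-edge : ∀ {k} → Rel k → Fin k → Fin k → Rel k
 add-edge E u v a b = E a b ∨ ((does (a ≟ u) ∧ does (b ≟ v)) ∨ (does (a ≟ v) ∧ does (b ≟ u)))

 add-elim : ∀ {k} (E : Rel k) u v a b → add-edge E u v a b ≡ true → E a b ≡ true ⊎ ((a ≡ u × b ≡ v) ⊎ (a ≡ v × b ≡ u))
 add-elim E u v a b h with E a b
 ... | true = inj₁ refl
 ... | false with a ≟ u | b ≟ v | a ≟ v | b ≟ u
 ...   | yes p | yes q | _ | _ = inj₂ (inj₁ (p , q))
 ...   | yes p | no q | yes p' | yes q' = inj₂ (inj₂ (p' , q'))
 ...   | no p | _ | yes p' | yes q' = inj₂ (inj₂ (p' , q'))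

 -- Among the m positions j, those with p₀ adjacent to p_{j+1} and those with p_j adjacent to p_m
 -- number at least m + 1 together. Some position has both properties and allows the rotation.
 closing : ∀ {m} (E : Rel (suc m)) → Symmetric E → Irreflexive E → (p : Fin (suc m) → Fin (suc m)) → (∀ i j → p i ≡ p j → i ≡ j) →
   (∀ i → toℕ i ℕ.< m → E (p i) (p (next i)) ≡ true) → + suc m ≤ deg E (p zero) + deg E (p (fromℕ m)) → Ham E
 closing {m} E sE iE p inj path h = Rotation.ham E sE p inj path i (∧-l (both i hit)) (∧-r (both i hit))
   where
   a b : Fin m → Bool
   a j = E (p zero) (p (suc j))
   b j = E (p (inject₁ j)) (p (fromℕ m))
   degA : deg E (p zero) ≡ sum (λ j → 𝟙 (a j))
   degA = trans (sym (∑-inj p inj (λ v → 𝟙 (E (p zero) v)))) (trans (∑-∷ (λ x → 𝟙 (E (p zero) (p x)))) (trans (cong (λ z → 𝟙 z + sum (λ j → 𝟙 (a j))) (iE (p zero))) (ℤ.+-identityˡ _)))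
   degB : deg E (p (fromℕ m)) ≡ sum (λ j → 𝟙 (b j))
   degB = trans (sym (∑-inj p inj (λ v → 𝟙 (E (p (fromℕ m)) v)))) (trans (∑-snoc (λ x → 𝟙 (E (p (fromℕ m)) (p x)))) (trans (cong₂ _+_ (∑-cong λ j → cong 𝟙 (sE _ _)) (cong 𝟙 (iE (p (fromℕ m))))) (ℤ.+-identityʳ _)))
   big : 0ℤ < sum (λ j → 𝟙 (a j) + 𝟙 (b j) - 1ℤ)
   big = subst (0ℤ <_) (sym (trans (∑-sub (λ j → 𝟙 (a j) + 𝟙 (b j)) (λ _ → 1ℤ)) (cong₂ _-_ (trans (∑-+ (λ j → 𝟙 (a j)) (λ j → 𝟙 (b j))) (sym (cong₂ _+_ degA degB))) (∑-ones m))))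
     (ℤ.<-≤-trans (+<+ (s≤s z≤n)) (subst (1ℤ ≤_) refl (≤-shift h)))
     where
     ≤-shift : ∀ {s} → + suc m ≤ s → 1ℤ ≤ s - + m
     ≤-shift {s} q = ≤-cert (s - + suc m) (≤-diff q) (l s (+ m))
       where
       l : ∀ s m → s - m ≡ 1ℤ + (s - (1ℤ + m))
       l = solve-∀
   i : Fin m
   i = proj₁ (∑-pos _ big)
   hit : 0ℤ < 𝟙 (a i) + 𝟙 (b i) - 1ℤ
   hit = proj₂ (∑-pos _ big)
   both : ∀ j → 0ℤ < 𝟙 (a j) + 𝟙 (b j) - 1ℤ → a j ∧ b j ≡ true
   both j q = go (a j) (b j) q
     where
     go : ∀ x y → 0ℤ < 𝟙 x + 𝟙 y - 1ℤ → x ∧ y ≡ true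
     go true true _ = refl
     go true false (+<+ ())
     go false true (+<+ ())
     go false false ()
   ∧-l : ∀ {x y} → x ∧ y ≡ true → x ≡ true
   ∧-l {true} _ = refl
   ∧-r : ∀ {x y} → x ∧ y ≡ true → y ≡ true
   ∧-r {true} e = e

 -- Bondy and Chvátal: an edge joining vertices of large degree sum is not needed.
 ore : ∀ {m} → 2 ℕ.≤ m → (E : Rel (suc m)) → Symmetric E → Irreflexive E → ∀ u v → + suc m ≤ deg E u + deg E v → Ham (add-edge E u v) → Ham E
 ore {m} 2≤m E sE iE u v h (p , inj , e) with any? (λ i → ¬? (E (p i) (p (next i)) Bool.≟ true))
 ... | no all = p , inj , λ i → dec i (E (p i) (p (next i)) Bool.≟ true)
   where
   dec : ∀ i → Dec (E (p i) (p (next i)) ≡ true) → E (p i) (p (next i)) ≡ true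
   dec i (yes q) = q
   dec i (no q) = ⊥-elim (all (i , q))
 ... | yes (i , bad) = closing E sE iE p' inj' path' (degs ends)
   where
   r : ℕ
   r = proj₁ (reach (toℕ i) i refl)
   p' : Fin (suc m) → Fin (suc m)
   p' a = p (next^ r a)
   inj' : ∀ a b → p' a ≡ p' b → a ≡ b
   inj' a b q = next^-inj r a b (inj _ _ q)
   e' : ∀ a → add-edge E u v (p' a) (p' (next a)) ≡ true
   e' a = subst (λ z → add-edge E u v (p' a) (p z) ≡ true) (sym (next^-next r a)) (e (next^ r a))
   last : Fin (suc m)
   last = fromℕ m
   ends : (p' last ≡ u × p' zero ≡ v) ⊎ (p' last ≡ v × p' zero ≡ u)
   ends with add-elim E u v (p' last) (p' (next last)) (e' last)
   ... | inj₁ q = ⊥-elim (bad (subst₂ (λ a b → E a b ≡ true) (cong p (proj₂ (reach (toℕ i) i refl))) (cong p (trans (next^-next r last) (cong next (proj₂ (reach (toℕ i) i refl))))) q))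
   ... | inj₂ q = subst (λ z → (p' last ≡ u × p' z ≡ v) ⊎ (p' last ≡ v × p' z ≡ u)) (next-last last (toℕ-fromℕ m)) q
   degs : (p' last ≡ u × p' zero ≡ v) ⊎ (p' last ≡ v × p' zero ≡ u) → + suc m ≤ deg E (p' zero) + deg E (p' last)
   degs (inj₁ (a , b)) = subst₂ (λ x y → + suc m ≤ deg E x + deg E y) (sym b) (sym a) (subst (+ suc m ≤_) (ℤ.+-comm (deg E u) (deg E v)) h)
   degs (inj₂ (a , b)) = subst₂ (λ x y → + suc m ≤ deg E x + deg E y) (sym b) (sym a) h
   -- an inner edge cannot be {u, v} as well
   clash : ∀ a → toℕ a ℕ.< m → ∀ {x y} → p' a ≡ x → p' (next a) ≡ y → (p' last ≡ x × p' zero ≡ y) ⊎ (p' last ≡ y × p' zero ≡ x) → ⊥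
   clash a a<m ex ey (inj₁ (l , z)) = ℕ.<⇒≢ a<m (trans (cong toℕ (inj' a last (trans ex (sym l)))) (toℕ-fromℕ m))
   clash a a<m ex ey (inj₂ (l , z)) = ℕ.<⇒≢ 2≤m (sym (trans (sym (toℕ-fromℕ m)) (trans (cong toℕ (inj' last (next a) (trans l (sym ey)))) (trans (next-< a a<m) (cong suc (cong toℕ (inj' a zero (trans ex (sym z)))))))))
   path' : ∀ a → toℕ a ℕ.< m → E (p' a) (p' (next a)) ≡ true
   path' a a<m with add-elim E u v (p' a) (p' (next a)) (e' a)
   ... | inj₁ q = q
   ... | inj₂ (inj₁ (x , y)) = ⊥-elim (clash a a<m x y ends)
   ... | inj₂ (inj₂ (x , y)) = ⊥-elim (clash a a<m x y (swap ends))
     where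
     swap : ∀ {A B : Set} → A ⊎ B → B ⊎ A
     swap (inj₁ x) = inj₂ x
     swap (inj₂ x) = inj₁ x

 deg≤ᵇ : ∀ {k} → Rel k → ℤ → Fin k → Bool
 deg≤ᵇ E j i = does (deg E i ℤ.≤? j)

 -- Pósa's condition, demanded strictly also at j = (k - 1)/2 when k is odd. Adding edges preserves
 -- it.
 PosaCondition : ∀ {k} → Rel k → Set
 PosaCondition {k} E = ∀ j → 1 ℕ.≤ j → 2 ℕ.* j ℕ.< k → count (deg≤ᵇ E (+ j)) < + j

 module Closure {m} (2≤m : 2 ℕ.≤ m) where

   NonAdj : Rel (suc m) → Fin (suc m) → Fin (suc m) → Set
   NonAdj E u v = u ≢ v × E u v ≢ true

   nonAdj? : ∀ E u v → Dec (NonAdj E u v)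
   nonAdj? E u v = ¬? (u ≟ v) ×-dec ¬? (E u v Bool.≟ true)

   -- Either a nonadjacent pair has a degree sum large enough for `ore`, or a nonadjacent pair of
   -- maximal degree sum is found. The fuel bounds how often the sum can still increase below k.
   maxPair : ∀ E f u v → NonAdj E u v → + suc m - (deg E u + deg E v) ≤ + f →
     (∃ λ u → ∃ λ v → NonAdj E u v × + suc m ≤ deg E u + deg E v) ⊎
     (∃ λ u → ∃ λ v → NonAdj E u v × deg E u + deg E v < + suc m × (∀ a b → NonAdj E a b → deg E a + deg E b ≤ deg E u + deg E v))
   maxPair E f u v nuv hf with + suc m ℤ.≤? deg E u + deg E v
   ... | yes h = inj₁ (u , v , nuv , h)
   ... | no h with any? (λ a → any? (λ b → nonAdj? E a b ×-dec ((deg E u + deg E v) ℤ.<? (deg E a + deg E b))))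
   ...   | no none = inj₂ (u , v , nuv , ℤ.≰⇒> h , λ a b nab → ℤ.≮⇒≥ (λ q → none (a , b , nab , q)))
   ...   | yes (a , b , nab , lt) with f
   ...     | zero = ⊥-elim (h (ℤ.i-j≤0⇒i≤j hf))
   ...     | suc f' = maxPair E f' a b nab (dec {s = + suc m} lt hf)
     where
     dec : ∀ {x y s g} → x < y → s - x ≤ + suc g → s - y ≤ + g
     dec {x} {y} {s} {g} p q = ≤-cert ((+ suc g - (s - x)) + (y - ℤ.suc x)) (0≤+ (≤-diff q) (≤-diff (ℤ.i<j⇒suc[i]≤j p))) (l (+ g) s x y)
       where
       l : ∀ g s x y → g ≡ (s - y) + (((1ℤ + g) - (s - x)) + (y - (1ℤ + x)))
       l = solve-∀

   0≤deg : ∀ E u → 0ℤ ≤ deg {suc m} E u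
   0≤deg E u = ∑-0≤ (λ v → 0≤𝟙 (E u v))

   -- All non-neighbours of v have degree at most deg u, which contradicts the degree condition.
   stuck : ∀ E → Symmetric E → PosaCondition E → ∀ u v → NonAdj E u v → deg E u ≤ deg E v → deg E u + deg E v < + suc m →
     (∀ w → NonAdj E w v → deg E w ≤ deg E u) → ⊥
   stuck E sE cond u v (u≢v , Euv) du≤dv du+dv<k dom = go ∣ deg E u ∣' refl
     where
     open import Data.Integer.Base using (∣_∣)
     ∣_∣' : ℤ → ℕ
     ∣ x ∣' = ∣ x ∣
     du : + ∣ deg E u ∣ ≡ deg E u
     du = ℤ.0≤i⇒+∣i∣≡i (0≤deg E u)
     many : deg E u ≤ count (deg≤ᵇ E (deg E u))
     many = ℤ.≤-trans lower (∑-mono point)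
       where
       lower : deg E u ≤ sum (λ w → 1ℤ - (𝟙 (E w v) + δ w v))
       lower = subst (deg E u ≤_) (sym (trans (∑-sub (λ _ → 1ℤ) (λ w → 𝟙 (E w v) + δ w v)) (cong₂ _-_ (∑-ones (suc m)) (trans (∑-+ (λ w → 𝟙 (E w v)) (λ w → δ w v)) (cong₂ _+_ (∑-cong λ w → cong 𝟙 (sE w v)) (trans (∑-cong λ w → δ-sym w v) (∑-δ1 v)))))))
         (≤-cert (+ suc m - ℤ.suc (deg E u + deg E v)) (≤-diff (ℤ.i<j⇒suc[i]≤j du+dv<k)) (l (+ suc m) (deg E u) (deg E v)))
         where
         l : ∀ k a b → k - (b + 1ℤ) ≡ a + (k - (1ℤ + (a + b)))
         l = solve-∀
       point : ∀ w → 1ℤ - (𝟙 (E w v) + δ w v) ≤ 𝟙 (deg≤ᵇ E (deg E u) w)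
       point w with δ-cases w v
       ... | inj₁ (_ , d) = ℤ.≤-trans (subst (λ z → 1ℤ - (𝟙 (E w v) + z) ≤ 0ℤ) (sym d) (c (E w v))) (0≤𝟙 (deg≤ᵇ E (deg E u) w))
         where
         c : ∀ b → 1ℤ - (𝟙 b + 1ℤ) ≤ 0ℤ
         c true = ℤ.-≤+
         c false = ℤ.≤-refl
       ... | inj₂ (w≢v , d) with E w v in eq
       ...   | true = subst (λ z → 1ℤ - (1ℤ + z) ≤ _) (sym d) (0≤𝟙 (deg≤ᵇ E (deg E u) w))
       ...   | false = subst₂ (λ z b → 1ℤ - (0ℤ + z) ≤ 𝟙 b) (sym d) (sym (dec-true (deg E w ℤ.≤? deg E u) (dom w (w≢v , λ q → tf (trans (sym q) eq))))) ℤ.≤-refl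
         where
         tf : true ≢ false
         tf ()
     small : ∀ d → + d ≡ deg E u → 2 ℕ.* d ℕ.< suc m
     small d e = ℤ.drop‿+<+ (ℤ.≤-<-trans (subst₂ _≤_ (trans (cong₂ _+_ (sym e) (sym e)) (cong (λ z → + (d ℕ.+ z)) (sym (ℕ.+-identityʳ d)))) refl (ℤ.+-monoʳ-≤ (deg E u) du≤dv)) du+dv<k)
     go : ∀ d → ∣ deg E u ∣' ≡ d → ⊥
     -- The condition begins at j = 1, and that instance excludes a vertex of degree 0.
     go zero e = ℤ.<⇒≱ (cond 1 ℕ.≤-refl (s≤s 2≤m)) (ℤ.≤-trans (ℤ.≤-reflexive (sym one)) (∑-term (λ i → 0≤𝟙 (deg≤ᵇ E (+ 1) i)) u))
       where
       one : 𝟙 (deg≤ᵇ E (+ 1) u) ≡ 1ℤ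
       one = cong 𝟙 (dec-true (deg E u ℤ.≤? + 1) (subst (_≤ + 1) (trans (cong +_ (sym e)) du) (+≤+ z≤n)))
     go (suc d) e = ℤ.<⇒≱ (cond (suc d) (s≤s z≤n) (small (suc d) eq)) (subst (λ z → z ≤ count (deg≤ᵇ E z)) (sym eq) many)
       where
       eq : + suc d ≡ deg E u
       eq = trans (cong +_ (sym e)) du

   -- In a nonadjacent pair of maximal degree sum let u have the smaller degree. Any w not adjacent
   -- to v satisfies deg w ≤ deg u, since otherwise w and v would form a better pair; this is the
   -- situation that `stuck` refutes.
   find : ∀ E → Symmetric E → PosaCondition E → (∃ λ u → ∃ λ v → NonAdj E u v) → ∃ λ u → ∃ λ v → NonAdj E u v × + suc m ≤ deg E u + deg E v
   find E sE cond (u , v , nuv) with maxPair E (suc m) u v nuv (≤-cert (deg E u + deg E v) (0≤+ (0≤deg E u) (0≤deg E v)) (l (+ suc m) (deg E u + deg E v)))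
     where
     l : ∀ k s → k ≡ (k - s) + s
     l = solve-∀
   ... | inj₁ r = r
   ... | inj₂ (a , b , nab , lt , mx) with ℤ.≤-total (deg E a) (deg E b)
   ...   | inj₁ a≤b = ⊥-elim (stuck E sE cond a b nab a≤b lt (λ w nw → +-cancelˡ (deg E b) (subst₂ _≤_ (ℤ.+-comm (deg E w) (deg E b)) (ℤ.+-comm (deg E a) (deg E b)) (mx w b nw))))
   ...   | inj₂ b≤a = ⊥-elim (stuck E sE cond b a ((proj₁ nab ∘ sym) , λ q → proj₂ nab (trans (sE a b) q)) b≤a (subst (_< + suc m) (ℤ.+-comm (deg E a) (deg E b)) lt)
             (λ w nw → +-cancelˡ (deg E a) (mx a w ((proj₁ nw ∘ sym) , λ q → proj₂ nw (trans (sE w a) q)))))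

   missing : Rel (suc m) → ℤ
   missing E = sum λ u → sum λ v → 𝟙 (not (E u v))

   module _ (E : Rel (suc m)) (sE : Symmetric E) (iE : Irreflexive E) (u v : Fin (suc m)) (nuv : NonAdj E u v) where
     E' : Rel (suc m)
     E' = add-edge E u v

     ≤E' : ∀ a b → 𝟙 (E a b) ≤ 𝟙 (E' a b)
     ≤E' a b with E a b
     ... | true = ℤ.≤-refl
     ... | false = 0≤𝟙 _

     sE' : Symmetric E'
     sE' a b = cong₂ _∨_ (sE a b) (trans (Bool.∨-comm (does (a ≟ u) ∧ does (b ≟ v)) (does (a ≟ v) ∧ does (b ≟ u))) (cong₂ _∨_ (Bool.∧-comm (does (a ≟ v)) (does (b ≟ u))) (Bool.∧-comm (does (a ≟ u)) (does (b ≟ v)))))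

     iE' : Irreflexive E'
     iE' a with E' a a in eq
     ... | false = refl
     ... | true with add-elim E u v a a eq
     ...   | inj₁ q = trans (sym q) (iE a)
     ...   | inj₂ (inj₁ (x , y)) = ⊥-elim (proj₁ nuv (trans (sym x) y))
     ...   | inj₂ (inj₂ (x , y)) = ⊥-elim (proj₁ nuv (trans (sym y) x))

     cond' : PosaCondition E → PosaCondition E'
     cond' cond j 1≤j 2j = ℤ.≤-<-trans (∑-mono λ i → mono i) (cond j 1≤j 2j)
       where
       mono : ∀ i → 𝟙 (deg≤ᵇ E' (+ j) i) ≤ 𝟙 (deg≤ᵇ E (+ j) i)
       mono i with deg E' i ℤ.≤? + j
       ... | no _ = 0≤𝟙 _
       ... | yes h = subst (λ b → 1ℤ ≤ 𝟙 b) (sym (dec-true (deg E i ℤ.≤? + j) (ℤ.≤-trans (∑-mono λ b → ≤E' i b) h))) ℤ.≤-refl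

     missing-dec : ∀ f → missing E ≤ + suc f → missing E' ≤ + f
     missing-dec f h = +-cancelˡ 1ℤ (ℤ.≤-trans (subst (_≤ missing E) (ℤ.+-comm (missing E') 1ℤ) (subst (_≤ missing E) (trans (∑-+ (λ a → sum λ b → 𝟙 (not (E' a b))) (λ a → sum λ b → δ u a * δ v b))
         (cong (λ z → missing E' + z) (trans (∑-cong λ a → trans (∑-*ˡ (δ u a) (δ v)) (trans (cong (δ u a *_) (∑-δ1 v)) (ℤ.*-identityʳ _))) (∑-δ1 u)))) (∑-mono λ a → subst (_≤ _) (∑-+ (λ b → 𝟙 (not (E' a b))) (λ b → δ u a * δ v b)) (∑-mono λ b → point a b)))) h)
       where
       le : ∀ x y → 𝟙 (not (x ∨ y)) + 0ℤ ≤ 𝟙 (not x)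
       le true y = ℤ.≤-refl
       le false true = +≤+ z≤n
       le false false = ℤ.≤-refl
       point : ∀ a b → 𝟙 (not (E' a b)) + δ u a * δ v b ≤ 𝟙 (not (E a b))
       point a b with δ-cases u a | δ-cases v b
       ... | inj₁ (refl , d) | inj₁ (refl , d') = subst₂ (λ x y → x + y ≤ 𝟙 (not (E u v))) (sym (cong (λ z → 𝟙 (not z)) new)) (sym (cong₂ _*_ d d')) (subst (λ z → 1ℤ ≤ 𝟙 (not z)) (sym old) ℤ.≤-refl)
         where
         old : E u v ≡ false
         old with E u v | proj₂ nuv
         ... | false | _ = refl
         ... | true | q = ⊥-elim (q refl)
         new : E' u v ≡ true
         new = trans (cong₂ (λ x y → E u v ∨ ((x ∧ y) ∨ (does (u ≟ v) ∧ does (v ≟ u)))) (dec-true (u ≟ u) refl) (dec-true (v ≟ v) refl)) (Bool.∨-zeroʳ (E u v))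
       ... | inj₂ (_ , d) | _ = subst (λ z → 𝟙 (not (E' a b)) + z ≤ 𝟙 (not (E a b))) (sym (trans (cong (_* δ v b) d) (ℤ.*-zeroˡ (δ v b)))) (le (E a b) _)
       ... | inj₁ _ | inj₂ (_ , d) = subst (λ z → 𝟙 (not (E' a b)) + z ≤ 𝟙 (not (E a b))) (sym (trans (cong (δ u a *_) d) (ℤ.*-zeroʳ (δ u a)))) (le (E a b) _)

   complete⇒ham : ∀ E → (∀ u v → u ≢ v → E u v ≡ true) → Ham E
   complete⇒ham E all = (λ i → i) , (λ _ _ e → e) , λ i → all i (next i) (ne i)
     where
     ne : ∀ i → i ≢ next i
     ne i e with last-or-< i
     ... | inj₂ h = ℕ.<⇒≢ ℕ.≤-refl (trans (cong toℕ e) (next-< i h))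
     ... | inj₁ h = ℕ.<⇒≢ (ℕ.≤-trans (s≤s z≤n) 2≤m) (trans (sym (cong toℕ (next-last i h))) (trans (cong toℕ (sym e)) h))

   -- Each added edge lowers the number of missing ordered pairs, so the closure ends in a complete
   -- graph; its Hamilton cycle is pulled back edge by edge with `ore`.
   run : ∀ f E → Symmetric E → Irreflexive E → PosaCondition E → missing E ≤ + f → Ham E
   run f E sE iE cond hf with any? (λ u → any? (λ v → nonAdj? E u v))
   ... | no none = complete⇒ham E (λ u v h → dec u v h (E u v Bool.≟ true))
     where
     dec : ∀ u v → u ≢ v → Dec (E u v ≡ true) → E u v ≡ true
     dec u v h (yes q) = q
     dec u v h (no q) = ⊥-elim (none (u , v , h , q))
   ... | yes some with find E sE cond some
   ...   | u , v , nuv , big with f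
   ...     | zero = ⊥-elim (pos (ℤ.≤-trans (missing-pos E sE iE u v nuv) hf))
     where
     missing-pos : ∀ E (sE : Symmetric E) (iE : Irreflexive E) u v (nuv : NonAdj E u v) → 1ℤ ≤ missing E
     missing-pos E sE iE u v nuv = ℤ.≤-trans (ℤ.≤-reflexive (sym one)) (ℤ.≤-trans (∑-term (λ b → 0≤𝟙 (not (E u b))) v) (∑-term (λ a → ∑-0≤ (λ b → 0≤𝟙 (not (E a b)))) u))
       where
       one : 𝟙 (not (E u v)) ≡ 1ℤ
       one with E u v | proj₂ nuv
       ... | false | _ = refl
       ... | true | q = ⊥-elim (q refl)
     pos : ¬ (1ℤ ≤ 0ℤ)
     pos (+≤+ ())
   ...     | suc f' = ore 2≤m E sE iE u v big (run f' (add-edge E u v) (sE' E sE iE u v nuv) (iE' E sE iE u v nuv) (cond' E sE iE u v nuv cond) (missing-dec E sE iE u v nuv f' hf))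

 posa : ∀ {m} → 2 ℕ.≤ m → (E : Rel (suc m)) → Symmetric E → Irreflexive E → PosaCondition E → Ham E
 posa {m} 2≤m E sE iE cond = run ∣ missing E ∣ E sE iE cond (ℤ.≤-reflexive (sym (ℤ.0≤i⇒+∣i∣≡i (∑-0≤ λ u → ∑-0≤ λ v → 0≤𝟙 (not (E u v))))))
   where
   open Closure 2≤m
   open import Data.Integer.Base using (∣_∣)

-- Induced cycles from Hamilton cycles, and the one-stage method

module CyclePatterns where
 open Sums
 open Designs
 open Variances
 open HamiltonCycles
 open import Data.Fin.Properties using (_≟_; any?)
 open import Data.Integer.Base using (+_; _+_; _*_; _-_; -_; _^_; _≤_; _<_)
 open import Data.Integer.Tactic.RingSolver using (solve-∀)
 open import Data.Vec.Base using (Vec; lookup; tabulate)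
 open import Data.Vec.Properties using (lookup∘tabulate)

 isPair : ∀ {k} → Fin k → Fin k → Fin k → Bool
 isPair i j w = does (w ≟ i) ∨ does (w ≟ j)

 isPair-inj : ∀ {k l} (f : Fin k → Fin l) → (∀ i j → f i ≡ f j → i ≡ j) → ∀ i j w → isPair (f i) (f j) (f w) ≡ isPair i j w
 isPair-inj f inj i j w = cong₂ _∨_ (lem w i) (lem w j)
   where
   lem : ∀ a b → does (f a ≟ f b) ≡ does (a ≟ b)
   lem a b with a ≟ b
   ... | yes refl = dec-true (f a ≟ f a) refl
   ... | no h = dec-false (f a ≟ f b) (h ∘ inj a b)

 -- An induced cycle of length 2 (m + 1) whose two colour classes lie on the two lines.
 CyclePattern : ∀ {N L} → Design N L → ℕ → Set
 CyclePattern {N} {L} D m = Σ (Fin (suc m) → Fin N) λ A → Σ (Fin (suc m) → Fin L) λ B →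
   ∀ i j → Design.edge D (A i) (B j) ≡ isPair j (next j) i

 module Alive {N L m} (D : Design N L) (A : Fin (suc m) → Fin N) where
   open Design D

   Realises : Fin (suc m) → Fin (suc m) → Fin L → Set
   Realises u v y = ∀ w → edge (A w) y ≡ isPair u v w

   realises? : ∀ u v → Dec (∃ (Realises u v))
   realises? u v = any? (λ y → Fin.all? (λ w → edge (A w) y Bool.≟ isPair u v w))

   Γ : Rel (suc m)
   Γ u v = not (does (u ≟ v)) ∧ does (realises? u v)

   Γ-intro : ∀ {u v} → u ≢ v → ∃ (Realises u v) → Γ u v ≡ true
   Γ-intro {u} {v} h r = cong₂ (λ a b → not a ∧ b) (dec-false (u ≟ v) h) (dec-true (realises? u v) r)

   Γ-elim : ∀ {u v} → Γ u v ≡ true → ∃ (Realises u v)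
   Γ-elim {u} {v} h = go (u ≟ v) (realises? u v) h
     where
     go : (d : Dec (u ≡ v)) (e : Dec (∃ (Realises u v))) → not (does d) ∧ does e ≡ true → ∃ (Realises u v)
     go (no _) (yes r) _ = r

   Γ-sym : Symmetric Γ
   Γ-sym u v = cong₂ (λ a b → not a ∧ b) (eq-sym u v) (re-sym u v)
     where
     eq-sym : ∀ u v → does (u ≟ v) ≡ does (v ≟ u)
     eq-sym u v with u ≟ v
     ... | yes refl = sym (dec-true (u ≟ u) refl)
     ... | no h = sym (dec-false (v ≟ u) (h ∘ sym))
     flip : ∀ u v → ∃ (Realises u v) → ∃ (Realises v u)
     flip u v (y , h) = y , λ w → trans (h w) (Bool.∨-comm (does (w ≟ u)) (does (w ≟ v)))
     re-sym : ∀ u v → does (realises? u v) ≡ does (realises? v u)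
     re-sym u v = go (realises? u v)
       where
       go : (d : Dec (∃ (Realises u v))) → does d ≡ does (realises? v u)
       go (yes r) = sym (dec-true (realises? v u) (flip u v r))
       go (no r) = sym (dec-false (realises? v u) (r ∘ flip v u))

   Γ-irr : Irreflexive Γ
   Γ-irr u = cong (λ a → not a ∧ does (realises? u u)) (dec-true (u ≟ u) refl)

   -- The witness of the edge from p j to p (next j) sees no further vertex of the tuple, so the
   -- closed walk through vertices and witnesses has no chords.
   ham⇒cycle : Ham Γ → CyclePattern D m
   ham⇒cycle (p , inj , e) = (λ i → A (p i)) , (λ j → proj₁ (Γ-elim (e j))) , λ i j → trans (proj₂ (Γ-elim (e j)) (p i)) (isPair-inj p inj j (next j) i)

 one-stage-identity : ∀ K T l → + 4 * (T * (l * l - 1ℤ)) ≡ + 4 * (K * (+ 5 * (T * T) * l + K * K * (l * l))) + ((+ 2 * (T * l)) * (l - + 10 * (K * T)) + (l * l) * (T - + 4 * (K * (K * K))) + T * (l * l - + 4))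
 one-stage-identity = solve-∀

 -- Three quantities share T l²: the term 5 K T² l takes 1/2 by 10 K T ≤ l, the term K³ l² takes 1/4
 -- by 4 K³ ≤ T, and the subtracted T takes 1/4 by 4 ≤ l².
 one-stage-budget : ∀ K T l → 0ℤ ≤ T → + 10 * (K * T) ≤ l → 1ℤ ≤ l → + 4 * (K * (K * K)) ≤ T → + 4 ≤ l * l → K * (+ 5 * (T * T) * l + K * K * (l * l)) ≤ T * (l * l - 1ℤ)
 one-stage-budget K T l 0≤T h₁ h₂ h₃ h₄ = *-cancelˡ (+ 4) (+<+ (s≤s z≤n))
     (≤-cert ((+ 2 * (T * l)) * (l - + 10 * (K * T)) + (l * l) * (T - + 4 * (K * (K * K))) + T * (l * l - + 4))
       (0≤+ (0≤+ (*-0≤ (*-0≤ {+ 2} (+≤+ z≤n) (*-0≤ 0≤T (ℤ.≤-trans (+≤+ z≤n) h₂))) (≤-diff h₁)) (*-0≤ (0≤sq l) (≤-diff h₃))) (*-0≤ 0≤T (≤-diff h₄))) (one-stage-identity K T l))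

 *-left-comm : ∀ a b c → a * (b * c) ≡ b * (a * c)
 *-left-comm = solve-∀

 dead-dev : ∀ T x → (T * 0ℤ - x) * (T * 0ℤ - x) ≡ x * x
 dead-dev = solve-∀

 -- With enough room every consecutive pair of a random tuple is alive.
 module OneStage {N L} (D : Design N L) (0<N : 0ℤ < + N) (k : ℕ) (P : Fin k → Fin k → Bool) where
   open Design D
   open Variance D 0<N

   pat : Fin k → Vec Bool k
   pat j = tabulate (P j)

   one : Fin L → ℤ
   one _ = 1ℤ

   total : Vec (Fin N) k → ℤ
   total v = ∑[ j < k ] dev one (pat j) v

   sum1 : sum one ≡ + L
   sum1 = ∑-ones L

   abstract
     average : + 10 * (+ k * (+ 2) ^ k) ≤ + L → 1ℤ ≤ + L → + 4 * (+ k * (+ k * + k)) ≤ (+ 2) ^ k → + 4 ≤ + L * + L → ∑T total ≤ (+ N) ^ k * (+ L * + L - 1ℤ)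
     average h₁ h₂ h₃ h₄ = avg
       where
       rhs : ℤ
       rhs = + k * (+ 5 * ((+ 2) ^ k * (+ 2) ^ k) * + L + + k * + k * (+ L * + L))
       e₁ : ∑[ j < k ] ((+ 2) ^ k * ∑T (dev one (pat j))) ≡ (+ 2) ^ k * ∑T total
       e₁ = trans (∑-*ˡ ((+ 2) ^ k) (λ j → ∑T (dev one (pat j)))) (cong ((+ 2) ^ k *_) (sym (∑T-∑ (λ v j → dev one (pat j) v))))
       e₂ : ∑[ j < k ] ((+ N) ^ k * (+ 5 * ((+ 2) ^ k * (+ 2) ^ k) * sum one + + k * + k * (sum one * sum one))) ≡ (+ N) ^ k * rhs
       e₂ = trans (∑-const k ((+ N) ^ k * (+ 5 * ((+ 2) ^ k * (+ 2) ^ k) * sum one + + k * + k * (sum one * sum one))))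
         (trans (cong (λ z → + k * ((+ N) ^ k * (+ 5 * ((+ 2) ^ k * (+ 2) ^ k) * z + + k * + k * (z * z)))) sum1) (*-left-comm (+ k) ((+ N) ^ k) (+ 5 * ((+ 2) ^ k * (+ 2) ^ k) * + L + + k * + k * (+ L * + L))))
       step₁ : (+ 2) ^ k * ∑T total ≤ (+ N) ^ k * rhs
       step₁ = subst₂ _≤_ e₁ e₂ (∑-mono {f = λ j → (+ 2) ^ k * ∑T (dev one (pat j))} {g = λ j → (+ N) ^ k * (+ 5 * ((+ 2) ^ k * (+ 2) ^ k) * sum one + + k * + k * (sum one * sum one))}
         (λ j → variance one (pat j) (λ _ → +≤+ z≤n) (λ _ → ℤ.≤-refl)))
       step₂ : (+ N) ^ k * rhs ≤ (+ 2) ^ k * ((+ N) ^ k * (+ L * + L - 1ℤ))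
       step₂ = subst ((+ N) ^ k * rhs ≤_) (*-left-comm ((+ N) ^ k) ((+ 2) ^ k) (+ L * + L - 1ℤ))
         (*-monoˡ {rhs} {(+ 2) ^ k * (+ L * + L - 1ℤ)} ((+ N) ^ k) (0≤^ k (+≤+ z≤n)) (one-stage-budget (+ k) ((+ 2) ^ k) (+ L) (0≤^ {+ 2} k (+≤+ z≤n)) h₁ h₂ h₃ h₄))
       avg : ∑T total ≤ (+ N) ^ k * (+ L * + L - 1ℤ)
       avg = *-cancelˡ {∑T total} {(+ N) ^ k * (+ L * + L - 1ℤ)} ((+ 2) ^ k) (0<^ {+ 2} k (+<+ (s≤s z≤n))) step
         where
         step : (+ 2) ^ k * ∑T total ≤ (+ 2) ^ k * ((+ N) ^ k * (+ L * + L - 1ℤ))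
         step = ℤ.≤-trans step₁ step₂

   -- A pattern without a witness has Z = 0 and deviation exactly L². A tuple whose deviations sum
   -- to at most L² - 1 therefore realises every pattern.
   find : + 10 * (+ k * (+ 2) ^ k) ≤ + L → 1ℤ ≤ + L → + 4 * (+ k * (+ k * + k)) ≤ (+ 2) ^ k → + 4 ≤ + L * + L →
     ∃ λ (v : Vec (Fin N) k) → ∀ j → ∃ λ y → ∀ i → edge (lookup v i) y ≡ P j i
   find h₁ h₂ h₃ h₄ = v , y
     where
     chosen : ∃ λ v → total v ≤ + L * + L - 1ℤ
     chosen = ∑T-avg total (+ L * + L - 1ℤ) 0<N (average h₁ h₂ h₃ h₄)
     v : Vec (Fin N) k
     v = proj₁ chosen
     0≤Zterm : ∀ j y → 0ℤ ≤ one y * 𝟙 (matches v (pat j) y)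
     0≤Zterm j y = *-0≤ {1ℤ} (+≤+ z≤n) (0≤𝟙 (matches v (pat j) y))
     0<Z : ∀ j → 0ℤ < Z one (pat j) v
     0<Z j with 0ℤ ℤ.<? Z one (pat j) v
     ... | yes p = p
     ... | no q = ⊥-elim (ℤ.<⇒≱ (ℤ.<-≤-trans (lt (+ L * + L)) (ℤ.≤-reflexive (sym dead))) (ℤ.≤-trans (∑-term (λ j → 0≤sq ((+ 2) ^ k * Z one (pat j) v - sum one)) j) (proj₂ chosen)))
       where
       lt : ∀ x → x - 1ℤ < x
       lt x = subst (x - 1ℤ <_) (ℤ.+-identityʳ x) (ℤ.+-monoʳ-< x ℤ.-<+)
       z0 : Z one (pat j) v ≡ 0ℤ
       z0 = ℤ.≤-antisym (ℤ.≮⇒≥ q) (∑-0≤ (0≤Zterm j))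
       dead : dev one (pat j) v ≡ + L * + L
       dead = trans (cong₂ (λ a b → ((+ 2) ^ k * a - b) * ((+ 2) ^ k * a - b)) z0 sum1) (dead-dev ((+ 2) ^ k) (+ L))
     y : ∀ j → ∃ λ y → ∀ i → edge (lookup v i) y ≡ P j i
     y j = y₀ , λ i → trans (matches⇒ v (pat j) y₀ mt i) (lookup∘tabulate (P j) i)
       where
       hit : ∃ λ y → 0ℤ < one y * 𝟙 (matches v (pat j) y)
       hit = ∑-pos _ (0<Z j)
       y₀ : Fin L
       y₀ = proj₁ hit
       mt : matches v (pat j) y₀ ≡ true
       mt = 0<𝟙* (matches v (pat j) y₀) (subst (0ℤ <_) (ℤ.*-comm 1ℤ _) (proj₂ hit))

 one-stage-cycle : ∀ {N L} (D : Design N L) → 0ℤ < + N → ∀ m → + 10 * (+ suc m * (+ 2) ^ suc m) ≤ + L → 1ℤ ≤ + L →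
   + 4 * (+ suc m * (+ suc m * + suc m)) ≤ (+ 2) ^ suc m → + 4 ≤ + L * + L → CyclePattern D m
 one-stage-cycle D 0<N m h₁ h₂ h₃ h₄ = lookup (proj₁ r) , (λ j → proj₁ (proj₂ r j)) , λ i j → proj₂ (proj₂ r j) i
   where
   r = OneStage.find D 0<N (suc m) (λ j i → isPair j (next j) i) h₁ h₂ h₃ h₄

-- First stage: pair counts on the first k₁ vertices

module FirstStage where
 open Sums
 open Designs
 open Universality using (count)
 open Variances
 open CyclePatterns
 open import Data.Integer.Base using (+_; _+_; _*_; _-_; -_; _^_; _≤_; _<_)
 open import Data.Integer.Tactic.RingSolver using (solve-∀)
 open import Data.Vec.Base using (Vec; tabulate)

 stage₁-identity : ∀ K T u → T * (T * T * (u * u)) ≡ K * (K * (+ 5 * (T * T) * (+ 16 * (u * T)) + K * K * (+ 16 * (u * T) * (+ 16 * (u * T))))) + (T * T) * (T * (u * u) - K * K * (+ 80 * (u * T) + + 256 * (K * K * (u * u))))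
 stage₁-identity = solve-∀

 -- The expected sum of the deviations over all K² pairs is brought down to T² u². A tuple that
 -- meets this bound has every pair count within u of the mean 16 u.
 stage₁-budget : ∀ K T u → K * K * (+ 80 * (u * T) + + 256 * (K * K * (u * u))) ≤ T * (u * u) →
   K * (K * (+ 5 * (T * T) * (+ 16 * (u * T)) + K * K * (+ 16 * (u * T) * (+ 16 * (u * T))))) ≤ T * (T * T * (u * u))
 stage₁-budget K T u h = ≤-cert ((T * T) * (T * (u * u) - K * K * (+ 80 * (u * T) + + 256 * (K * K * (u * u))))) (*-0≤ (0≤sq T) (≤-diff h)) (stage₁-identity K T u)

 stage₂-identity : ∀ K K₁ T u H → u ≡ + 11 * T → + 11 * (T * (+ 16 * (K * K * (u * u)))) ≡
   + 11 * (K * (K₁ * (+ 5 * (T * T) * (+ 17 * u) + H * H * (+ 17 * u * (+ 17 * u))) + (+ 5 * (T * T) * (K₁ * (+ 17 * u)) + H * H * (K₁ * (+ 17 * u) * (K₁ * (+ 17 * u))))))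
   + (K * (u * u)) * ((K - K₁) * (+ 170 * T) + + 6 * (K * (T - + 530 * (H * H * (K + 1ℤ)))) + K * (H * H * (K + 1ℤ)) + + 3179 * (H * H * ((K - K₁) * (K + K₁ + 1ℤ))))
 stage₂-identity K K₁ T _ H refl = lem K K₁ T H
   where
   lem : ∀ K K₁ T H → + 11 * (T * (+ 16 * (K * K * (+ 11 * T * (+ 11 * T))))) ≡
     + 11 * (K * (K₁ * (+ 5 * (T * T) * (+ 17 * (+ 11 * T)) + H * H * (+ 17 * (+ 11 * T) * (+ 17 * (+ 11 * T)))) + (+ 5 * (T * T) * (K₁ * (+ 17 * (+ 11 * T))) + H * H * (K₁ * (+ 17 * (+ 11 * T)) * (K₁ * (+ 17 * (+ 11 * T)))))))
     + (K * (+ 11 * T * (+ 11 * T))) * ((K - K₁) * (+ 170 * T) + + 6 * (K * (T - + 530 * (H * H * (K + 1ℤ)))) + K * (H * H * (K + 1ℤ)) + + 3179 * (H * H * ((K - K₁) * (K + K₁ + 1ℤ))))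
   lem = solve-∀

 -- The leading coefficients are 2 · 5 · 17 = 170 on the left and 16 · 11 = 176 on the right; 11 is
 -- the least factor in u = 11 T for which the right side wins. The remaining 6 has to absorb the
 -- terms in H² with coefficient 17² · 11 = 3179, whence 530 ≥ 3179/6.
 stage₂-budget : ∀ K K₁ T u H → u ≡ + 11 * T → 0ℤ ≤ K₁ → K₁ ≤ K → 0ℤ ≤ T → + 530 * (H * H * (K + 1ℤ)) ≤ T →
   K * (K₁ * (+ 5 * (T * T) * (+ 17 * u) + H * H * (+ 17 * u * (+ 17 * u))) + (+ 5 * (T * T) * (K₁ * (+ 17 * u)) + H * H * (K₁ * (+ 17 * u) * (K₁ * (+ 17 * u))))) ≤ T * (+ 16 * (K * K * (u * u)))
 stage₂-budget K K₁ T u H u≡ 0≤K₁ K₁≤K 0≤T h = *-cancelˡ (+ 11) (+<+ (s≤s z≤n)) (≤-cert _ cert (stage₂-identity K K₁ T u H u≡))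
   where
   0≤K : 0ℤ ≤ K
   0≤K = ℤ.≤-trans 0≤K₁ K₁≤K
   0≤K+1 : 0ℤ ≤ K + 1ℤ
   0≤K+1 = 0≤+ 0≤K (+≤+ z≤n)
   cert : 0ℤ ≤ (K * (u * u)) * ((K - K₁) * (+ 170 * T) + + 6 * (K * (T - + 530 * (H * H * (K + 1ℤ)))) + K * (H * H * (K + 1ℤ)) + + 3179 * (H * H * ((K - K₁) * (K + K₁ + 1ℤ))))
   cert = *-0≤ (*-0≤ 0≤K (0≤sq u)) (0≤+ (0≤+ (0≤+ (*-0≤ (≤-diff K₁≤K) (*-0≤ {+ 170} (+≤+ z≤n) 0≤T)) (*-0≤ {+ 6} (+≤+ z≤n) (*-0≤ 0≤K (≤-diff h)))) (*-0≤ 0≤K (*-0≤ (0≤sq H) 0≤K+1)))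
     (*-0≤ {+ 3179} (+≤+ z≤n) (*-0≤ (0≤sq H) (*-0≤ (≤-diff K₁≤K) (0≤+ (0≤+ 0≤K 0≤K₁) (+≤+ z≤n))))))

 quad-mono : ∀ a b {x y} → 0ℤ ≤ a → 0ℤ ≤ b → 0ℤ ≤ x → x ≤ y → a * x + b * (x * x) ≤ a * y + b * (y * y)
 quad-mono a b 0≤a 0≤b 0≤x x≤y = ℤ.+-mono-≤ (*-monoˡ a 0≤a x≤y) (*-monoˡ b 0≤b (*-mono 0≤x (ℤ.≤-trans 0≤x x≤y) x≤y x≤y))

 -- The selected indices alone carry the sum, so their number takes the place of k.
 cauchy-schwarz : ∀ {k} (a : Fin k → Bool) (g : Fin k → ℤ) → (∑[ i < k ] (𝟙 (a i) * g i)) * (∑[ i < k ] (𝟙 (a i) * g i)) ≤ (∑[ i < k ] 𝟙 (a i)) * (∑[ i < k ] (g i * g i))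
 cauchy-schwarz {k} a g = *-cancelˡ (+ 2) (+<+ (s≤s z≤n)) (subst₂ _≤_ e₁ e₂ (∑-mono λ i → ∑-mono λ j → point (a i) (a j) (g i) (g j)))
   where
   lemA : ∀ x y → + 2 * (x * y) ≤ x * x + y * y
   lemA x y = ≤-cert ((x - y) * (x - y)) (0≤sq (x - y)) (l x y)
     where
     l : ∀ x y → x * x + y * y ≡ + 2 * (x * y) + (x - y) * (x - y)
     l = solve-∀
   point : ∀ a b x y → + 2 * (𝟙 a * x * (𝟙 b * y)) ≤ 𝟙 b * (x * x) + 𝟙 a * (y * y)
   point true true x y = subst₂ _≤_ (l₁ x y) (l₂ x y) (lemA x y)
     where
     l₁ : ∀ x y → + 2 * (x * y) ≡ + 2 * (1ℤ * x * (1ℤ * y))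
     l₁ = solve-∀
     l₂ : ∀ x y → x * x + y * y ≡ 1ℤ * (x * x) + 1ℤ * (y * y)
     l₂ = solve-∀
   point true false x y = subst₂ _≤_ (l₁ x y) (l₂ x y) (0≤sq y)
     where
     l₁ : ∀ x y → 0ℤ ≡ + 2 * (1ℤ * x * (0ℤ * y))
     l₁ = solve-∀
     l₂ : ∀ x y → y * y ≡ 0ℤ * (x * x) + 1ℤ * (y * y)
     l₂ = solve-∀
   point false true x y = subst₂ _≤_ (l₁ x y) (l₂ x y) (0≤sq x)
     where
     l₁ : ∀ x y → 0ℤ ≡ + 2 * (0ℤ * x * (1ℤ * y))
     l₁ = solve-∀
     l₂ : ∀ x y → x * x ≡ 1ℤ * (x * x) + 0ℤ * (y * y)
     l₂ = solve-∀
   point false false x y = ℤ.≤-reflexive (l₁ x y)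
     where
     l₁ : ∀ x y → + 2 * (0ℤ * x * (0ℤ * y)) ≡ 0ℤ * (x * x) + 0ℤ * (y * y)
     l₁ = solve-∀
   s = ∑[ i < k ] (𝟙 (a i) * g i)
   c = ∑[ i < k ] 𝟙 (a i)
   q = ∑[ i < k ] (g i * g i)
   e₁ : (∑[ i < k ] (∑[ j < k ] (+ 2 * (𝟙 (a i) * g i * (𝟙 (a j) * g j))))) ≡ + 2 * (s * s)
   e₁ = trans (∑-cong λ i → ∑-*ˡ (+ 2) (λ j → 𝟙 (a i) * g i * (𝟙 (a j) * g j))) (trans (∑-*ˡ (+ 2) (λ i → ∑[ j < k ] (𝟙 (a i) * g i * (𝟙 (a j) * g j)))) (cong (+ 2 *_) (sym (∑-sq (λ i → 𝟙 (a i) * g i)))))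
   e₂ : (∑[ i < k ] (∑[ j < k ] (𝟙 (a j) * (g i * g i) + 𝟙 (a i) * (g j * g j)))) ≡ + 2 * (c * q)
   e₂ = trans (∑-cong λ i → trans (∑-+ (λ j → 𝟙 (a j) * (g i * g i)) (λ j → 𝟙 (a i) * (g j * g j))) (cong₂ _+_ (∑-*ʳ (g i * g i) (λ j → 𝟙 (a j))) (∑-*ˡ (𝟙 (a i)) (λ j → g j * g j))))
     (trans (∑-+ (λ i → c * (g i * g i)) (λ i → 𝟙 (a i) * q)) (trans (cong₂ _+_ (∑-*ˡ c (λ i → g i * g i)) (∑-*ʳ q (λ i → 𝟙 (a i)))) (l c q)))
     where
     l : ∀ c q → c * q + c * q ≡ + 2 * (c * q)
     l = solve-∀

 module VarT {N L} (D : Design N L) (0<N : 0ℤ < + N) where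
   open Variance D 0<N public

   dev-T : ∀ {k} w (e : Vec Bool k) v T → T ≡ (+ 2) ^ k → dev w e v ≡ (T * Z w e v - sum w) * (T * Z w e v - sum w)
   dev-T w e v _ refl = refl

   variance-T : ∀ {k} w (e : Vec Bool k) T → T ≡ (+ 2) ^ k → (∀ y → 0ℤ ≤ w y) → (∀ y → w y ≤ 1ℤ) →
     T * ∑T (dev w e) ≤ (+ N) ^ k * (+ 5 * (T * T) * sum w + + k * + k * (sum w * sum w))
   variance-T w e _ refl = variance w e

   0≤dev : ∀ {k} w (e : Vec Bool k) v → 0ℤ ≤ dev w e v
   0≤dev {k} w e v = 0≤sq ((+ 2) ^ k * Z w e v - sum w)

   -- The mean is 16 u. The case i = j concerns points that see a single first-stage vertex; these
   -- are the candidates for pairs with a second-stage vertex.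
   NearPairs : ∀ {k} → (Fin L → Bool) → ℤ → Vec (Fin N) k → Set
   NearPairs B₀ u x = ∀ i j → Z (λ y → 𝟙 (B₀ y)) (tabulate (isPair i j)) x ≤ + 17 * u × + 15 * u ≤ Z (λ y → 𝟙 (B₀ y)) (tabulate (isPair i j)) x

 module Stage₁ {N L} (D : Design N L) (0<N : 0ℤ < + N) (k₁ : ℕ) (T₁ u : ℤ) (T₁≡ : T₁ ≡ (+ 2) ^ k₁) (B₀ : Fin L → Bool) (cB₀ : count B₀ ≡ + 16 * (u * T₁)) where
   open Design D
   open VarT D 0<N

   w₀ : Fin L → ℤ
   w₀ y = 𝟙 (B₀ y)

   pr : Fin k₁ → Fin k₁ → Vec Bool k₁
   pr i j = tabulate (isPair i j)

   F₁ : Vec (Fin N) k₁ → ℤ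
   F₁ v = ∑[ i < k₁ ] (∑[ j < k₁ ] dev w₀ (pr i j) v)

   R : ℤ
   R = + 5 * (T₁ * T₁) * (+ 16 * (u * T₁)) + + k₁ * + k₁ * (+ 16 * (u * T₁) * (+ 16 * (u * T₁)))

   opaque
     total : T₁ * ∑T F₁ ≤ (+ N) ^ k₁ * (+ k₁ * (+ k₁ * R))
     total = subst₂ _≤_ e₁ e₂ (∑-mono λ i → ∑-mono λ j → one i j)
       where
       one : ∀ i j → T₁ * ∑T (dev w₀ (pr i j)) ≤ (+ N) ^ k₁ * R
       one i j = subst (λ z → T₁ * ∑T (dev w₀ (pr i j)) ≤ (+ N) ^ k₁ * (+ 5 * (T₁ * T₁) * z + + k₁ * + k₁ * (z * z))) cB₀ (variance-T w₀ (pr i j) T₁ T₁≡ (λ y → 0≤𝟙 (B₀ y)) (λ y → 𝟙≤1 (B₀ y)))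
       e₁ : (∑[ i < k₁ ] (∑[ j < k₁ ] (T₁ * ∑T (dev w₀ (pr i j))))) ≡ T₁ * ∑T F₁
       e₁ = trans (∑-cong λ i → ∑-*ˡ T₁ (λ j → ∑T (dev w₀ (pr i j)))) (trans (∑-*ˡ T₁ (λ i → ∑[ j < k₁ ] ∑T (dev w₀ (pr i j))))
         (cong (T₁ *_) (sym (trans (∑T-∑ (λ v i → ∑[ j < k₁ ] dev w₀ (pr i j) v)) (∑-cong λ i → ∑T-∑ (λ v j → dev w₀ (pr i j) v))))))
       e₂ : (∑[ i < k₁ ] (∑[ j < k₁ ] ((+ N) ^ k₁ * R))) ≡ (+ N) ^ k₁ * (+ k₁ * (+ k₁ * R))
       e₂ = trans (∑-cong λ i → ∑-const k₁ ((+ N) ^ k₁ * R)) (trans (∑-const k₁ (+ k₁ * ((+ N) ^ k₁ * R))) (l (+ k₁) ((+ N) ^ k₁) R))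
         where
         l : ∀ k p r → k * (k * (p * r)) ≡ p * (k * (k * r))
         l = solve-∀

   opaque
     chosen : + k₁ * + k₁ * (+ 80 * (u * T₁) + + 256 * (+ k₁ * + k₁ * (u * u))) ≤ T₁ * (u * u) → 0ℤ < T₁ → ∃ λ v → F₁ v ≤ T₁ * T₁ * (u * u)
     chosen h 0<T₁ = ∑T-avg F₁ (T₁ * T₁ * (u * u)) 0<N (*-cancelˡ T₁ 0<T₁ (ℤ.≤-trans total step))
       where
       step : (+ N) ^ k₁ * (+ k₁ * (+ k₁ * R)) ≤ T₁ * ((+ N) ^ k₁ * (T₁ * T₁ * (u * u)))
       step = subst ((+ N) ^ k₁ * (+ k₁ * (+ k₁ * R)) ≤_) (*-left-comm ((+ N) ^ k₁) T₁ (T₁ * T₁ * (u * u))) (*-monoˡ ((+ N) ^ k₁) (0≤^ k₁ (+≤+ z≤n)) (stage₁-budget (+ k₁) T₁ u h))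

   bounds : ∀ v → F₁ v ≤ T₁ * T₁ * (u * u) → 0ℤ < T₁ → 0ℤ ≤ u → NearPairs B₀ u v
   bounds v h 0<T₁ 0≤u i j = near T₁ u (Z w₀ (pr i j) v) 0<T₁ 0≤u (subst (_≤ T₁ * T₁ * (u * u)) (trans (dev-T w₀ (pr i j) v T₁ T₁≡) (cong (λ z → (T₁ * Z w₀ (pr i j) v - z) * (T₁ * Z w₀ (pr i j) v - z)) cB₀))
       (ℤ.≤-trans (∑-term (λ j → 0≤dev w₀ (pr i j) v) j) (ℤ.≤-trans (∑-term (λ i → ∑-0≤ (λ j → 0≤dev w₀ (pr i j) v)) i) h)))
     where
     near : ∀ T u z → 0ℤ < T → 0ℤ ≤ u → (T * z - + 16 * (u * T)) * (T * z - + 16 * (u * T)) ≤ T * T * (u * u) → z ≤ + 17 * u × + 15 * u ≤ z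
     near T u z 0<T 0≤u q = *-cancelˡ T 0<T (≤-cert (T * u - (T * z - + 16 * (u * T))) (≤-diff up) (l₁ T u z)) , *-cancelˡ T 0<T (≤-cert (T * u - - (T * z - + 16 * (u * T))) (≤-diff dn) (l₂ T u z))
       where
       l₁ : ∀ T u z → T * (+ 17 * u) ≡ T * z + (T * u - (T * z - + 16 * (u * T)))
       l₁ = solve-∀
       l₂ : ∀ T u z → T * z ≡ T * (+ 15 * u) + (T * u - - (T * z - + 16 * (u * T)))
       l₂ = solve-∀
       l₃ : ∀ T u → T * T * (u * u) ≡ (T * u) * (T * u)
       l₃ = solve-∀
       l₄ : ∀ x → x * x ≡ (- x) * (- x)
       l₄ = solve-∀
       0≤Tu : 0ℤ ≤ T * u
       0≤Tu = *-0≤ (ℤ.<⇒≤ 0<T) 0≤u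
       up : T * z - + 16 * (u * T) ≤ T * u
       up = sq-mono⁻¹ (T * z - + 16 * (u * T)) (T * u) 0≤Tu (subst ((T * z - + 16 * (u * T)) * (T * z - + 16 * (u * T)) ≤_) (l₃ T u) q)
       dn : - (T * z - + 16 * (u * T)) ≤ T * u
       dn = sq-mono⁻¹ (- (T * z - + 16 * (u * T))) (T * u) 0≤Tu (subst₂ _≤_ (l₄ (T * z - + 16 * (u * T))) (l₃ T u) q)

-- The cost of a vertex of low degree

module DegreeCosts where
 open Sums
 open Universality using (count)
 open CyclePatterns
 open FirstStage
 open import Data.Integer.Base using (+_; _+_; _*_; _-_; -_; _≤_; _<_)
 open import Data.Integer.Tactic.RingSolver using (solve-∀)

 case-A-identity : ∀ K K₁ J d → + 20 * (+ 9 * (K₁ - d)) ≡ + 20 * (+ 4 * K) + (+ 9 * (+ 20 * K₁ - (+ 19 * K + + 20)) + + 180 * (J + 1ℤ - d) + + 90 * (K - + 2 * J) + K)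
 case-A-identity = solve-∀

 case-A-cost : ∀ K J U Q E → + 5 * (J * Q) ≡ + 5 * (+ 17 * (K * K * (U * U))) + (+ 5 * (J * (Q - E * (+ 225 * (U * U)))) + + 125 * (J * (U * U) * (+ 9 * E - + 4 * K)) + + 100 * (K * (U * U) * (+ 5 * J - K)) + + 15 * (K * K * (U * U)))
 case-A-cost = solve-∀

 case-B-identity : ∀ K K₁ J U S d → + 20 * (S - + 4 * (K * U) - d * (+ 17 * U)) ≡ + 20 * (+ 6 * (K * U)) + (+ 20 * (S - K₁ * (+ 15 * U)) + + 15 * (U * (+ 20 * K₁ - (+ 19 * K + + 20))) + + 340 * (U * (J + 1ℤ - d)) + + 68 * (U * (K - (+ 5 * J + 1ℤ))) + + 17 * (K * U) + + 28 * U)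
 case-B-identity = solve-∀

 case-B-cost : ∀ K J U Q d G → + 2 * (J * Q) ≡ + 2 * (+ 17 * (K * K * (U * U))) + (Q * (J + 1ℤ - d) + Q * (J - 1ℤ) + (d * Q - G * G) + (G * G - (+ 6 * (K * U)) * (+ 6 * (K * U))) + + 2 * (K * K * (U * U)))
 case-B-cost = solve-∀

 gain-bound : ∀ W S x b → - (W - S) ≤ b → S - b - x ≤ W - x
 gain-bound W S x b h = ≤-cert (b - - (W - S)) (≤-diff h) (l W S x b)
   where
   l : ∀ W S x b → W - x ≡ (S - b - x) + (b - - (W - S))
   l = solve-∀

 -- Let d ≤ J + 1 partners be alive and let Q be the sum of squares. If K ≤ 5 J, at least 4 K / 9
 -- partners are dead, and each of them costs (15 U)²; this gives J Q ≥ 20 K² U². If K > 5 J, the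
 -- few alive partners carry the whole count: the bound on the total deviation forces their scaled
 -- counts to exceed their means by 6 K U together, and Cauchy-Schwarz over d ≤ 2 J terms gives J Q
 -- ≥ 18 K² U². Both exceed the available 16 K² U².
 low-cost : ∀ {k₁} (K J U T : ℤ) (z s : Fin k₁ → ℤ) (al : Fin k₁ → Bool) → (∀ i → al i ≡ false → z i ≡ 0ℤ) → (∀ i → s i ≤ + 17 * U × + 15 * U ≤ s i) → 0ℤ ≤ U →
   + k₁ ≤ K → + 19 * K + + 20 ≤ + 20 * + k₁ → (∑[ i < k₁ ] 𝟙 (al i)) ≤ J + 1ℤ → 1ℤ ≤ J → + 2 * J ≤ K →
   (T * sum z - sum s) * (T * sum z - sum s) ≤ + 16 * (K * K * (U * U)) →
   + 17 * (K * K * (U * U)) ≤ J * (∑[ i < k₁ ] ((T * z i - s i) * (T * z i - s i)))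
 low-cost {k₁} K J U T z s al dead near 0≤U K₁≤K slack d≤ 1≤J 2J≤K W² with K ℤ.≤? + 5 * J
 ... | yes K≤5J = *-cancelˡ {+ 17 * (K * K * (U * U))} {J * Q} (+ 5) (+<+ (s≤s z≤n)) (≤-cert (+ 5 * (J * (Q - (+ k₁ - d) * (+ 225 * (U * U)))) + + 125 * (J * (U * U) * (+ 9 * (+ k₁ - d) - + 4 * K)) + + 100 * (K * (U * U) * (+ 5 * J - K)) + + 15 * (K * K * (U * U))) cert (case-A-cost K J U Q (+ k₁ - d)))
   where
   Q d : ℤ
   Q = ∑[ i < k₁ ] ((T * z i - s i) * (T * z i - s i))
   d = ∑[ i < k₁ ] 𝟙 (al i)
   0≤J : 0ℤ ≤ J
   0≤J = ℤ.≤-trans (+≤+ z≤n) 1≤J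
   0≤K : 0ℤ ≤ K
   0≤K = ℤ.≤-trans (+≤+ z≤n) K₁≤K
   point : ∀ b zi si → (b ≡ false → zi ≡ 0ℤ) → + 15 * U ≤ si → (1ℤ - 𝟙 b) * (+ 225 * (U * U)) ≤ (T * zi - si) * (T * zi - si)
   point true zi si _ _ = 0≤sq (T * zi - si)
   point false zi si e h with refl ← e refl = subst₂ _≤_ (l U) (sym (dead-dev T si)) (*-mono (*-0≤ {+ 15} (+≤+ z≤n) 0≤U) (ℤ.≤-trans (*-0≤ {+ 15} (+≤+ z≤n) 0≤U) h) h h)
     where
     l : ∀ U → + 15 * U * (+ 15 * U) ≡ 1ℤ * (+ 225 * (U * U))
     l = solve-∀
   Q≥ : (+ k₁ - d) * (+ 225 * (U * U)) ≤ Q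
   Q≥ = subst (_≤ Q) (trans (∑-*ʳ (+ 225 * (U * U)) (λ i → 1ℤ - 𝟙 (al i))) (cong (_* (+ 225 * (U * U))) (trans (∑-sub (λ _ → 1ℤ) (λ i → 𝟙 (al i))) (cong (_- d) (∑-ones k₁)))))
     (∑-mono λ i → point (al i) (z i) (s i) (dead i) (proj₂ (near i)))
   JU : 0ℤ ≤ J * (U * U)
   JU = *-0≤ 0≤J (0≤sq U)
   KU : 0ℤ ≤ K * (U * U)
   KU = *-0≤ 0≤K (0≤sq U)
   9E≥ : + 4 * K ≤ + 9 * (+ k₁ - d)
   9E≥ = *-cancelˡ {+ 4 * K} {+ 9 * (+ k₁ - d)} (+ 20) (+<+ (s≤s z≤n)) (≤-cert (+ 9 * (+ 20 * + k₁ - (+ 19 * K + + 20)) + + 180 * (J + 1ℤ - d) + + 90 * (K - + 2 * J) + K)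
     (0≤+ (0≤+ (0≤+ (*-0≤ {+ 9} (+≤+ z≤n) (≤-diff slack)) (*-0≤ {+ 180} (+≤+ z≤n) (≤-diff d≤))) (*-0≤ {+ 90} (+≤+ z≤n) (≤-diff 2J≤K))) 0≤K) (case-A-identity K (+ k₁) J d))
   cert : 0ℤ ≤ + 5 * (J * (Q - (+ k₁ - d) * (+ 225 * (U * U)))) + + 125 * (J * (U * U) * (+ 9 * (+ k₁ - d) - + 4 * K)) + + 100 * (K * (U * U) * (+ 5 * J - K)) + + 15 * (K * K * (U * U))
   cert = 0≤+ (0≤+ (0≤+ (*-0≤ {+ 5} (+≤+ z≤n) (*-0≤ 0≤J (≤-diff Q≥))) (*-0≤ {+ 125} (+≤+ z≤n) (*-0≤ JU (≤-diff 9E≥)))) (*-0≤ {+ 100} (+≤+ z≤n) (*-0≤ KU (≤-diff K≤5J)))) (*-0≤ {+ 15} (+≤+ z≤n) (*-0≤ (0≤sq K) (0≤sq U)))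
 ... | no K≰5J = *-cancelˡ {+ 17 * (K * K * (U * U))} {J * Q} (+ 2) (+<+ (s≤s z≤n)) (≤-cert (Q * (J + 1ℤ - d) + Q * (J - 1ℤ) + (d * Q - G * G) + (G * G - (+ 6 * (K * U)) * (+ 6 * (K * U))) + + 2 * (K * K * (U * U))) cert (case-B-cost K J U Q d G))
   where
   Q d G x : ℤ
   Q = ∑[ i < k₁ ] ((T * z i - s i) * (T * z i - s i))
   d = ∑[ i < k₁ ] 𝟙 (al i)
   G = ∑[ i < k₁ ] (𝟙 (al i) * (T * z i - s i))
   x = ∑[ i < k₁ ] (𝟙 (al i) * s i)
   0≤K : 0ℤ ≤ K
   0≤K = ℤ.≤-trans (+≤+ z≤n) K₁≤K
   0≤KU : 0ℤ ≤ + 4 * (K * U)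
   0≤KU = *-0≤ {+ 4} (+≤+ z≤n) (*-0≤ 0≤K 0≤U)
   5J<K : + 5 * J + 1ℤ ≤ K
   5J<K = subst (_≤ K) (ℤ.+-comm 1ℤ (+ 5 * J)) (ℤ.i<j⇒suc[i]≤j (ℤ.≰⇒> K≰5J))
   G≡ : G ≡ T * sum z - x
   G≡ = trans (∑-cong λ i → point (al i) (z i) (s i) (dead i)) (trans (∑-sub (λ i → T * z i) (λ i → 𝟙 (al i) * s i)) (cong (_- x) (∑-*ˡ T z)))
     where
     point : ∀ b zi si → (b ≡ false → zi ≡ 0ℤ) → 𝟙 b * (T * zi - si) ≡ T * zi - 𝟙 b * si
     point true zi si _ = l T zi si
       where
       l : ∀ T z s → 1ℤ * (T * z - s) ≡ T * z - 1ℤ * s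
       l = solve-∀
     point false zi si e with refl ← e refl = l T si
       where
       l : ∀ T s → 0ℤ * (T * 0ℤ - s) ≡ T * 0ℤ - 0ℤ * s
       l = solve-∀
   x≤ : x ≤ d * (+ 17 * U)
   x≤ = subst (x ≤_) (∑-*ʳ (+ 17 * U) (λ i → 𝟙 (al i))) (∑-mono λ i → *-monoˡ (𝟙 (al i)) (0≤𝟙 (al i)) (proj₁ (near i)))
   S≥ : + k₁ * (+ 15 * U) ≤ sum s
   S≥ = subst (_≤ sum s) (∑-const k₁ (+ 15 * U)) (∑-mono λ i → proj₂ (near i))
   W≥ : - (T * sum z - sum s) ≤ + 4 * (K * U)
   W≥ = sq-mono⁻¹ (- (T * sum z - sum s)) (+ 4 * (K * U)) 0≤KU (subst₂ _≤_ (l₁ (T * sum z - sum s)) (l₂ K U) W²)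
     where
     l₁ : ∀ x → x * x ≡ (- x) * (- x)
     l₁ = solve-∀
     l₂ : ∀ K U → + 16 * (K * K * (U * U)) ≡ + 4 * (K * U) * (+ 4 * (K * U))
     l₂ = solve-∀
   G≥ : sum s - + 4 * (K * U) - d * (+ 17 * U) ≤ G
   G≥ = subst (sum s - + 4 * (K * U) - d * (+ 17 * U) ≤_) (sym G≡) (ℤ.≤-trans (gain-bound (T * sum z) (sum s) (d * (+ 17 * U)) (+ 4 * (K * U)) W≥) (ℤ.+-monoʳ-≤ (T * sum z) (ℤ.neg-mono-≤ x≤)))
   G≥6 : + 6 * (K * U) ≤ G
   G≥6 = ℤ.≤-trans (*-cancelˡ {+ 6 * (K * U)} {sum s - + 4 * (K * U) - d * (+ 17 * U)} (+ 20) (+<+ (s≤s z≤n)) (≤-cert (+ 20 * (sum s - + k₁ * (+ 15 * U)) + + 15 * (U * (+ 20 * + k₁ - (+ 19 * K + + 20))) + + 340 * (U * (J + 1ℤ - d)) + + 68 * (U * (K - (+ 5 * J + 1ℤ))) + + 17 * (K * U) + + 28 * U) c (case-B-identity K (+ k₁) J U (sum s) d))) G≥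
     where
     c : 0ℤ ≤ + 20 * (sum s - + k₁ * (+ 15 * U)) + + 15 * (U * (+ 20 * + k₁ - (+ 19 * K + + 20))) + + 340 * (U * (J + 1ℤ - d)) + + 68 * (U * (K - (+ 5 * J + 1ℤ))) + + 17 * (K * U) + + 28 * U
     c = 0≤+ (0≤+ (0≤+ (0≤+ (0≤+ (*-0≤ {+ 20} (+≤+ z≤n) (≤-diff S≥)) (*-0≤ {+ 15} (+≤+ z≤n) (*-0≤ 0≤U (≤-diff slack)))) (*-0≤ {+ 340} (+≤+ z≤n) (*-0≤ 0≤U (≤-diff d≤)))) (*-0≤ {+ 68} (+≤+ z≤n) (*-0≤ 0≤U (≤-diff 5J<K)))) (*-0≤ {+ 17} (+≤+ z≤n) (*-0≤ 0≤K 0≤U))) (*-0≤ {+ 28} (+≤+ z≤n) 0≤U)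
   0≤Q : 0ℤ ≤ Q
   0≤Q = ∑-0≤ λ i → 0≤sq (T * z i - s i)
   0≤6 : 0ℤ ≤ + 6 * (K * U)
   0≤6 = *-0≤ {+ 6} (+≤+ z≤n) (*-0≤ 0≤K 0≤U)
   cert : 0ℤ ≤ Q * (J + 1ℤ - d) + Q * (J - 1ℤ) + (d * Q - G * G) + (G * G - (+ 6 * (K * U)) * (+ 6 * (K * U))) + + 2 * (K * K * (U * U))
   cert = 0≤+ (0≤+ (0≤+ (0≤+ (*-0≤ 0≤Q (≤-diff d≤)) (*-0≤ 0≤Q (≤-diff 1≤J))) (≤-diff (cauchy-schwarz al (λ i → T * z i - s i))))
     (≤-diff (*-mono 0≤6 (ℤ.≤-trans 0≤6 G≥6) G≥6 G≥6))) (*-0≤ {+ 2} (+≤+ z≤n) (*-0≤ (0≤sq K) (0≤sq U)))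

 -- J vertices of low degree would cost at least 17 X together, but only 16 X is available.
 few-low : ∀ {k} (low : Fin k → Bool) (D : Fin k → ℤ) (X J : ℤ) → (∀ u → 0ℤ ≤ D u) → 0ℤ < X → 1ℤ ≤ J → sum D ≤ + 16 * X → (∀ u → low u ≡ true → + 17 * X ≤ J * D u) → count low < J
 few-low {k} low D X J 0≤D 0<X 1≤J total cost = ℤ.≰⇒> λ J≤c → ℤ.<⇒≱ (pos X J 0<X 1≤J) (fin X J (count low) (sum D) J≤c (ℤ.<⇒≤ 0<X) (ℤ.≤-trans (+≤+ z≤n) 1≤J) summed total)
   where
   0≤J : 0ℤ ≤ J
   0≤J = ℤ.≤-trans (+≤+ z≤n) 1≤J
   point : ∀ b x → 0ℤ ≤ x → (b ≡ true → + 17 * X ≤ J * x) → 𝟙 b * (+ 17 * X) ≤ J * x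
   point true x _ h = subst (_≤ J * x) (sym (ℤ.*-identityˡ (+ 17 * X))) (h refl)
   point false x h _ = subst (_≤ J * x) (sym (ℤ.*-zeroˡ (+ 17 * X))) (*-0≤ 0≤J h)
   summed : count low * (+ 17 * X) ≤ J * sum D
   summed = subst₂ _≤_ (∑-*ʳ (+ 17 * X) (λ u → 𝟙 (low u))) (∑-*ˡ J D) (∑-mono λ u → point (low u) (D u) (0≤D u) (cost u))
   fin : ∀ X J c S → J ≤ c → 0ℤ ≤ X → 0ℤ ≤ J → c * (+ 17 * X) ≤ J * S → S ≤ + 16 * X → J * X ≤ 0ℤ
   fin X J c S h₁ 0≤X 0≤J h₂ h₃ = ≤-cert ((c - J) * (+ 17 * X) + (J * S - c * (+ 17 * X)) + J * (+ 16 * X - S)) (0≤+ (0≤+ (*-0≤ (≤-diff h₁) (*-0≤ {+ 17} (+≤+ z≤n) 0≤X)) (≤-diff h₂)) (*-0≤ 0≤J (≤-diff h₃))) (l X J c S)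
     where
     l : ∀ X J c S → 0ℤ ≡ J * X + ((c - J) * (+ 17 * X) + (J * S - c * (+ 17 * X)) + J * (+ 16 * X - S))
     l = solve-∀
   pos : ∀ X J → 0ℤ < X → 1ℤ ≤ J → 0ℤ < J * X
   pos (+ suc x) (+ suc j) _ _ = +<+ (s≤s z≤n)
   pos (+ zero) _ (+<+ ()) _
   pos (+ suc x) (+ zero) _ (+≤+ ())

-- Second stage: the last h vertices and the degree condition

module SecondStage where
 open Sums
 open Designs
 open Universality using (count)
 open Variances
 open HamiltonCycles
 open CyclePatterns
 open FirstStage
 open DegreeCosts
 open import Data.Fin.Base using (splitAt; _↑ˡ_; _↑ʳ_; join)
 open import Data.Fin.Properties using (_≟_; splitAt-↑ˡ; splitAt-↑ʳ; join-splitAt; ↑ˡ-injective; ↑ʳ-injective)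
 open import Data.Integer.Base using (+_; _+_; _*_; _-_; -_; _^_; _≤_; _<_)
 open import Data.Vec.Base using (Vec; lookup; tabulate)
 open import Data.Vec.Properties using (lookup∘tabulate)

 module Stage₂ {N L} (D : Design N L) (0<N : 0ℤ < + N) (m₁ h : ℕ) (T U : ℤ) (T≡ : T ≡ (+ 2) ^ h) (U≡ : U ≡ + 11 * T) (B₀ : Fin L → Bool) (x : Vec (Fin N) (suc m₁))
     (near : VarT.NearPairs D 0<N B₀ U x) where
   open Design D
   open VarT D 0<N

   k₁ k : ℕ
   k₁ = suc m₁
   k = suc (m₁ ℕ.+ h)

   V : Set
   V = Fin k₁ ⊎ Fin h

   -- A witness for the pair of u and i sees exactly `α u i` and i among the first-stage vertices: u
   -- and i if u belongs to the first stage, and i alone otherwise. On the second stage it must show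
   -- `sel u`, which does not depend on i.
   α : V → Fin k₁ → Fin k₁
   α (inj₁ i) _ = i
   α (inj₂ _) i' = i'

   sel : V → Fin h → Bool
   sel (inj₁ _) _ = false
   sel (inj₂ j) j' = does (j' ≟ j)

   weight : V → Fin k₁ → Fin L → Bool
   weight u i y = B₀ y ∧ matches x (tabulate (isPair (α u i) i)) y

   ω : V → Fin k₁ → Fin L → ℤ
   ω u i y = 𝟙 (weight u i y)

   Ω : V → Fin L → ℤ
   Ω u y = ∑[ i < k₁ ] ω u i y

   pat : V → Vec Bool h
   pat u = tabulate (sel u)

   sum-ω : ∀ u i → sum (ω u i) ≡ Z (λ y → 𝟙 (B₀ y)) (tabulate (isPair (α u i) i)) x
   sum-ω u i = ∑-cong λ y → 𝟙-∧ (B₀ y) (matches x (tabulate (isPair (α u i) i)) y)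

   near-ω : ∀ u i → sum (ω u i) ≤ + 17 * U × + 15 * U ≤ sum (ω u i)
   near-ω u i = subst (λ z → z ≤ + 17 * U × + 15 * U ≤ z) (sym (sum-ω u i)) (near (α u i) i)

   ∧-left : ∀ {a b} → a ∧ b ≡ true → a ≡ true
   ∧-left {true} _ = refl

   ∧-right : ∀ a {b} → a ∧ b ≡ true → b ≡ true
   ∧-right true e = e

   on-first : ∀ u i y → weight u i y ≡ true → ∀ w → edge (lookup x w) y ≡ isPair (α u i) i w
   on-first u i y e w = trans (matches⇒ x (tabulate (isPair (α u i) i)) y (∧-right (B₀ y) e) w) (lookup∘tabulate (isPair (α u i) i) w)

   pair-at : ∀ {n} (a b : Fin n) → isPair a b b ≡ true
   pair-at a b = trans (cong (does (b ≟ a) ∨_) (dec-true (b ≟ b) refl)) (Bool.∨-zeroʳ (does (b ≟ a)))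

   pair-elim : ∀ {n} (a b w : Fin n) → isPair a b w ≡ true → w ≡ a ⊎ w ≡ b
   pair-elim a b w e with w ≟ a | w ≟ b
   ... | yes p | _ = inj₁ p
   ... | no _ | yes p = inj₂ p

   -- What y sees of the first stage determines i. The weights of the different partners therefore
   -- add up to a weight `Ω u` with values 0 and 1, to which the variance bound applies as a whole.
   disjoint : ∀ u y i i' → weight u i y ≡ true → weight u i' y ≡ true → i ≡ i'
   disjoint u y i i' e e' = go u (pair-elim _ _ _ (same i (pair-at _ i) e e')) (pair-elim _ _ _ (same i' (pair-at _ i') e' e))
     where
     same : ∀ w {a b} → isPair (α u a) a w ≡ true → weight u a y ≡ true → weight u b y ≡ true → isPair (α u b) b w ≡ true
     same w {a} {b} q ea eb = trans (sym (on-first u b y eb w)) (trans (on-first u a y ea w) q)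
     go : ∀ u → i ≡ α u i' ⊎ i ≡ i' → i' ≡ α u i ⊎ i' ≡ i → i ≡ i'
     go u (inj₂ p) _ = p
     go (inj₁ a) (inj₁ p) (inj₁ q) = trans p (sym q)
     go (inj₁ a) (inj₁ p) (inj₂ q) = sym q
     go (inj₂ b) (inj₁ p) _ = p

   0≤Ω : ∀ u y → 0ℤ ≤ Ω u y
   0≤Ω u y = ∑-0≤ λ i → 0≤𝟙 (weight u i y)

   Ω≤1 : ∀ u y → Ω u y ≤ 1ℤ
   Ω≤1 u y = ∑-fiber≤1 (λ i → weight u i y) (disjoint u y)

   sum-Ω : ∀ u → sum (Ω u) ≡ ∑[ i < k₁ ] sum (ω u i)
   sum-Ω u = ∑-comm (λ y i → ω u i y)

   Z-Ω : ∀ u v → Z (Ω u) (pat u) v ≡ ∑[ i < k₁ ] Z (ω u i) (pat u) v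
   Z-Ω u v = trans (∑-cong λ y → sym (∑-*ʳ (𝟙 (matches v (pat u) y)) (λ i → ω u i y))) (∑-comm (λ y i → ω u i y * 𝟙 (matches v (pat u) y)))

   q : ℤ → ℤ
   q s = + 5 * (T * T) * s + + h * + h * (s * s)

   q-mono : ∀ {s t} → 0ℤ ≤ s → s ≤ t → q s ≤ q t
   q-mono = quad-mono (+ 5 * (T * T)) (+ h * + h) (*-0≤ {+ 5} (+≤+ z≤n) (0≤sq T)) (0≤sq (+ h))

   -- One deviation for each partner, to charge for dead pairs, and one for their union, which keeps
   -- the total count of witnesses from being small.
   cost : V → Vec (Fin N) h → ℤ
   cost u v = (∑[ i < k₁ ] dev (ω u i) (pat u) v) + dev (Ω u) (pat u) v

   R : ℤ
   R = + k₁ * q (+ 17 * U) + q (+ k₁ * (+ 17 * U))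

   vtx : Fin k → V
   vtx = splitAt k₁

   F₂ : Vec (Fin N) h → ℤ
   F₂ v = ∑[ a < k ] cost (vtx a) v

   p : ℤ
   p = (+ N) ^ h

   0≤p : 0ℤ ≤ p
   0≤p = 0≤^ h (+≤+ z≤n)

   opaque
     cost-total : ∀ u → T * ∑T (cost u) ≤ p * R
     cost-total u = subst₂ _≤_ e₁ e₂ (ℤ.+-mono-≤ {∑[ i < k₁ ] (T * ∑T (dev (ω u i) (pat u)))} {∑[ i < k₁ ] (p * q (+ 17 * U))} {T * ∑T (dev (Ω u) (pat u))} {p * q (+ k₁ * (+ 17 * U))} (∑-mono one) two)
       where
       one : ∀ i → T * ∑T (dev (ω u i) (pat u)) ≤ p * q (+ 17 * U)
       one i = ℤ.≤-trans (variance-T (ω u i) (pat u) T T≡ (λ y → 0≤𝟙 (weight u i y)) (λ y → 𝟙≤1 (weight u i y))) (*-monoˡ p 0≤p (q-mono (∑-0≤ λ y → 0≤𝟙 (weight u i y)) (proj₁ (near-ω u i))))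
       two : T * ∑T (dev (Ω u) (pat u)) ≤ p * q (+ k₁ * (+ 17 * U))
       two = ℤ.≤-trans (variance-T (Ω u) (pat u) T T≡ (0≤Ω u) (Ω≤1 u)) (*-monoˡ p 0≤p (q-mono (∑-0≤ (0≤Ω u)) (subst₂ _≤_ (sym (sum-Ω u)) (∑-const k₁ (+ 17 * U)) (∑-mono λ i → proj₁ (near-ω u i)))))
       e₁ : (∑[ i < k₁ ] (T * ∑T (dev (ω u i) (pat u)))) + T * ∑T (dev (Ω u) (pat u)) ≡ T * ∑T (cost u)
       e₁ = trans (cong (_+ T * ∑T (dev (Ω u) (pat u))) (trans (∑-*ˡ T (λ i → ∑T (dev (ω u i) (pat u)))) (cong (T *_) (sym (∑T-∑ (λ v i → dev (ω u i) (pat u) v))))))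
         (trans (sym (ℤ.*-distribˡ-+ T (∑T (λ v → ∑[ i < k₁ ] dev (ω u i) (pat u) v)) (∑T (dev (Ω u) (pat u))))) (cong (T *_) (sym (∑T-+ (λ v → ∑[ i < k₁ ] dev (ω u i) (pat u) v) (dev (Ω u) (pat u))))))
       e₂ : (∑[ i < k₁ ] (p * q (+ 17 * U))) + p * q (+ k₁ * (+ 17 * U)) ≡ p * R
       e₂ = trans (cong (_+ p * q (+ k₁ * (+ 17 * U))) (trans (∑-const k₁ (p * q (+ 17 * U))) (*-left-comm (+ k₁) p (q (+ 17 * U))))) (sym (ℤ.*-distribˡ-+ p (+ k₁ * q (+ 17 * U)) (q (+ k₁ * (+ 17 * U)))))

     F₂-total : T * ∑T F₂ ≤ p * (+ k * R)
     F₂-total = subst₂ _≤_ (trans (∑-*ˡ T (λ a → ∑T (cost (vtx a)))) (cong (T *_) (sym (∑T-∑ (λ v a → cost (vtx a) v))))) (trans (∑-const k (p * R)) (*-left-comm (+ k) p R)) (∑-mono λ a → cost-total (vtx a))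

     chosen : 0ℤ < T → + 530 * (+ h * + h * (+ k + 1ℤ)) ≤ T → ∃ λ v → F₂ v ≤ + 16 * (+ k * + k * (U * U))
     chosen 0<T h₂ = ∑T-avg F₂ (+ 16 * (+ k * + k * (U * U))) 0<N (*-cancelˡ T 0<T (ℤ.≤-trans F₂-total (subst (p * (+ k * R) ≤_) (*-left-comm p T (+ 16 * (+ k * + k * (U * U)))) (*-monoˡ p 0≤p
       (stage₂-budget (+ k) (+ k₁) T U (+ h) U≡ (+≤+ z≤n) (+≤+ (s≤s (ℕ.m≤m+n m₁ h))) (ℤ.<⇒≤ 0<T) h₂)))))

   module Found (v : Vec (Fin N) h) (small : F₂ v ≤ + 16 * (+ k * + k * (U * U))) (0<U : 0ℤ < U) (slack : + 19 * + k + + 20 ≤ + 20 * + k₁) where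

     A : Fin k → Fin N
     A a = [ lookup x , lookup v ]′ (vtx a)

     open Alive D A

     z : V → Fin k₁ → ℤ
     z u i = Z (ω u i) (pat u) v

     al : V → Fin k₁ → Bool
     al u i = does (0ℤ ℤ.<? z u i)

     al-dead : ∀ u i → al u i ≡ false → z u i ≡ 0ℤ
     al-dead u i e with 0ℤ ℤ.<? z u i
     ... | no q = ℤ.≤-antisym (ℤ.≮⇒≥ q) (∑-0≤ λ y → *-0≤ (0≤𝟙 (weight u i y)) (0≤𝟙 (matches v (pat u) y)))

     lift : Fin k₁ → Fin k
     lift i = i ↑ˡ h

     edge-at : V → Fin L → Bool
     edge-at t y = edge ([ lookup x , lookup v ]′ t) y

     does-inj : ∀ {n n'} (f : Fin n → Fin n') → (∀ a b → f a ≡ f b → a ≡ b) → ∀ a b → does (f a ≟ f b) ≡ does (a ≟ b)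
     does-inj f inj a b with a ≟ b
     ... | yes refl = dec-true (f a ≟ f a) refl
     ... | no q = dec-false (f a ≟ f b) (q ∘ inj a b)

     ↑ˡ≢↑ʳ : ∀ (i : Fin k₁) (j : Fin h) → i ↑ˡ h ≢ k₁ ↑ʳ j
     ↑ˡ≢↑ʳ i j e with () ← trans (sym (splitAt-↑ˡ k₁ i h)) (trans (cong (splitAt k₁) e) (splitAt-↑ʳ k₁ h j))

     on-second : ∀ u y → matches v (pat u) y ≡ true → ∀ b → edge (lookup v b) y ≡ sel u b
     on-second u y e b = trans (matches⇒ v (pat u) y e b) (lookup∘tabulate (sel u) b)

     realise : ∀ u t i y → weight u i y ≡ true → matches v (pat u) y ≡ true → edge-at t y ≡ isPair (join k₁ h u) (lift i) (join k₁ h t)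
     realise (inj₁ j) (inj₁ b) i y e₁ e₂ = trans (on-first (inj₁ j) i y e₁ b) (sym (isPair-inj lift (↑ˡ-injective h) j i b))
     realise (inj₂ j) (inj₁ b) i y e₁ e₂ = trans (on-first (inj₂ j) i y e₁ b) (trans (Bool.∨-idem (does (b ≟ i))) (sym (cong₂ _∨_ (dec-false (lift b ≟ k₁ ↑ʳ j) (↑ˡ≢↑ʳ b j)) (does-inj lift (↑ˡ-injective h) b i))))
     realise (inj₁ j) (inj₂ b) i y e₁ e₂ = trans (on-second (inj₁ j) y e₂ b) (sym (cong₂ _∨_ (dec-false (k₁ ↑ʳ b ≟ lift j) (↑ˡ≢↑ʳ j b ∘ sym)) (dec-false (k₁ ↑ʳ b ≟ lift i) (↑ˡ≢↑ʳ i b ∘ sym))))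
     realise (inj₂ j) (inj₂ b) i y e₁ e₂ = trans (on-second (inj₂ j) y e₂ b) (sym (trans (cong₂ _∨_ (does-inj (k₁ ↑ʳ_) (↑ʳ-injective k₁) b j) (dec-false (k₁ ↑ʳ b ≟ lift i) (↑ˡ≢↑ʳ i b ∘ sym))) (Bool.∨-identityʳ (does (b ≟ j)))))

     dec : ∀ {P : Set} (d : Dec P) → does d ≡ true → P
     dec (yes q) _ = q

     alive⇒ : ∀ a i → al (vtx a) i ≡ true → ∃ (Realises a (lift i))
     alive⇒ a i e = proj₁ hit , λ w → trans (realise (vtx a) (vtx w) i (proj₁ hit) w₁ w₂) (cong₂ (λ a w → isPair a (lift i) w) (join-splitAt k₁ h a) (join-splitAt k₁ h w))
       where
       0<z : 0ℤ < z (vtx a) i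
       0<z = dec (0ℤ ℤ.<? z (vtx a) i) e
       hit : ∃ λ y → 0ℤ < ω (vtx a) i y * 𝟙 (matches v (pat (vtx a)) y)
       hit = ∑-pos (λ y → ω (vtx a) i y * 𝟙 (matches v (pat (vtx a)) y)) 0<z
       w₁ : weight (vtx a) i (proj₁ hit) ≡ true
       w₁ = 0<𝟙* (weight (vtx a) i (proj₁ hit)) (proj₂ hit)
       w₂ : matches v (pat (vtx a)) (proj₁ hit) ≡ true
       w₂ = 0<𝟙* (matches v (pat (vtx a)) (proj₁ hit)) (subst (0ℤ <_) (ℤ.*-comm (ω (vtx a) i (proj₁ hit)) (𝟙 (matches v (pat (vtx a)) (proj₁ hit)))) (proj₂ hit))

     -- The summand 1 accounts for the partner that is the vertex itself, which `Γ` does not count.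
     degree : ∀ a → (∑[ i < k₁ ] 𝟙 (al (vtx a) i)) ≤ deg Γ a + 1ℤ
     degree a = ℤ.≤-trans (∑-mono point) (subst (_≤ deg Γ a + 1ℤ) (sym (∑-+ (λ i → 𝟙 (Γ a (lift i))) (λ i → δ a (lift i))))
         (ℤ.+-mono-≤ (∑-inj-≤ lift (↑ˡ-injective h) (λ b → 𝟙 (Γ a b)) (λ b → 0≤𝟙 (Γ a b))) (ℤ.≤-trans (∑-inj-≤ lift (↑ˡ-injective h) (δ a) (λ b → 0≤𝟙 (does (a ≟ b)))) (ℤ.≤-reflexive (∑-δ1 a)))))
       where
       point : ∀ i → 𝟙 (al (vtx a) i) ≤ 𝟙 (Γ a (lift i)) + δ a (lift i)
       point i = go (al (vtx a) i) refl (δ-cases a (lift i))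
         where
         go : ∀ b → al (vtx a) i ≡ b → (a ≡ lift i × δ a (lift i) ≡ 1ℤ) ⊎ (a ≢ lift i × δ a (lift i) ≡ 0ℤ) → 𝟙 b ≤ 𝟙 (Γ a (lift i)) + δ a (lift i)
         go false _ _ = 0≤+ (0≤𝟙 (Γ a (lift i))) (0≤𝟙 (does (a ≟ lift i)))
         go true e (inj₁ (_ , d)) = subst (λ z → 1ℤ ≤ 𝟙 (Γ a (lift i)) + z) (sym d) (ℤ.+-monoˡ-≤ 1ℤ (0≤𝟙 (Γ a (lift i))))
         go true e (inj₂ (n , d)) = subst (λ g → 1ℤ ≤ 𝟙 g + δ a (lift i)) (sym (Γ-intro n (alive⇒ a i e))) (ℤ.+-monoʳ-≤ 1ℤ (0≤𝟙 (does (a ≟ lift i))))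

     X : ℤ
     X = + k * + k * (U * U)

     D₂ : Fin k → ℤ
     D₂ a = cost (vtx a) v

     0≤devs : ∀ u → 0ℤ ≤ (∑[ i < k₁ ] dev (ω u i) (pat u) v)
     0≤devs u = ∑-0≤ λ i → 0≤dev (ω u i) (pat u) v

     0≤D₂ : ∀ a → 0ℤ ≤ D₂ a
     0≤D₂ a = 0≤+ (0≤devs (vtx a)) (0≤dev (Ω (vtx a)) (pat (vtx a)) v)

     dev-Ω : ∀ u → dev (Ω u) (pat u) v ≡ (T * sum (z u) - (∑[ i < k₁ ] sum (ω u i))) * (T * sum (z u) - (∑[ i < k₁ ] sum (ω u i)))
     dev-Ω u = trans (dev-T (Ω u) (pat u) v T T≡) (cong₂ (λ a b → (T * a - b) * (T * a - b)) (Z-Ω u v) (sum-Ω u))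

     dev-Ω≤ : ∀ a → dev (Ω (vtx a)) (pat (vtx a)) v ≤ + 16 * X
     dev-Ω≤ a = ℤ.≤-trans (subst (_≤ D₂ a) (ℤ.+-identityˡ (dev (Ω (vtx a)) (pat (vtx a)) v)) (ℤ.+-monoˡ-≤ (dev (Ω (vtx a)) (pat (vtx a)) v) (0≤devs (vtx a)))) (ℤ.≤-trans (∑-term 0≤D₂ a) small)

     devs≤ : ∀ a → (∑[ i < k₁ ] dev (ω (vtx a) i) (pat (vtx a)) v) ≤ D₂ a
     devs≤ a = subst (_≤ D₂ a) (ℤ.+-identityʳ (∑[ i < k₁ ] dev (ω (vtx a) i) (pat (vtx a)) v)) (ℤ.+-monoʳ-≤ (∑[ i < k₁ ] dev (ω (vtx a) i) (pat (vtx a)) v) (0≤dev (Ω (vtx a)) (pat (vtx a)) v))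

     low-D₂ : ∀ j → 1 ℕ.≤ j → 2 ℕ.* j ℕ.< k → ∀ a → deg Γ a ≤ + j → + 17 * X ≤ + j * D₂ a
     low-D₂ j 1≤j 2j<k a le = ℤ.≤-trans
       (low-cost (+ k) (+ j) U T (z (vtx a)) (λ i → sum (ω (vtx a) i)) (al (vtx a)) (al-dead (vtx a)) (near-ω (vtx a)) (ℤ.<⇒≤ 0<U) (+≤+ (s≤s (ℕ.m≤m+n m₁ h))) slack
         (ℤ.≤-trans (degree a) (ℤ.+-monoˡ-≤ 1ℤ le)) (+≤+ 1≤j) (subst (_≤ + k) (ℤ.pos-* 2 j) (+≤+ (ℕ.<⇒≤ 2j<k))) (subst (_≤ + 16 * X) (dev-Ω (vtx a)) (dev-Ω≤ a)))
       (*-monoˡ (+ j) (+≤+ z≤n) (subst (_≤ D₂ a) (∑-cong λ i → dev-T (ω (vtx a) i) (pat (vtx a)) v T T≡) (devs≤ a)))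

     posa-condition : PosaCondition Γ
     posa-condition j 1≤j 2j<k = few-low (deg≤ᵇ Γ (+ j)) D₂ X (+ j) 0≤D₂ (pos U 0<U) (+≤+ 1≤j) small λ a e → low-D₂ j 1≤j 2j<k a (dec (deg Γ a ℤ.≤? + j) e)
       where
       pos : ∀ u → 0ℤ < u → 0ℤ < + k * + k * (u * u)
       pos (+ suc u) _ = +<+ (s≤s z≤n)
       pos (+ zero) (+<+ ())

     cycle : 2 ℕ.≤ m₁ ℕ.+ h → CyclePattern D (m₁ ℕ.+ h)
     cycle 2≤m = ham⇒cycle (posa 2≤m Γ Γ-sym Γ-irr posa-condition)

 two-stage-cycle : ∀ {N L} (D : Design N L) → 0ℤ < + N → ∀ m₁ h (T₁ T U : ℤ) → T₁ ≡ (+ 2) ^ suc m₁ → T ≡ (+ 2) ^ h → U ≡ + 11 * T → (B₀ : Fin L → Bool) → count B₀ ≡ + 16 * (U * T₁) →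
   + suc m₁ * + suc m₁ * (+ 80 * (U * T₁) + + 256 * (+ suc m₁ * + suc m₁ * (U * U))) ≤ T₁ * (U * U) →
   + 530 * (+ h * + h * (+ suc (m₁ ℕ.+ h) + 1ℤ)) ≤ T → + 19 * + suc (m₁ ℕ.+ h) + + 20 ≤ + 20 * + suc m₁ → 0ℤ < T₁ → 0ℤ < T → 0ℤ < U → 2 ℕ.≤ m₁ ℕ.+ h → CyclePattern D (m₁ ℕ.+ h)
 two-stage-cycle {N} {L} D 0<N m₁ h T₁ T U T₁≡ T≡ U≡ B₀ cB₀ h₁ h₂ slack 0<T₁ 0<T 0<U 2≤m = S₂.Found.cycle (proj₁ c₂) (proj₂ c₂) 0<U slack 2≤m
   where
   module S₁ = Stage₁ D 0<N (suc m₁) T₁ U T₁≡ B₀ cB₀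
   c₁ : ∃ λ v → S₁.F₁ v ≤ T₁ * T₁ * (U * U)
   c₁ = S₁.chosen h₁ 0<T₁
   module S₂ = Stage₂ D 0<N m₁ h T U T≡ U≡ B₀ (proj₁ c₁) (S₁.bounds (proj₁ c₁) (proj₂ c₁) 0<T₁ (ℤ.<⇒≤ 0<U))
   c₂ : ∃ λ v → S₂.F₂ v ≤ + 16 * (+ suc (m₁ ℕ.+ h) * + suc (m₁ ℕ.+ h) * (U * U))
   c₂ = S₂.chosen 0<T h₂

-- Bicliques: greedy choice and the Kővári-Sós-Turán argument

module Bicliques where
 open Sums
 open Designs
 open Universality using (count; trim; 0≤count; _⊆_)
 open Variances
 open CyclePatterns using (*-left-comm)
 open import Data.Fin.Base using (splitAt; join)
 open import Data.Fin.Properties using (_≟_; any?; suc-injective; join-splitAt)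
 open import Data.Integer.Base using (+_; _+_; _*_; _-_; -_; _^_; _≤_; _<_; -≤+)
 open import Data.Integer.Tactic.RingSolver using (solve-∀)

 0<* : ∀ {a b} → 0ℤ < a → 0ℤ < b → 0ℤ < a * b
 0<* {+ suc a} {+ suc b} _ _ = +<+ (s≤s z≤n)
 0<* {+ suc a} {+ zero} _ (+<+ ())
 0<* {+ zero} (+<+ ())

 0<*⁻ : ∀ a {b} → 0ℤ ≤ a → 0ℤ < a * b → 0ℤ < b
 0<*⁻ (+ zero) {b} _ h = ⊥-elim (ℤ.<-irrefl (sym (ℤ.*-zeroˡ b)) h)
 0<*⁻ (+ suc a) {+ zero} _ h = ⊥-elim (ℤ.<-irrefl (sym (ℤ.*-zeroʳ (+ suc a))) h)
 0<*⁻ (+ suc a) {+ suc b} _ _ = +<+ (s≤s z≤n)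

 ∧-left : ∀ {a b} → a ∧ b ≡ true → a ≡ true
 ∧-left {true} _ = refl

 ∧-right : ∀ a {b} → a ∧ b ≡ true → b ≡ true
 ∧-right true e = e

 -- The slope of the tangent to xᵃ at m, namely a mᵃ⁻¹.
 slope : ℤ → ℕ → ℤ
 slope m zero = 0ℤ
 slope m (suc a) = m * slope m a + m ^ a

 0≤slope : ∀ {m} a → 0ℤ ≤ m → 0ℤ ≤ slope m a
 0≤slope zero h = ℤ.≤-refl
 0≤slope (suc a) h = 0≤+ (*-0≤ h (0≤slope a h)) (0≤^ a h)

 slope-eq : ∀ m a → m * slope m a ≡ + a * m ^ a
 slope-eq m zero = trans (ℤ.*-zeroʳ m) (sym (ℤ.*-zeroˡ 1ℤ))
 slope-eq m (suc a) = trans (l₁ m (slope m a) (m ^ a)) (trans (cong (λ z → m * z + m * m ^ a) (slope-eq m a)) (l₂ m (+ a) (m ^ a)))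
   where
   l₁ : ∀ m s p → m * (m * s + p) ≡ m * (m * s) + m * p
   l₁ = solve-∀
   l₂ : ∀ m a p → m * (a * p) + m * p ≡ (1ℤ + a) * (m * p)
   l₂ = solve-∀

 -- Convexity by induction: multiplying the tangent inequality by x leaves the error slope · (x -
 -- m)², which is nonnegative.
 tangent : ∀ m x a → 0ℤ ≤ m → 0ℤ ≤ x → m ^ a + slope m a * (x - m) ≤ x ^ a
 tangent m x zero _ _ = ℤ.≤-reflexive (l (x - m))
   where
   l : ∀ y → 1ℤ + 0ℤ * y ≡ 1ℤ
   l = solve-∀
 tangent m x (suc a) 0≤m 0≤x = ℤ.≤-trans (≤-cert (slope m a * ((x - m) * (x - m))) (*-0≤ (0≤slope a 0≤m) (0≤sq (x - m))) (l m x (m ^ a) (slope m a))) (*-monoˡ x 0≤x (tangent m x a 0≤m 0≤x))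
   where
   l : ∀ m x p s → x * (p + s * (x - m)) ≡ m * p + (m * s + p) * (x - m) + s * ((x - m) * (x - m))
   l = solve-∀

 trunc : ℤ → ℤ
 trunc (+ n) = + n
 trunc -[1+ n ] = 0ℤ

 0≤trunc : ∀ z → 0ℤ ≤ trunc z
 0≤trunc (+ n) = +≤+ z≤n
 0≤trunc -[1+ n ] = ℤ.≤-refl

 ≤trunc : ∀ z → z ≤ trunc z
 ≤trunc (+ n) = ℤ.≤-refl
 ≤trunc -[1+ n ] = -≤+

 trunc≤ : ∀ {z d} → 0ℤ ≤ d → z ≤ d → trunc z ≤ d
 trunc≤ {+ n} _ h = h
 trunc≤ { -[1+ n ]} h _ = h

 pick : ∀ {n} (B : Fin n → Bool) h → + h ≤ count B → ∃ λ (f : Fin h → Fin n) → (∀ i j → f i ≡ f j → i ≡ j) × (∀ i → B (f i) ≡ true)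
 pick B zero _ = (λ ()) , (λ ()) , (λ ())
 pick {zero} B (suc h) le with +≤+ () ← subst (+ suc h ≤_) (∑-[] _) le
 pick {suc n} B (suc h) le = go (B zero) refl (subst (+ suc h ≤_) (∑-∷ (λ i → 𝟙 (B i))) le)
   where
   go : ∀ b → B zero ≡ b → + suc h ≤ 𝟙 (B zero) + count (B ∘ suc) → ∃ λ (f : Fin (suc h) → Fin (suc n)) → (∀ i j → f i ≡ f j → i ≡ j) × (∀ i → B (f i) ≡ true)
   go true eq q = f , inj , on
     where
     r : ∃ λ (f : Fin h → Fin n) → (∀ i j → f i ≡ f j → i ≡ j) × (∀ i → B (suc (f i)) ≡ true)
     r = pick (B ∘ suc) h (+-cancelˡ 1ℤ (subst (λ z → + suc h ≤ 𝟙 z + count (B ∘ suc)) eq q))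
     f : Fin (suc h) → Fin (suc n)
     f zero = zero
     f (suc i) = suc (proj₁ r i)
     inj : ∀ i j → f i ≡ f j → i ≡ j
     inj zero zero _ = refl
     inj (suc i) (suc j) e = cong suc (proj₁ (proj₂ r) i j (suc-injective e))
     on : ∀ i → B (f i) ≡ true
     on zero = eq
     on (suc i) = proj₂ (proj₂ r) i
   go false eq q = (suc ∘ proj₁ r) , (λ i j e → proj₁ (proj₂ r) i j (suc-injective e)) , proj₂ (proj₂ r)
     where
     r : ∃ λ (f : Fin (suc h) → Fin n) → (∀ i j → f i ≡ f j → i ≡ j) × (∀ i → B (suc (f i)) ≡ true)
     r = pick (B ∘ suc) (suc h) (subst (+ suc h ≤_) (ℤ.+-identityˡ (count (B ∘ suc))) (subst (λ z → + suc h ≤ 𝟙 z + count (B ∘ suc)) eq q))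

 phase₁-identity : ∀ N L A i W v v' → N * (+ 2 * W * (N * v')) ≡ N * (L * (N - + 2 * (A * (1ℤ + i)))) + (W * N * (+ 2 * N * v' - v * (N - + 2 * i)) + (N - + 2 * i) * (W * (N * v) - L * (N - + 2 * (A * i))) + L * (+ 2 * (N * (A - i)) + + 4 * (A * (i * i))))
 phase₁-identity = solve-∀

 -- The accumulated loss is kept linear in i. This works because (N - 2 A i)(N - 2 i) is at least N
 -- (N - 2 A (i + 1)), the difference being 2 N (A - i) + 4 A i².
 phase₁-step : ∀ N L A i W v v' → 0ℤ < N → 0ℤ ≤ L → 0ℤ ≤ A → 0ℤ ≤ W → i ≤ A → 0ℤ < N - + 2 * i → v * (N - + 2 * i) ≤ + 2 * N * v' → L * (N - + 2 * (A * i)) ≤ W * (N * v) →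
   L * (N - + 2 * (A * (1ℤ + i))) ≤ + 2 * W * (N * v')
 phase₁-step N L A i W v v' 0<N 0≤L 0≤A 0≤W i≤A 0<N-i step inv = *-cancelˡ {L * (N - + 2 * (A * (1ℤ + i)))} {+ 2 * W * (N * v')} N 0<N
   (≤-cert (W * N * (+ 2 * N * v' - v * (N - + 2 * i)) + (N - + 2 * i) * (W * (N * v) - L * (N - + 2 * (A * i))) + L * (+ 2 * (N * (A - i)) + + 4 * (A * (i * i))))
     (0≤+ (0≤+ (*-0≤ (*-0≤ 0≤W 0≤N) (≤-diff step)) (*-0≤ (ℤ.<⇒≤ 0<N-i) (≤-diff inv))) (*-0≤ 0≤L (0≤+ (*-0≤ {+ 2} (+≤+ z≤n) (*-0≤ 0≤N (≤-diff i≤A))) (*-0≤ {+ 4} (+≤+ z≤n) (*-0≤ 0≤A (0≤sq i))))))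
     (phase₁-identity N L A i W v v'))
   where
   0≤N : 0ℤ ≤ N
   0≤N = ℤ.<⇒≤ 0<N

 one-minus : ∀ x → 1ℤ ≡ (1ℤ - x) + x
 one-minus = solve-∀

 double-sub : ∀ a b → + 2 * (a - b) ≡ + 2 * a - + 2 * b
 double-sub = solve-∀

 double-assoc : ∀ n s → + 2 * n * s ≡ n * (+ 2 * s)
 double-assoc = solve-∀

 phase₁-base : ∀ l n a → l * (n - + 2 * (a * 0ℤ)) ≡ 1ℤ * (n * l)
 phase₁-base = solve-∀

 sub-suc : ∀ x r → x - (1ℤ + r) ≡ (x - 1ℤ) - r
 sub-suc = solve-∀

 sub-add : ∀ x r → x ≡ (x - r) + r
 sub-add = solve-∀

 ∧-identity : ∀ b → b ∧ true ≡ b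
 ∧-identity true = refl
 ∧-identity false = refl

 opaque
   -- This power stands in for the falling factorial x (x - 1) ⋯ (x - r + 1). It satisfies the
   -- recursion of the latter as an inequality, as the successive choice of columns needs, and it is
   -- convex, so its average is bounded by a tangent.
   Φ : ℕ → ℤ → ℤ
   Φ r x = trunc (x - + r) ^ r

   Φ-def : ∀ r x → Φ r x ≡ trunc (x - + r) ^ r
   Φ-def r x = refl

   0≤Φ : ∀ r x → 0ℤ ≤ Φ r x
   0≤Φ r x = 0≤^ r (0≤trunc (x - + r))

   Φ-zero : ∀ x → Φ 0 x ≡ 1ℤ
   Φ-zero x = refl

   Φ-step : ∀ r x → 0ℤ ≤ x → Φ (suc r) x ≤ x * Φ r (x - 1ℤ)
   Φ-step r x 0≤x = subst (λ z → trunc (x - + suc r) * trunc (x - + suc r) ^ r ≤ x * trunc z ^ r) (sub-suc x (+ r))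
     (*-monoʳ {trunc (x - + suc r)} {x} (trunc (x - + suc r) ^ r) (0≤^ r (0≤trunc (x - + suc r))) (trunc≤ {x - + suc r} {x} 0≤x (≤-cert (+ suc r) (+≤+ z≤n) (sub-add x (+ suc r)))))

 module Biclique {N L} (D : Design N L) (0<N : 0ℤ < + N) where
   open Design D
   open Variance D 0<N using (one-point)

   d : (Fin L → Bool) → Fin N → ℤ
   d V t = ∑[ y < L ] 𝟙 (V y ∧ edge t y)

   0≤d : ∀ V t → 0ℤ ≤ d V t
   0≤d V t = ∑-0≤ λ y → 0≤𝟙 (V y ∧ edge t y)

   unused : ∀ {i} → (Fin i → Fin N) → Fin N → Bool
   unused f t = not (does (any? (λ j → f j ≟ t)))

   unused⇒ : ∀ {i} (f : Fin i → Fin N) t → unused f t ≡ true → ∀ j → f j ≢ t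
   unused⇒ f t e j q with any? (λ j → f j ≟ t)
   ... | no h = h (j , q)

   unused-≥ : ∀ {i} (f : Fin i → Fin N) t → 1ℤ - (∑[ j < i ] δ (f j) t) ≤ 𝟙 (unused f t)
   unused-≥ {i} f t with any? (λ j → f j ≟ t)
   ... | no h = ≤-cert (∑[ j < i ] δ (f j) t) (∑-0≤ λ j → 0≤𝟙 (does (f j ≟ t))) (one-minus (∑[ j < i ] δ (f j) t))
   ... | yes (j , q) = subst (1ℤ - (∑[ j < i ] δ (f j) t) ≤_) (ℤ.+-inverseʳ 1ℤ) (ℤ.+-monoʳ-≤ 1ℤ (ℤ.neg-mono-≤ (subst (_≤ (∑[ j < i ] δ (f j) t)) (trans (cong (λ x → δ x t) q) (δ-refl t)) (∑-term (λ j → 0≤𝟙 (does (f j ≟ t))) j))))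

   half : ∀ y → + 2 * (∑[ t < N ] 𝟙 (edge t y)) ≡ + N
   half y = trans (cong (+ 2 *_) (∑-cong λ t → c (edge t y))) (one-point true y)
     where
     c : ∀ b → 𝟙 b ≡ 𝟙 (eqb b true)
     c true = refl
     c false = refl

   avoid : ∀ {i} (f : Fin i → Fin N) y → + N - + 2 * + i ≤ + 2 * (∑[ t < N ] 𝟙 (unused f t ∧ edge t y))
   avoid {i} f y = subst (_≤ + 2 * (∑[ t < N ] 𝟙 (unused f t ∧ edge t y))) (cong (_- + 2 * + i) (half y)) (subst (_≤ + 2 * (∑[ t < N ] 𝟙 (unused f t ∧ edge t y))) (double-sub (∑[ t < N ] 𝟙 (edge t y)) (+ i)) (*-monoˡ (+ 2) (+≤+ z≤n) lower))
     where
     point : ∀ t → 𝟙 (edge t y) - (∑[ j < i ] δ (f j) t) ≤ 𝟙 (unused f t ∧ edge t y)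
     point t = go (edge t y)
       where
       go : ∀ b → 𝟙 b - (∑[ j < i ] δ (f j) t) ≤ 𝟙 (unused f t ∧ b)
       go true = subst (λ z → 1ℤ - (∑[ j < i ] δ (f j) t) ≤ 𝟙 z) (sym (∧-identity (unused f t))) (unused-≥ f t)
       go false = ℤ.≤-trans (subst (_≤ 0ℤ) (sym (ℤ.+-identityˡ (- (∑[ j < i ] δ (f j) t)))) (ℤ.neg-mono-≤ (∑-0≤ λ j → 0≤𝟙 (does (f j ≟ t))))) (0≤𝟙 (unused f t ∧ false))
     lower : (∑[ t < N ] 𝟙 (edge t y)) - + i ≤ (∑[ t < N ] 𝟙 (unused f t ∧ edge t y))
     lower = subst (_≤ (∑[ t < N ] 𝟙 (unused f t ∧ edge t y))) (trans (∑-sub (λ t → 𝟙 (edge t y)) (λ t → ∑[ j < i ] δ (f j) t)) (cong (λ z → (∑[ t < N ] 𝟙 (edge t y)) - z) (trans (∑-comm (λ t j → δ (f j) t)) (trans (∑-cong λ j → ∑-δ1 (f j)) (∑-ones i)))))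
       (∑-mono point)

   swap-count : ∀ (U : Fin N → Bool) V → (∑[ t < N ] (𝟙 (U t) * d V t)) ≡ ∑[ y < L ] (𝟙 (V y) * (∑[ t < N ] 𝟙 (U t ∧ edge t y)))
   swap-count U V = trans (∑-cong λ t → sym (∑-*ˡ (𝟙 (U t)) (λ y → 𝟙 (V y ∧ edge t y)))) (trans (∑-comm (λ t y → 𝟙 (U t) * 𝟙 (V y ∧ edge t y)))
       (∑-cong λ y → trans (∑-cong λ t → pt (U t) (V y) (edge t y)) (∑-*ˡ (𝟙 (V y)) (λ t → 𝟙 (U t ∧ edge t y)))))
     where
     pt : ∀ u v e → 𝟙 u * 𝟙 (v ∧ e) ≡ 𝟙 v * 𝟙 (u ∧ e)
     pt true true e = refl
     pt true false e = sym (ℤ.*-zeroˡ (𝟙 e))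
     pt false true e = ℤ.*-zeroˡ (𝟙 e)
     pt false false e = refl

   -- Each column has edges to half of the rows, and at most i rows have been used.
   unused-mass : ∀ {i} (f : Fin i → Fin N) V → count V * (+ N - + 2 * + i) ≤ + 2 * (∑[ t < N ] (𝟙 (unused f t) * d V t))
   unused-mass {i} f V = subst₂ _≤_ (∑-*ʳ (+ N - + 2 * + i) (λ y → 𝟙 (V y))) (trans (trans (∑-cong λ y → *-left-comm (𝟙 (V y)) (+ 2) (∑[ t < N ] 𝟙 (unused f t ∧ edge t y))) (∑-*ˡ (+ 2) (λ y → 𝟙 (V y) * (∑[ t < N ] 𝟙 (unused f t ∧ edge t y))))) (cong (+ 2 *_) (sym (swap-count (unused f) V))))
       (∑-mono λ y → *-monoˡ (𝟙 (V y)) (0≤𝟙 (V y)) (avoid f y))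

   Common : ∀ {i} → (Fin i → Fin N) → (Fin L → Bool) → Set
   Common f V = ∀ j y → V y ≡ true → edge (f j) y ≡ true

   opaque
     phase₁ : ∀ a i → i ℕ.≤ a → 0ℤ < + N - + 2 * (+ a * + a) → 0ℤ < + L →
       ∃ λ (f : Fin i → Fin N) → ∃ λ V → (∀ j j' → f j ≡ f j' → j ≡ j') × Common f V × + L * (+ N - + 2 * (+ a * + i)) ≤ (+ 2) ^ i * (+ N * count V)
     phase₁ a zero _ _ _ = (λ ()) , (λ _ → true) , (λ ()) , (λ ()) , ℤ.≤-reflexive (trans (phase₁-base (+ L) (+ N) (+ a)) (cong (λ z → 1ℤ * (+ N * z)) (sym (∑-ones L))))
     phase₁ a (suc i) i<a 0<N' 0<L = f' , V' , inj' , com' , inv'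
       where
       rec : ∃ λ (f : Fin i → Fin N) → ∃ λ V → (∀ j j' → f j ≡ f j' → j ≡ j') × Common f V × + L * (+ N - + 2 * (+ a * + i)) ≤ (+ 2) ^ i * (+ N * count V)
       rec = phase₁ a i (ℕ.<⇒≤ i<a) 0<N' 0<L
       f : Fin i → Fin N
       f = proj₁ rec
       V : Fin L → Bool
       V = proj₁ (proj₂ rec)
       inv : + L * (+ N - + 2 * (+ a * + i)) ≤ (+ 2) ^ i * (+ N * count V)
       inv = proj₂ (proj₂ (proj₂ (proj₂ rec)))
       i≤a : + i ≤ + a
       i≤a = +≤+ (ℕ.<⇒≤ i<a)
       0<N-ai : 0ℤ < + N - + 2 * (+ a * + i)
       0<N-ai = ℤ.<-≤-trans 0<N' (ℤ.+-monoʳ-≤ (+ N) (ℤ.neg-mono-≤ (*-monoˡ (+ 2) (+≤+ z≤n) (*-monoˡ (+ a) (+≤+ z≤n) i≤a))))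
       i≤ai : + i ≤ + a * + i
       i≤ai = subst (+ i ≤_) (ℤ.pos-* a i) (+≤+ (ℕ.m≤n*m i a {{ℕ.>-nonZero (ℕ.≤-trans (s≤s z≤n) i<a)}}))
       0<N-i : 0ℤ < + N - + 2 * + i
       0<N-i = ℤ.<-≤-trans 0<N-ai (ℤ.+-monoʳ-≤ (+ N) (ℤ.neg-mono-≤ (*-monoˡ (+ 2) (+≤+ z≤n) i≤ai)))
       0<V : 0ℤ < count V
       0<V = 0<*⁻ (+ N) (+≤+ z≤n) (0<*⁻ ((+ 2) ^ i) (0≤^ {+ 2} i (+≤+ z≤n)) (ℤ.<-≤-trans (0<* 0<L 0<N-ai) inv))
       c : ℤ
       c = count V * (+ N - + 2 * + i)
       found : ∃ λ t → 0ℤ < 1ℤ × c ≤ + 2 * + N * (𝟙 (unused f t) * d V t)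
       found = ∑-avg {N} (λ _ → 1ℤ) (λ _ → c) (λ t → + 2 * + N * (𝟙 (unused f t) * d V t)) (λ _ → +≤+ z≤n) (subst (0ℤ <_) (sym (∑-ones N)) 0<N)
         (subst₂ _≤_ (sym (trans (∑-cong {N} λ _ → ℤ.*-identityˡ c) (∑-const N c))) (sym (trans (∑-cong λ t → ℤ.*-identityˡ (+ 2 * + N * (𝟙 (unused f t) * d V t))) (trans (∑-*ˡ (+ 2 * + N) (λ t → 𝟙 (unused f t) * d V t)) (double-assoc (+ N) (∑[ t < N ] (𝟙 (unused f t) * d V t))))))
           (*-monoˡ (+ N) (+≤+ z≤n) (unused-mass f V)))
       t : Fin N
       t = proj₁ found
       un : unused f t ≡ true
       un = 0<𝟙* (unused f t) (0<*⁻ (+ 2 * + N) (*-0≤ {+ 2} {+ N} (+≤+ z≤n) (+≤+ z≤n)) (ℤ.<-≤-trans (0<* 0<V 0<N-i) (proj₂ (proj₂ found))))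
       f' : Fin (suc i) → Fin N
       f' zero = t
       f' (suc j) = f j
       V' : Fin L → Bool
       V' y = V y ∧ edge t y
       inj' : ∀ j j' → f' j ≡ f' j' → j ≡ j'
       inj' zero zero _ = refl
       inj' zero (suc j') e = ⊥-elim (unused⇒ f t un j' (sym e))
       inj' (suc j) zero e = ⊥-elim (unused⇒ f t un j e)
       inj' (suc j) (suc j') e = cong suc (proj₁ (proj₂ (proj₂ rec)) j j' e)
       com' : Common f' V'
       com' zero y e = ∧-right (V y) e
       com' (suc j) y e = proj₁ (proj₂ (proj₂ (proj₂ rec))) j y (∧-left e)
       step : count V * (+ N - + 2 * + i) ≤ + 2 * + N * count V'
       step = subst (λ z → c ≤ + 2 * + N * z) (trans (cong (λ b → 𝟙 b * d V t) un) (ℤ.*-identityˡ (d V t))) (proj₂ (proj₂ found))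
       inv' : + L * (+ N - + 2 * (+ a * + suc i)) ≤ (+ 2) ^ suc i * (+ N * count V')
       inv' = phase₁-step (+ N) (+ L) (+ a) (+ i) ((+ 2) ^ i) (count V) (count V') 0<N (+≤+ z≤n) (+≤+ z≤n) (0≤^ {+ 2} i (+≤+ z≤n)) i≤a 0<N-i step inv

   -- A lower bound for the number of rows in U taken together with an ordered r-tuple of distinct
   -- neighbours in V, the quantity that is counted twice.
   Ψ : ℕ → (Fin L → Bool) → (Fin N → Bool) → ℤ
   Ψ r V U = ∑[ t < N ] (𝟙 (U t) * Φ r (d V t))

   _∖_ : (Fin L → Bool) → Fin L → Fin L → Bool
   (V ∖ y) z = V z ∧ not (does (y ≟ z))

   _⊓_ : (Fin N → Bool) → Fin L → Fin N → Bool
   (U ⊓ y) t = U t ∧ edge t y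

   d-∖ : ∀ V y t → V y ≡ true → edge t y ≡ true → d (V ∖ y) t ≡ d V t - 1ℤ
   d-∖ V y t vy ey = trans (∑-cong point) (trans (∑-sub (λ z → 𝟙 (V z ∧ edge t z)) (δ y)) (cong (λ z → d V t - z) (∑-δ1 y)))
     where
     point : ∀ z → 𝟙 ((V ∖ y) z ∧ edge t z) ≡ 𝟙 (V z ∧ edge t z) - δ y z
     point z with y ≟ z
     ... | yes refl = trans (cong₂ (λ a b → 𝟙 ((a ∧ false) ∧ b)) vy ey) (sym (cong₂ (λ a b → 𝟙 (a ∧ b) - 1ℤ) vy ey))
     ... | no _ = trans (cong (λ a → 𝟙 (a ∧ edge t z)) (∧-identity (V z))) (sym (ℤ.+-identityʳ (𝟙 (V z ∧ edge t z))))

   ∖-≢ : ∀ V y z → (V ∖ y) z ≡ true → y ≢ z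
   ∖-≢ V y z e q with y ≟ z | ∧-right (V z) e
   ... | no h | _ = h q

   -- Split off the first column y of the tuple: the rows must then see y, and y leaves V.
   -- Exchanging the sums groups the terms by y.
   Ψ-step : ∀ r V U → Ψ (suc r) V U ≤ ∑[ y < L ] (𝟙 (V y) * Ψ r (V ∖ y) (U ⊓ y))
   Ψ-step r V U = subst (Ψ (suc r) V U ≤_) (trans (∑-comm (λ t y → 𝟙 (V y) * (𝟙 ((U ⊓ y) t) * Φ r (d (V ∖ y) t)))) (∑-cong λ y → ∑-*ˡ (𝟙 (V y)) (λ t → 𝟙 ((U ⊓ y) t) * Φ r (d (V ∖ y) t)))) (∑-mono λ t →
       subst (𝟙 (U t) * Φ (suc r) (d V t) ≤_) (e t) (*-monoˡ {Φ (suc r) (d V t)} {d V t * Φ r (d V t - 1ℤ)} (𝟙 (U t)) (0≤𝟙 (U t)) (Φ-step r (d V t) (0≤d V t))))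
     where
     e : ∀ t → 𝟙 (U t) * (d V t * Φ r (d V t - 1ℤ)) ≡ ∑[ y < L ] (𝟙 (V y) * (𝟙 ((U ⊓ y) t) * Φ r (d (V ∖ y) t)))
     e t = trans (cong (𝟙 (U t) *_) (sym (∑-*ʳ (Φ r (d V t - 1ℤ)) (λ y → 𝟙 (V y ∧ edge t y))))) (trans (sym (∑-*ˡ (𝟙 (U t)) (λ y → 𝟙 (V y ∧ edge t y) * Φ r (d V t - 1ℤ)))) (∑-cong point))
       where
       alg : ∀ v u b p q → (v ≡ true → b ≡ true → p ≡ q) → 𝟙 u * (𝟙 (v ∧ b) * p) ≡ 𝟙 v * (𝟙 (u ∧ b) * q)
       alg true true true p q h = cong (λ z → 1ℤ * (1ℤ * z)) (h refl refl)
       alg true true false p q h = cong (1ℤ *_) (trans (ℤ.*-zeroˡ p) (sym (ℤ.*-zeroˡ q)))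
       alg true false b p q h = trans (ℤ.*-zeroˡ (𝟙 b * p)) (sym (trans (ℤ.*-identityˡ (0ℤ * q)) (ℤ.*-zeroˡ q)))
       alg false true b p q h = trans (ℤ.*-identityˡ (0ℤ * p)) (trans (ℤ.*-zeroˡ p) (sym (ℤ.*-zeroˡ (𝟙 b * q))))
       alg false false b p q h = trans (ℤ.*-zeroˡ (0ℤ * p)) (sym (ℤ.*-zeroˡ (0ℤ * q)))
       point : ∀ y → 𝟙 (U t) * (𝟙 (V y ∧ edge t y) * Φ r (d V t - 1ℤ)) ≡ 𝟙 (V y) * (𝟙 ((U ⊓ y) t) * Φ r (d (V ∖ y) t))
       point y = alg (V y) (U t) (edge t y) (Φ r (d V t - 1ℤ)) (Φ r (d (V ∖ y) t)) λ vy ey → cong (Φ r) (sym (d-∖ V y t vy ey))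

   opaque
     -- Columns are picked one at a time, each keeping at least a share 1/C of Ψ. After r choices Ψ
     -- has become the number of surviving rows.
     phase₂ : ∀ r C V U → 0ℤ ≤ C → count V ≤ C → 0ℤ < Ψ r V U →
       ∃ λ (B : Fin r → Fin L) → ∃ λ U' → (∀ j j' → B j ≡ B j' → j ≡ j') × (∀ j → V (B j) ≡ true) × U' ⊆ U × (∀ t j → U' t ≡ true → edge t (B j) ≡ true) × Ψ r V U ≤ C ^ r * count U'
     phase₂ zero C V U _ _ _ = (λ ()) , U , (λ ()) , (λ ()) , (λ _ e → e) , (λ _ ()) , ℤ.≤-reflexive (trans (∑-cong λ t → trans (cong (𝟙 (U t) *_) (Φ-zero (d V t))) (ℤ.*-identityʳ (𝟙 (U t)))) (sym (ℤ.*-identityˡ (count U))))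
     phase₂ (suc r) C V U 0≤C cV 0<Ψ = B , proj₁ (proj₂ rec) , inj , on , (λ t e → ∧-left (sub t e)) , common , bound
       where
       W : Fin L → ℤ
       W y = Ψ r (V ∖ y) (U ⊓ y)
       0≤W : ∀ y → 0ℤ ≤ W y
       0≤W y = ∑-0≤ λ t → *-0≤ (0≤𝟙 ((U ⊓ y) t)) (0≤Φ r (d (V ∖ y) t))
       some : ∃ λ y → 0ℤ < 𝟙 (V y) * W y
       some = ∑-pos (λ y → 𝟙 (V y) * W y) (ℤ.<-≤-trans 0<Ψ (Ψ-step r V U))
       0<V : 0ℤ < count V
       0<V = ℤ.<-≤-trans (subst (λ b → 0ℤ < 𝟙 b) (sym (0<𝟙* (V (proj₁ some)) (proj₂ some))) (+<+ (s≤s z≤n))) (∑-term (λ y → 0≤𝟙 (V y)) (proj₁ some))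
       found : ∃ λ y → 0ℤ < 𝟙 (V y) × Ψ (suc r) V U ≤ C * W y
       found = ∑-avg (λ y → 𝟙 (V y)) (λ _ → Ψ (suc r) V U) (λ y → C * W y) (λ y → 0≤𝟙 (V y)) 0<V
         (subst₂ _≤_ (sym (∑-*ʳ (Ψ (suc r) V U) (λ y → 𝟙 (V y)))) (sym (trans (∑-cong λ y → *-left-comm (𝟙 (V y)) C (W y)) (∑-*ˡ C (λ y → 𝟙 (V y) * W y)))) (*-mono {count V} {C} {Ψ (suc r) V U} {∑[ y < L ] (𝟙 (V y) * W y)} (0≤count V) (∑-0≤ λ y → *-0≤ (0≤𝟙 (V y)) (0≤W y)) cV (Ψ-step r V U)))
       y : Fin L
       y = proj₁ found
       vy : V y ≡ true
       vy = 0<𝟙* (V y) (subst (0ℤ <_) (sym (ℤ.*-identityʳ (𝟙 (V y)))) (proj₁ (proj₂ found)))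
       cV' : count (V ∖ y) ≤ C
       cV' = ℤ.≤-trans (∑-mono λ z → mono (V z) (not (does (y ≟ z)))) cV
         where
         mono : ∀ a b → 𝟙 (a ∧ b) ≤ 𝟙 a
         mono true b = 𝟙≤1 b
         mono false b = ℤ.≤-refl
       rec : ∃ λ (B : Fin r → Fin L) → ∃ λ U' → (∀ j j' → B j ≡ B j' → j ≡ j') × (∀ j → (V ∖ y) (B j) ≡ true) × U' ⊆ (U ⊓ y) × (∀ t j → U' t ≡ true → edge t (B j) ≡ true) × Ψ r (V ∖ y) (U ⊓ y) ≤ C ^ r * count U'
       rec = phase₂ r C (V ∖ y) (U ⊓ y) 0≤C cV' (0<*⁻ C 0≤C (ℤ.<-≤-trans 0<Ψ (proj₂ (proj₂ found))))
       B : Fin (suc r) → Fin L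
       B zero = y
       B (suc j) = proj₁ rec j
       in∖ : ∀ j → (V ∖ y) (proj₁ rec j) ≡ true
       in∖ = proj₁ (proj₂ (proj₂ (proj₂ rec)))
       y≢ : ∀ j → y ≢ proj₁ rec j
       y≢ j = ∖-≢ V y (proj₁ rec j) (in∖ j)
       inj : ∀ j j' → B j ≡ B j' → j ≡ j'
       inj zero zero _ = refl
       inj zero (suc j') e = ⊥-elim (y≢ j' e)
       inj (suc j) zero e = ⊥-elim (y≢ j (sym e))
       inj (suc j) (suc j') e = cong suc (proj₁ (proj₂ (proj₂ rec)) j j' e)
       on : ∀ j → V (B j) ≡ true
       on zero = vy
       on (suc j) = ∧-left (in∖ j)
       sub : proj₁ (proj₂ rec) ⊆ (U ⊓ y)
       sub = proj₁ (proj₂ (proj₂ (proj₂ (proj₂ rec))))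
       common : ∀ t j → proj₁ (proj₂ rec) t ≡ true → edge t (B j) ≡ true
       common t zero e = ∧-right (U t) (sub t e)
       common t (suc j) e = proj₁ (proj₂ (proj₂ (proj₂ (proj₂ (proj₂ rec))))) t j e
       bound : Ψ (suc r) V U ≤ C ^ suc r * count (proj₁ (proj₂ rec))
       bound = ℤ.≤-trans (proj₂ (proj₂ found)) (subst (C * W y ≤_) (sym (ℤ.*-assoc C (C ^ r) (count (proj₁ (proj₂ rec))))) (*-monoˡ {W y} {C ^ r * count (proj₁ (proj₂ rec))} C 0≤C (proj₂ (proj₂ (proj₂ (proj₂ (proj₂ (proj₂ rec))))))))

 ^-*-distrib : ∀ x y a → (x * y) ^ a ≡ x ^ a * y ^ a
 ^-*-distrib x y zero = refl
 ^-*-distrib x y (suc a) = trans (cong (x * y *_) (^-*-distrib x y a)) (l x y (x ^ a) (y ^ a))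
   where
   l : ∀ x y p q → x * y * (p * q) ≡ x * p * (y * q)
   l = solve-∀

 half-power-identity : ∀ M m a p q s → M * (+ 2 * q) ≡ M * p + (+ 2 * (M * (q - (p + s * (+ 2 * m - M)))) + + 2 * ((+ 2 * m - M) * (M * s - a * p)) + p * (M - + 2 * (a * (M - + 2 * m))))
 half-power-identity = solve-∀

 -- Bernoulli's inequality: 2 m falls short of M by at most a fraction 1/(2 a), so (2 m / M)^a is at
 -- least 1/2.
 half-power : ∀ M m a → 0ℤ < M → 0ℤ ≤ m → + 2 * (+ a * (M - + 2 * m)) ≤ M → M ^ a ≤ + 2 * ((+ 2) ^ a * m ^ a)
 half-power M m a 0<M 0≤m h = subst (λ z → M ^ a ≤ + 2 * z) (^-*-distrib (+ 2) m a) (*-cancelˡ M 0<M (≤-cert (+ 2 * (M * ((+ 2 * m) ^ a - (M ^ a + slope M a * (+ 2 * m - M)))) + + 2 * ((+ 2 * m - M) * (M * slope M a - + a * M ^ a)) + M ^ a * (M - + 2 * (+ a * (M - + 2 * m))))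
     (0≤+ (0≤+ (*-0≤ {+ 2} (+≤+ z≤n) (*-0≤ (ℤ.<⇒≤ 0<M) (≤-diff (tangent M (+ 2 * m) a (ℤ.<⇒≤ 0<M) (*-0≤ {+ 2} (+≤+ z≤n) 0≤m))))) (ℤ.≤-reflexive (sym zero'))) (*-0≤ (0≤^ a (ℤ.<⇒≤ 0<M)) (≤-diff h)))
     (half-power-identity M m (+ a) (M ^ a) ((+ 2 * m) ^ a) (slope M a))))
   where
   zero' : + 2 * ((+ 2 * m - M) * (M * slope M a - + a * M ^ a)) ≡ 0ℤ
   zero' = trans (cong (λ z → + 2 * ((+ 2 * m - M) * (z - + a * M ^ a))) (slope-eq M a)) (l (+ 2 * m - M) (+ a * M ^ a))
     where
     l : ∀ x y → + 2 * (x * (y - y)) ≡ 0ℤ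
     l = solve-∀

 finish-identity : ∀ W u u' p q → p * (+ 2 * W * u') ≡ p * u + (+ 2 * (W * (p * u' - q * u)) + u * (+ 2 * (W * q) - p))
 finish-identity = solve-∀

 -- W = 2ᵃ, p = Mᵃ, q = mᵃ
 finish : ∀ W u u' p q → 0ℤ < p → 0ℤ ≤ W → 0ℤ ≤ u → q * u ≤ p * u' → p ≤ + 2 * (W * q) → u ≤ + 2 * W * u'
 finish W u u' p q 0<p 0≤W 0≤u h₁ h₂ = *-cancelˡ p 0<p (≤-cert (+ 2 * (W * (p * u' - q * u)) + u * (+ 2 * (W * q) - p)) (0≤+ (*-0≤ {+ 2} (+≤+ z≤n) (*-0≤ 0≤W (≤-diff h₁))) (*-0≤ 0≤u (≤-diff h₂))) (finish-identity W u u' p q))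

 large-identity : ∀ N L W v A K → + 2 * (W * (N * v)) ≡ N * L + (+ 2 * (W * (N * v) - L * (N - + 2 * (A * K))) + L * (N - + 4 * (A * K)))
 large-identity = solve-∀

 large : ∀ N L W v A K M → 0ℤ < N → 0ℤ < W → 0ℤ ≤ L → + 4 * (A * K) ≤ N → L * (N - + 2 * (A * K)) ≤ W * (N * v) → + 2 * W * M ≤ L → M ≤ v
 large N L W v A K M 0<N 0<W 0≤L h₁ h₂ h₃ = *-cancelˡ {M} {v} (+ 2 * W) (0<* {+ 2} (+<+ (s≤s z≤n)) 0<W) (ℤ.≤-trans h₃ (*-cancelˡ {L} {+ 2 * W * v} N 0<N (subst (N * L ≤_) (l N W v)
     (≤-cert (+ 2 * (W * (N * v) - L * (N - + 2 * (A * K))) + L * (N - + 4 * (A * K))) (0≤+ (*-0≤ {+ 2} (+≤+ z≤n) (≤-diff h₂)) (*-0≤ 0≤L (≤-diff h₁))) (large-identity N L W v A K)))))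
   where
   l : ∀ N W v → + 2 * (W * (N * v)) ≡ N * (+ 2 * W * v)
   l = solve-∀

 mean-identity : ∀ N K m A S u → + 2 * S ≡ + 2 * ((m + A) * u) + ((+ 2 * S - + 2 * (m + A + 1ℤ) * (N - + 2 * K)) + + 2 * ((m + A) * (N - u)) + + 2 * (N - K * (+ 2 * (m + A + 1ℤ))))
 mean-identity = solve-∀

 mean : ∀ N K m A S u → 0ℤ ≤ m + A → + 2 * (m + A + 1ℤ) * (N - + 2 * K) ≤ + 2 * S → u ≤ N → K * (+ 2 * (m + A + 1ℤ)) ≤ N → (m + A) * u ≤ S
 mean N K m A S u 0≤m h₁ h₂ h₃ = *-cancelˡ {(m + A) * u} {S} (+ 2) (+<+ (s≤s z≤n)) (≤-cert ((+ 2 * S - + 2 * (m + A + 1ℤ) * (N - + 2 * K)) + + 2 * ((m + A) * (N - u)) + + 2 * (N - K * (+ 2 * (m + A + 1ℤ))))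
   (0≤+ (0≤+ (≤-diff h₁) (*-0≤ {+ 2} (+≤+ z≤n) (*-0≤ 0≤m (≤-diff h₂)))) (*-0≤ {+ 2} (+≤+ z≤n) (≤-diff h₃))) (mean-identity N K m A S u))

 weighted-tangent : ∀ b m x a s → 0ℤ ≤ m → 0ℤ ≤ s → s ≡ slope m a → ∀ A → 𝟙 b * m ^ a + s * (𝟙 b * x - (m + A) * 𝟙 b) ≤ 𝟙 b * trunc (x - A) ^ a
 weighted-tangent false m x a s _ _ _ A = ℤ.≤-reflexive (l (m ^ a) s x (m + A) (trunc (x - A) ^ a))
   where
   l : ∀ p s x y t → 0ℤ * p + s * (0ℤ * x - y * 0ℤ) ≡ 0ℤ * t
   l = solve-∀
 weighted-tangent true m x a s 0≤m 0≤s s≡ A = subst₂ _≤_ (l₁ (m ^ a) s x m A) (sym (ℤ.*-identityˡ (trunc (x - A) ^ a))) (ℤ.≤-trans (ℤ.+-monoʳ-≤ (m ^ a) (*-monoˡ {x - A - m} {trunc (x - A) - m} s 0≤s (ℤ.+-monoˡ-≤ (- m) (≤trunc (x - A)))))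
     (subst (λ s → m ^ a + s * (trunc (x - A) - m) ≤ trunc (x - A) ^ a) (sym s≡) (tangent m (trunc (x - A)) a 0≤m (0≤trunc (x - A)))))
   where
   l₁ : ∀ p s x m A → p + s * (x - A - m) ≡ 1ℤ * p + s * (1ℤ * x - (m + A) * 1ℤ)
   l₁ = solve-∀

 record BicliqueIn {N L} (D : Design N L) (a : ℕ) : Set where
   field
     A : Fin a → Fin N
     B : Fin a → Fin L
     A-inj : ∀ i j → A i ≡ A j → i ≡ j
     B-inj : ∀ i j → B i ≡ B j → i ≡ j
     edges : ∀ i j → Design.edge D (A i) (B j) ≡ true

 -- The rows of the biclique are k₀ chosen greedily and h found by averaging. The averaging keeps a
 -- share 1/(2 · 2^a) of the rows and has to leave only h of them, so that N of size 2 · 2^a h + k₀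
 -- is enough where averaging alone would ask for about 2 · 2^a a.
 module _ {N L} (D : Design N L) (0<N : 0ℤ < + N) (k₀ h m M : ℕ) (0<m : 0ℤ < + m) (M≡ : + M ≡ + 2 * (+ m + + (k₀ ℕ.+ h) + 1ℤ)) (room : + 2 * (+ (k₀ ℕ.+ h) * (+ M - + 2 * + m)) ≤ + M)
     (h₁ : + 4 * (+ (k₀ ℕ.+ h) * + (k₀ ℕ.+ h)) < + N) (h₂ : + (k₀ ℕ.+ h) * + M ≤ + N) (h₃ : + 2 * (+ 2) ^ k₀ * + M ≤ + L) (h₄ : + 2 * (+ 2) ^ (k₀ ℕ.+ h) * + h ≤ + N - + k₀) (k₀<N : 0ℤ < + N - + k₀) where
   open Design D
   open Biclique D 0<N

   a : ℕ
   a = k₀ ℕ.+ h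

   k₀≤a : + k₀ ≤ + a
   k₀≤a = +≤+ (ℕ.m≤m+n k₀ h)

   0<M : 0ℤ < + M
   0<M = subst (0ℤ <_) (sym M≡) (0<* {+ 2} {+ m + + a + 1ℤ} (+<+ (s≤s z≤n)) (+<+ (subst (0 ℕ.<_) (ℕ.+-comm 1 (m ℕ.+ a)) (s≤s z≤n))))

   0<L : 0ℤ < + L
   0<L = ℤ.<-≤-trans (0<* (0<* {+ 2} (+<+ (s≤s z≤n)) (0<^ {+ 2} k₀ (+<+ (s≤s z≤n)))) 0<M) h₃

   first : ∃ λ (f : Fin k₀ → Fin N) → ∃ λ V → (∀ j j' → f j ≡ f j' → j ≡ j') × Common f V × + L * (+ N - + 2 * (+ a * + k₀)) ≤ (+ 2) ^ k₀ * (+ N * count V)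
   first = phase₁ a k₀ (ℕ.m≤m+n k₀ h) (pos (+ N) (+ a * + a) h₁ (0≤sq (+ a))) 0<L
     where
     pos : ∀ n x → + 4 * x < n → 0ℤ ≤ x → 0ℤ < n - + 2 * x
     pos n x q 0≤x = ℤ.<-≤-trans (subst (_< n - + 4 * x) (ℤ.+-inverseʳ (+ 4 * x)) (ℤ.+-monoˡ-< (- (+ 4 * x)) q)) (≤-cert (+ 2 * x) (*-0≤ {+ 2} (+≤+ z≤n) 0≤x) (l n x))
       where
       l : ∀ n x → n - + 2 * x ≡ (n - + 4 * x) + + 2 * x
       l = solve-∀

   f : Fin k₀ → Fin N
   f = proj₁ first

   U : Fin N → Bool
   U = unused f

   trimmed : ∃ λ V → V ⊆ proj₁ (proj₂ first) × count V ≡ + M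
   trimmed = trim (proj₁ (proj₂ first)) M (large (+ N) (+ L) ((+ 2) ^ k₀) (count (proj₁ (proj₂ first))) (+ a) (+ k₀) (+ M) 0<N (0<^ {+ 2} k₀ (+<+ (s≤s z≤n))) (+≤+ z≤n)
     (ℤ.≤-trans (*-monoˡ (+ 4) (+≤+ z≤n) (*-monoˡ (+ a) (+≤+ z≤n) k₀≤a)) (ℤ.<⇒≤ h₁)) (proj₂ (proj₂ (proj₂ (proj₂ first)))) h₃)

   V : Fin L → Bool
   V = proj₁ trimmed

   U≤N : count U ≤ + N
   U≤N = subst (count U ≤_) (∑-ones N) (∑-mono λ t → 𝟙≤1 (U t))

   U≥ : + N - + k₀ ≤ count U
   U≥ = subst (_≤ count U) (trans (∑-sub (λ _ → 1ℤ) (λ t → ∑[ j < k₀ ] δ (f j) t)) (cong₂ _-_ (∑-ones N) (trans (∑-comm (λ t j → δ (f j) t)) (trans (∑-cong λ j → ∑-δ1 (f j)) (∑-ones k₀))))) (∑-mono (unused-≥ f))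

   mass : (+ m + + a) * count U ≤ (∑[ t < N ] (𝟙 (U t) * d V t))
   mass = mean (+ N) (+ k₀) (+ m) (+ a) (∑[ t < N ] (𝟙 (U t) * d V t)) (count U) (+≤+ z≤n) (subst (λ z → z * (+ N - + 2 * + k₀) ≤ + 2 * (∑[ t < N ] (𝟙 (U t) * d V t))) (trans (proj₂ (proj₂ trimmed)) M≡) (unused-mass f V)) U≤N
     (ℤ.≤-trans (subst (λ z → + k₀ * z ≤ + a * + M) M≡ (*-monoʳ (+ M) (+≤+ z≤n) k₀≤a)) h₂)

   s : ℤ
   s = slope (+ m) a

   0≤s : 0ℤ ≤ s
   0≤s = 0≤slope a (+≤+ z≤n)

   -- Jensen's inequality through the tangent at m: the linear term is nonnegative in total, because
   -- `d V` has mean at least m + a over U.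
   Ψ≥ : (+ m) ^ a * count U ≤ Ψ a V U
   Ψ≥ = ℤ.≤-trans (subst ((+ m) ^ a * count U ≤_) (sym e) (≤-cert (s * ((∑[ t < N ] (𝟙 (U t) * d V t)) - (+ m + + a) * count U)) (*-0≤ 0≤s (≤-diff mass)) (cong (_+ s * ((∑[ t < N ] (𝟙 (U t) * d V t)) - (+ m + + a) * count U)) (ℤ.*-comm (count U) ((+ m) ^ a)))))
       (∑-mono λ t → subst (λ z → 𝟙 (U t) * (+ m) ^ a + s * (𝟙 (U t) * d V t - (+ m + + a) * 𝟙 (U t)) ≤ 𝟙 (U t) * z) (sym (Φ-def a (d V t))) (weighted-tangent (U t) (+ m) (d V t) a s (+≤+ z≤n) 0≤s refl (+ a)))
     where
     e : ∑[ t < N ] (𝟙 (U t) * (+ m) ^ a + s * (𝟙 (U t) * d V t - (+ m + + a) * 𝟙 (U t))) ≡ count U * (+ m) ^ a + s * ((∑[ t < N ] (𝟙 (U t) * d V t)) - (+ m + + a) * count U)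
     e = trans (∑-+ (λ t → 𝟙 (U t) * (+ m) ^ a) (λ t → s * (𝟙 (U t) * d V t - (+ m + + a) * 𝟙 (U t)))) (cong₂ _+_ (∑-*ʳ ((+ m) ^ a) (λ t → 𝟙 (U t)))
       (trans (∑-*ˡ s (λ t → 𝟙 (U t) * d V t - (+ m + + a) * 𝟙 (U t))) (cong (s *_) (trans (∑-sub (λ t → 𝟙 (U t) * d V t) (λ t → (+ m + + a) * 𝟙 (U t))) (cong (λ z → (∑[ t < N ] (𝟙 (U t) * d V t)) - z) (∑-*ˡ (+ m + + a) (λ t → 𝟙 (U t))))))))

   second : ∃ λ (B : Fin a → Fin L) → ∃ λ U' → (∀ j j' → B j ≡ B j' → j ≡ j') × (∀ j → V (B j) ≡ true) × U' ⊆ U × (∀ t j → U' t ≡ true → edge t (B j) ≡ true) × Ψ a V U ≤ (+ M) ^ a * count U'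
   second = phase₂ a (+ M) V U (+≤+ z≤n) (ℤ.≤-reflexive (proj₂ (proj₂ trimmed))) (ℤ.<-≤-trans (0<* (0<^ a 0<m) (ℤ.<-≤-trans k₀<N U≥)) Ψ≥)

   U' : Fin N → Bool
   U' = proj₁ (proj₂ second)

   enough : + h ≤ count U'
   enough = *-cancelˡ {+ h} {count U'} (+ 2 * (+ 2) ^ a) (0<* {+ 2} (+<+ (s≤s z≤n)) (0<^ {+ 2} a (+<+ (s≤s z≤n)))) (ℤ.≤-trans h₄ (ℤ.≤-trans U≥
     (finish ((+ 2) ^ a) (count U) (count U') ((+ M) ^ a) ((+ m) ^ a) (0<^ a 0<M) (0≤^ {+ 2} a (+≤+ z≤n)) (0≤count U) (ℤ.≤-trans Ψ≥ (proj₂ (proj₂ (proj₂ (proj₂ (proj₂ (proj₂ second))))))) (half-power (+ M) (+ m) a 0<M (+≤+ z≤n) room))))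

   rest : ∃ λ (g : Fin h → Fin N) → (∀ i j → g i ≡ g j → i ≡ j) × (∀ i → U' (g i) ≡ true)
   rest = pick U' h enough

   bicliqueIn : BicliqueIn D a
   bicliqueIn = record { A = λ i → at (splitAt k₀ i) ; B = proj₁ second ; A-inj = λ i j e → trans (sym (join-splitAt k₀ h i)) (trans (cong (join k₀ h) (at-inj (splitAt k₀ i) (splitAt k₀ j) e)) (join-splitAt k₀ h j))
       ; B-inj = proj₁ (proj₂ (proj₂ second)) ; edges = λ i j → at-edge (splitAt k₀ i) j }
     where
     at : Fin k₀ ⊎ Fin h → Fin N
     at = [ f , proj₁ rest ]′
     fresh : ∀ i j → f i ≢ proj₁ rest j
     fresh i j = unused⇒ f (proj₁ rest j) (proj₁ (proj₂ (proj₂ (proj₂ (proj₂ second)))) _ (proj₂ (proj₂ rest) j)) i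
     at-inj : ∀ i j → at i ≡ at j → i ≡ j
     at-inj (inj₁ i) (inj₁ j) e = cong inj₁ (proj₁ (proj₂ (proj₂ first)) i j e)
     at-inj (inj₁ i) (inj₂ j) e = ⊥-elim (fresh i j e)
     at-inj (inj₂ i) (inj₁ j) e = ⊥-elim (fresh j i (sym e))
     at-inj (inj₂ i) (inj₂ j) e = cong inj₂ (proj₁ (proj₂ rest) i j e)
     at-edge : ∀ i j → edge (at i) (proj₁ second j) ≡ true
     at-edge (inj₁ i) j = proj₁ (proj₂ (proj₂ (proj₂ first))) i _ (proj₁ (proj₂ trimmed) _ (proj₁ (proj₂ (proj₂ (proj₂ second))) j))
     at-edge (inj₂ i) j = proj₁ (proj₂ (proj₂ (proj₂ (proj₂ (proj₂ second))))) _ j (proj₂ (proj₂ rest) i)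

-- From patterns to induced subgraphs of Paley graphs

module Realisations where
 open import Defs hiding (Injective)
 open Characters
 open Universality
 open LineModels using (LineModel)
 open HamiltonCycles using (next; next-<; next-last; last-or-<)
 open CyclePatterns using (isPair; CyclePattern)
 open Bicliques using (BicliqueIn)
 open import Data.Fin.Base using (splitAt; join; inject≤)
 open import Data.Fin.Properties using (_≟_; toℕ-injective; toℕ<n; toℕ-↑ˡ; toℕ-↑ʳ; join-splitAt; toℕ-inject≤; inject≤-injective)
 open import Data.Nat.Base using (_*_; _∸_; _≤_; _<_; _<ᵇ_)
 open import Data.Nat.Tactic.RingSolver using (solve-∀)

 bool-ext : ∀ {a b} → (a ≡ true → b ≡ true) → (b ≡ true → a ≡ true) → a ≡ b
 bool-ext {true} {true} _ _ = refl
 bool-ext {true} {false} f _ = sym (f refl)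
 bool-ext {false} {true} _ g = g refl
 bool-ext {false} {false} _ _ = refl

 ==-intro : ∀ {m n} → m ≡ n → (m == n) ≡ true
 ==-intro {m} refl = T⇒≡ (ℕ.≡⇒≡ᵇ m m refl)

 ==-elim : ∀ {m n} → (m == n) ≡ true → m ≡ n
 ==-elim {m} {n} e = ℕ.≡ᵇ⇒≡ m n (≡⇒T e)

 ∨-introˡ : ∀ {a} b → a ≡ true → a ∨ b ≡ true
 ∨-introˡ _ refl = refl

 ∨-introʳ : ∀ a {b} → b ≡ true → a ∨ b ≡ true
 ∨-introʳ true _ = refl
 ∨-introʳ false e = e

 ∨-elim : ∀ a {b} → a ∨ b ≡ true → a ≡ true ⊎ b ≡ true
 ∨-elim true _ = inj₁ refl
 ∨-elim false e = inj₂ e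

 ∧-intro : ∀ {a b} → a ≡ true → b ≡ true → a ∧ b ≡ true
 ∧-intro refl refl = refl

 ∧-elim : ∀ a {b} → a ∧ b ≡ true → a ≡ true × b ≡ true
 ∧-elim true e = refl , e

 PathAdj : ℕ → ℕ → Set
 PathAdj i j = suc i ≡ j ⊎ suc j ≡ i

 CycleAdj : ℕ → ℕ → ℕ → Set
 CycleAdj k i j = suc i ≡ j ⊎ suc j ≡ i ⊎ (i ≡ 0 × j ≡ k ∸ 1) ⊎ (j ≡ 0 × i ≡ k ∸ 1)

 path-intro : ∀ k (i j : Fin k) → PathAdj (toℕ i) (toℕ j) → adj (Path k) i j ≡ true
 path-intro k i j (inj₁ e) = ∨-introˡ _ (==-intro e)
 path-intro k i j (inj₂ e) = ∨-introʳ (suc (toℕ i) == toℕ j) (==-intro e)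

 path-elim : ∀ k (i j : Fin k) → adj (Path k) i j ≡ true → PathAdj (toℕ i) (toℕ j)
 path-elim k i j e with ∨-elim (suc (toℕ i) == toℕ j) e
 ... | inj₁ p = inj₁ (==-elim p)
 ... | inj₂ p = inj₂ (==-elim p)

 cycle-intro : ∀ k (i j : Fin k) → CycleAdj k (toℕ i) (toℕ j) → adj (Cycle k) i j ≡ true
 cycle-intro k i j (inj₁ e) = ∨-introˡ _ (==-intro e)
 cycle-intro k i j (inj₂ (inj₁ e)) = ∨-introʳ (suc (toℕ i) == toℕ j) (∨-introˡ _ (==-intro e))
 cycle-intro k i j (inj₂ (inj₂ (inj₁ (e , e')))) = ∨-introʳ (suc (toℕ i) == toℕ j) (∨-introʳ (suc (toℕ j) == toℕ i) (∨-introˡ _ (∧-intro (==-intro e) (==-intro e'))))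
 cycle-intro k i j (inj₂ (inj₂ (inj₂ (e , e')))) = ∨-introʳ (suc (toℕ i) == toℕ j) (∨-introʳ (suc (toℕ j) == toℕ i) (∨-introʳ ((toℕ i == 0) ∧ (toℕ j == (k ∸ 1))) (∧-intro (==-intro e) (==-intro e'))))

 cycle-elim : ∀ k (i j : Fin k) → adj (Cycle k) i j ≡ true → CycleAdj k (toℕ i) (toℕ j)
 cycle-elim k i j e with ∨-elim (suc (toℕ i) == toℕ j) e
 ... | inj₁ p = inj₁ (==-elim p)
 ... | inj₂ p with ∨-elim (suc (toℕ j) == toℕ i) p
 ...   | inj₁ p' = inj₂ (inj₁ (==-elim p'))
 ...   | inj₂ p' with ∨-elim ((toℕ i == 0) ∧ (toℕ j == (k ∸ 1))) p'
 ...     | inj₁ q = let a , b = ∧-elim (toℕ i == 0) q in inj₂ (inj₂ (inj₁ (==-elim a , ==-elim b)))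
 ...     | inj₂ q = let a , b = ∧-elim (toℕ j == 0) q in inj₂ (inj₂ (inj₂ (==-elim a , ==-elim b)))

 cycle-sym : ∀ {k i j} → CycleAdj k i j → CycleAdj k j i
 cycle-sym (inj₁ e) = inj₂ (inj₁ e)
 cycle-sym (inj₂ (inj₁ e)) = inj₁ e
 cycle-sym (inj₂ (inj₂ (inj₁ e))) = inj₂ (inj₂ (inj₂ e))
 cycle-sym (inj₂ (inj₂ (inj₂ e))) = inj₂ (inj₂ (inj₁ e))

 -- With 2 ≤ k the closing edge between 0 and k - 1 is not a loop.
 cycle-simple : ∀ k → 2 ≤ k → IsSimple (Cycle k)
 cycle-simple k 2≤k = (λ u → not-true (irr u ∘ cycle-elim k u u)) , λ u v → bool-ext (λ e → cycle-intro k v u (cycle-sym {k} (cycle-elim k u v e))) (λ e → cycle-intro k u v (cycle-sym {k} (cycle-elim k v u e)))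
   where
   not-true : ∀ {b} → ¬ (b ≡ true) → b ≡ false
   not-true {true} h = ⊥-elim (h refl)
   not-true {false} _ = refl
   bad : ∀ {x} → x ≡ 0 → x ≡ k ∸ 1 → ⊥
   bad refl e with () ← ℕ.<⇒≢ (ℕ.≤-trans (s≤s z≤n) (ℕ.∸-monoˡ-≤ 1 2≤k)) e
   irr : ∀ u → ¬ CycleAdj k (toℕ u) (toℕ u)
   irr u (inj₁ e) = ℕ.1+n≢n e
   irr u (inj₂ (inj₁ e)) = ℕ.1+n≢n e
   irr u (inj₂ (inj₂ (inj₁ (e , e')))) = bad e e'
   irr u (inj₂ (inj₂ (inj₂ (e , e')))) = bad e e'

 K-simple : ∀ a b → IsSimple (K a b)
 K-simple a b = (λ u → same (toℕ u <ᵇ a)) , λ u v → comm (toℕ u <ᵇ a) (toℕ v <ᵇ a)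
   where
   same : ∀ x → x xor x ≡ false
   same true = refl
   same false = refl
   comm : ∀ x y → x xor y ≡ y xor x
   comm true true = refl
   comm true false = refl
   comm false true = refl
   comm false false = refl

 ⊑ᵢ-trans : ∀ {G H J} → G ⊑ᵢ H → H ⊑ᵢ J → G ⊑ᵢ J
 ⊑ᵢ-trans (f , fi , fa) (g , gi , ga) = (g ∘ f) , (λ x y e → fi x y (gi _ _ e)) , λ u v → trans (fa u v) (ga _ _)

 path-in-cycle : ∀ l k → l < k → Path l ⊑ᵢ Cycle k
 path-in-cycle l k l<k = f , (λ x y e → inject≤-injective l≤k l≤k x y e) , λ u v → bool-ext (λ e → cycle-intro k (f u) (f v) (up u v (path-elim l u v e))) (λ e → path-intro l u v (down u v (cycle-elim k (f u) (f v) e)))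
   where
   l≤k : l ≤ k
   l≤k = ℕ.<⇒≤ l<k
   f : Fin l → Fin k
   f i = inject≤ i l≤k
   tof : ∀ i → toℕ (f i) ≡ toℕ i
   tof i = toℕ-inject≤ i l≤k
   up : ∀ u v → PathAdj (toℕ u) (toℕ v) → CycleAdj k (toℕ (f u)) (toℕ (f v))
   up u v (inj₁ e) = inj₁ (trans (cong suc (tof u)) (trans e (sym (tof v))))
   up u v (inj₂ e) = inj₂ (inj₁ (trans (cong suc (tof v)) (trans e (sym (tof u)))))
   small : ∀ v → toℕ (f v) ≢ k ∸ 1
   small v e = ℕ.<⇒≱ (toℕ<n v) (subst (l ≤_) (trans (sym e) (tof v)) (ℕ.∸-monoˡ-≤ 1 l<k))
   down : ∀ u v → CycleAdj k (toℕ (f u)) (toℕ (f v)) → PathAdj (toℕ u) (toℕ v)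
   down u v (inj₁ e) = inj₁ (trans (cong suc (sym (tof u))) (trans e (tof v)))
   down u v (inj₂ (inj₁ e)) = inj₂ (trans (cong suc (sym (tof v))) (trans e (tof u)))
   down u v (inj₂ (inj₂ (inj₁ (_ , e)))) = ⊥-elim (small v e)
   down u v (inj₂ (inj₂ (inj₂ (_ , e)))) = ⊥-elim (small u e)

 -- Even positions of the cycle go to one line and odd positions to the other; p indexes the point
 -- there.
 Half : ℕ → ℕ → Set
 Half k i = (∃ λ (p : Fin k) → i ≡ 2 * toℕ p) ⊎ (∃ λ (p : Fin k) → i ≡ suc (2 * toℕ p))

 2*suc : ∀ k → 2 * suc k ≡ suc (suc (2 * k))
 2*suc = solve-∀

 halve : ∀ k i → i < 2 * k → Half k i
 halve (suc k) zero _ = inj₁ (zero , refl)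
 halve (suc k) (suc zero) _ = inj₂ (zero , refl)
 halve (suc k) (suc (suc i)) h with halve k i (ℕ.≤-pred (ℕ.≤-pred (subst (suc (suc i) <_) (2*suc k) h)))
 ... | inj₁ (p , e) = inj₁ (suc p , trans (cong (λ z → suc (suc z)) e) (sym (2*suc (toℕ p))))
 ... | inj₂ (p , e) = inj₂ (suc p , cong suc (trans (cong suc e) (sym (2*suc (toℕ p)))))

 even≢odd : ∀ a b → 2 * a ≢ suc (2 * b)
 even≢odd zero b ()
 even≢odd (suc a) zero e with () ← trans (sym (2*suc a)) e
 even≢odd (suc a) (suc b) e = even≢odd a b (ℕ.suc-injective (ℕ.suc-injective (trans (sym (2*suc a)) (trans e (cong suc (2*suc b))))))

 double-inj : ∀ {a b} → 2 * a ≡ 2 * b → a ≡ b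
 double-inj {a} {b} = ℕ.*-cancelˡ-≡ a b 2

 -- Cyclic orders of length 2 are excluded by 2 ≤ m. In longer ones the unordered pair of p and next
 -- p determines p.
 next²≢ : ∀ {m} → 2 ≤ m → (p : Fin (suc m)) → next (next p) ≢ p
 next²≢ {m} 2≤m p e with last-or-< p
 ... | inj₁ pl = ℕ.<⇒≢ 2≤m (trans (trans (cong suc (cong toℕ (sym (next-last p pl)))) (sym (next-< (next p) (subst (_< m) (sym (cong toℕ (next-last p pl))) (ℕ.≤-trans (s≤s z≤n) 2≤m))))) (trans (cong toℕ e) pl))
 ... | inj₂ p< with last-or-< (next p)
 ...   | inj₁ nl = ℕ.<⇒≢ 2≤m (trans (cong suc (trans (sym (cong toℕ (next-last (next p) nl))) (cong toℕ e))) (trans (sym (next-< p p<)) nl))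
 ...   | inj₂ n< = ℕ.<⇒≢ (ℕ.m≤n⇒m≤1+n ℕ.≤-refl) (trans (sym (cong toℕ e)) (trans (next-< (next p) n<) (cong suc (next-< p p<))))

 isPair-elim : ∀ {n} (a b w : Fin n) → isPair a b w ≡ true → w ≡ a ⊎ w ≡ b
 isPair-elim a b w e with w ≟ a | w ≟ b
 ... | yes p | _ = inj₁ p
 ... | no _ | yes p = inj₂ p

 isPair-left : ∀ {n} (a b : Fin n) → isPair a b a ≡ true
 isPair-left a b = ∨-introˡ _ (dec-true (a ≟ a) refl)

 isPair-right : ∀ {n} (a b : Fin n) → isPair a b b ≡ true
 isPair-right a b = ∨-introʳ (does (b ≟ a)) (dec-true (b ≟ b) refl)

 module Realise {r} (F : FieldOn r) (n c : ℕ) (n≡ : n ≡ suc (2 * c)) (r≡ : r ≡ n * n) {N l} (M : LineModel F N l) where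
   open SquareField F n c n≡ r≡
   open LineModel M

   χ-mixed : ∀ {t y} b → t ≢ inf → edge t y ≡ b → χ (vT t ⊕ ⊖ vL y) ≡ sg b × χ (vL y ⊕ ⊖ vT t) ≡ sg b
   χ-mixed b h e = trans (χ-swap _ _) e' , e'
     where e' = trans (vLT h) (cong sg e)

   module CycleOf {m} (2≤m : 2 ≤ m) (P : CyclePattern design m) where
     k : ℕ
     k = suc m

     A : Fin k → Fin N
     A = proj₁ P

     B : Fin k → Fin l
     B = proj₁ (proj₂ P)

     pat : ∀ i j → edge (A i) (B j) ≡ isPair j (next j) i
     pat = proj₂ (proj₂ P)

     -- The point at infinity has no edges, but A p has one; thus the balancing point never enters
     -- an embedding.
     A≢inf : ∀ p → A p ≢ inf
     A≢inf p e with () ← trans (sym (isPair-left p (next p))) (trans (sym (pat p p)) (trans (cong (λ t → edge t (B p)) e) (edge-inf (B p))))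

     apart : ∀ {p p'} → p ≢ p' → (p' ≡ p ⊎ p' ≡ next p) → (p ≡ p' ⊎ p ≡ next p') → ⊥
     apart h (inj₁ e) _ = h (sym e)
     apart h _ (inj₁ e) = h e
     apart {p} h (inj₂ e) (inj₂ e') = next²≢ 2≤m p (sym (trans e' (cong next e)))

     -- Equal points see the same columns, so each of p and p' would lie in the pair belonging to
     -- the other. As they differ, each would be the successor of the other, against `next²≢`.
     A-apart : ∀ {p p'} → p ≢ p' → A p ≢ A p'
     A-apart {p} {p'} h e = apart h (isPair-elim p (next p) p' (go p p' e)) (isPair-elim p' (next p') p (go p' p (sym e)))
       where
       go : ∀ p p' → A p ≡ A p' → isPair p (next p) p' ≡ true
       go p p' e = trans (sym (pat p' p)) (trans (cong (λ t → edge t (B p)) (sym e)) (trans (pat p p) (isPair-left p (next p))))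

     B-apart : ∀ {p p'} → p ≢ p' → B p ≢ B p'
     B-apart {p} {p'} h e = apart h (isPair-elim p (next p) p' (go p p' e)) (isPair-elim p' (next p') p (go p' p (sym e)))
       where
       go : ∀ p p' → B p ≡ B p' → isPair p (next p) p' ≡ true
       go p p' e = trans (sym (pat p' p)) (trans (cong (edge (A p')) e) (trans (pat p' p') (isPair-left p' (next p'))))

     at : ∀ {i} → Half k i → Fin r
     at (inj₁ (p , _)) = vT (A p)
     at (inj₂ (p , _)) = vL (B p)

     2k∸1 : 2 * k ∸ 1 ≡ suc (2 * m)
     2k∸1 = cong (_∸ 1) (2*suc m)

     double-suc : ∀ {a b} → b ≡ suc a → suc (suc (2 * a)) ≡ 2 * b
     double-suc {a} refl = sym (2*suc a)

     double-suc⁻¹ : ∀ {a b} → suc (suc (2 * a)) ≡ 2 * b → b ≡ suc a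
     double-suc⁻¹ {a} e = double-inj (trans (sym e) (double-suc {a} refl))

     mixed : ∀ {i j : Fin (2 * k)} (p p' : Fin k) → toℕ i ≡ 2 * toℕ p → toℕ j ≡ suc (2 * toℕ p') → isPair p' (next p') p ≡ adj (Cycle (2 * k)) i j
     mixed {i} {j} p p' ei ej = bool-ext (λ e → cycle-intro (2 * k) i j (subst₂ (CycleAdj (2 * k)) (sym ei) (sym ej) (to (isPair-elim p' (next p') p e)))) (λ e → from (subst₂ (CycleAdj (2 * k)) ei ej (cycle-elim (2 * k) i j e)))
       where
       to : p ≡ p' ⊎ p ≡ next p' → CycleAdj (2 * k) (2 * toℕ p) (suc (2 * toℕ p'))
       to (inj₁ refl) = inj₁ refl
       to (inj₂ refl) with last-or-< p'
       ... | inj₁ l' = inj₂ (inj₂ (inj₁ (cong (λ z → 2 * toℕ z) (next-last p' l') , trans (cong (λ z → suc (2 * z)) l') (sym 2k∸1))))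
       ... | inj₂ p'< = inj₂ (inj₁ (double-suc (next-< p' p'<)))
       from : CycleAdj (2 * k) (2 * toℕ p) (suc (2 * toℕ p')) → isPair p' (next p') p ≡ true
       from (inj₁ e) = subst (λ z → isPair p' (next p') z ≡ true) (toℕ-injective {i = p'} {j = p} (double-inj (sym (ℕ.suc-injective e)))) (isPair-left p' (next p'))
       from (inj₂ (inj₁ e)) = subst (λ z → isPair p' (next p') z ≡ true) (sym p≡) (isPair-right p' (next p'))
         where
         e' : toℕ p ≡ suc (toℕ p')
         e' = double-suc⁻¹ e
         p≡ : p ≡ next p'
         p≡ = toℕ-injective (trans e' (sym (next-< p' (ℕ.≤-pred (subst (_< k) e' (toℕ<n p))))))
       from (inj₂ (inj₂ (inj₁ (e , e')))) = subst (λ z → isPair p' (next p') z ≡ true) (sym p≡) (isPair-right p' (next p'))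
         where
         p≡ : p ≡ next p'
         p≡ = toℕ-injective (trans (double-inj {toℕ p} {0} e) (sym (cong toℕ (next-last p' (double-inj (ℕ.suc-injective (trans e' 2k∸1)))))))
       from (inj₂ (inj₂ (inj₂ (() , _))))

     same-even : ∀ {i j : Fin (2 * k)} (p p' : Fin k) → toℕ i ≡ 2 * toℕ p → toℕ j ≡ 2 * toℕ p' → adj (Cycle (2 * k)) i j ≡ false
     same-even {i} {j} p p' ei ej = bool-ext (λ e → ⊥-elim (bad (subst₂ (CycleAdj (2 * k)) ei ej (cycle-elim (2 * k) i j e)))) (λ ())
       where
       bad : ¬ CycleAdj (2 * k) (2 * toℕ p) (2 * toℕ p')
       bad (inj₁ e) = even≢odd (toℕ p') (toℕ p) (sym e)
       bad (inj₂ (inj₁ e)) = even≢odd (toℕ p) (toℕ p') (sym e)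
       bad (inj₂ (inj₂ (inj₁ (_ , e)))) = even≢odd (toℕ p') m (trans e 2k∸1)
       bad (inj₂ (inj₂ (inj₂ (_ , e)))) = even≢odd (toℕ p) m (trans e 2k∸1)

     same-odd : ∀ {i j : Fin (2 * k)} (p p' : Fin k) → toℕ i ≡ suc (2 * toℕ p) → toℕ j ≡ suc (2 * toℕ p') → adj (Cycle (2 * k)) i j ≡ false
     same-odd {i} {j} p p' ei ej = bool-ext (λ e → ⊥-elim (bad (subst₂ (CycleAdj (2 * k)) ei ej (cycle-elim (2 * k) i j e)))) (λ ())
       where
       bad : ¬ CycleAdj (2 * k) (suc (2 * toℕ p)) (suc (2 * toℕ p'))
       bad (inj₁ e) = even≢odd (toℕ p') (toℕ p) (sym (ℕ.suc-injective e))
       bad (inj₂ (inj₁ e)) = even≢odd (toℕ p) (toℕ p') (sym (ℕ.suc-injective e))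
       bad (inj₂ (inj₂ (inj₁ (() , _))))
       bad (inj₂ (inj₂ (inj₂ (() , _))))

     χ-at : ∀ {i j : Fin (2 * k)} (s : Half k (toℕ i)) (t : Half k (toℕ j)) → i ≢ j → χ (at s ⊕ ⊖ at t) ≡ sg (adj (Cycle (2 * k)) i j)
     χ-at {i} {j} (inj₁ (p , ei)) (inj₁ (p' , ej)) h = trans (vTT (A≢inf p) (A≢inf p') (A-apart λ e → h (toℕ-injective (trans ei (trans (cong (λ z → 2 * toℕ z) e) (sym ej)))))) (cong sg (sym (same-even {i} {j} p p' ei ej)))
     χ-at {i} {j} (inj₂ (p , ei)) (inj₂ (p' , ej)) h = trans (vLL (B-apart λ e → h (toℕ-injective (trans ei (trans (cong (λ z → suc (2 * toℕ z)) e) (sym ej)))))) (cong sg (sym (same-odd {i} {j} p p' ei ej)))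
     χ-at {i} {j} (inj₁ (p , ei)) (inj₂ (p' , ej)) h = proj₁ (χ-mixed _ (A≢inf p) (trans (pat p p') (mixed {i} {j} p p' ei ej)))
     χ-at {i} {j} (inj₂ (p , ei)) (inj₁ (p' , ej)) h = trans (proj₂ (χ-mixed _ (A≢inf p') (trans (pat p' p) (mixed {j} {i} p' p ej ei)))) (cong sg (proj₂ (cycle-simple (2 * k) (ℕ.*-monoʳ-≤ 2 {1} {k} (s≤s z≤n))) j i))

     cycle-embed : Cycle (2 * k) ⊑ᵢ Paley F
     cycle-embed = paley-embed (adj (Cycle (2 * k))) (proj₁ (cycle-simple (2 * k) (ℕ.*-monoʳ-≤ 2 {1} {k} (s≤s z≤n)))) (λ i → at (halve k (toℕ i) (toℕ<n i))) (λ i j → χ-at (halve k (toℕ i) (toℕ<n i)) (halve k (toℕ j) (toℕ<n j)))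

   module BicliqueOf {a} (P : BicliqueIn design a) (k₁ k₂ : ℕ) (k₁≤a : k₁ ≤ a) (k₂≤a : k₂ ≤ a) where
     open BicliqueIn P

     at : Fin k₁ ⊎ Fin k₂ → Fin r
     at (inj₁ p) = vT (A (inject≤ p k₁≤a))
     at (inj₂ p) = vL (B (inject≤ p k₂≤a))

     left : Fin k₁ ⊎ Fin k₂ → Bool
     left (inj₁ _) = true
     left (inj₂ _) = false

     side : ∀ s → (toℕ (join k₁ k₂ s) <ᵇ k₁) ≡ left s
     side (inj₁ p) = T⇒≡ (ℕ.<⇒<ᵇ (subst (_< k₁) (sym (toℕ-↑ˡ p k₂)) (toℕ<n p)))
     side (inj₂ p) = bool-ext (λ e → ⊥-elim (ℕ.<⇒≱ (ℕ.<ᵇ⇒< _ _ (≡⇒T e)) (subst (k₁ ≤_) (sym (toℕ-↑ʳ k₁ p)) (ℕ.m≤m+n k₁ (toℕ p))))) (λ ())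

     edges' : ∀ p p' → edge (A (inject≤ p k₁≤a)) (B (inject≤ p' k₂≤a)) ≡ true
     edges' p p' = edges _ _

     A≢inf : ∀ (p : Fin k₁) (p' : Fin a) → A (inject≤ p k₁≤a) ≢ inf
     A≢inf p p' e with () ← trans (sym (edges (inject≤ p k₁≤a) p')) (trans (cong (λ t → edge t (B p')) e) (edge-inf (B p')))

     A≢ : ∀ p → A (inject≤ p k₁≤a) ≢ inf
     A≢ p = A≢inf p (inject≤ p k₁≤a)

     χ-at : ∀ s t → s ≢ t → χ (at s ⊕ ⊖ at t) ≡ sg (left s xor left t)
     χ-at (inj₁ p) (inj₁ p') h = vTT (A≢ p) (A≢ p') (λ e → h (cong inj₁ (inject≤-injective k₁≤a k₁≤a p p' (A-inj _ _ e))))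
     χ-at (inj₂ p) (inj₂ p') h = vLL (λ e → h (cong inj₂ (inject≤-injective k₂≤a k₂≤a p p' (B-inj _ _ e))))
     χ-at (inj₁ p) (inj₂ p') h = proj₁ (χ-mixed true (A≢ p) (edges' p p'))
     χ-at (inj₂ p) (inj₁ p') h = proj₂ (χ-mixed true (A≢ p') (edges' p' p))

     K-embed : K k₁ k₂ ⊑ᵢ Paley F
     K-embed = paley-embed (adj (K k₁ k₂)) (proj₁ (K-simple k₁ k₂)) (at ∘ splitAt k₁) λ i j h → trans (χ-at (splitAt k₁ i) (splitAt k₁ j) (h ∘ split-inj i j)) (cong sg (cong₂ _xor_ (left≡ i) (left≡ j)))
       where
       split-inj : ∀ i j → splitAt k₁ i ≡ splitAt k₁ j → i ≡ j
       split-inj i j e = trans (sym (join-splitAt k₁ k₂ i)) (trans (cong (join k₁ k₂) e) (join-splitAt k₁ k₂ j))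
       left≡ : ∀ i → left (splitAt k₁ i) ≡ (toℕ i <ᵇ k₁)
       left≡ i = trans (sym (side (splitAt k₁ i))) (cong (λ z → toℕ z <ᵇ k₁) (join-splitAt k₁ k₂ i))

-- Decidable search

module Search where
 open import Data.Fin.Properties using (any?)
 open import Data.Nat.Base using (_+_; _≤_)
 open import Data.Vec.Base using (Vec; []; _∷_)
 open import Relation.Unary using (Decidable)

 anyVec? : ∀ {p} d {P : Vec (Fin p) d → Set} → Decidable P → Dec (∃ P)
 anyVec? zero P? = map′ ([] ,_) (λ { ([] , h) → h }) (P? [])
 anyVec? (suc d) P? = map′ (λ { (x , v , h) → x ∷ v , h }) (λ { (x ∷ v , h) → x , v , h }) (any? λ x → anyVec? d λ v → P? (x ∷ v))

 -- An upper bound for an index defined through `IsMin` includes the existence of the minimum. It is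
 -- obtained by searching with a decision procedure.
 least : ∀ (P : ℕ → Set) → Decidable P → ∀ n → P n → ∃ λ m → m ≤ n × P m × (∀ j → P j → m ≤ j)
 least P P? n pn = search n 0 (λ j _ → z≤n) (ℕ.+-identityʳ n)
   where
   search : ∀ fuel m → (∀ j → P j → m ≤ j) → fuel + m ≡ n → ∃ λ m → m ≤ n × P m × (∀ j → P j → m ≤ j)
   search fuel m below e with P? m
   ... | yes pm = m , subst (m ≤_) e (ℕ.m≤n+m m fuel) , pm , below
   search zero m below refl | no ¬pm = ⊥-elim (¬pm pn)
   search (suc fuel) m below e | no ¬pm = search fuel (suc m) (λ j pj → ℕ.≤∧≢⇒< (below j pj) λ { refl → ¬pm pj }) (trans (ℕ.+-suc fuel m) e)

-- Transfer of a generator to a larger field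

module Extensions where
 open import Defs hiding (Injective)
 open Generators using (prime-coprime)
 open Characters
 open Universality using (sg; module SquareField)
 open Subfields using (module Frobenius)
 open Search
 open import Data.Fin.Base using (fromℕ<)
 open import Data.Fin.Properties using (_≟_; toℕ-fromℕ<; any?)
 open import Data.Integer.Base using (+_)
 open import Data.Integer.DivMod using (_%ℕ_; _/ℕ_; a≡a%ℕn+[a/ℕn]*n; n%ℕd<d)
 open import Data.List.Base as List using (List; []; _∷_; length)
 import Data.List.Properties as List
 open import Data.Nat.Base using (pred; NonZero; _+_; _*_; _∸_; _≤_; _<_)
 open import Data.Nat.Coprimality using (coprime-Bézout)
 open import Data.Nat.Divisibility using (_∣_; _∣?_)
 open import Data.Nat.GCD using (module Bézout)
 open import Data.Nat.Primality using (Prime; prime⇒nonZero)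
 open import Data.Vec.Base as Vec using (Vec; []; _∷_; _∷ʳ_; zipWith; map; replicate)
 open import Data.Vec.Relation.Unary.All as All using (All; []; _∷_)

 infixl 6 _⊞[_]_
 _⊞[_]_ : ∀ {n} → Vec ℤ n → ℤ → Vec ℤ n → Vec ℤ n
 w ⊞[ c ] u = zipWith (λ x z → x ℤ.+ c ℤ.* z) w u

 zeros : ∀ n → Vec ℤ n
 zeros n = replicate n 0ℤ

 -- Evaluation of integer polynomials by Horner's rule, highest coefficient first.
 module Horner {r} (F : FieldOn r) where
   open FieldChar F

   H : ∀ {n} → Fin r → Vec ℤ n → Fin r → Fin r
   H a [] y = a
   H a (c ∷ w) y = H (a ⊗ y ⊕ int c) w y

   H-acc : ∀ {n} a (w : Vec ℤ n) y → H a w y ≡ a ⊗ y ^ n ⊕ H 0ᶠ w y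
   H-acc a [] y = sym (trans (⊕-identityʳ _) (⊗-identityʳ a))
   H-acc {suc n} a (c ∷ w) y = trans (H-acc (a ⊗ y ⊕ int c) w y) (trans (solve 5 (λ a y c p h → (a :* y :+ c) :* p :+ h := a :* (y :* p) :+ ((con 0ℤ :* y :+ c) :* p :+ h)) refl a y (int c) (y ^ n) (H 0ᶠ w y))
     (cong (a ⊗ y ^ suc n ⊕_) (sym (H-acc (0ᶠ ⊗ y ⊕ int c) w y))))

   H-∷ʳ : ∀ {n} a (w : Vec ℤ n) c y → H a (w ∷ʳ c) y ≡ H a w y ⊗ y ⊕ int c
   H-∷ʳ a [] c y = refl
   H-∷ʳ a (x ∷ w) c y = H-∷ʳ (a ⊗ y ⊕ int x) w c y

   H-⊞ : ∀ {n} a b c (w u : Vec ℤ n) y → H (a ⊕ int c ⊗ b) (w ⊞[ c ] u) y ≡ H a w y ⊕ int c ⊗ H b u y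
   H-⊞ a b c [] [] y = refl
   H-⊞ a b c (x ∷ w) (z ∷ u) y = trans (cong (λ t → H t (w ⊞[ c ] u) y) e) (H-⊞ (a ⊗ y ⊕ int x) (b ⊗ y ⊕ int z) c w u y)
     where
     e : (a ⊕ int c ⊗ b) ⊗ y ⊕ int (x ℤ.+ c ℤ.* z) ≡ (a ⊗ y ⊕ int x) ⊕ int c ⊗ (b ⊗ y ⊕ int z)
     e = trans (cong ((a ⊕ int c ⊗ b) ⊗ y ⊕_) (trans (int-+ x (c ℤ.* z)) (cong (int x ⊕_) (int-* c z))))
       (solve 6 (λ a b c x y z → (a :+ c :* b) :* y :+ (x :+ c :* z) := (a :* y :+ x) :+ c :* (b :* y :+ z)) refl a b (int c) (int x) y (int z))

   H₀-⊞ : ∀ {n} c (w u : Vec ℤ n) y → H 0ᶠ (w ⊞[ c ] u) y ≡ H 0ᶠ w y ⊕ int c ⊗ H 0ᶠ u y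
   H₀-⊞ c w u y = trans (cong (λ t → H t (w ⊞[ c ] u) y) (sym (trans (⊕-identityˡ _) (⊗-zeroʳ (int c))))) (H-⊞ 0ᶠ 0ᶠ c w u y)

   H-zeros : ∀ n a y → H a (zeros n) y ≡ a ⊗ y ^ n
   H-zeros zero a y = sym (⊗-identityʳ a)
   H-zeros (suc n) a y = trans (H-zeros n (a ⊗ y ⊕ 0ᶠ) y) (trans (cong (_⊗ y ^ n) (⊕-identityʳ (a ⊗ y))) (⊗-assoc a y (y ^ n)))

   H₀-zeros : ∀ n y → H 0ᶠ (zeros n) y ≡ 0ᶠ
   H₀-zeros n y = trans (H-zeros n 0ᶠ y) (⊗-zeroˡ (y ^ n))

   H-scale : ∀ {n} u a (w : Vec ℤ n) y → H (int u ⊗ a) (map (u ℤ.*_) w) y ≡ int u ⊗ H a w y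
   H-scale u a [] y = refl
   H-scale u a (c ∷ w) y = trans (cong (λ t → H t (map (u ℤ.*_) w) y) (trans (cong (int u ⊗ a ⊗ y ⊕_) (int-* u c)) (solve 4 (λ u a y c → u :* a :* y :+ u :* c := u :* (a :* y :+ c)) refl (int u) a y (int c)))) (H-scale u (a ⊗ y ⊕ int c) w y)

   H-map : ∀ {n} (f : ℤ → ℤ) → (∀ z → int (f z) ≡ int z) → ∀ a (w : Vec ℤ n) y → H a (map f w) y ≡ H a w y
   H-map f h a [] y = refl
   H-map f h a (c ∷ w) y = trans (cong (λ t → H (a ⊗ y ⊕ t) (map f w) y) (h c)) (H-map f h (a ⊗ y ⊕ int c) w y)

   H-null : ∀ {n} (w : Vec ℤ n) y → All (λ z → int z ≡ 0ᶠ) w → H 0ᶠ w y ≡ 0ᶠ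
   H-null [] y [] = refl
   H-null (c ∷ w) y (h ∷ hs) = trans (cong (λ t → H t w y) (trans (cong₂ _⊕_ (⊗-zeroˡ y) h) (⊕-identityʳ 0ᶠ))) (H-null w y hs)

   int-^ : ∀ z k → int (z ℤ.^ k) ≡ int z ^ k
   int-^ z zero = ⊕-identityʳ 1ᶠ
   int-^ z (suc k) = trans (int-* z (z ℤ.^ k)) (cong (int z ⊗_) (int-^ z k))

 module Division {d'} (V : Vec ℤ (suc d')) where
   d : ℕ
   d = suc d'

   -- Multiplication by X modulo the monic polynomial with lower coefficients V.
   step : Vec ℤ d → Vec ℤ d
   step (s ∷ w) = (w ∷ʳ 0ℤ) ⊞[ ℤ.- s ] V

   lead : Vec ℤ d → ℤ
   lead (s ∷ w) = s

   module _ {r} (F : FieldOn r) where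
     open FieldChar F
     open Horner F

     Quotient : ℕ → List ℤ → Vec ℤ d → Fin r → Set
     Quotient e Q S y = y ^ (e + d) ≡ monic (List.map int Q) y ⊗ H 1ᶠ V y ⊕ H 0ᶠ S y

     H-monic : ∀ y → H 1ᶠ V y ≡ y ^ d ⊕ H 0ᶠ V y
     H-monic y = trans (H-acc 1ᶠ V y) (cong (_⊕ H 0ᶠ V y) (⊗-identityˡ (y ^ d)))

     step-eval : ∀ S y → y ⊗ H 0ᶠ S y ≡ int (lead S) ⊗ H 1ᶠ V y ⊕ H 0ᶠ (step S) y
     step-eval (s ∷ w) y = trans (cong (y ⊗_) (H-acc (0ᶠ ⊗ y ⊕ int s) w y))
       (trans (solve 5 (λ y s p h v → y :* ((con 0ℤ :* y :+ s) :* p :+ h) := s :* (y :* p :+ v) :+ ((h :* y :+ con 0ℤ) :+ (:- s) :* v)) refl y (int s) (y ^ d') (H 0ᶠ w y) (H 0ᶠ V y))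
       (cong₂ _⊕_ (cong (int s ⊗_) (sym (H-monic y)))
         (sym (trans (H₀-⊞ (ℤ.- s) (w ∷ʳ 0ℤ) V y) (cong₂ (λ a b → a ⊕ b ⊗ H 0ᶠ V y) (H-∷ʳ 0ᶠ w 0ℤ y) (int-neg s))))))

     quotient-zero : ∀ y → Quotient 0 [] (zeros d ⊞[ -1ℤ ] V) y
     quotient-zero y = sym (trans (cong₂ (λ a b → 1ᶠ ⊗ a ⊕ b) (H-monic y) (trans (H₀-⊞ -1ℤ (zeros d) V y) (cong₂ (λ a b → a ⊕ b ⊗ H 0ᶠ V y) (H₀-zeros d y) (cong ⊖_ (⊕-identityʳ 1ᶠ)))))
       (trans (cong (_⊕ (0ᶠ ⊕ ⊖ 1ᶠ ⊗ H 0ᶠ V y)) (⊗-identityˡ (y ^ d ⊕ H 0ᶠ V y))) (trans (cong (λ z → (y ^ d ⊕ H 0ᶠ V y) ⊕ (0ᶠ ⊕ z)) (trans (sym (⊖-distribˡ 1ᶠ (H 0ᶠ V y))) (cong ⊖_ (⊗-identityˡ (H 0ᶠ V y))))) (solve 2 (λ p v → (p :+ v) :+ (con 0ℤ :+ :- v) := p) refl (y ^ d) (H 0ᶠ V y)))))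

     quotient-suc : ∀ e Q S y → Quotient e Q S y → Quotient (suc e) (lead S ∷ Q) (step S) y
     quotient-suc e Q S y div = trans (cong (y ⊗_) div) (trans (solve 4 (λ y q f s → y :* (q :* f :+ s) := y :* q :* f :+ y :* s) refl y (monic (List.map int Q) y) (H 1ᶠ V y) (H 0ᶠ S y))
       (trans (cong (y ⊗ monic (List.map int Q) y ⊗ H 1ᶠ V y ⊕_) (step-eval S y)) (solve 5 (λ y q f s h → y :* q :* f :+ (s :* f :+ h) := (s :+ y :* q) :* f :+ h) refl y (monic (List.map int Q) y) (H 1ᶠ V y) (int (lead S)) (H 0ᶠ (step S) y))))

   -- The division takes place over the integers, so one identity holds in all fields at once; this
   -- is the link between the small and the large field.
   Divides : ℕ → List ℤ → Vec ℤ d → Set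
   Divides e Q S = ∀ {r} (F : FieldOn r) y → Quotient F e Q S y

   divide-power : ∀ e → ∃ λ Q → ∃ λ S → length Q ≡ e × Divides e Q S
   divide-power zero = [] , (zeros d ⊞[ -1ℤ ] V) , refl , λ F → quotient-zero F
   divide-power (suc e) with Q , S , len , div ← divide-power e = lead S ∷ Q , step S , cong suc len , λ F y → quotient-suc F e Q S y (div F y)

 module Characteristic {r} (F : FieldOn r) {p} (pp : Prime p) (E : ℕ) (r≡ : r ≡ p ℕ.^ E) where
   open FieldChar F
   open Frobenius F pp E r≡ using (nat-p; nat-∣)

   -- If p did not divide c, a Bézout identity for p and c would give 1 = 0 in the field.
   nat≡0⇒∣ : ∀ c → nat c ≡ 0ᶠ → p ∣ c
   nat≡0⇒∣ c h with p ∣? c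
   ... | yes q = q
   ... | no q = ⊥-elim (0≢1 (sym (trans (sym (⊕-identityʳ 1ᶠ)) (go (coprime-Bézout (prime-coprime pp q))))))
     where
     null : ∀ x {k} → nat k ≡ 0ᶠ → nat (x * k) ≡ 0ᶠ
     null x {k} e = trans (nat-* x k) (trans (cong (nat x ⊗_) e) (⊗-zeroʳ (nat x)))
     go : Bézout.Identity 1 p c → nat 1 ≡ 0ᶠ
     go (Bézout.+- x y e) = trans (sym (trans (nat-+ 1 (y * c)) (trans (cong (nat 1 ⊕_) (null y h)) (⊕-identityʳ (nat 1))))) (trans (cong nat e) (null x nat-p))
     go (Bézout.-+ x y e) = trans (sym (trans (nat-+ 1 (x * p)) (trans (cong (nat 1 ⊕_) (null x nat-p)) (⊕-identityʳ (nat 1))))) (trans (cong nat e) (null y h))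

   ∣⇒int≡0 : ∀ z → p ∣ ℤ.∣ z ∣ → int z ≡ 0ᶠ
   ∣⇒int≡0 (+ k) h = nat-∣ h
   ∣⇒int≡0 -[1+ k ] h = trans (cong ⊖_ (nat-∣ h)) ⊖-0

   int≡0⇒∣ : ∀ z → int z ≡ 0ᶠ → p ∣ ℤ.∣ z ∣
   int≡0⇒∣ (+ k) h = nat≡0⇒∣ k h
   int≡0⇒∣ -[1+ k ] h = nat≡0⇒∣ (suc k) (trans (sym (⊖-involutive (nat (suc k)))) (trans (cong ⊖_ h) ⊖-0))

   instance
     p≢0 : NonZero p
     p≢0 = prime⇒nonZero pp

   red : ℤ → Fin p
   red z = fromℕ< (n%ℕd<d z p)

   int-red : ∀ z → int (+ toℕ (red z)) ≡ int z
   int-red z = trans (cong nat (toℕ-fromℕ< (n%ℕd<d z p))) (sym (trans (cong int (a≡a%ℕn+[a/ℕn]*n z p)) (trans (int-+ (+ (z %ℕ p)) (z /ℕ p ℤ.* + p)) (trans (cong (nat (z %ℕ p) ⊕_) (trans (int-* (z /ℕ p) (+ p)) (trans (cong (int (z /ℕ p) ⊗_) nat-p) (⊗-zeroʳ _)))) (⊕-identityʳ _)))))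

 module Minimal {r} (F : FieldOn r) {p} (pp : Prime p) (E : ℕ) (r≡ : r ≡ p ℕ.^ E) where
   open FieldChar F
   open Horner F
   open Characteristic F pp E r≡
   open Frobenius F pp E r≡ using (nat-p)

   lift : Fin p → ℤ
   lift c = + toℕ c

   -- Coefficients are taken among the residues below p, which makes the existence of a monic
   -- relation of given degree decidable and the minimal degree searchable.
   Vanishes : ℕ → Set
   Vanishes j = ∃ λ (v : Vec (Fin p) j) → H 1ᶠ (map lift v) g ≡ 0ᶠ

   vanishes? : ∀ j → Dec (Vanishes j)
   vanishes? j = anyVec? j λ v → H 1ᶠ (map lift v) g ≟ 0ᶠ

   map-map : ∀ {n} (w : Vec ℤ n) → map lift (map red w) ≡ map (lift ∘ red) w
   map-map [] = refl
   map-map (c ∷ w) = cong (lift (red c) ∷_) (map-map w)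

   reduced : ∀ {j} (w : Vec ℤ j) → H 1ᶠ w g ≡ 0ᶠ → Vanishes j
   reduced w h = map red w , trans (cong (λ w → H 1ᶠ w g) (map-map w)) (trans (H-map (lift ∘ red) int-red 1ᶠ w g) h)

   vanishes-m : Vanishes m
   vanishes-m = subst Vanishes (ℕ.suc-pred m) (reduced (zeros (pred m) ∷ʳ -1ℤ) (trans (H-∷ʳ 1ᶠ (zeros (pred m)) -1ℤ g)
     (trans (cong₂ _⊕_ (trans (cong (_⊗ g) (trans (H-zeros (pred m) 1ᶠ g) (⊗-identityˡ _))) (trans (⊗-comm (g ^ pred m) g) (trans (cong (g ^_) (ℕ.suc-pred m)) g^m))) (cong ⊖_ (⊕-identityʳ 1ᶠ))) (⊖-inverseʳ 1ᶠ))))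

   opaque
     minimum : ∃ λ d → d ≤ m × Vanishes d × (∀ j → Vanishes j → d ≤ j)
     minimum = least Vanishes vanishes? m vanishes-m

   opaque
     minimal : ∃ λ d' → suc d' ≤ m × Vanishes (suc d') × (∀ j → Vanishes j → suc d' ≤ j)
     minimal = go minimum
       where
       go : (∃ λ d → d ≤ m × Vanishes d × (∀ j → Vanishes j → d ≤ j)) → ∃ λ d' → suc d' ≤ m × Vanishes (suc d') × (∀ j → Vanishes j → suc d' ≤ j)
       go (zero , _ , ([] , e) , _) = ⊥-elim (0≢1 (sym e))
       go (suc d' , h) = d' , h

   -- A nonzero leading coefficient s could be made 1 by the factor s^(m-1), its inverse by Fermat.
   -- That would be a monic relation for g of degree below the minimum.
   kill : ∀ {j} (S : Vec ℤ j) → j ≤ suc (proj₁ minimal) → H 0ᶠ S g ≡ 0ᶠ → All (λ z → int z ≡ 0ᶠ) S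
   kill [] _ _ = []
   kill {suc j} (s ∷ w) j<d h with 0? (int s)
   ... | inj₁ s≡0 = s≡0 ∷ kill w (ℕ.<⇒≤ j<d) (trans (cong (λ t → H t w g) (sym (trans (cong₂ _⊕_ (⊗-zeroˡ g) s≡0) (⊕-identityʳ 0ᶠ)))) h)
   ... | inj₂ s≢0 = ⊥-elim (ℕ.<⇒≱ j<d (proj₂ (proj₂ (proj₂ minimal)) j (reduced (map (u ℤ.*_) w) (trans (cong (λ t → H t (map (u ℤ.*_) w) g) (sym us)) (trans (H-scale u (0ᶠ ⊗ g ⊕ int s) w g) (trans (cong (int u ⊗_) h) (⊗-zeroʳ (int u))))))))
     where
     u : ℤ
     u = s ℤ.^ pred m
     us : int u ⊗ (0ᶠ ⊗ g ⊕ int s) ≡ 1ᶠ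
     us = trans (cong₂ _⊗_ (int-^ s (pred m)) (trans (cong (_⊕ int s) (⊗-zeroˡ g)) (⊕-identityˡ (int s)))) (trans (⊗-comm _ _) (trans (cong (int s ^_) (ℕ.suc-pred m)) (fermat s≢0)))

 module Extension {r R} (F : FieldOn r) (G : FieldOn R) {p} (pp : Prime p) (E E' : ℕ) (r≡ : r ≡ p ℕ.^ E) (R≡ : R ≡ p ℕ.^ E')
     (t : ℕ) (R∸1 : pred R ≡ pred r * suc (2 * t)) where
   private
     module F = FieldChar F
     module G = FieldChar G
     module HF = Horner F
     module HG = Horner G
     module CF = Characteristic F pp E r≡
     module CG = Characteristic G pp E' R≡
   open Minimal F pp E r≡ using (minimal; kill; lift)

   d' : ℕ
   d' = proj₁ minimal

   V : Vec ℤ (suc d')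
   V = map lift (proj₁ (proj₁ (proj₂ (proj₂ minimal))))

   f-g : HF.H F.1ᶠ V F.g ≡ F.0ᶠ
   f-g = proj₂ (proj₁ (proj₂ (proj₂ minimal)))

   open Division V

   -- All coefficients vanish in the small field, so they are divisible by p and vanish in the large
   -- field too.
   transfer : ∀ (S : Vec ℤ d) → HF.H F.0ᶠ S F.g ≡ F.0ᶠ → ∀ y → HG.H G.0ᶠ S y ≡ G.0ᶠ
   transfer S h y = HG.H-null S y (All.map (λ {z} e → CG.∣⇒int≡0 z (CF.int≡0⇒∣ z e)) (kill S ℕ.≤-refl h))

   one : Vec ℤ d
   one = zeros d' ∷ʳ 1ℤ

   e₀ : ℕ
   e₀ = G.m ∸ d

   d≤ : d ≤ G.m
   d≤ = ℕ.≤-trans (proj₁ (proj₂ minimal)) (subst (F.m ≤_) (sym R∸1) (ℕ.m≤m*n F.m (suc (2 * t))))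

   e₀+d : e₀ + d ≡ G.m
   e₀+d = ℕ.m∸n+n≡m d≤

   opaque
     big : ∃ λ Q → ∃ λ S → length Q ≡ e₀ × Divides e₀ Q S
     big = divide-power e₀

   Q : List ℤ
   Q = proj₁ big

   S : Vec ℤ d
   S = proj₁ (proj₂ big)

   at-g : ∀ e Q' S' → Divides e Q' S' → F.g F.^ (e + d) ≡ HF.H F.0ᶠ S' F.g
   at-g e Q' S' div = trans (div F F.g) (trans (cong (λ z → F.monic (List.map F.int Q') F.g F.⊗ z F.⊕ HF.H F.0ᶠ S' F.g) f-g) (trans (cong (F._⊕ HF.H F.0ᶠ S' F.g) (F.⊗-zeroʳ _)) (F.⊕-identityˡ _)))

   g^Gm : F.g F.^ G.m ≡ F.1ᶠ
   g^Gm = trans (cong (F.g F.^_) R∸1) (trans (F.^-* F.g F.m (suc (2 * t))) (trans (cong (F._^ suc (2 * t)) F.g^m) (F.1^ (suc (2 * t)))))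

   one-F : HF.H F.0ᶠ one F.g ≡ F.1ᶠ
   one-F = trans (HF.H-∷ʳ F.0ᶠ (zeros d') 1ℤ F.g) (trans (cong₂ F._⊕_ (trans (cong (F._⊗ F.g) (HF.H₀-zeros d' F.g)) (F.⊗-zeroˡ F.g)) (F.⊕-identityʳ F.1ᶠ)) (F.⊕-identityˡ F.1ᶠ))

   one-G : ∀ y → HG.H G.0ᶠ one y ≡ G.1ᶠ
   one-G y = trans (HG.H-∷ʳ G.0ᶠ (zeros d') 1ℤ y) (trans (cong₂ G._⊕_ (trans (cong (G._⊗ y) (HG.H₀-zeros d' y)) (G.⊗-zeroˡ y)) (G.⊕-identityʳ G.1ᶠ)) (G.⊕-identityˡ G.1ᶠ))

   -- S is the remainder of X^(R-1) modulo V. Its value at g is g^(R-1) = 1, so the difference from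
   -- the constant 1 vanishes at g, and `transfer` carries this to every y.
   H₀S : ∀ y → HG.H G.0ᶠ S y ≡ G.1ᶠ
   H₀S y = G.sub≡0⇒≡ (trans (cong (HG.H G.0ᶠ S y G.⊕_) (sym neg)) (trans (sym (HG.H₀-⊞ -1ℤ S one y)) (transfer (S ⊞[ -1ℤ ] one) vanish y)))
     where
     neg : G.int -1ℤ G.⊗ HG.H G.0ᶠ one y ≡ G.⊖ G.1ᶠ
     neg = trans (cong₂ G._⊗_ (cong G.⊖_ (G.⊕-identityʳ G.1ᶠ)) (one-G y)) (G.⊗-identityʳ _)
     vanish : HF.H F.0ᶠ (S ⊞[ -1ℤ ] one) F.g ≡ F.0ᶠ
     vanish = trans (HF.H₀-⊞ -1ℤ S one F.g) (trans (cong₂ F._⊕_ (trans (sym (at-g e₀ Q S (proj₂ (proj₂ (proj₂ big))))) (trans (cong (F.g F.^_) e₀+d) g^Gm)) (trans (cong₂ F._⊗_ (cong F.⊖_ (F.⊕-identityʳ F.1ᶠ)) one-F) (F.⊗-identityʳ _))) (F.⊖-inverseʳ F.1ᶠ))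

   product : ∀ y → y ≢ G.0ᶠ → G.monic (List.map G.int Q) y G.⊗ HG.H G.1ᶠ V y ≡ G.0ᶠ
   product y h = cancel (trans (trans (cong (G.monic (List.map G.int Q) y G.⊗ HG.H G.1ᶠ V y G.⊕_) (sym (H₀S y))) (sym (proj₂ (proj₂ (proj₂ big)) G y))) (trans (cong (y G.^_) e₀+d) (trans (G.fermat h) (sym (G.⊕-identityˡ G.1ᶠ)))))
     where
     cancel : ∀ {x} → x G.⊕ G.1ᶠ ≡ G.0ᶠ G.⊕ G.1ᶠ → x ≡ G.0ᶠ
     cancel {x} e = trans (G.solve 2 (λ x o → x G.:= (x G.:+ o) G.:+ (G.:- o)) refl x G.1ᶠ) (trans (cong (G._⊕ G.⊖ G.1ᶠ) (trans e (G.⊕-identityˡ G.1ᶠ))) (G.⊖-inverseʳ G.1ᶠ))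

   opaque
     -- By `product` every nonzero y is a root of Q or of the minimal polynomial. Since X Q has
     -- degree below R, it does not vanish everywhere, and a point where it is nonzero is the root
     -- sought.
     root : ∃ λ β → β ≢ G.0ᶠ × HG.H G.1ᶠ V β ≡ G.0ᶠ
     root with any? (λ y → ¬? (y G.⊗ G.monic (List.map G.int Q) y ≟ G.0ᶠ))
     ... | yes (y , h) = y , y≢0 , zero-right
       where
       y≢0 : y ≢ G.0ᶠ
       y≢0 e = h (trans (cong (λ z → z G.⊗ G.monic (List.map G.int Q) y) e) (G.⊗-zeroˡ _))
       q≢0 : G.monic (List.map G.int Q) y ≢ G.0ᶠ
       q≢0 e = h (trans (cong (y G.⊗_) e) (G.⊗-zeroʳ y))
       zero-right : HG.H G.1ᶠ V y ≡ G.0ᶠ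
       zero-right = G.⊗-cancelˡ q≢0 (trans (product y y≢0) (sym (G.⊗-zeroʳ _)))
     ... | no none = ⊥-elim (ℕ.<⇒≱ short (G.root-bound (G.0ᶠ ∷ List.map G.int Q) (λ y → y) (λ _ _ e → e) vanish))
       where
       vanish : ∀ y → G.monic (G.0ᶠ ∷ List.map G.int Q) y ≡ G.0ᶠ
       vanish y with y G.⊗ G.monic (List.map G.int Q) y ≟ G.0ᶠ
       ... | yes e = trans (G.⊕-identityˡ _) e
       ... | no e = ⊥-elim (none (y , e))
       short : length (G.0ᶠ ∷ List.map G.int Q) < R
       short = subst₂ _<_ (cong suc (sym (trans (List.length-map G.int Q) (proj₁ (proj₂ (proj₂ big)))))) (sym G.1+m) (s≤s (subst (suc e₀ ≤_) e₀+d (subst (suc e₀ ≤_) (ℕ.+-comm (suc d') e₀) (s≤s (ℕ.m≤n+m e₀ d')))))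

   β : Fin R
   β = proj₁ root

   β≢0 : β ≢ G.0ᶠ
   β≢0 = proj₁ (proj₂ root)

   at-β : ∀ e Q' S' → Divides e Q' S' → β G.^ (e + d) ≡ HG.H G.0ᶠ S' β
   at-β e Q' S' div = trans (div G β) (trans (cong (λ z → G.monic (List.map G.int Q') β G.⊗ z G.⊕ HG.H G.0ᶠ S' β) (proj₂ (proj₂ root))) (trans (cong (G._⊕ HG.H G.0ᶠ S' β) (G.⊗-zeroʳ _)) (G.⊕-identityˡ _)))

   -- Multiplied by g^d, the powers become remainders modulo V; their combination vanishes at g and
   -- hence everywhere in the large field. Three terms are enough for the equations u - v = g^l that
   -- decide adjacency.
   relation : ∀ a b c i j l → F.int a F.⊗ F.g F.^ i F.⊕ F.int b F.⊗ F.g F.^ j F.⊕ F.int c F.⊗ F.g F.^ l ≡ F.0ᶠ →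
     G.int a G.⊗ β G.^ i G.⊕ G.int b G.⊗ β G.^ j G.⊕ G.int c G.⊗ β G.^ l ≡ G.0ᶠ
   relation a b c i j l h = G.⊗-cancelˡ (G.≢0-^ d β≢0) (trans (trans (expandG (β G.^ d) (β G.^ i) (β G.^ j) (β G.^ l)) (trans evalG (transfer W vanish β))) (sym (G.⊗-zeroʳ (β G.^ d))))
     where
     Sᵢ Sⱼ Sₗ W : Vec ℤ d
     Sᵢ = proj₁ (proj₂ (divide-power i))
     Sⱼ = proj₁ (proj₂ (divide-power j))
     Sₗ = proj₁ (proj₂ (divide-power l))
     W = zeros d ⊞[ a ] Sᵢ ⊞[ b ] Sⱼ ⊞[ c ] Sₗ
     expandG : ∀ D x y z → D G.⊗ (G.int a G.⊗ x G.⊕ G.int b G.⊗ y G.⊕ G.int c G.⊗ z) ≡ ((G.0ᶠ G.⊕ G.int a G.⊗ (x G.⊗ D)) G.⊕ G.int b G.⊗ (y G.⊗ D)) G.⊕ G.int c G.⊗ (z G.⊗ D)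
     expandG D x y z = G.solve 7 (λ D x y z a b c → D G.:* (a G.:* x G.:+ b G.:* y G.:+ c G.:* z) G.:= ((G.con 0ℤ G.:+ a G.:* (x G.:* D)) G.:+ b G.:* (y G.:* D)) G.:+ c G.:* (z G.:* D)) refl D x y z (G.int a) (G.int b) (G.int c)
     expandF : ∀ D x y z → D F.⊗ (F.int a F.⊗ x F.⊕ F.int b F.⊗ y F.⊕ F.int c F.⊗ z) ≡ ((F.0ᶠ F.⊕ F.int a F.⊗ (x F.⊗ D)) F.⊕ F.int b F.⊗ (y F.⊗ D)) F.⊕ F.int c F.⊗ (z F.⊗ D)
     expandF D x y z = F.solve 7 (λ D x y z a b c → D F.:* (a F.:* x F.:+ b F.:* y F.:+ c F.:* z) F.:= ((F.con 0ℤ F.:+ a F.:* (x F.:* D)) F.:+ b F.:* (y F.:* D)) F.:+ c F.:* (z F.:* D)) refl D x y z (F.int a) (F.int b) (F.int c)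
     HW-G : ∀ y → HG.H G.0ᶠ W y ≡ ((G.0ᶠ G.⊕ G.int a G.⊗ HG.H G.0ᶠ Sᵢ y) G.⊕ G.int b G.⊗ HG.H G.0ᶠ Sⱼ y) G.⊕ G.int c G.⊗ HG.H G.0ᶠ Sₗ y
     HW-G y = trans (HG.H₀-⊞ c (zeros d ⊞[ a ] Sᵢ ⊞[ b ] Sⱼ) Sₗ y) (cong (G._⊕ G.int c G.⊗ HG.H G.0ᶠ Sₗ y) (trans (HG.H₀-⊞ b (zeros d ⊞[ a ] Sᵢ) Sⱼ y) (cong (G._⊕ G.int b G.⊗ HG.H G.0ᶠ Sⱼ y) (trans (HG.H₀-⊞ a (zeros d) Sᵢ y) (cong (G._⊕ G.int a G.⊗ HG.H G.0ᶠ Sᵢ y) (HG.H₀-zeros d y))))))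
     HW-F : ∀ y → HF.H F.0ᶠ W y ≡ ((F.0ᶠ F.⊕ F.int a F.⊗ HF.H F.0ᶠ Sᵢ y) F.⊕ F.int b F.⊗ HF.H F.0ᶠ Sⱼ y) F.⊕ F.int c F.⊗ HF.H F.0ᶠ Sₗ y
     HW-F y = trans (HF.H₀-⊞ c (zeros d ⊞[ a ] Sᵢ ⊞[ b ] Sⱼ) Sₗ y) (cong (F._⊕ F.int c F.⊗ HF.H F.0ᶠ Sₗ y) (trans (HF.H₀-⊞ b (zeros d ⊞[ a ] Sᵢ) Sⱼ y) (cong (F._⊕ F.int b F.⊗ HF.H F.0ᶠ Sⱼ y) (trans (HF.H₀-⊞ a (zeros d) Sᵢ y) (cong (F._⊕ F.int a F.⊗ HF.H F.0ᶠ Sᵢ y) (HF.H₀-zeros d y))))))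
     power-G : ∀ i → β G.^ i G.⊗ β G.^ d ≡ HG.H G.0ᶠ (proj₁ (proj₂ (divide-power i))) β
     power-G i = trans (sym (G.^-+ β i d)) (at-β i (proj₁ (divide-power i)) (proj₁ (proj₂ (divide-power i))) (proj₂ (proj₂ (proj₂ (divide-power i)))))
     power-F : ∀ i → F.g F.^ i F.⊗ F.g F.^ d ≡ HF.H F.0ᶠ (proj₁ (proj₂ (divide-power i))) F.g
     power-F i = trans (sym (F.^-+ F.g i d)) (at-g i (proj₁ (divide-power i)) (proj₁ (proj₂ (divide-power i))) (proj₂ (proj₂ (proj₂ (divide-power i)))))
     evalG : ((G.0ᶠ G.⊕ G.int a G.⊗ (β G.^ i G.⊗ β G.^ d)) G.⊕ G.int b G.⊗ (β G.^ j G.⊗ β G.^ d)) G.⊕ G.int c G.⊗ (β G.^ l G.⊗ β G.^ d) ≡ HG.H G.0ᶠ W β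
     evalG = sym (trans (HW-G β) (sym (cong₂ G._⊕_ (cong₂ (λ x y → (G.0ᶠ G.⊕ G.int a G.⊗ x) G.⊕ G.int b G.⊗ y) (power-G i) (power-G j)) (cong (G.int c G.⊗_) (power-G l)))))
     vanish : HF.H F.0ᶠ W F.g ≡ F.0ᶠ
     vanish = trans (HW-F F.g) (trans (sym (cong₂ F._⊕_ (cong₂ (λ x y → (F.0ᶠ F.⊕ F.int a F.⊗ x) F.⊕ F.int b F.⊗ y) (power-F i) (power-F j)) (cong (F.int c F.⊗_) (power-F l))))
       (trans (sym (expandF (F.g F.^ d) (F.g F.^ i) (F.g F.^ j) (F.g F.^ l))) (trans (cong (F.g F.^ d F.⊗_) h) (F.⊗-zeroʳ _))))

 module PaleyExtension {r R} (F : FieldOn r) (G : FieldOn R) {p} (pp : Prime p) (E E' : ℕ) (r≡ : r ≡ p ℕ.^ E) (R≡ : R ≡ p ℕ.^ E') (t : ℕ) (R∸1 : pred R ≡ pred r * suc (2 * t))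
     (n c : ℕ) (n≡ : n ≡ suc (2 * c)) (r≡n² : r ≡ n * n) (n' c' : ℕ) (n'≡ : n' ≡ suc (2 * c')) (R≡n² : R ≡ n' * n') where
   private
     module F = SquareField F n c n≡ r≡n²
     module G = SquareField G n' c' n'≡ R≡n²
   open Extension F G pp E E' r≡ R≡ t R∸1 using (β; β≢0; relation)

   β^half : β G.^ F.half ≡ G.⊖ G.1ᶠ
   β^half = trans (G.solve 2 (λ x o → x G.:= (x G.:+ o) G.:+ (G.:- o)) refl (β G.^ F.half) G.1ᶠ) (trans (cong (G._⊕ G.⊖ G.1ᶠ) (trans (sym e) (relation 1ℤ 1ℤ 0ℤ F.half 0 0 h))) (G.⊕-identityˡ _))
     where
     h : F.int 1ℤ F.⊗ F.g F.^ F.half F.⊕ F.int 1ℤ F.⊗ F.1ᶠ F.⊕ F.int 0ℤ F.⊗ F.1ᶠ ≡ F.0ᶠ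
     h = trans (F.solve 2 (λ x o → F.con 1ℤ F.:* x F.:+ F.con 1ℤ F.:* o F.:+ F.con 0ℤ F.:* o F.:= x F.:+ o) refl (F.g F.^ F.half) F.1ᶠ) (trans (cong (F._⊕ F.1ᶠ) F.g^h) (F.⊖-inverseˡ F.1ᶠ))
     e : G.int 1ℤ G.⊗ β G.^ F.half G.⊕ G.int 1ℤ G.⊗ G.1ᶠ G.⊕ G.int 0ℤ G.⊗ G.1ᶠ ≡ β G.^ F.half G.⊕ G.1ᶠ
     e = G.solve 2 (λ x o → G.con 1ℤ G.:* x G.:+ G.con 1ℤ G.:* o G.:+ G.con 0ℤ G.:* o G.:= x G.:+ o) refl (β G.^ F.half) G.1ᶠ

   odd-power : (G.⊖ G.1ᶠ) G.^ suc (2 * t) ≡ G.⊖ G.1ᶠ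
   odd-power = trans (cong (G.⊖ G.1ᶠ G.⊗_) (trans (G.^-* (G.⊖ G.1ᶠ) 2 t) (trans (cong (G._^ t) e) (G.1^ t)))) (G.⊗-identityʳ _)
     where
     e : (G.⊖ G.1ᶠ) G.^ 2 ≡ G.1ᶠ
     e = trans (cong (G.⊖ G.1ᶠ G.⊗_) (G.⊗-identityʳ _)) (trans (G.solve 1 (λ o → (G.:- o) G.:* (G.:- o) G.:= o G.:* o) refl G.1ᶠ) (G.⊗-identityˡ G.1ᶠ))

   -- If w² = β, then w^(R-1) = (β^half)^(2t+1) = -1 because R - 1 = 2 half (2t + 1), against
   -- Fermat's theorem.
   nonsquare : ∀ w → w G.⊗ w ≡ β → ⊥
   nonsquare w e = G.g^h≢1 (trans G.g^h (trans (sym chain) (G.fermat w≢0)))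
     where
     w≢0 : w ≢ G.0ᶠ
     w≢0 e' = β≢0 (trans (sym e) (trans (cong (G._⊗ w) e') (G.⊗-zeroˡ w)))
     chain : w G.^ G.m ≡ G.⊖ G.1ᶠ
     chain = trans (cong (w G.^_) (trans R∸1 (cong (_* suc (2 * t)) F.m≡))) (trans (G.^-* w (2 * F.half) (suc (2 * t))) (trans (cong (G._^ suc (2 * t)) (trans (G.^-* w 2 F.half) (trans (cong (G._^ F.half) (trans (cong (w G.⊗_) (G.⊗-identityʳ w)) e)) β^half))) odd-power))

   χβ : G.χ β ≡ -1ℤ
   χβ with G.χ-cases β≢0
   ... | inj₂ e = e
   ... | inj₁ e with w , e' ← G.sqr-elim (G.χ≡1⇒sqr e) = ⊥-elim (nonsquare w e')

   χ-β^ : ∀ l → G.χ (β G.^ l) ≡ sgn l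
   χ-β^ zero = G.χ-g^ 0
   χ-β^ (suc l) = trans (G.χ-⊗ β (β G.^ l)) (trans (cong₂ ℤ._*_ χβ (χ-β^ l)) (ℤ.-1*i≡-i (sgn l)))

   -- An integer factor a lets 0 be written in the same form as the powers of g, so that `relation`
   -- covers differences with 0 as well.
   Rep : Fin r → Set
   Rep x = ∃ λ a → ∃ λ i → x ≡ F.int a F.⊗ F.g F.^ i

   rep : ∀ x → Rep x
   rep x with F.0? x
   ... | inj₁ e = 0ℤ , 0 , trans e (sym (F.⊗-zeroˡ _))
   ... | inj₂ h with i , _ , e ← F.log x h = 1ℤ , i , trans e (sym (trans (cong (F._⊗ F.g F.^ i) (F.⊕-identityʳ F.1ᶠ)) (F.⊗-identityˡ _)))

   value : ∀ {x} → Rep x → Fin R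
   value (a , i , _) = G.int a G.⊗ β G.^ i

   difference : ∀ {u v} (s : Rep u) (s' : Rep v) l → u F.⊕ F.⊖ v ≡ F.g F.^ l → value s G.⊕ G.⊖ value s' ≡ β G.^ l
   difference {u} {v} (a , i , e) (b , j , e') l h = G.sub≡0⇒≡ (trans eG (relation a (ℤ.- b) -1ℤ i j l hF))
     where
     hF : F.int a F.⊗ F.g F.^ i F.⊕ F.int (ℤ.- b) F.⊗ F.g F.^ j F.⊕ F.int -1ℤ F.⊗ F.g F.^ l ≡ F.0ᶠ
     hF = trans (cong (λ z → F.int a F.⊗ F.g F.^ i F.⊕ z F.⊗ F.g F.^ j F.⊕ F.int -1ℤ F.⊗ F.g F.^ l) (F.int-neg b))
       (trans (F.solve 5 (λ a x b y z → a F.:* x F.:+ (F.:- b) F.:* y F.:+ F.con -1ℤ F.:* z F.:= (a F.:* x F.:+ F.:- (b F.:* y)) F.:+ F.:- z) refl (F.int a) (F.g F.^ i) (F.int b) (F.g F.^ j) (F.g F.^ l))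
         (trans (cong₂ (λ x y → (x F.⊕ F.⊖ y) F.⊕ F.⊖ F.g F.^ l) (sym e) (sym e')) (F.≡⇒sub≡0 h)))
     eG : (G.int a G.⊗ β G.^ i G.⊕ G.⊖ (G.int b G.⊗ β G.^ j)) G.⊕ G.⊖ β G.^ l ≡ G.int a G.⊗ β G.^ i G.⊕ G.int (ℤ.- b) G.⊗ β G.^ j G.⊕ G.int -1ℤ G.⊗ β G.^ l
     eG = sym (trans (cong (λ z → G.int a G.⊗ β G.^ i G.⊕ z G.⊗ β G.^ j G.⊕ G.int -1ℤ G.⊗ β G.^ l) (G.int-neg b))
       (G.solve 5 (λ a x b y z → a G.:* x G.:+ (G.:- b) G.:* y G.:+ G.con -1ℤ G.:* z G.:= (a G.:* x G.:+ G.:- (b G.:* y)) G.:+ G.:- z) refl (G.int a) (β G.^ i) (G.int b) (β G.^ j) (β G.^ l)))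

   χ-sg : ∀ {d} → d ≢ F.0ᶠ → F.χ d ≡ sg (F.sqr d)
   χ-sg {d} h = trans (F.χ-sqr h) (b (F.sqr d))
     where
     b : ∀ b → (if b then 1ℤ else -1ℤ) ≡ sg b
     b true = refl
     b false = refl

   paley-⊑ᵢ : Paley F ⊑ᵢ Paley G
   paley-⊑ᵢ = G.paley-embed (adj (Paley F)) (λ u → trans (cong F.sqr (F.⊖-inverseʳ u)) F.sqr0) (λ x → value (rep x)) λ u v u≢v → go u v u≢v (F.log (u F.⊕ F.⊖ v) (u≢v ∘ F.sub≡0⇒≡))
     where
     go : ∀ u v → u ≢ v → (∃ λ l → l < F.m × u F.⊕ F.⊖ v ≡ F.g F.^ l) → G.χ (value (rep u) G.⊕ G.⊖ value (rep v)) ≡ sg (adj (Paley F) u v)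
     go u v u≢v (l , _ , e) = trans (cong G.χ (difference (rep u) (rep v) l e)) (trans (χ-β^ l) (trans (sym (F.χ-g^ l)) (trans (cong F.χ (sym e)) (χ-sg (u≢v ∘ F.sub≡0⇒≡)))))

-- Homomorphism counts and the polynomials X

module Homomorphisms where
 open import Defs hiding (Injective)
 open Sums
 open Variances using (module Tuples)
 open Realisations using (bool-ext; ∧-intro; ∧-elim)
 open Characters using (T⇒≡; ≡⇒T)
 open import Data.Bool.ListAction using (all)
 open import Data.Fin.Properties using (_≟_; injective⇒≤)
 open import Data.Integer.Base using (+_; _+_; _*_; _-_; -_; _≤_; _<_)
 open import Data.List.Base as List using (List; []; _∷_; allFin; map; concatMap; length; filterᵇ; tabulate; _++_)
 open import Data.Vec.Base as Vec using (Vec; []; _∷_; lookup)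
 import Data.Vec.Properties as Vec

 all-intro : ∀ {A : Set} {n} (p : A → Bool) (f : Fin n → A) → (∀ i → p (f i) ≡ true) → all p (tabulate f) ≡ true
 all-intro {n = zero} p f h = refl
 all-intro {n = suc n} p f h = cong₂ _∧_ (h zero) (all-intro p (f ∘ suc) (h ∘ suc))

 all-elim : ∀ {A : Set} {n} (p : A → Bool) (f : Fin n → A) → all p (tabulate f) ≡ true → ∀ i → p (f i) ≡ true
 all-elim {n = suc n} p f h i with p (f zero) in eq
 all-elim {n = suc n} p f h zero | true = eq
 all-elim {n = suc n} p f h (suc i) | true = all-elim p (f ∘ suc) h i

 IsHom : (G H : Graph) → (Fin (size G) → Fin (size H)) → Set
 IsHom G H f = ∀ u v → adj G u v ≡ true → adj H (f u) (f v) ≡ true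

 implies-intro : ∀ {a b} → (a ≡ true → b ≡ true) → not a ∨ b ≡ true
 implies-intro {true} h = h refl
 implies-intro {false} _ = refl

 implies-elim : ∀ {a b} → not a ∨ b ≡ true → a ≡ true → b ≡ true
 implies-elim {true} h _ = h

 isHom-intro : ∀ G H f → IsHom G H f → isHom G H f ≡ true
 isHom-intro G H f h = all-intro _ id λ u → all-intro _ id λ v → implies-intro (h u v)

 isHom-elim : ∀ G H f → isHom G H f ≡ true → IsHom G H f
 isHom-elim G H f h u v = implies-elim (all-elim _ id (all-elim _ id h u) v)

 LS : ∀ {A : Set} → (A → ℤ) → List A → ℤ
 LS W [] = 0ℤ
 LS W (x ∷ xs) = W x + LS W xs

 LS-filter : ∀ {A : Set} (p : A → Bool) xs → + length (filterᵇ p xs) ≡ LS (λ x → 𝟙 (p x)) xs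
 LS-filter p [] = refl
 LS-filter p (x ∷ xs) with p x
 ... | true = cong (λ z → 1ℤ + z) (LS-filter p xs)
 ... | false = trans (LS-filter p xs) (sym (ℤ.+-identityˡ _))

 LS-++ : ∀ {A : Set} (W : A → ℤ) xs ys → LS W (xs ++ ys) ≡ LS W xs + LS W ys
 LS-++ W [] ys = sym (ℤ.+-identityˡ _)
 LS-++ W (x ∷ xs) ys = trans (cong (λ z → W x + z) (LS-++ W xs ys)) (sym (ℤ.+-assoc (W x) (LS W xs) (LS W ys)))

 LS-concatMap : ∀ {A B : Set} (W : B → ℤ) (h : A → List B) xs → LS W (concatMap h xs) ≡ LS (λ x → LS W (h x)) xs
 LS-concatMap W h [] = refl
 LS-concatMap W h (x ∷ xs) = trans (LS-++ W (h x) (concatMap h xs)) (cong (λ z → LS W (h x) + z) (LS-concatMap W h xs))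

 LS-map : ∀ {A B : Set} {n} (W : B → ℤ) (k : A → B) (f : Fin n → A) → LS W (map k (tabulate f)) ≡ ∑[ i < n ] W (k (f i))
 LS-map {n = zero} W k f = sym (∑-[] _)
 LS-map {n = suc n} W k f = trans (cong (λ z → W (k (f zero)) + z) (LS-map W k (f ∘ suc))) (sym (∑-∷ _))

 LS-tabulate : ∀ {A : Set} {n} (W : A → ℤ) (f : Fin n → A) → LS W (tabulate f) ≡ ∑[ i < n ] W (f i)
 LS-tabulate {n = zero} W f = sym (∑-[] _)
 LS-tabulate {n = suc n} W f = trans (cong (λ z → W (f zero) + z) (LS-tabulate W (f ∘ suc))) (sym (∑-∷ _))

 LS-cong : ∀ {A : Set} {W W' : A → ℤ} → (∀ x → W x ≡ W' x) → ∀ xs → LS W xs ≡ LS W' xs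
 LS-cong h [] = refl
 LS-cong h (x ∷ xs) = cong₂ _+_ (h x) (LS-cong h xs)

 -- Respect for pointwise equality, which is weaker than equality of functions. It allows the sum
 -- over `allFuns` to be rewritten as a sum over vectors.
 Ext : ∀ {n m} {A : Set} → ((Fin n → Fin m) → A) → Set
 Ext W = ∀ f g → (∀ i → f i ≡ g i) → W f ≡ W g

 module _ {m : ℕ} where
   open Tuples m

   -- Stated for any c with the equations of prepending a value, because the function that does this
   -- in `allFuns` is local to its definition.
   LS-extend : ∀ {n} (c : Fin m → (Fin n → Fin m) → Fin (suc n) → Fin m) → (∀ x f → c x f zero ≡ x) → (∀ x f i → c x f (suc i) ≡ f i) → ∀ fs →
     ((W : (Fin n → Fin m) → ℤ) → Ext W → LS W fs ≡ ∑T (λ v → W (lookup v))) → (W : (Fin (suc n) → Fin m) → ℤ) → Ext W →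
     LS W (concatMap (λ f → map (λ x → c x f) (allFin m)) fs) ≡ ∑T (λ v → W (lookup v))
   LS-extend c c₀ cₛ fs rec W ext = trans (LS-concatMap W (λ f → map (λ x → c x f) (allFin m)) fs) (trans (LS-cong (λ f → LS-map W (λ x → c x f) id) fs)
     (trans (rec (λ f → ∑[ x < m ] W (c x f)) (λ f g h → ∑-cong λ x → ext (c x f) (c x g) λ { zero → trans (c₀ x f) (sym (c₀ x g)) ; (suc i) → trans (cₛ x f i) (trans (h i) (sym (cₛ x g i))) }))
       (trans (∑T-∑ (λ v x → W (c x (lookup v)))) (∑-cong λ x → ∑T-cong λ v → ext (c x (lookup v)) (lookup (x ∷ v)) λ { zero → c₀ x (lookup v) ; (suc i) → cₛ x (lookup v) i }))))

   LS-allFuns : ∀ n (W : (Fin n → Fin m) → ℤ) → Ext W → LS W (allFuns n m) ≡ ∑T (λ v → W (lookup v))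
   LS-allFuns zero W ext = trans (ℤ.+-identityʳ _) (ext _ _ λ ())
   LS-allFuns (suc n) W ext = LS-extend _ (λ _ _ → refl) (λ _ _ _ → refl) (allFuns n m) (LS-allFuns n) W ext

   ∑T-0≤ : ∀ {k} (f : Vec (Fin m) k → ℤ) → (∀ v → 0ℤ ≤ f v) → 0ℤ ≤ ∑T f
   ∑T-0≤ {zero} f h = h []
   ∑T-0≤ {suc k} f h = ∑-0≤ λ x → ∑T-0≤ _ λ v → h (x ∷ v)

   ∑T-term : ∀ {k} (f : Vec (Fin m) k → ℤ) → (∀ v → 0ℤ ≤ f v) → ∀ v → f v ≤ ∑T f
   ∑T-term {zero} f h [] = ℤ.≤-refl
   ∑T-term {suc k} f h (x ∷ v) = ℤ.≤-trans (∑T-term (λ v → f (x ∷ v)) (λ v → h (x ∷ v)) v) (∑-term (λ x → ∑T-0≤ (λ v → f (x ∷ v)) λ v → h (x ∷ v)) x)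

   ∑T-pos : ∀ {k} (f : Vec (Fin m) k → ℤ) → 0ℤ < ∑T f → ∃ λ v → 0ℤ < f v
   ∑T-pos {zero} f h = [] , h
   ∑T-pos {suc k} f h with x , h' ← ∑-pos _ h with v , h'' ← ∑T-pos (λ v → f (x ∷ v)) h' = x ∷ v , h''

   ∑T-comm : ∀ {k l} (f : Vec (Fin m) k → Vec (Fin m) l → ℤ) → ∑T (λ v → ∑T (λ w → f v w)) ≡ ∑T (λ w → ∑T (λ v → f v w))
   ∑T-comm {zero} f = refl
   ∑T-comm {suc k} f = trans (∑-cong λ x → ∑T-comm (λ v w → f (x ∷ v) w)) (sym (∑T-∑ (λ w x → ∑T (λ v → f (x ∷ v) w))))

   infix 4 _≟ᵛ_
   _≟ᵛ_ : ∀ {k} (v w : Vec (Fin m) k) → Dec (v ≡ w)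
   _≟ᵛ_ = Vec.≡-dec _≟_

   δV : ∀ {k} → Vec (Fin m) k → Vec (Fin m) k → ℤ
   δV v w = 𝟙 (does (v ≟ᵛ w))

   δV-∷ : ∀ {k} x y (v w : Vec (Fin m) k) → δV (x ∷ v) (y ∷ w) ≡ δ x y * δV v w
   δV-∷ x y v w = 𝟙-∧ (does (x ≟ y)) (does (v ≟ᵛ w))

   ∑T-δ : ∀ {k} (v : Vec (Fin m) k) f → ∑T (λ w → δV v w * f w) ≡ f v
   ∑T-δ {zero} [] f = ℤ.*-identityˡ (f [])
   ∑T-δ {suc k} (x ∷ v) f = trans (∑-cong λ y → trans (∑T-cong λ w → trans (cong (_* f (y ∷ w)) (δV-∷ x y v w)) (ℤ.*-assoc (δ x y) (δV v w) (f (y ∷ w)))) (trans (∑T-*ˡ (δ x y) (λ w → δV v w * f (y ∷ w))) (cong (δ x y *_) (∑T-δ v (λ w → f (y ∷ w))))))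
     (∑-δ x (λ y → f (y ∷ v)))

   ∑T-reindex : ∀ {k l} (σ : Vec (Fin m) k → Vec (Fin m) l) (τ : Vec (Fin m) l → Vec (Fin m) k) → (∀ v → τ (σ v) ≡ v) → (∀ w → σ (τ w) ≡ w) → ∀ f → ∑T (λ v → f (σ v)) ≡ ∑T f
   ∑T-reindex σ τ τσ στ f = trans (∑T-cong λ v → sym (∑T-δ (σ v) f)) (trans (∑T-comm (λ v w → δV (σ v) w * f w)) (∑T-cong λ w → trans (∑T-cong λ v → trans (cong (_* f w) (flip v w)) (trans (ℤ.*-comm (δV (τ w) v) (f w)) refl))
       (trans (∑T-*ˡ (f w) (λ v → δV (τ w) v)) (trans (cong (f w *_) (trans (∑T-cong λ v → sym (ℤ.*-identityʳ (δV (τ w) v))) (∑T-δ (τ w) (λ _ → 1ℤ)))) (ℤ.*-identityʳ (f w))))))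
     where
     flip : ∀ v w → δV (σ v) w ≡ δV (τ w) v
     flip v w with σ v ≟ᵛ w
     ... | yes refl = sym (cong 𝟙 (dec-true (τ (σ v) ≟ᵛ v) (τσ v)))
     ... | no h = sym (cong 𝟙 (dec-false (τ w ≟ᵛ v) λ e → h (trans (cong σ (sym e)) (στ w))))

 fiber-∑ : ∀ {n m} (f : Fin n → Fin m) u → + fiber f u ≡ ∑[ v < n ] 𝟙 (does (f v ≟ u))
 fiber-∑ {n} f u = trans (LS-filter _ (allFin n)) (LS-tabulate _ id)

 Good : (H G : Graph) → (Fin (size H) → ℕ) → (Fin (size G) → Fin (size H)) → Bool
 Good H G a f = isHom G H f ∧ all (λ u → fiber f u == a u) (allFin (size H))

 IsGood : (H G : Graph) → (Fin (size H) → ℕ) → (Fin (size G) → Fin (size H)) → Set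
 IsGood H G a f = IsHom G H f × (∀ u → fiber f u ≡ a u)

 good-intro : ∀ H G a f → IsGood H G a f → Good H G a f ≡ true
 good-intro H G a f (h , e) = ∧-intro (isHom-intro G H f h) (all-intro _ id λ u → T⇒≡ (ℕ.≡⇒≡ᵇ (fiber f u) (a u) (e u)))

 good-elim : ∀ H G a f → Good H G a f ≡ true → IsGood H G a f
 good-elim H G a f h = let p , q = ∧-elim (isHom G H f) h in isHom-elim G H f p , λ u → ℕ.≡ᵇ⇒≡ (fiber f u) (a u) (≡⇒T (all-elim _ id q u))

 fiber-ext : ∀ {n m} (f g : Fin n → Fin m) → (∀ i → f i ≡ g i) → ∀ u → fiber f u ≡ fiber g u
 fiber-ext f g h u = ℤ.+-injective (trans (fiber-∑ f u) (trans (∑-cong λ v → cong (λ x → 𝟙 (does (x ≟ u))) (h v)) (sym (fiber-∑ g u))))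

 good-ext : ∀ H G a → Ext (Good H G a)
 good-ext H G a f g h = bool-ext (go f g h) (go g f (sym ∘ h))
   where
   go : ∀ f g → (∀ i → f i ≡ g i) → Good H G a f ≡ true → Good H G a g ≡ true
   go f g h e = let p , q = good-elim H G a f e in good-intro H G a g ((λ u v a → subst₂ (λ x y → adj H x y ≡ true) (h u) (h v) (p u v a)) , λ u → trans (sym (fiber-ext f g h u)) (q u))

 module _ (H : Graph) where
   open Tuples (size H)

   X-∑T : ∀ G a → + X H G a ≡ ∑T (λ v → 𝟙 (Good H G a (lookup v)))
   X-∑T G a = trans (LS-filter (Good H G a) (allFuns (size G) (size H))) (LS-allFuns (size G) (λ f → 𝟙 (Good H G a f)) λ f g h → cong 𝟙 (good-ext H G a f g h))

   X-cong : ∀ G a b → (∀ u → a u ≡ b u) → X H G a ≡ X H G b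
   X-cong G a b h = ℤ.+-injective (trans (X-∑T G a) (trans (∑T-cong λ v → cong 𝟙 (bool-ext (go a b h (lookup v)) (go b a (sym ∘ h) (lookup v)))) (sym (X-∑T G b))))
     where
     go : ∀ a b → (∀ u → a u ≡ b u) → ∀ f → Good H G a f ≡ true → Good H G b f ≡ true
     go a b h f e = let p , q = good-elim H G a f e in good-intro H G b f (p , λ u → trans (q u) (h u))

   -- No fibre has more elements than G. This confines the exponents to be inspected when two
   -- polynomials are compared.
   X-large : ∀ G a u → size G ℕ.< a u → X H G a ≡ 0
   X-large G a u h = ℤ.+-injective (trans (X-∑T G a) (trans (∑T-cong λ v → none (lookup v)) (trans (∑T-const (size G) 0ℤ) (ℤ.*-zeroʳ ((+ size H) ℤ.^ size G)))))
     where
     none : ∀ f → 𝟙 (Good H G a f) ≡ 0ℤ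
     none f with Good H G a f in eq
     ... | false = refl
     ... | true = ⊥-elim (ℕ.<⇒≱ h (subst (ℕ._≤ size G) (proj₂ (good-elim H G a f eq) u) (ℤ.drop‿+≤+ (subst₂ _≤_ (sym (fiber-∑ f u)) (∑-ones (size G)) (∑-mono λ v → 𝟙≤1 (does (f v ≟ u)))))))

   fiber-iso : ∀ {n n' : ℕ} (f : Fin n → Fin n') (g : Fin n' → Fin n) → (∀ x → g (f x) ≡ x) → (∀ y → f (g y) ≡ y) → ∀ (φ : Fin n' → Fin (size H)) u → fiber (φ ∘ f) u ≡ fiber φ u
   fiber-iso f g gf fg φ u = ℤ.+-injective (trans (fiber-∑ (φ ∘ f) u) (trans (ℤ.≤-antisym
       (∑-inj-≤ f (λ i j e → trans (sym (gf i)) (trans (cong g e) (gf j))) (λ v → 𝟙 (does (φ v ≟ u))) (λ v → 0≤𝟙 (does (φ v ≟ u))))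
       (subst (_≤ _) (∑-cong λ v → cong (λ z → 𝟙 (does (φ z ≟ u))) (fg v)) (∑-inj-≤ g (λ i j e → trans (sym (fg i)) (trans (cong f e) (fg j))) (λ v → 𝟙 (does (φ (f v) ≟ u))) (λ v → 0≤𝟙 (does (φ (f v) ≟ u)))))) (sym (fiber-∑ φ u))))

   iso⇒X : ∀ G G' → G ≅ G' → XEq H G G'
   iso⇒X G G' (f , g , gf , fg , pres) a = ℤ.+-injective (trans (X-∑T G a) (trans (sym (∑T-reindex σ τ τσ στ (λ v → 𝟙 (Good H G a (lookup v))))) (trans (∑T-cong λ v → cong 𝟙 (same v)) (sym (X-∑T G' a)))))
     where
     σ : Vec (Fin (size H)) (size G') → Vec (Fin (size H)) (size G)
     σ v = Vec.tabulate (lookup v ∘ f)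
     τ : Vec (Fin (size H)) (size G) → Vec (Fin (size H)) (size G')
     τ v = Vec.tabulate (lookup v ∘ g)
     τσ : ∀ v → τ (σ v) ≡ v
     τσ v = trans (Vec.tabulate-cong λ i → trans (Vec.lookup∘tabulate (lookup v ∘ f) (g i)) (cong (lookup v) (fg i))) (Vec.tabulate∘lookup v)
     στ : ∀ v → σ (τ v) ≡ v
     στ v = trans (Vec.tabulate-cong λ i → trans (Vec.lookup∘tabulate (lookup v ∘ g) (f i)) (cong (lookup v) (gf i))) (Vec.tabulate∘lookup v)
     to : ∀ φ → IsGood H G' a φ → IsGood H G a (φ ∘ f)
     to φ (h , e) = (λ u v q → h (f u) (f v) (trans (sym (pres u v)) q)) , λ u → trans (fiber-iso f g gf fg φ u) (e u)
     from : ∀ φ → IsGood H G a (φ ∘ f) → IsGood H G' a φ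
     from φ (h , e) = (λ u v q → subst₂ (λ x y → adj H (φ x) (φ y) ≡ true) (fg u) (fg v) (h (g u) (g v) (trans (pres (g u) (g v)) (trans (cong₂ (adj G') (fg u) (fg v)) q)))) , λ u → trans (sym (fiber-iso f g gf fg φ u)) (e u)
     same : ∀ v → Good H G a (lookup (σ v)) ≡ Good H G' a (lookup v)
     same v = trans (good-ext H G a (lookup (σ v)) (lookup v ∘ f) (Vec.lookup∘tabulate (lookup v ∘ f))) (bool-ext (λ e → good-intro H G' a (lookup v) (from (lookup v) (good-elim H G a (lookup v ∘ f) e))) (λ e → good-intro H G a (lookup v ∘ f) (to (lookup v) (good-elim H G' a (lookup v) e))))

   BijHom : Graph → Graph → Set
   BijHom G G' = ∃ λ (π : Fin (size G) → Fin (size G')) → (∀ i j → π i ≡ π j → i ≡ j) × IsHom G G' π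

   -- The monomial of the embedding e of G also occurs for G', through some φ with the same fibres.
   -- So φ is injective with the image of e, and following φ by the inverse of e is a homomorphism
   -- because e is induced.
   X⇒hom : ∀ G G' → XEq H G G' → G ⊑ᵢ H → BijHom G' G
   X⇒hom G G' eq (e , inj , pres) = π , π-inj , π-hom
     where
     a : Fin (size H) → ℕ
     a = fiber e
     good-e : Good H G a (lookup (Vec.tabulate e)) ≡ true
     good-e = trans (good-ext H G a (lookup (Vec.tabulate e)) e (Vec.lookup∘tabulate e)) (good-intro H G a e ((λ u v q → trans (sym (pres u v)) q) , λ _ → refl))
     0<X : 0ℤ < + X H G a
     0<X = ℤ.<-≤-trans (subst (λ b → 0ℤ < 𝟙 b) (sym good-e) (+<+ (s≤s z≤n))) (subst (𝟙 (Good H G a (lookup (Vec.tabulate e))) ≤_) (sym (X-∑T G a)) (∑T-term _ (λ v → 0≤𝟙 (Good H G a (lookup v))) (Vec.tabulate e)))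
     found : ∃ λ v → 0ℤ < 𝟙 (Good H G' a (lookup v))
     found = ∑T-pos _ (subst (0ℤ <_) (trans (cong +_ (eq a)) (X-∑T G' a)) 0<X)
     φ : Fin (size G') → Fin (size H)
     φ = lookup (proj₁ found)
     good : IsGood H G' a φ
     good = good-elim H G' a φ (0<𝟙* (Good H G' a φ) (subst (0ℤ <_) (sym (ℤ.*-identityʳ _)) (proj₂ found)))
     fib : ∀ u → (∑[ v < size G' ] 𝟙 (does (φ v ≟ u))) ≡ (∑[ v < size G ] 𝟙 (does (e v ≟ u)))
     fib u = trans (sym (fiber-∑ φ u)) (trans (cong +_ (proj₂ good u)) (fiber-∑ e u))
     hit : ∀ x → 𝟙 (does (φ x ≟ φ x)) ≡ 1ℤ
     hit x = cong 𝟙 (dec-true (φ x ≟ φ x) refl)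
     preimage : ∀ x → ∃ λ w → e w ≡ φ x
     preimage x = proj₁ p , does-true (0<𝟙* (does (e (proj₁ p) ≟ φ x)) (subst (0ℤ <_) (sym (ℤ.*-identityʳ _)) (proj₂ p)))
       where
       p : ∃ λ w → 0ℤ < 𝟙 (does (e w ≟ φ x))
       p = ∑-pos _ (subst (0ℤ <_) (fib (φ x)) (ℤ.<-≤-trans (subst (0ℤ <_) (sym (hit x)) (+<+ (s≤s z≤n))) (∑-term (λ v → 0≤𝟙 (does (φ v ≟ φ x))) x)))
     φ-inj : ∀ x y → φ x ≡ φ y → x ≡ y
     φ-inj x y q with x ≟ y
     ... | yes p = p
     ... | no h = ⊥-elim (two≰one (ℤ.≤-trans two (subst (_≤ 1ℤ) (sym (fib (φ x))) (∑-fiber≤1 (λ v → does (e v ≟ φ x)) λ i j p q → inj i j (trans (does-true p) (sym (does-true q)))))))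
       where
       two≰one : ¬ (+ 2 ≤ 1ℤ)
       two≰one (+≤+ (s≤s ()))
       point : ∀ v → δ x v + δ y v ≤ 𝟙 (does (φ v ≟ φ x))
       point v with δ-cases x v | δ-cases y v
       ... | inj₁ (refl , d) | inj₁ (refl , _) = ⊥-elim (h refl)
       ... | inj₁ (refl , d) | inj₂ (_ , d') = ℤ.≤-reflexive (trans (cong₂ _+_ d d') (sym (hit x)))
       ... | inj₂ (_ , d) | inj₁ (refl , d') = ℤ.≤-reflexive (trans (cong₂ _+_ d d') (sym (cong 𝟙 (dec-true (φ y ≟ φ x) (sym q)))))
       ... | inj₂ (_ , d) | inj₂ (_ , d') = subst (_≤ 𝟙 (does (φ v ≟ φ x))) (sym (cong₂ _+_ d d')) (0≤𝟙 (does (φ v ≟ φ x)))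
       two : + 2 ≤ (∑[ v < size G' ] 𝟙 (does (φ v ≟ φ x)))
       two = subst (_≤ (∑[ v < size G' ] 𝟙 (does (φ v ≟ φ x)))) (trans (∑-+ (δ x) (δ y)) (cong₂ _+_ (∑-δ1 x) (∑-δ1 y))) (∑-mono point)
     π : Fin (size G') → Fin (size G)
     π x = proj₁ (preimage x)
     π-inj : ∀ i j → π i ≡ π j → i ≡ j
     π-inj i j q = φ-inj i j (trans (sym (proj₂ (preimage i))) (trans (cong e q) (proj₂ (preimage j))))
     π-hom : IsHom G' G π
     π-hom u v q = trans (pres (π u) (π v)) (trans (cong₂ (adj H) (proj₂ (preimage u)) (proj₂ (preimage v))) (proj₁ good u v q))

   edges : Graph → ℤ
   edges G = ∑[ u < size G ] (∑[ v < size G ] 𝟙 (adj G u v))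

   𝟙-mono : ∀ {a b} → (a ≡ true → b ≡ true) → 𝟙 a ≤ 𝟙 b
   𝟙-mono {true} h = ℤ.≤-reflexive (sym (cong 𝟙 (h refl)))
   𝟙-mono {false} {b} h = 0≤𝟙 b

   module _ (G G' : Graph) (bij : BijHom G G') where
     π : Fin (size G) → Fin (size G')
     π = proj₁ bij

     inj : ∀ i j → π i ≡ π j → i ≡ j
     inj = proj₁ (proj₂ bij)

     hom : IsHom G G' π
     hom = proj₂ (proj₂ bij)

     pulled : ℤ
     pulled = ∑[ u < size G ] (∑[ v < size G ] 𝟙 (adj G' (π u) (π v)))

     pulled≤ : pulled ≤ edges G'
     pulled≤ = ℤ.≤-trans (∑-mono λ u → ∑-inj-≤ π inj (λ v → 𝟙 (adj G' (π u) v)) (λ v → 0≤𝟙 (adj G' (π u) v))) (∑-inj-≤ π inj (λ u → ∑[ v < size G' ] 𝟙 (adj G' u v)) (λ u → ∑-0≤ λ v → 0≤𝟙 (adj G' u v)))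

     edges≤pulled : edges G ≤ pulled
     edges≤pulled = ∑-mono λ u → ∑-mono λ v → 𝟙-mono (hom u v)

     edges≤ : edges G ≤ edges G'
     edges≤ = ℤ.≤-trans edges≤pulled pulled≤

     -- The indicator differences are nonnegative, and equal edge numbers make their sum at most 0,
     -- so none of them is positive.
     reflects : edges G' ≤ edges G → ∀ u v → adj G u v ≡ adj G' (π u) (π v)
     reflects le u v = bool-ext (hom u v) (decide (adj G u v) (adj G' (π u) (π v)) zero-diff)
       where
       d : Fin (size G) → Fin (size G) → ℤ
       d u v = 𝟙 (adj G' (π u) (π v)) - 𝟙 (adj G u v)
       0≤d : ∀ u v → 0ℤ ≤ d u v
       0≤d u v = ≤-diff (𝟙-mono (hom u v))
       total : (∑[ u < size G ] (∑[ v < size G ] d u v)) ≡ pulled - edges G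
       total = trans (∑-cong λ u → ∑-sub (λ v → 𝟙 (adj G' (π u) (π v))) (λ v → 𝟙 (adj G u v))) (∑-sub (λ u → ∑[ v < size G ] 𝟙 (adj G' (π u) (π v))) (λ u → ∑[ v < size G ] 𝟙 (adj G u v)))
       zero-diff : d u v ≤ 0ℤ
       zero-diff = ℤ.≤-trans (∑-term (0≤d u) v) (ℤ.≤-trans (∑-term (λ u → ∑-0≤ (0≤d u)) u) (subst₂ _≤_ (sym total) (ℤ.+-inverseʳ (edges G)) (ℤ.+-monoˡ-≤ (- edges G) (ℤ.≤-trans pulled≤ le))))
       decide : ∀ a b → 𝟙 b - 𝟙 a ≤ 0ℤ → b ≡ true → a ≡ true
       decide true _ _ _ = refl
       decide false true (+≤+ ()) _

   X⇒iso : ∀ G G' → XEq H G G' → G ⊑ᵢ H → G' ⊑ᵢ H → G ≅ G'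
   X⇒iso G G' eq emb emb' = π₀ , ρ , ρπ , πρ , reflects G G' fwd (edges≤ G' G bwd)
     where
     bwd : BijHom G' G
     bwd = X⇒hom G G' eq emb
     fwd : BijHom G G'
     fwd = X⇒hom G' G (λ a → sym (eq a)) emb'
     π₀ : Fin (size G) → Fin (size G')
     π₀ = proj₁ fwd
     same-size : size G' ≡ size G
     same-size = ℕ.≤-antisym (injective⇒≤ {f = proj₁ bwd} (λ {i} {j} → proj₁ (proj₂ bwd) i j)) (injective⇒≤ {f = π₀} (λ {i} {j} → proj₁ (proj₂ fwd) i j))
     surj : ∀ {n n'} → n' ≡ n → (f : Fin n → Fin n') → (∀ i j → f i ≡ f j → i ≡ j) → ∀ y → ∃ λ x → f x ≡ y
     surj refl f inj y = inj⇒surj f inj y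
     ρ : Fin (size G') → Fin (size G)
     ρ y = proj₁ (surj same-size π₀ (proj₁ (proj₂ fwd)) y)
     πρ : ∀ y → π₀ (ρ y) ≡ y
     πρ y = proj₂ (surj same-size π₀ (proj₁ (proj₂ fwd)) y)
     ρπ : ∀ x → ρ (π₀ x) ≡ x
     ρπ x = proj₁ (proj₂ fwd) _ _ (πρ (π₀ x))

-- Deciding completeness and finding minimal indices

module CompleteInvariants where
 open import Defs hiding (Injective; K)
 open Search
 open Homomorphisms
 open import Data.Fin.Base using (fromℕ<; combine; remQuot)
 open import Data.Fin.Properties using (_≟_; all?; toℕ<n; toℕ-fromℕ<; remQuot-combine)
 open import Data.Nat.Base using (_≤_; _*_; _+_)
 open import Data.Vec.Base as Vec using (Vec; lookup)
 import Data.Vec.Properties as Vec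
 open import Function.Bundles using (mk⇔; Equivalence)
 open import Relation.Unary using (Decidable)

 allVec? : ∀ {p} d {P : Vec (Fin p) d → Set} → Decidable P → Dec (∀ v → P v)
 allVec? d P? = map′ (λ h v → decidable-stable (P? v) λ q → h (v , q)) (λ h (v , q) → q (h v)) (¬? (anyVec? d λ v → ¬? (P? v)))

 ⊑ᵢ? : ∀ G H → Dec (G ⊑ᵢ H)
 ⊑ᵢ? G H = map′ (λ (v , h) → lookup v , h) (λ (f , i , a) → Vec.tabulate f , (λ x y e → i x y (trans (sym (Vec.lookup∘tabulate f x)) (trans e (Vec.lookup∘tabulate f y)))) , λ u v → trans (a u v) (sym (cong₂ (adj H) (Vec.lookup∘tabulate f u) (Vec.lookup∘tabulate f v))))
   (anyVec? (size G) λ v → all? (λ x → all? λ y → (lookup v x ≟ lookup v y) →-dec (x ≟ y)) ×-dec all? (λ x → all? λ y → adj G x y Bool.≟ adj H (lookup v x) (lookup v y)))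

 induced-index : ∀ (P : ℕ → Graph) G s → 1 ≤ s → G ⊑ᵢ P s → Σ ℕ λ t → (t ≤ s) × InducedIndex P G t
 induced-index P G s 1≤s h = least (λ n → (1 ≤ n) × (G ⊑ᵢ P n)) (λ n → (1 ℕ.≤? n) ×-dec ⊑ᵢ? G (P n)) s (1≤s , h)

 ≅-sym : ∀ {G H} → G ≅ H → H ≅ G
 ≅-sym {G} {H} (f , g , gf , fg , a) = g , f , fg , gf , λ u v → sym (trans (a (g u) (g v)) (cong₂ (adj H) (fg u) (fg v)))

 ≅-trans : ∀ {G H J} → G ≅ H → H ≅ J → G ≅ J
 ≅-trans (f , g , gf , fg , a) (f' , g' , gf' , fg' , a') = (f' ∘ f) , (g ∘ g') , (λ x → trans (cong g (gf' (f x))) (gf x)) , (λ y → trans (cong f' (fg (g' y))) (fg' y)) , λ u v → trans (a u v) (a' (f u) (f v))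

 ≅? : ∀ G H → Dec (G ≅ H)
 ≅? G H = map′ (λ (v , w , h) → lookup v , lookup w , h)
   (λ (f , g , gf , fg , a) → Vec.tabulate f , Vec.tabulate g , (λ x → trans (Vec.lookup∘tabulate g _) (trans (cong g (Vec.lookup∘tabulate f x)) (gf x))) , (λ y → trans (Vec.lookup∘tabulate f _) (trans (cong f (Vec.lookup∘tabulate g y)) (fg y))) ,
     λ u v → trans (a u v) (sym (cong₂ (adj H) (Vec.lookup∘tabulate f u) (Vec.lookup∘tabulate f v))))
   (anyVec? (size G) λ v → anyVec? (size H) λ w → all? (λ x → lookup w (lookup v x) ≟ x) ×-dec all? (λ y → lookup v (lookup w y) ≟ y) ×-dec all? (λ x → all? λ y → adj G x y Bool.≟ adj H (lookup v x) (lookup v y)))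

 -- If some exponent exceeds the sum of the two sizes, both coefficients are 0 by `X-large`;
 -- finitely many exponent vectors remain.
 XEq? : ∀ H G G' → Dec (XEq H G G')
 XEq? H G G' = map′ to (λ h v → h (toℕ ∘ lookup v)) (allVec? (size H) λ v → X H G (toℕ ∘ lookup v) ℕ.≟ X H G' (toℕ ∘ lookup v))
   where
   K : ℕ
   K = size G + size G'
   to : (∀ (v : Vec (Fin (suc K)) (size H)) → X H G (toℕ ∘ lookup v) ≡ X H G' (toℕ ∘ lookup v)) → XEq H G G'
   to h a with all? (λ u → a u ℕ.≤? K)
   ... | yes small = trans (X-cong H G a (toℕ ∘ lookup v) (sym ∘ v≡)) (trans (h v) (X-cong H G' (toℕ ∘ lookup v) a v≡))
     where
     v : Vec (Fin (suc K)) (size H)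
     v = Vec.tabulate λ u → fromℕ< (s≤s (small u))
     v≡ : ∀ u → toℕ (lookup v u) ≡ a u
     v≡ u = trans (cong toℕ (Vec.lookup∘tabulate (λ u → fromℕ< (s≤s (small u))) u)) (toℕ-fromℕ< (s≤s (small u)))
   ... | no big with u , q ← Fin.¬∀⟶∃¬ (size H) (λ u → a u ≤ K) (λ u → a u ℕ.≤? K) big =
     trans (X-large H G a u (ℕ.≤-<-trans (ℕ.m≤m+n (size G) (size G')) (ℕ.≰⇒> q))) (sym (X-large H G' a u (ℕ.≤-<-trans (ℕ.m≤n+m (size G') (size G)) (ℕ.≰⇒> q))))

 bit : Bool → Fin 2
 bit true = suc zero
 bit false = zero

 unbit : Fin 2 → Bool
 unbit zero = false
 unbit (suc _) = true

 unbit-bit : ∀ b → unbit (bit b) ≡ b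
 unbit-bit true = refl
 unbit-bit false = refl

 -- Completeness quantifies over all graphs. Adjacency matrices stored as bit vectors represent
 -- every isomorphism class of a given size and can be searched exhaustively.
 decode : ∀ n → Vec (Fin 2) (n * n) → Graph
 decode n v = record { size = n ; adj = λ i j → unbit (lookup v (combine {n} {n} i j)) }

 encode : ∀ G → Vec (Fin 2) (size G * size G)
 encode G = Vec.tabulate λ x → bit (adj G (proj₁ (remQuot {size G} (size G) x)) (proj₂ (remQuot {size G} (size G) x)))

 decode-encode : ∀ G i j → adj (decode (size G) (encode G)) i j ≡ adj G i j
 decode-encode G i j = trans (cong unbit (trans (Vec.lookup∘tabulate (λ x → bit (adj G (proj₁ (remQuot {size G} (size G) x)) (proj₂ (remQuot {size G} (size G) x)))) (combine {size G} {size G} i j)) (cong (λ p → bit (adj G (proj₁ p) (proj₂ p))) (remQuot-combine {size G} {size G} i j)))) (unbit-bit (adj G i j))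

 ≅-decode : ∀ G → G ≅ decode (size G) (encode G)
 ≅-decode G = id , id , (λ _ → refl) , (λ _ → refl) , λ u v → sym (decode-encode G u v)

 simple-decode : ∀ G → IsSimple G → IsSimple (decode (size G) (encode G))
 simple-decode G (i , s) = (λ u → trans (decode-encode G u u) (i u)) , λ u v → trans (decode-encode G u v) (trans (s u v) (sym (decode-encode G v u)))

 simple? : ∀ G → Dec (IsSimple G)
 simple? G = all? (λ u → adj G u u Bool.≟ false) ×-dec all? (λ u → all? λ v → adj G u v Bool.≟ adj G v u)

 module _ (P : ℕ → Graph) where

   Indistinct : ℕ → Graph → Graph → Set
   Indistinct t G G' = ∀ n → 1 ≤ n → n ≤ t → XEq (P n) G G'

   indistinct? : ∀ t G G' → Dec (Indistinct t G G')
   indistinct? t G G' = map′ (λ h n 1≤n n≤t → at h n 1≤n n≤t) (λ h i → h (suc (toℕ i)) (s≤s z≤n) (toℕ<n i)) (all? {n = t} λ i → XEq? (P (suc (toℕ i))) G G')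
     where
     at : (∀ (i : Fin t) → XEq (P (suc (toℕ i))) G G') → Indistinct t G G'
     at h (suc n) _ n<t = subst (λ z → XEq (P (suc z)) G G') (toℕ-fromℕ< n<t) (h (fromℕ< n<t))

   Separates : ℕ → Graph → Graph → Set
   Separates t G G' = IsSimple G → IsSimple G' → Indistinct t G G' → G ≅ G'

   AllCodes : ℕ → ℕ → Set
   AllCodes k t = ∀ (n n' : Fin (suc k)) v v' → Separates t (decode (toℕ n) v) (decode (toℕ n') v')

   allCodes? : ∀ k t → Dec (AllCodes k t)
   allCodes? k t = all? λ n → all? λ n' → allVec? (toℕ n * toℕ n) λ v → allVec? (toℕ n' * toℕ n') λ v' →
     simple? (decode (toℕ n) v) →-dec simple? (decode (toℕ n') v') →-dec indistinct? t (decode (toℕ n) v) (decode (toℕ n') v') →-dec ≅? (decode (toℕ n) v) (decode (toℕ n') v')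

   iso⇒indistinct : ∀ t {G G'} → G ≅ G' → Indistinct t G G'
   iso⇒indistinct t {G} {G'} i n _ _ = iso⇒X (P n) G G' i

   complete : ∀ k t → (∀ G G' → size G ≤ k → size G' ≤ k → Separates t G G') → CompleteInvariantOn≤ P k t
   complete k t h G G' sG sG' G≤ G'≤ = mk⇔ (h G G' G≤ G'≤ sG sG') (iso⇒indistinct t)

   complete? : ∀ k t → Dec (CompleteInvariantOn≤ P k t)
   complete? k t = map′ (λ h → complete k t (from h)) (λ c n n' v v' s s' → Equivalence.to (c _ _ s s' (ℕ.≤-pred (toℕ<n n)) (ℕ.≤-pred (toℕ<n n')))) (allCodes? k t)
     where
     codes : AllCodes k t → ∀ n n' → n ≤ k → n' ≤ k → ∀ v v' → Separates t (decode n v) (decode n' v')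
     codes h n n' n≤k n'≤k = subst₂ (λ a b → ∀ v v' → Separates t (decode a v) (decode b v')) (toℕ-fromℕ< (s≤s n≤k)) (toℕ-fromℕ< (s≤s n'≤k)) (h (fromℕ< (s≤s n≤k)) (fromℕ< (s≤s n'≤k)))
     from : AllCodes k t → ∀ G G' → size G ≤ k → size G' ≤ k → Separates t G G'
     from h G G' G≤ G'≤ sG sG' ind = ≅-trans {G} {decode (size G) (encode G)} {G'} (≅-decode G) (≅-trans {decode (size G) (encode G)} {decode (size G') (encode G')} {G'}
         (codes h (size G) (size G') G≤ G'≤ (encode G) (encode G') (simple-decode G sG) (simple-decode G' sG') λ n a b x →
           trans (sym (iso⇒indistinct t (≅-decode G) n a b x)) (trans (ind n a b x) (iso⇒indistinct t (≅-decode G') n a b x)))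
         (≅-sym {G'} {decode (size G') (encode G')} (≅-decode G')))

   -- The polynomial of P s alone separates the graphs concerned, because all of them embed in P s.
   complete-index : ∀ k s → 1 ≤ s → (∀ G → IsSimple G → size G ≤ k → G ⊑ᵢ P s) → IP≤ P k s
   complete-index k s 1≤s emb = least (λ t → (1 ≤ t) × CompleteInvariantOn≤ P k t) (λ t → (1 ℕ.≤? t) ×-dec complete? k t) s
     (1≤s , complete k s λ G G' G≤ G'≤ sG sG' ind → X⇒iso (P s) G G' (ind s 1≤s ℕ.≤-refl) (emb G sG G≤) (emb G' sG' G'≤))

-- Cycles and paths in the rook's graph

module Pancyclicity where
 open import Defs hiding (Injective)
 open Characters
 open Directions using (module LineDesign)
 open Realisations using (CycleAdj; cycle-elim; PathAdj; path-elim; cycle-intro)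
 open import Data.Fin.Base using (fromℕ<)
 open import Data.Fin.Properties using (_≟_; toℕ-injective; toℕ<n; toℕ-fromℕ<; injective⇒≤)
 open import Data.Nat.Base using (NonZero; _+_; _*_; _∸_; _≤_; _<_; _%_)
 open import Data.Nat.DivMod using (m%n<n; [m+n]%n≡m%n; m<n⇒m%n≡m; %-distribˡ-+)

 -- Walk through a w × w board row by row, shifting each row so that consecutive rows meet in a column.
 module Snake (w : ℕ) (2<w : 2 < w) where
   instance
     w≢0 : NonZero w
     w≢0 = ℕ.>-nonZero (ℕ.≤-trans (s≤s z≤n) 2<w)

   rc : ℕ → ℕ × ℕ
   advance : ℕ × ℕ → ℕ × ℕ
   rc zero = 0 , 0
   rc (suc p) = advance (rc p)
   advance (i , c) with suc c ℕ.<? w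
   ... | yes _ = i , suc c
   ... | no _ = suc i , 0

   row pos : ℕ → ℕ
   row p = proj₁ (rc p)
   pos p = proj₂ (rc p)

   Advance : ℕ × ℕ → Set
   Advance (i , c) = (advance (i , c) ≡ (i , suc c) × suc c < w) ⊎ (advance (i , c) ≡ (suc i , 0) × w ≤ suc c)

   advance-cases : ∀ ic → Advance ic
   advance-cases (i , c) with suc c ℕ.<? w
   ... | yes h = inj₁ (refl , h)
   ... | no h = inj₂ (refl , ℕ.≮⇒≥ h)

   pos<w : ∀ p → pos p < w
   pos<w zero = ℕ.≤-trans (s≤s z≤n) 2<w
   pos<w (suc p) with advance-cases (rc p)
   ... | inj₁ (e , h) = subst (λ z → proj₂ z < w) (sym e) h
   ... | inj₂ (e , h) = subst (λ z → proj₂ z < w) (sym e) (ℕ.≤-trans (s≤s z≤n) 2<w)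

   rc-sum : ∀ p → pos p + row p * w ≡ p
   rc-sum zero = refl
   rc-sum (suc p) with advance-cases (rc p)
   ... | inj₁ (e , h) = trans (cong (λ z → proj₂ z + proj₁ z * w) e) (cong suc (rc-sum p))
   ... | inj₂ (e , h) = trans (cong (λ z → proj₂ z + proj₁ z * w) e) (trans (cong (_+ row p * w) (ℕ.≤-antisym h (pos<w p))) (cong suc (rc-sum p)))

   row-< : ∀ p {b} → p < b * w → row p < b
   row-< p {b} h = ℕ.*-cancelʳ-< w (row p) b (ℕ.≤-<-trans (subst (row p * w ≤_) (rc-sum p) (ℕ.m≤n+m (row p * w) (pos p))) h)

   rc-unique : ∀ {i c} p → c < w → c + i * w ≡ p → row p ≡ i × pos p ≡ c
   rc-unique {i} {c} p c<w e = row≡ , ℕ.+-cancelʳ-≡ (row p * w) (pos p) c (trans (rc-sum p) (trans (sym e) (cong (λ z → c + z * w) (sym row≡))))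
     where
     below : ∀ {i c i' c'} → c < w → c + i * w ≡ c' + i' * w → i' ≤ i
     below {i} {c} {i'} {c'} h q = ℕ.≤-pred (ℕ.*-cancelʳ-< w i' (suc i) (ℕ.≤-<-trans (subst (i' * w ≤_) (sym q) (ℕ.m≤n+m (i' * w) c')) (ℕ.+-monoˡ-< (i * w) h)))
     row≡ : row p ≡ i
     row≡ = ℕ.≤-antisym (below {i} {c} {row p} {pos p} c<w (trans e (sym (rc-sum p)))) (below {row p} {pos p} {i} {c} (pos<w p) (trans (rc-sum p) (sym e)))

   -- Row i is shifted cyclically by -i; its last cell then lies in the column of the first cell of
   -- row i + 1.
   col : ℕ → ℕ → ℕ
   col i c = (c + (w ∸ i)) % w

   col<w : ∀ i c → col i c < w
   col<w i c = m%n<n (c + (w ∸ i)) w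

   col-inj : ∀ {i c c'} → i ≤ w → c < w → c' < w → col i c ≡ col i c' → c ≡ c'
   col-inj {i} {c} {c'} i≤w h h' e = trans (sym (back c h)) (trans (trans (%-distribˡ-+ (c + (w ∸ i)) i w) (trans (cong (λ z → (z + i % w) % w) e) (sym (%-distribˡ-+ (c' + (w ∸ i)) i w)))) (back c' h'))
     where
     back : ∀ c → c < w → (c + (w ∸ i) + i) % w ≡ c
     back c h = trans (cong (_% w) (trans (ℕ.+-assoc c (w ∸ i) i) (cong (λ z → c + z) (ℕ.m∸n+n≡m i≤w)))) (trans ([m+n]%n≡m%n c w) (m<n⇒m%n≡m h))

   col-turn : ∀ {i c} → suc i ≤ w → suc c ≡ w → col i c ≡ col (suc i) 0
   col-turn {i} {c} h e = trans (cong (_% w) lem) ([m+n]%n≡m%n (w ∸ suc i) w)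
     where
     lem : c + (w ∸ i) ≡ (w ∸ suc i) + w
     lem = trans (cong (λ z → c + z) (ℕ.+-∸-assoc 1 h)) (trans (ℕ.+-suc c (w ∸ suc i)) (trans (ℕ.+-comm (suc c) (w ∸ suc i)) (cong (λ z → (w ∸ suc i) + z) e)))

   col-start : ∀ {o} → o < w → col 0 o ≡ o
   col-start {o} h = trans ([m+n]%n≡m%n o w) (m<n⇒m%n≡m h)

   col-first : ∀ {i} → 1 ≤ i → i ≤ w → col i 0 ≡ w ∸ i
   col-first {suc i} _ h = m<n⇒m%n≡m (ℕ.≤-<-trans (ℕ.∸-monoʳ-≤ w (s≤s z≤n)) (ℕ.∸-monoʳ-< {w} {1} {0} (s≤s z≤n) (ℕ.≤-trans (s≤s z≤n) 2<w)))

   swap : ℕ → ℕ → ℕ → ℕ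
   swap a b x with x ℕ.≟ a
   ... | yes _ = b
   ... | no _ with x ℕ.≟ b
   ...   | yes _ = a
   ...   | no _ = x

   swap-left : ∀ a b → swap a b a ≡ b
   swap-left a b with a ℕ.≟ a
   ... | yes _ = refl
   ... | no h = ⊥-elim (h refl)

   swap-other : ∀ {a b x} → x ≢ a → x ≢ b → swap a b x ≡ x
   swap-other {a} {b} {x} h h' with x ℕ.≟ a
   ... | yes q = ⊥-elim (h q)
   ... | no _ with x ℕ.≟ b
   ...   | yes q = ⊥-elim (h' q)
   ...   | no _ = refl

   swap-< : ∀ {a b x} → a < w → b < w → x < w → swap a b x < w
   swap-< {a} {b} {x} ha hb hx with x ℕ.≟ a
   ... | yes _ = hb
   ... | no _ with x ℕ.≟ b
   ...   | yes _ = ha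
   ...   | no _ = hx

   swap-inj : ∀ a b x y → swap a b x ≡ swap a b y → x ≡ y
   swap-inj a b x y e with x ℕ.≟ a | y ℕ.≟ a
   ... | yes p | yes q = trans p (sym q)
   swap-inj a b x y e | yes p | no q with y ℕ.≟ b
   ... | yes r = trans p (trans (sym e) (trans e (sym (trans r e))))
   ... | no r = ⊥-elim (r (sym e))
   swap-inj a b x y e | no p | yes q with x ℕ.≟ b
   ... | yes r = trans r (trans (sym e) (sym q))
   ... | no r = ⊥-elim (r e)
   swap-inj a b x y e | no p | no q with x ℕ.≟ b | y ℕ.≟ b
   ... | yes r | yes s = trans r (sym s)
   ... | yes r | no s = ⊥-elim (q (sym e))
   ... | no r | yes s = ⊥-elim (p e)
   ... | no r | no s = e

   Share : ℕ × ℕ → ℕ × ℕ → Set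
   Share (i , j) (i' , j') = i ≡ i' ⊎ j ≡ j'

   record Tour (k : ℕ) : Set where
     field
       cell : ℕ → ℕ × ℕ
       on-board : ∀ x → x < k → proj₁ (cell x) < w × proj₂ (cell x) < w
       distinct : ∀ x y → x < k → y < k → cell x ≡ cell y → x ≡ y
       consecutive : ∀ x → suc x < k → Share (cell x) (cell (suc x))
       closes : Share (cell 0) (cell (k ∸ 1))

   short-tour : ∀ k → k ≤ w → Tour k
   short-tour k k≤w = record { cell = λ x → 0 , x ; on-board = λ x h → ℕ.≤-trans (s≤s z≤n) 2<w , ℕ.<-≤-trans h k≤w ; distinct = λ x y _ _ e → cong proj₂ e ; consecutive = λ _ _ → inj₁ refl ; closes = inj₁ refl }

   -- The tour starts in row 0 at offset o and ends in row I at position c. Exchanging the column of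
   -- this last cell with column o inside row I closes the tour, and moves within the row remain
   -- legal. The cell where row I is entered must stay in place, hence 1 ≤ c and `col I 0 ≢ o`.
   module Long (k' o I c : ℕ) (o<w : o < w) (1≤I : 1 ≤ I) (I<w : I < w) (1≤c : 1 ≤ c) (c<w : c < w) (last : o + k' ≡ c + I * w) (o≢ : col I 0 ≢ o) where
     k a : ℕ
     k = suc k'
     a = col I c

     place : ℕ → ℕ → ℕ
     place i c' with i ℕ.≟ I
     ... | yes _ = swap a o (col i c')
     ... | no _ = col i c'

     place-I : ∀ c' → place I c' ≡ swap a o (col I c')
     place-I c' with I ℕ.≟ I
     ... | yes _ = refl
     ... | no h = ⊥-elim (h refl)

     place-other : ∀ {i} → i ≢ I → ∀ c' → place i c' ≡ col i c'
     place-other {i} h c' with i ℕ.≟ I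
     ... | yes q = ⊥-elim (h q)
     ... | no _ = refl

     place-< : ∀ i c' → place i c' < w
     place-< i c' with i ℕ.≟ I
     ... | yes _ = swap-< (col<w I c) o<w (col<w i c')
     ... | no _ = col<w i c'

     place-inj : ∀ i {c' c''} → i ≤ w → c' < w → c'' < w → place i c' ≡ place i c'' → c' ≡ c''
     place-inj i h h' h'' e with i ℕ.≟ I
     ... | yes _ = col-inj h h' h'' (swap-inj a o _ _ e)
     ... | no _ = col-inj h h' h'' e

     place-first : place I 0 ≡ col I 0
     place-first = trans (place-I 0) (swap-other (λ e → ℕ.<⇒≢ 1≤c (col-inj (ℕ.<⇒≤ I<w) (ℕ.≤-trans (s≤s z≤n) 2<w) c<w e)) o≢)

     at : ℕ → ℕ × ℕ
     at p = row p , place (row p) (pos p)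

     row≤I : ∀ p → p ≤ o + k' → row p ≤ I
     row≤I p h = ℕ.≤-pred (row-< p (ℕ.≤-<-trans h (subst (_< suc I * w) (sym last) (ℕ.+-monoˡ-< (I * w) c<w))))

     step : ∀ p → suc p ≤ o + k' → Share (at p) (at (suc p))
     step p h with advance-cases (rc p)
     ... | inj₁ (e , _) = inj₁ (sym (cong proj₁ e))
     ... | inj₂ (e , w≤) = inj₂ (trans (place-other (ℕ.<⇒≢ i<I) (pos p)) (trans (col-turn (ℕ.≤-trans i<I (ℕ.<⇒≤ I<w)) (ℕ.≤-antisym (pos<w p) w≤)) (sym (trans (cong₂ place (cong proj₁ e) (cong proj₂ e)) first))))
       where
       i<I : row p < I
       i<I = subst (_≤ I) (cong proj₁ e) (row≤I (suc p) h)
       first : place (suc (row p)) 0 ≡ col (suc (row p)) 0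
       first with suc (row p) ℕ.≟ I
       ... | yes q = trans (cong (λ z → swap a o (col z 0)) q) (trans (trans (sym (place-I 0)) place-first) (cong (λ z → col z 0) (sym q)))
       ... | no _ = refl

     start : at o ≡ (0 , o)
     start with row≡ , pos≡ ← rc-unique {0} {o} o o<w (ℕ.+-identityʳ o) = cong₂ _,_ row≡ (trans (cong₂ place row≡ pos≡) (trans (place-other (ℕ.<⇒≢ 1≤I) o) (col-start o<w)))

     end : at (o + k') ≡ (I , o)
     end with row≡ , pos≡ ← rc-unique {I} {c} (o + k') c<w (sym last) = cong₂ _,_ row≡ (trans (cong₂ place row≡ pos≡) (trans (place-I c) (swap-left a o)))

     bound : ∀ {x} → x < k → o + x ≤ o + k'
     bound h = ℕ.+-monoʳ-≤ o (ℕ.≤-pred h)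

     tour : Tour k
     tour = record
       { cell = λ x → at (o + x)
       ; on-board = λ x h → ℕ.≤-<-trans (row≤I (o + x) (bound h)) I<w , place-< (row (o + x)) (pos (o + x))
       ; distinct = λ x y hx hy e → ℕ.+-cancelˡ-≡ o x y (same (o + x) (o + y) (ℕ.≤-trans (row≤I (o + x) (bound hx)) (ℕ.<⇒≤ I<w)) (cong proj₁ e) (cong proj₂ e))
       ; consecutive = λ x h → subst (λ z → Share (at (o + x)) (at z)) (sym (ℕ.+-suc o x)) (step (o + x) (subst (_≤ o + k') (ℕ.+-suc o x) (bound h)))
       ; closes = inj₂ (trans (cong proj₂ (trans (cong at (ℕ.+-identityʳ o)) start)) (sym (cong proj₂ end))) }
       where
       same : ∀ p p' → row p ≤ w → row p ≡ row p' → place (row p) (pos p) ≡ place (row p') (pos p') → p ≡ p'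
       same p p' h er ep = trans (sym (rc-sum p)) (trans (cong₂ (λ c i → c + i * w) (place-inj (row p) h (pos<w p) (pos<w p') (trans ep (cong (λ z → place z (pos p')) (sym er)))) er) (rc-sum p'))

   tour : ∀ k → k ≤ w * w → Tour k
   tour k k≤ with k ℕ.≤? w
   ... | yes h = short-tour k h
   tour zero _ | no h = ⊥-elim (h z≤n)
   tour (suc k') k≤ | no h = go (pos k') refl
     where
     w≤k' : w ≤ k'
     w≤k' = ℕ.≤-pred (ℕ.≰⇒> h)
     I : ℕ
     I = row k'
     I<w : I < w
     I<w = row-< k' k≤
     1≤I : 1 ≤ I
     1≤I = pos-row I refl
       where
       pos-row : ∀ i → row k' ≡ i → 1 ≤ i
       pos-row zero e = ⊥-elim (ℕ.<⇒≱ (subst (_< w) (trans (sym (ℕ.+-identityʳ (pos k'))) (trans (cong (λ z → pos k' + z * w) (sym e)) (rc-sum k'))) (pos<w k')) w≤k')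
       pos-row (suc i) _ = s≤s z≤n
     go : ∀ c → pos k' ≡ c → Tour (suc k')
     go (suc c) e = Long.tour k' 0 I (suc c) (ℕ.≤-trans (s≤s z≤n) 2<w) 1≤I I<w (s≤s z≤n) (subst (_< w) e (pos<w k')) (trans (sym (rc-sum k')) (cong (_+ I * w) e))
       (λ q → ℕ.<⇒≢ (ℕ.m<n⇒0<n∸m I<w) (sym (trans (sym (col-first 1≤I (ℕ.<⇒≤ I<w))) q)))
     -- Row I is entered and left in the same cell. Starting at offset 1 adds a cell to it; if the
     -- entry column w - I is itself 1, offset 2 is taken, for which 2 < w is needed.
     go zero e with (w ∸ I) ℕ.≟ 1
     ... | no q = Long.tour k' 1 I 1 (ℕ.<-trans (s≤s (s≤s z≤n)) 2<w) 1≤I I<w ℕ.≤-refl (ℕ.<-trans (s≤s (s≤s z≤n)) 2<w) (cong suc (trans (sym (rc-sum k')) (cong (_+ I * w) e))) (λ q' → q (trans (sym (col-first 1≤I (ℕ.<⇒≤ I<w))) q'))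
     ... | yes q = Long.tour k' 2 I 2 2<w 1≤I I<w (s≤s z≤n) 2<w (cong (λ z → suc (suc z)) (trans (sym (rc-sum k')) (cong (_+ I * w) e))) λ q' → one≢two (trans (sym q) (trans (sym (col-first 1≤I (ℕ.<⇒≤ I<w))) q'))
       where
       one≢two : 1 ≢ 2
       one≢two ()

 path-⊑-cycle : ∀ k → Path k ⊑ Cycle k
 path-⊑-cycle k = (λ x → x) , (λ _ _ e → e) , λ u v e → cycle-intro k u v (up (path-elim k u v e))
   where
   up : ∀ {i j} → PathAdj i j → CycleAdj k i j
   up (inj₁ e) = inj₁ e
   up (inj₂ e) = inj₂ (inj₁ e)

 ⊑-trans : ∀ {G H J} → G ⊑ H → H ⊑ J → G ⊑ J
 ⊑-trans (f , fi , fa) (g , gi , ga) = (g ∘ f) , (λ x y e → fi x y (gi _ _ e)) , λ u v e → ga _ _ (fa u v e)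

 ⊑-size : ∀ {G H} → G ⊑ H → size G ≤ size H
 ⊑-size (f , inj , _) = injective⇒≤ {f = f} (λ {i} {j} → inj i j)

 module Rook {r} (F : FieldOn r) (n c : ℕ) (1≤c : 1 ≤ c) (n≡ : n ≡ suc (2 * c)) (r≡ : r ≡ n * n)
     (frob-n : FieldChar.AdditivePower F n) where
   open LineDesign F n c 1≤c n≡ r≡ frob-n

   w : ℕ
   w = suc (2 * c)

   d : Fin r
   d = proj₁ direction

   ¬Sd : ¬ Sub d
   ¬Sd = proj₁ (proj₂ direction)

   χd : χ d ≡ 1ℤ
   χd = proj₁ (proj₂ (proj₂ direction))

   val : Fin w → Fin w → Fin r
   val i j = ι i ⊕ d ⊗ ι j

   row-adj : ∀ i {j j'} → j ≢ j' → adj (Paley F) (val i j) (val i j') ≡ true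
   row-adj i {j} {j'} h = χ≡1⇒sqr (trans (cong χ (solve 4 (λ a d x y → (a :+ d :* x) :+ :- (a :+ d :* y) := d :* (x :+ :- y)) refl (ι i) d (ι j) (ι j'))) (trans (χ-⊗ d _) (cong₂ ℤ._*_ χd (Sub-χ (h ∘ ι-inj j j' ∘ sub≡0⇒≡) (Sub-sub (ι-Sub j) (ι-Sub j'))))))

   col-adj : ∀ {i i'} j → i ≢ i' → adj (Paley F) (val i j) (val i' j) ≡ true
   col-adj {i} {i'} j h = χ≡1⇒sqr (trans (cong χ (solve 3 (λ a b x → (a :+ x) :+ :- (b :+ x) := a :+ :- b) refl (ι i) (ι i') (d ⊗ ι j))) (Sub-χ (h ∘ ι-inj i i' ∘ sub≡0⇒≡) (Sub-sub (ι-Sub i) (ι-Sub i'))))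

   -- 1 and d are linearly independent over the subfield.
   val-inj : ∀ {i j i' j'} → val i j ≡ val i' j' → i ≡ i' × j ≡ j'
   val-inj {i} {j} {i'} {j'} e with j ≟ j'
   ... | yes refl = ι-inj i i' (sub≡0⇒≡ (trans (solve 3 (λ a b x → a :+ :- b := (a :+ x) :+ :- (b :+ x)) refl (ι i) (ι i') (d ⊗ ι j)) (≡⇒sub≡0 e))) , refl
   ... | no h = ⊥-elim (¬Sd (subst Sub d≡ (Sub-⊗ (Sub-inv z≢0 (Sub-sub (ι-Sub j) (ι-Sub j'))) (Sub-sub (ι-Sub i') (ι-Sub i)))))
     where
     z : Fin r
     z = ι j ⊕ ⊖ ι j'
     z≢0 : z ≢ 0ᶠ
     z≢0 = h ∘ ι-inj j j' ∘ sub≡0⇒≡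
     eq : d ⊗ z ≡ ι i' ⊕ ⊖ ι i
     eq = sub≡0⇒≡ (trans (solve 5 (λ d x y a b → d :* (x :+ :- y) :+ :- (b :+ :- a) := (a :+ d :* x) :+ :- (b :+ d :* y)) refl d (ι j) (ι j') (ι i) (ι i')) (≡⇒sub≡0 e))
     d≡ : inv z ⊗ (ι i' ⊕ ⊖ ι i) ≡ d
     d≡ = trans (cong (inv z ⊗_) (sym eq)) (trans (solve 3 (λ v d z → v :* (d :* z) := d :* (v :* z)) refl (inv z) d z) (trans (cong (d ⊗_) (inv-l z≢0)) (⊗-identityʳ d)))

   cycle-⊑ : ∀ k → 3 ≤ k → k ≤ r → Cycle k ⊑ Paley F
   cycle-⊑ k 3≤k k≤r = f , f-inj , λ u v e → edge u v (cycle-elim k u v e)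
     where
     open Snake w (s≤s (ℕ.*-monoʳ-≤ 2 1≤c))
     T : Tour k
     T = tour k (subst (k ≤_) (trans r≡ (cong₂ _*_ n≡ n≡)) k≤r)
     open Tour T
     ri ci : Fin k → Fin w
     ri x = fromℕ< (proj₁ (on-board (toℕ x) (toℕ<n x)))
     ci x = fromℕ< (proj₂ (on-board (toℕ x) (toℕ<n x)))
     f : Fin k → Fin r
     f x = val (ri x) (ci x)
     toℕ-r : ∀ x → toℕ (ri x) ≡ proj₁ (cell (toℕ x))
     toℕ-r x = toℕ-fromℕ< (proj₁ (on-board (toℕ x) (toℕ<n x)))
     toℕ-c : ∀ x → toℕ (ci x) ≡ proj₂ (cell (toℕ x))
     toℕ-c x = toℕ-fromℕ< (proj₂ (on-board (toℕ x) (toℕ<n x)))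
     cell-inj : ∀ x y → ri x ≡ ri y → ci x ≡ ci y → x ≡ y
     cell-inj x y er ec = toℕ-injective (distinct (toℕ x) (toℕ y) (toℕ<n x) (toℕ<n y) (cong₂ _,_ (trans (sym (toℕ-r x)) (trans (cong toℕ er) (toℕ-r y))) (trans (sym (toℕ-c x)) (trans (cong toℕ ec) (toℕ-c y)))))
     f-inj : ∀ x y → f x ≡ f y → x ≡ y
     f-inj x y e = let er , ec = val-inj e in cell-inj x y er ec
     shared : ∀ u v → u ≢ v → Share (cell (toℕ u)) (cell (toℕ v)) → adj (Paley F) (f u) (f v) ≡ true
     shared u v h (inj₁ e) = subst (λ z → adj (Paley F) (f u) (val z (ci v)) ≡ true) er (row-adj (ri u) λ ec → h (cell-inj u v er ec))
       where
       er : ri u ≡ ri v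
       er = toℕ-injective (trans (toℕ-r u) (trans e (sym (toℕ-r v))))
     shared u v h (inj₂ e) = subst (λ z → adj (Paley F) (f u) (val (ri v) z) ≡ true) ec (col-adj (ci u) λ er → h (cell-inj u v er ec))
       where
       ec : ci u ≡ ci v
       ec = toℕ-injective (trans (toℕ-c u) (trans e (sym (toℕ-c v))))
     flip : ∀ {x y} → Share x y → Share y x
     flip (inj₁ e) = inj₁ (sym e)
     flip (inj₂ e) = inj₂ (sym e)
     next-share : ∀ (u v : Fin k) → suc (toℕ u) ≡ toℕ v → Share (cell (toℕ u)) (cell (toℕ v))
     next-share u v e = subst (λ z → Share (cell (toℕ u)) (cell z)) e (consecutive (toℕ u) (subst (_< k) (sym e) (toℕ<n v)))
     close-share : ∀ (u v : Fin k) → toℕ u ≡ 0 → toℕ v ≡ k ∸ 1 → Share (cell (toℕ u)) (cell (toℕ v))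
     close-share u v e e' = subst₂ (λ x y → Share (cell x) (cell y)) (sym e) (sym e') closes
     0≢k∸1 : ∀ (u v : Fin k) → toℕ u ≡ 0 → toℕ v ≡ k ∸ 1 → u ≢ v
     0≢k∸1 u v e e' refl = ℕ.<⇒≢ (ℕ.≤-trans (s≤s z≤n) (ℕ.∸-monoˡ-≤ 1 3≤k)) (trans (sym e) e')
     suc≢ : ∀ (u v : Fin k) → suc (toℕ u) ≡ toℕ v → u ≢ v
     suc≢ u v e refl = ℕ.1+n≢n e
     edge : ∀ u v → CycleAdj k (toℕ u) (toℕ v) → adj (Paley F) (f u) (f v) ≡ true
     edge u v (inj₁ e) = shared u v (suc≢ u v e) (next-share u v e)
     edge u v (inj₂ (inj₁ e)) = shared u v (suc≢ v u e ∘ sym) (flip (next-share v u e))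
     edge u v (inj₂ (inj₂ (inj₁ (e , e')))) = shared u v (0≢k∸1 u v e e') (close-share u v e e')
     edge u v (inj₂ (inj₂ (inj₂ (e , e')))) = shared u v (0≢k∸1 v u e e' ∘ sym) (flip (close-share v u e e'))

-- Numerical estimates

module Estimates where
 open Characters using (C-absorb)
 open Realisations using (2*suc)
 open import Data.Fin.Base using (fromℕ<)
 open import Data.Fin.Properties using (all?; toℕ-fromℕ<)
 open import Data.Nat.Base using (>-nonZero; _+_; _*_; _∸_; _^_; _≤_; _<_)
 open import Data.Nat.Properties
 open import Data.Nat.Combinatorics using (_C_; nCk≡nC[n∸k])
 open import Data.Nat.Tactic.RingSolver using (solve-∀)
 open import Data.Vec.Base using (Vec; []; _∷_; lookup)

 by : ∀ {a b} {t : True (a ≤? b)} → a ≤ b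
 by {t = t} = toWitness t

 +-cert : ∀ {a b} d → b ≡ a + d → a ≤ b
 +-cert {a} d refl = m≤m+n a d

 sq-cancel : ∀ a b → a * a ≤ b * b → a ≤ b
 sq-cancel a b h with a ≤? b
 ... | yes q = q
 ... | no q = ⊥-elim (<⇒≱ (*-mono-< (≰⇒> q) (≰⇒> q)) h)

 suc²≤ : ∀ x → 3 ≤ x → suc x * (suc x * 1) ≤ 2 * (x * (x * 1))
 suc²≤ x h = subst (λ x → suc x * (suc x * 1) ≤ 2 * (x * (x * 1))) (m+[n∸m]≡n h) (+-cert _ (l (x ∸ 3)))
   where
   l : ∀ y → 2 * ((3 + y) * ((3 + y) * 1)) ≡ suc (3 + y) * (suc (3 + y) * 1) + (y * y + 4 * y + 2)
   l = solve-∀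

 suc³≤ : ∀ x → 4 ≤ x → suc x * (suc x * (suc x * 1)) ≤ 2 * (x * (x * (x * 1)))
 suc³≤ x h = subst (λ x → suc x * (suc x * (suc x * 1)) ≤ 2 * (x * (x * (x * 1)))) (m+[n∸m]≡n h) (+-cert _ (l (x ∸ 4)))
   where
   l : ∀ y → 2 * ((4 + y) * ((4 + y) * ((4 + y) * 1))) ≡ suc (4 + y) * (suc (4 + y) * (suc (4 + y) * 1)) + (y * y * y + 9 * (y * y) + 21 * y + 3)
   l = solve-∀

 suc⁴≤ : ∀ x → 6 ≤ x → suc x * (suc x * (suc x * (suc x * 1))) ≤ 2 * (x * (x * (x * (x * 1))))
 suc⁴≤ x h = subst (λ x → suc x * (suc x * (suc x * (suc x * 1))) ≤ 2 * (x * (x * (x * (x * 1))))) (m+[n∸m]≡n h) (+-cert _ (l (x ∸ 6)))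
   where
   l : ∀ y → 2 * ((6 + y) * ((6 + y) * ((6 + y) * ((6 + y) * 1)))) ≡ suc (6 + y) * (suc (6 + y) * (suc (6 + y) * (suc (6 + y) * 1))) + (y * y * y * y + 20 * (y * y * y) + 138 * (y * y) + 356 * y + 191)
   l = solve-∀

 power-dominates : ∀ c d K x₀ → K * x₀ ^ d ≤ c ^ x₀ → (∀ x → x₀ ≤ x → suc x ^ d ≤ c * x ^ d) → ∀ x → x₀ ≤ x → K * x ^ d ≤ c ^ x
 power-dominates c d K x₀ base step x h = subst (λ x → K * x ^ d ≤ c ^ x) (m+[n∸m]≡n h) (go (x ∸ x₀))
   where
   swap : ∀ a b e → a * (b * e) ≡ b * (a * e)
   swap = solve-∀
   go : ∀ y → K * (x₀ + y) ^ d ≤ c ^ (x₀ + y)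
   go zero = subst (λ x → K * x ^ d ≤ c ^ x) (sym (+-identityʳ x₀)) base
   go (suc y) = subst (λ x → K * x ^ d ≤ c ^ x) (sym (+-suc x₀ y)) (≤-trans (*-monoʳ-≤ K (step (x₀ + y) (m≤m+n x₀ y))) (≤-trans (≤-reflexive (swap K c ((x₀ + y) ^ d))) (*-monoʳ-≤ c (go y))))

 4x³≤2^x : ∀ x → 14 ≤ x → 4 * x ^ 3 ≤ 2 ^ x
 4x³≤2^x = power-dominates 2 3 4 14 by λ x h → suc³≤ x (≤-trans by h)

 10x³≤2^x : ∀ x → 26 ≤ x → 10 * x ^ 3 ≤ 2 ^ x
 10x³≤2^x = power-dominates 2 3 10 26 by λ x h → suc³≤ x (≤-trans by h)

 512x⁴≤2^x : ∀ x → 30 ≤ x → 512 * x ^ 4 ≤ 2 ^ x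
 512x⁴≤2^x = power-dominates 2 4 512 30 by λ x h → suc⁴≤ x (≤-trans by h)

 9540x²≤4^x : ∀ x → 11 ≤ x → 9540 * x ^ 2 ≤ 4 ^ x
 9540x²≤4^x = power-dominates 4 2 9540 11 by λ x h → ≤-trans (suc²≤ x (≤-trans by h)) (*-monoˡ-≤ (x * (x * 1)) {2} {4} by)

 124x≤2^x : ∀ x → 11 ≤ x → 124 * x ^ 1 ≤ 2 ^ x
 124x≤2^x = power-dominates 2 1 124 11 by λ x h → linear-step x (≤-trans by h)
   where
   linear-step : ∀ x → 1 ≤ x → suc x * 1 ≤ 2 * (x * 1)
   linear-step (suc y) _ = +-cert y (l y)
     where
     l : ∀ y → 2 * (suc y * 1) ≡ suc (suc y) * 1 + y
     l = solve-∀

 197x²≤2^x : ∀ x → 16 ≤ x → 197 * x ^ 2 ≤ 2 ^ x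
 197x²≤2^x = power-dominates 2 2 197 16 by λ x h → suc²≤ x (≤-trans by h)

 6x≤2^x : ∀ x → 5 ≤ x → 6 * x ^ 1 ≤ 2 ^ x
 6x≤2^x = power-dominates 2 1 6 5 by λ x h → linear-step x (≤-trans by h)
   where
   linear-step : ∀ x → 1 ≤ x → suc x * 1 ≤ 2 * (x * 1)
   linear-step (suc y) _ = +-cert y (l y)
     where
     l : ∀ y → 2 * (suc y * 1) ≡ suc (suc y) * 1 + y
     l = solve-∀

 n<2^n : ∀ n → n < 2 ^ n
 n<2^n zero = s≤s z≤n
 n<2^n (suc n) = ≤-trans (+-mono-≤ (m^n>0 2 n) (n<2^n n)) (≤-reflexive (l (2 ^ n)))
   where
   l : ∀ x → x + x ≡ 2 * x
   l = solve-∀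

 binary-length : ∀ k → 1 ≤ k → ∃ λ b → k ≤ 2 ^ b × 2 ^ b ≤ 2 * k
 binary-length (suc zero) _ = 0 , ≤-refl , by
 binary-length (suc (suc k)) _ with b , h , h' ← binary-length (suc k) (s≤s z≤n) with suc (suc k) ≤? 2 ^ b
 ... | yes q = b , q , ≤-trans h' (*-monoʳ-≤ 2 (n≤1+n (suc k)))
 ... | no q = suc b , subst (λ z → suc (suc k) ≤ 2 * z) e (+-cert k (l k)) , subst (λ z → 2 * z ≤ 2 * suc (suc k)) e (*-monoʳ-≤ 2 (n≤1+n (suc k)))
   where
   e : suc k ≡ 2 ^ b
   e = ≤-antisym h (≤-pred (≰⇒> q))
   l : ∀ k → 2 * suc k ≡ suc (suc k) + k
   l = solve-∀

 exponent-≥ : ∀ {k} b j → k ≤ 2 ^ b → 2 ^ j < k → suc j ≤ b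
 exponent-≥ b j h h' with suc j ≤? b
 ... | yes q = q
 ... | no q = ⊥-elim (<⇒≱ h' (≤-trans h (^-monoʳ-≤ 2 (≤-pred (≰⇒> q)))))

 central : ℕ → ℕ
 central h = (2 * h) C h

 central-suc : ∀ h → suc h * central (suc h) ≡ 2 * (suc (2 * h) * central h)
 central-suc h = *-cancelˡ-≡ _ _ (suc h) (trans (cong (λ z → suc h * (suc h * z)) (cong (_C suc h) (2*suc h))) (trans (cong (suc h *_) (C-absorb (suc (2 * h)) h)) (trans (cong (λ z → suc h * (suc (suc (2 * h)) * z)) symm) (trans (l₁ h (suc (2 * h) C suc h)) (trans (cong (2 * suc h *_) (C-absorb (2 * h) h)) (l₂ h (central h)))))))
   where
   symm : suc (2 * h) C h ≡ suc (2 * h) C suc h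
   symm = trans (nCk≡nC[n∸k] {h} {suc (2 * h)} (≤-trans (m≤m+n h (h + 0)) (n≤1+n _))) (cong (suc (2 * h) C_) (trans (cong (_∸ h) (l h)) (m+n∸m≡n h (suc h))))
     where
     l : ∀ h → suc (2 * h) ≡ h + suc h
     l = solve-∀
   l₁ : ∀ h c → suc h * (suc (suc (2 * h)) * c) ≡ 2 * suc h * (suc h * c)
   l₁ = solve-∀
   l₂ : ∀ h c → 2 * suc h * (suc (2 * h) * c) ≡ suc h * (2 * (suc (2 * h) * c))
   l₂ = solve-∀

 4^≤ : ∀ h → 4 ≤ h → 4 ^ h ≤ h * central h
 4^≤ h q = subst (λ h → 4 ^ h ≤ h * central h) (m+[n∸m]≡n q) (go (h ∸ 4))
   where
   go : ∀ y → 4 ^ (4 + y) ≤ (4 + y) * central (4 + y)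
   go zero = by
   go (suc y) = subst (λ x → 4 ^ x ≤ x * central x) (sym (+-suc 4 y)) (≤-trans (*-monoʳ-≤ 4 (go y)) (subst (4 * ((4 + y) * central (4 + y)) ≤_) (sym (central-suc (4 + y))) (+-cert (2 * central (4 + y)) (l (4 + y) (central (4 + y))))))
     where
     l : ∀ h c → 2 * (suc (2 * h) * c) ≡ 4 * (h * c) + 2 * c
     l = solve-∀

 -- The bound C(2h, h) ≥ 4^h / (2 √h), squared to stay among the integers.
 16^≤ : ∀ h → 1 ≤ h → 16 ^ h ≤ 4 * h * (central h * central h)
 16^≤ (suc zero) _ = by
 16^≤ (suc (suc h)) _ = *-cancelˡ-≤ (suc (suc h)) (≤-trans (*-monoʳ-≤ (suc (suc h)) (*-monoʳ-≤ 16 (16^≤ (suc h) (s≤s z≤n))))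
     (subst (suc (suc h) * (16 * (4 * suc h * (central (suc h) * central (suc h)))) ≤_) (sym (trans (l₁ (suc (suc h)) (central (suc (suc h)))) (cong (λ z → 4 * (z * z)) (central-suc (suc h))))) (+-cert (16 * (central (suc h) * central (suc h))) (l₂ h (central (suc h))))))
   where
   l₁ : ∀ h c → h * (4 * h * (c * c)) ≡ 4 * (h * c * (h * c))
   l₁ = solve-∀
   l₂ : ∀ h c → 4 * (2 * (suc (2 * suc h) * c) * (2 * (suc (2 * suc h) * c))) ≡ suc (suc h) * (16 * (4 * suc h * (c * c))) + 16 * (c * c)
   l₂ = solve-∀

 4^≡ : ∀ h → 2 ^ (2 * h) ≡ 4 ^ h
 4^≡ h = sym (^-*-assoc 2 2 h)

 16^≡ : ∀ h → 4 ^ h * 4 ^ h ≡ 16 ^ h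
 16^≡ zero = refl
 16^≡ (suc h) = trans (l (4 ^ h)) (cong (16 *_) (16^≡ h))
   where
   l : ∀ x → 4 * x * (4 * x) ≡ 16 * (x * x)
   l = solve-∀

 -- A quadratic estimate: (z 2ᵃ)² ≤ z² 2a C(a,a/2)² ≤ ((a ∸ 2) C(a,a/2))².
 large-multiple : ∀ H z → 1 ≤ H → 2 * (z * z) + 4 ≤ 2 * H → z * 2 ^ (2 * H) ≤ (2 * H ∸ 2) * central H
 large-multiple H z 1≤H h = sq-cancel (z * 2 ^ (2 * H)) ((2 * H ∸ 2) * central H) (begin
     z * 2 ^ (2 * H) * (z * 2 ^ (2 * H)) ≡⟨ cong (λ w → z * w * (z * w)) (4^≡ H) ⟩
     z * 4 ^ H * (z * 4 ^ H) ≡⟨ l₁ z (4 ^ H) ⟩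
     z * z * (4 ^ H * 4 ^ H) ≡⟨ cong (z * z *_) (16^≡ H) ⟩
     z * z * 16 ^ H ≤⟨ *-monoʳ-≤ (z * z) (16^≤ H 1≤H) ⟩
     z * z * (4 * H * (central H * central H)) ≡⟨ l₂ (z * z) H (central H * central H) ⟩
     2 * (z * z) * (2 * H) * (central H * central H) ≤⟨ *-monoˡ-≤ (central H * central H) square ⟩
     (2 * H ∸ 2) * (2 * H ∸ 2) * (central H * central H) ≡⟨ l₃ (2 * H ∸ 2) (central H) ⟩
     (2 * H ∸ 2) * central H * ((2 * H ∸ 2) * central H) ∎)
   where
   open ≤-Reasoning
   l₁ : ∀ z w → z * w * (z * w) ≡ z * z * (w * w)
   l₁ = solve-∀
   l₂ : ∀ z h c → z * (4 * h * c) ≡ 2 * z * (2 * h) * c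
   l₂ = solve-∀
   l₃ : ∀ d c → d * d * (c * c) ≡ d * c * (d * c)
   l₃ = solve-∀
   square : 2 * (z * z) * (2 * H) ≤ (2 * H ∸ 2) * (2 * H ∸ 2)
   square = subst (λ a → 2 * (z * z) * a ≤ (a ∸ 2) * (a ∸ 2)) (trans (+-comm (2 * H ∸ (2 * (z * z) + 4)) (2 * (z * z) + 4)) (m+[n∸m]≡n h)) (go (2 * (z * z)) (2 * H ∸ (2 * (z * z) + 4)))
     where
     l : ∀ s e → (e + (s + 2)) * (e + (s + 2)) ≡ s * (e + (s + 4)) + (e * e + 4 * e + 4 + e * s)
     l = solve-∀
     go : ∀ s e → s * (e + (s + 4)) ≤ (e + (s + 4) ∸ 2) * (e + (s + 4) ∸ 2)
     go s e = subst (λ x → s * (e + (s + 4)) ≤ x * x) (sym (trans (+-∸-assoc e {s + 4} {2} (≤-trans by (m≤n+m 4 s))) (cong (e +_) (+-∸-assoc s {4} {2} by)))) (+-cert (e * e + 4 * e + 4 + e * s) (l s e))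

 -- The first two inequalities give q^(3^(d+i)) ≤ 2^a, the last two 2^(a+16) ≤ q^(3^(d+i+1)). Beyond
 -- level i only exponents are compared, so that q^(3^i) with small i is the largest tower power
 -- evaluated.
 Scale : ℕ → ℕ × ℕ × ℕ × ℕ → ℕ → Set
 Scale q (i , d , c₁ , c₂) a = q ^ (3 ^ i) ≤ 2 ^ c₂ × c₂ * 3 ^ d ≤ a × 2 ^ c₁ ≤ q ^ (3 ^ i) × a + 16 ≤ c₁ * 3 ^ suc d

 scale? : ∀ q t a → Dec (Scale q t a)
 scale? q (i , d , c₁ , c₂) a = (q ^ (3 ^ i) ≤? 2 ^ c₂) ×-dec (c₂ * 3 ^ d ≤? a) ×-dec (2 ^ c₁ ≤? q ^ (3 ^ i)) ×-dec (a + 16 ≤? c₁ * 3 ^ suc d)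

 -- For each q, binary bounds 2^c₁ ≤ q^(3^i) ≤ 2^c₂ showing that no q^(3^s) lies between 2ᵃ and 2^(a+16).
 scales : Vec (ℕ × ℕ × ℕ × ℕ) 37
 scales = (2 , 0 , 14 , 15) ∷ (1 , 2 , 6 , 7) ∷ (0 , 3 , 2 , 3) ∷ (3 , 1 , 69 , 70) ∷ (0 , 4 , 2 , 3) ∷ (0 , 4 , 3 , 4) ∷ (2 , 2 , 28 , 29) ∷ (0 , 5 , 3 , 4) ∷ (0 , 5 , 3 , 4) ∷ (0 , 5 , 3 , 4) ∷ (1 , 4 , 11 , 12) ∷ (4 , 1 , 308 , 309) ∷ (0 , 6 , 3 , 4) ∷ (0 , 6 , 4 , 5) ∷ (0 , 6 , 4 , 5) ∷ (0 , 6 , 4 , 5) ∷ (0 , 6 , 4 , 5) ∷ (0 , 6 , 4 , 5) ∷ (1 , 5 , 13 , 14) ∷ (1 , 6 , 13 , 14) ∷ (0 , 7 , 4 , 5) ∷ (0 , 7 , 4 , 5) ∷ (0 , 7 , 4 , 5) ∷ (0 , 7 , 4 , 5) ∷ (0 , 7 , 4 , 5) ∷ (0 , 7 , 4 , 5) ∷ (0 , 7 , 4 , 5) ∷ (1 , 6 , 14 , 15) ∷ (1 , 6 , 14 , 15) ∷ (0 , 7 , 5 , 6) ∷ (1 , 7 , 15 , 16) ∷ (1 , 7 , 15 , 16) ∷ (0 , 8 , 5 , 6) ∷ (0 , 8 , 5 , 6) ∷ (0 , 8 , 5 , 6) ∷ (0 , 8 , 5 , 6) ∷ (0 , 8 ,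 5 , 6) ∷ []

 scales-correct : ∀ x → Scale (3 + toℕ x) (lookup scales x) ((3 + toℕ x) ^ 3 ∸ 1)
 scales-correct = toWitness {a? = all? λ x → scale? (3 + toℕ x) (lookup scales x) ((3 + toℕ x) ^ 3 ∸ 1)} tt

 scale-3-9 : Scale 3 (1 , 7 , 4 , 5) (3 ^ 9 ∸ 1)
 scale-3-9 = toWitness {a? = scale? 3 (1 , 7 , 4 , 5) (3 ^ 9 ∸ 1)} tt

 tower : ∀ q i d → q ^ (3 ^ (d + i)) ≡ (q ^ (3 ^ i)) ^ (3 ^ d)
 tower q i d = trans (cong (q ^_) (trans (^-distribˡ-+-* 3 d i) (*-comm (3 ^ d) (3 ^ i)))) (sym (^-*-assoc q (3 ^ i) (3 ^ d)))

 gap : ∀ q t a s → 1 ≤ q → Scale q t a → 2 ^ a < q ^ (3 ^ s) → 2 ^ (a + 16) ≤ q ^ (3 ^ s)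
 gap q (i , d , c₁ , c₂) a s 1≤q (u₁ , u₂ , u₃ , u₄) h with s ≤? d + i
 ... | yes q' = ⊥-elim (<⇒≱ h (≤-trans (^-monoʳ-≤ q {{>-nonZero 1≤q}} (^-monoʳ-≤ 3 q')) (≤-trans (≤-reflexive (tower q i d)) (≤-trans (^-monoˡ-≤ (3 ^ d) u₁) (≤-trans (≤-reflexive (^-*-assoc 2 c₂ (3 ^ d))) (^-monoʳ-≤ 2 u₂))))))
 ... | no q' = ≤-trans (^-monoʳ-≤ 2 u₄) (≤-trans (≤-reflexive (sym (^-*-assoc 2 c₁ (3 ^ suc d)))) (≤-trans (^-monoˡ-≤ (3 ^ suc d) u₃) (≤-trans (≤-reflexive (sym (tower q i (suc d)))) (^-monoʳ-≤ q {{>-nonZero 1≤q}} (^-monoʳ-≤ 3 (≰⇒> q'))))))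

 -- 64000 = 40³ leaves q < 40 for m = 1, q = 3 for m = 2 and nothing beyond. It lies above 2 · 176²
 -- + 4 = 61956, from where `large-multiple` supplies the factor 176.
 exceptional : ∀ q m s → 3 ≤ q → 1 ≤ m → q ^ (3 ^ m) < 64000 → 2 ^ (q ^ (3 ^ m) ∸ 1) < q ^ (3 ^ s) → 2 ^ (q ^ (3 ^ m) ∸ 1 + 16) ≤ q ^ (3 ^ s)
 exceptional q (suc zero) s 3≤q _ small h = gap q (lookup scales x) (q ^ 3 ∸ 1) s (≤-trans by 3≤q) (subst (λ z → Scale z (lookup scales x) (z ^ 3 ∸ 1)) 3+x (scales-correct x)) h
   where
   q<40 : q < 40
   q<40 with q <? 40
   ... | yes r = r
   ... | no r = ⊥-elim (<⇒≱ small (^-monoˡ-≤ 3 {40} {q} (≮⇒≥ r)))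
   q∸3<37 : q ∸ 3 < 37
   q∸3<37 = ∸-monoˡ-< q<40 3≤q
   x : Fin 37
   x = fromℕ< q∸3<37
   3+x : 3 + toℕ x ≡ q
   3+x = trans (cong (3 +_) (toℕ-fromℕ< q∸3<37)) (m+[n∸m]≡n 3≤q)
 exceptional q (suc (suc zero)) s 3≤q _ small h = subst (λ q → 2 ^ (q ^ 9 ∸ 1) < q ^ (3 ^ s) → 2 ^ (q ^ 9 ∸ 1 + 16) ≤ q ^ (3 ^ s)) (≤-antisym 3≤q q≤3) (gap 3 (1 , 7 , 4 , 5) (3 ^ 9 ∸ 1) s by scale-3-9) h
   where
   q≤3 : q ≤ 3
   q≤3 with q ≤? 3
   ... | yes r = r
   ... | no r = ⊥-elim (<⇒≱ small (≤-trans (by {64000} {4 ^ 9}) (^-monoˡ-≤ 9 {4} {q} (≰⇒> r))))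
 exceptional q (suc (suc (suc m))) s 3≤q _ small h = ⊥-elim (<⇒≱ small (≤-trans (by {64000} {3 ^ 27}) (≤-trans (^-monoˡ-≤ 27 3≤q) (^-monoʳ-≤ q {{>-nonZero (≤-trans by 3≤q)}} (^-monoʳ-≤ 3 {3} {3 + m} (m≤m+n 3 m))))))

-- Numerical conditions for cycles and bicliques

module Thresholds where
 open Sums
 open Designs
 open Universality using (count; trim)
 open CyclePatterns using (CyclePattern; one-stage-cycle)
 open SecondStage using (two-stage-cycle)
 open Bicliques using (BicliqueIn; bicliqueIn)
 open Estimates
 open import Data.Integer.Base using (+_)
 open import Data.Nat.Base using (_+_; _*_; _∸_; _^_; _≤_; _<_)
 open import Data.Nat.Properties
 open import Data.Nat.Tactic.RingSolver using (solve-∀)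

 pw : ∀ k → + (2 ^ k) ≡ (+ 2) ℤ.^ k
 pw zero = refl
 pw (suc k) = trans (ℤ.pos-* 2 (2 ^ k)) (cong (+ 2 ℤ.*_) (pw k))

 cast-product : ∀ c a b → + (c * (a * b)) ≡ + c ℤ.* (+ a ℤ.* + b)
 cast-product c a b = trans (ℤ.pos-* c (a * b)) (cong (+ c ℤ.*_) (ℤ.pos-* a b))

 -- From k = 14 on 4 k³ ≤ 2^k holds; k = 13 just fails.
 one-stage : ∀ {N L} (D : Design N L) → 0 < N → ∀ m → 14 ≤ suc m → 10 * (suc m * 2 ^ suc m) ≤ L → CyclePattern D m
 one-stage {N} {L} D 0<N m 14≤k h = one-stage-cycle D (+<+ 0<N) m
     (subst (ℤ._≤ + L) (trans (cast-product 10 (suc m) (2 ^ suc m)) (cong (λ z → + 10 ℤ.* (+ suc m ℤ.* z)) (pw (suc m)))) (+≤+ h))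
     (+≤+ (≤-trans (s≤s z≤n) 4≤L))
     (subst₂ ℤ._≤_ (trans (ℤ.pos-* 4 (suc m ^ 3)) (cong (+ 4 ℤ.*_) (trans (cong (λ z → + (suc m * z)) (cong (suc m *_) (*-identityʳ (suc m)))) (cast-product (suc m) (suc m) (suc m))))) (pw (suc m)) (+≤+ (4x³≤2^x (suc m) 14≤k)))
     (subst (+ 4 ℤ.≤_) (ℤ.pos-* L L) (+≤+ (≤-trans 4≤L (m≤m*n L L {{>-nonZero (≤-trans (s≤s z≤n) 4≤L)}}))))
   where
   open import Data.Nat.Base using (>-nonZero)
   4≤L : 4 ≤ L
   4≤L = ≤-trans (≤-trans (by {4} {10}) (m≤m*n 10 (suc m * 2 ^ suc m) {{m*n≢0 (suc m) (2 ^ suc m) {{_}} {{m^n≢0 2 (suc m)}}}})) h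

 cast₁ : ∀ k u t → + (k * k * (80 * (u * t) + 256 * (k * k * (u * u)))) ≡ + k ℤ.* + k ℤ.* (+ 80 ℤ.* (+ u ℤ.* + t) ℤ.+ + 256 ℤ.* (+ k ℤ.* + k ℤ.* (+ u ℤ.* + u)))
 cast₁ k u t = trans (ℤ.pos-* (k * k) (80 * (u * t) + 256 * (k * k * (u * u)))) (cong₂ ℤ._*_ (ℤ.pos-* k k) (cong₂ ℤ._+_ (cast-product 80 u t)
   (trans (ℤ.pos-* 256 (k * k * (u * u))) (cong (+ 256 ℤ.*_) (trans (ℤ.pos-* (k * k) (u * u)) (cong₂ ℤ._*_ (ℤ.pos-* k k) (ℤ.pos-* u u)))))))

 cast₂ : ∀ h k → + (530 * (h * h * (k + 1))) ≡ + 530 ℤ.* (+ h ℤ.* + h ℤ.* (+ k ℤ.+ 1ℤ))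
 cast₂ h k = trans (ℤ.pos-* 530 (h * h * (k + 1))) (cong (+ 530 ℤ.*_) (trans (ℤ.pos-* (h * h) (k + 1)) (cong (ℤ._* + (k + 1)) (ℤ.pos-* h h))))

 cast₃ : ∀ k → + (19 * k + 20) ≡ + 19 ℤ.* + k ℤ.+ + 20
 cast₃ k = cong (ℤ._+ + 20) (ℤ.pos-* 19 k)

 8^≡ : ∀ b → 2 ^ (3 * b) ≡ 2 ^ b * (2 ^ b * 2 ^ b)
 8^≡ b = trans (cong (2 ^_) (l b)) (trans (^-distribˡ-+-* 2 b (b + b)) (cong (2 ^ b *_) (^-distribˡ-+-* 2 b b)))
   where
   l : ∀ b → 3 * b ≡ b + (b + b)
   l = solve-∀

 stage₁-room : ∀ k u t → 160 * (k * k) ≤ u → 512 * (k * k * (k * k)) ≤ t → k * k * (80 * (u * t) + 256 * (k * k * (u * u))) ≤ t * (u * u)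
 stage₁-room k u t h₁ h₂ = *-cancelˡ-≤ 2 (≤-trans (≤-reflexive (l₁ k u t)) (≤-trans (+-mono-≤ (*-monoˡ-≤ (u * t) h₁) (*-monoˡ-≤ (u * u) h₂)) (≤-reflexive (l₂ u t))))
   where
   l₁ : ∀ k u t → 2 * (k * k * (80 * (u * t) + 256 * (k * k * (u * u)))) ≡ 160 * (k * k) * (u * t) + 512 * (k * k * (k * k)) * (u * u)
   l₁ = solve-∀
   l₂ : ∀ u t → u * (u * t) + t * (u * u) ≡ 2 * (t * (u * u))
   l₂ = solve-∀

 -- With 2^b between k and 2 k and h = 3 b, the power 2^h is at least k³ and dominates 530 h² (k +
 -- 1), while h stays below k/20 as `low-cost` requires. The number 176 is 16 · 11: a board of 176 ·
 -- 2^k points has 16 u for each pattern on the first k₁ vertices, where u = 11 · 2^h.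
 module TwoStage {N L} (D : Design N L) (0<N : 0 < N) (m₁ b : ℕ) (11≤b : 11 ≤ b) (k≤ : suc (m₁ + 3 * b) ≤ 2 ^ b) (≤k : 2 ^ b ≤ 2 * suc (m₁ + 3 * b)) (room : 176 * 2 ^ suc (m₁ + 3 * b) ≤ L) where
   h k k₁ u t₁ : ℕ
   h = 3 * b
   k = suc (m₁ + h)
   k₁ = suc m₁
   u = 11 * 2 ^ h
   t₁ = 2 ^ k₁

   k₁≤ : k₁ ≤ 2 ^ b
   k₁≤ = ≤-trans (s≤s (m≤m+n m₁ h)) k≤

   slack : 60 * b + 20 ≤ k
   slack = *-cancelˡ-≤ 2 (≤-trans (≤-trans (lem b 11≤b) (124x≤2^x b 11≤b)) ≤k)
     where
     lem : ∀ b → 11 ≤ b → 2 * (60 * b + 20) ≤ 124 * (b * 1)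
     lem b h = subst (λ b → 2 * (60 * b + 20) ≤ 124 * (b * 1)) (m+[n∸m]≡n h) (+-cert (4 + 4 * (b ∸ 11)) (l (b ∸ 11)))
       where
       l : ∀ y → 124 * ((11 + y) * 1) ≡ 2 * (60 * (11 + y) + 20) + (4 + 4 * y)
       l = solve-∀

   slack′ : 19 * k + 20 ≤ 20 * k₁
   slack′ = +-cancelʳ-≤ (60 * b) (19 * k + 20) (20 * k₁) (≤-trans (≤-reflexive (l₁ (19 * k) b)) (≤-trans (+-monoʳ-≤ (19 * k) slack) (≤-reflexive (l₂ m₁ b))))
     where
     l₁ : ∀ x b → x + 20 + 60 * b ≡ x + (60 * b + 20)
     l₁ = solve-∀
     l₂ : ∀ m b → 19 * suc (m + 3 * b) + suc (m + 3 * b) ≡ 20 * suc m + 60 * b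
     l₂ = solve-∀

   30≤k₁ : 30 ≤ k₁
   30≤k₁ = *-cancelˡ-≤ 20 (≤-trans (≤-trans (by {20 * 30} {19 * 60}) (*-monoʳ-≤ 19 (≤-trans (by {60} {60 * 11}) (≤-trans (*-monoʳ-≤ 60 11≤b) (≤-trans (m≤m+n (60 * b) 20) slack))))) (≤-trans (m≤m+n (19 * k) 20) slack′))

   160k²≤u : 160 * (k₁ * k₁) ≤ u
   160k²≤u = ≤-trans (*-monoʳ-≤ 160 (*-mono-≤ k₁≤ k₁≤)) (≤-trans (*-monoˡ-≤ (2 ^ b * 2 ^ b) (≤-trans (by {160} {11 * 2 ^ 11}) (*-monoʳ-≤ 11 (^-monoʳ-≤ 2 11≤b)))) (≤-reflexive (trans (*-assoc 11 (2 ^ b) (2 ^ b * 2 ^ b)) (cong (11 *_) (sym (8^≡ b))))))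

   512k⁴≤t : 512 * (k₁ * k₁ * (k₁ * k₁)) ≤ t₁
   512k⁴≤t = subst (_≤ t₁) (cong (512 *_) (l k₁)) (512x⁴≤2^x k₁ 30≤k₁)
     where
     l : ∀ k → k * (k * (k * (k * 1))) ≡ k * k * (k * k)
     l = solve-∀

   h₂ : 530 * (h * h * (k + 1)) ≤ 2 ^ h
   h₂ = ≤-trans (*-monoʳ-≤ 530 (*-monoʳ-≤ (h * h) (≤-trans (+-mono-≤ k≤ (m^n>0 2 b)) (≤-reflexive (l₁ (2 ^ b)))))) (≤-trans (≤-reflexive (l₂ b (2 ^ b))) (≤-trans (*-monoˡ-≤ (2 ^ b) (9540x²≤4^x b 11≤b)) (≤-reflexive (trans (*-comm (4 ^ b) (2 ^ b)) (trans (cong (2 ^ b *_) (four b)) (sym (8^≡ b)))))))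
     where
     l₁ : ∀ x → x + x ≡ 2 * x
     l₁ = solve-∀
     l₂ : ∀ b x → 530 * (3 * b * (3 * b) * (2 * x)) ≡ 9540 * (b * (b * 1)) * x
     l₂ = solve-∀
     four : ∀ b → 4 ^ b ≡ 2 ^ b * 2 ^ b
     four zero = refl
     four (suc b) = trans (cong (4 *_) (four b)) (l (2 ^ b))
       where
       l : ∀ x → 4 * (x * x) ≡ 2 * x * (2 * x)
       l = solve-∀

   board : ∃ λ B₀ → count {L} B₀ ≡ + (176 * 2 ^ k)
   board = let B , _ , c = trim {L} (λ _ → true) (176 * 2 ^ k) (subst (+ (176 * 2 ^ k) ℤ.≤_) (sym (∑-ones L)) (+≤+ room)) in B , c

   board-size : + (176 * 2 ^ k) ≡ + 16 ℤ.* (+ u ℤ.* + t₁)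
   board-size = trans (cong +_ (trans (cong (176 *_) (^-distribˡ-+-* 2 k₁ h)) (l (2 ^ k₁) (2 ^ h)))) (cast-product 16 u t₁)
     where
     l : ∀ x y → 176 * (x * y) ≡ 16 * (11 * y * x)
     l = solve-∀

   cycle-pattern : CyclePattern D (m₁ + h)
   cycle-pattern = two-stage-cycle D (+<+ 0<N) m₁ h (+ t₁) (+ (2 ^ h)) (+ u) (pw k₁) (pw h) (ℤ.pos-* 11 (2 ^ h)) (proj₁ board) (trans (proj₂ board) board-size)
     (subst₂ ℤ._≤_ (cast₁ k₁ u t₁) (cast-product t₁ u u) (+≤+ (stage₁-room k₁ u t₁ 160k²≤u 512k⁴≤t)))
     (subst (ℤ._≤ + (2 ^ h)) (cast₂ h k) (+≤+ h₂)) (subst₂ ℤ._≤_ (cast₃ k) (ℤ.pos-* 20 k₁) (+≤+ slack′))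
     (+<+ (m^n>0 2 k₁)) (+<+ (m^n>0 2 h)) (+<+ (≤-trans (m^n>0 2 h) (m≤n*m (2 ^ h) 11))) (≤-trans (≤-trans (by {2} {29}) (≤-pred 30≤k₁)) (m≤m+n m₁ h))

 -- k > 2^10 gives b ≥ 11, the range in which 9540 b² ≤ 4^b and 124 b ≤ 2^b are available.
 two-stage : ∀ {N L} (D : Design N L) → 0 < N → ∀ m → 1025 ≤ suc m → 176 * 2 ^ suc m ≤ L → CyclePattern D m
 two-stage {N} {L} D 0<N m big room = subst (CyclePattern D) m≡ (TwoStage.cycle-pattern D 0<N (m ∸ 3 * b) b 11≤b (subst (λ z → suc z ≤ 2 ^ b) (sym m≡) k≤) (subst (λ z → 2 ^ b ≤ 2 * suc z) (sym m≡) ≤k) (subst (λ z → 176 * 2 ^ suc z ≤ L) (sym m≡) room))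
   where
   r : ∃ λ b → suc m ≤ 2 ^ b × 2 ^ b ≤ 2 * suc m
   r = binary-length (suc m) (s≤s z≤n)
   b : ℕ
   b = proj₁ r
   k≤ : suc m ≤ 2 ^ b
   k≤ = proj₁ (proj₂ r)
   ≤k : 2 ^ b ≤ 2 * suc m
   ≤k = proj₂ (proj₂ r)
   11≤b : 11 ≤ b
   11≤b = exponent-≥ b 10 k≤ big
   3b≤m : 3 * b ≤ m
   3b≤m = ≤-pred (*-cancelˡ-≤ 2 (≤-trans (≤-trans (lem b 11≤b) (124x≤2^x b 11≤b)) ≤k))
     where
     lem : ∀ b → 11 ≤ b → 2 * suc (3 * b) ≤ 124 * (b * 1)
     lem b h = subst (λ b → 2 * suc (3 * b) ≤ 124 * (b * 1)) (m+[n∸m]≡n h) (+-cert (1296 + 118 * (b ∸ 11)) (l (b ∸ 11)))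
       where
       l : ∀ y → 124 * ((11 + y) * 1) ≡ 2 * suc (3 * (11 + y)) + (1296 + 118 * y)
       l = solve-∀
   m≡ : m ∸ 3 * b + 3 * b ≡ m
   m≡ = m∸n+n≡m 3b≤m

 -- The choice m = 2 A² + A makes M - 2 m = 2 A + 2, so the hypothesis of `half-power` holds with 2
 -- to spare.
 room-identity : ∀ A m M → m ≡ + 2 ℤ.* (A ℤ.* A) ℤ.+ A → M ≡ + 2 ℤ.* (m ℤ.+ A ℤ.+ 1ℤ) → M ≡ + 2 ℤ.* (A ℤ.* (M ℤ.- + 2 ℤ.* m)) ℤ.+ + 2
 room-identity A _ _ refl refl = l A
   where
   l : ∀ A → + 2 ℤ.* ((+ 2 ℤ.* (A ℤ.* A) ℤ.+ A) ℤ.+ A ℤ.+ 1ℤ) ≡ + 2 ℤ.* (A ℤ.* (+ 2 ℤ.* ((+ 2 ℤ.* (A ℤ.* A) ℤ.+ A) ℤ.+ A ℤ.+ 1ℤ) ℤ.- + 2 ℤ.* (+ 2 ℤ.* (A ℤ.* A) ℤ.+ A))) ℤ.+ + 2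
   l = ℤ.solve-∀

 ≤-move : ∀ {x y z} → x ℤ.+ y ℤ.≤ z → x ℤ.≤ z ℤ.- y
 ≤-move {x} {y} {z} h = subst (ℤ._≤ z ℤ.- y) (l x y) (ℤ.+-monoˡ-≤ (ℤ.- y) h)
   where
   l : ∀ x y → x ℤ.+ y ℤ.- y ≡ x
   l = ℤ.solve-∀

 -- Again h = 3 b with a ≤ 2^b, here because the trimmed neighbourhood needs M ≤ 10 a² columns after
 -- k₀ = a - h halvings: the factor 2^h ≥ a³ saved by stopping early pays for them.
 module _ {L} (D : Design (suc (suc L)) L) (k₀ b : ℕ) (26≤a : 26 ≤ k₀ + 3 * b) (a≤ : k₀ + 3 * b ≤ 2 ^ b) (room₁ : 176 * 2 ^ (k₀ + 3 * b) ≤ L) (room₂ : (6 * b + 2) * 2 ^ (k₀ + 3 * b) ≤ L) where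
   N h a m M : ℕ
   N = suc (suc L)
   h = 3 * b
   a = k₀ + h
   m = 2 * (a * a) + a
   M = 2 * (m + a + 1)

   M≤ : M ≤ 10 * (a * a)
   M≤ = go a (≤-trans by 26≤a)
     where
     go : ∀ a → 1 ≤ a → 2 * (2 * (a * a) + a + a + 1) ≤ 10 * (a * a)
     go (suc y) _ = +-cert (8 * y + 6 * (y * y)) (l y)
       where
       l : ∀ y → 10 * (suc y * suc y) ≡ 2 * (2 * (suc y * suc y) + suc y + suc y + 1) + (8 * y + 6 * (y * y))
       l = solve-∀

   2^a≤L : 2 ^ a ≤ L
   2^a≤L = ≤-trans (m≤n*m (2 ^ a) 176) room₁

   aM≤L : a * M ≤ L
   aM≤L = ≤-trans (*-monoʳ-≤ a M≤) (≤-trans (≤-reflexive (l a)) (≤-trans (10x³≤2^x a 26≤a) 2^a≤L))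
     where
     l : ∀ a → a * (10 * (a * a)) ≡ 10 * (a * (a * (a * 1)))
     l = solve-∀

   4a²<N : 4 * (a * a) < N
   4a²<N = s≤s (≤-trans (≤-trans (≤-trans (m≤m+n (4 * (a * a)) (4 * a + 2)) (≤-reflexive (l a))) (m≤n*m M a {{>-nonZero (≤-trans (s≤s z≤n) 26≤a)}})) (≤-trans aM≤L (n≤1+n L)))
     where
     open import Data.Nat.Base using (>-nonZero)
     l : ∀ a → 4 * (a * a) + (4 * a + 2) ≡ 2 * (2 * (a * a) + a + a + 1)
     l = solve-∀

   h₃ : 2 * 2 ^ k₀ * M ≤ L
   h₃ = ≤-trans (*-monoʳ-≤ (2 * 2 ^ k₀) M≤) (≤-trans (≤-reflexive (l₁ (2 ^ k₀) (a * a))) (≤-trans (*-monoʳ-≤ (20 * 2 ^ k₀) (*-mono-≤ a≤ a≤)) (≤-trans (*-mono-≤ (*-monoˡ-≤ (2 ^ k₀) (by {20} {176})) (≤-trans (m≤n*m (2 ^ b * 2 ^ b) (2 ^ b) {{m^n≢0 2 b}}) (≤-reflexive (sym (8^≡ b)))))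
       (≤-trans (≤-reflexive (trans (*-assoc 176 (2 ^ k₀) (2 ^ h)) (cong (176 *_) (sym (^-distribˡ-+-* 2 k₀ h))))) room₁))))
     where
     l₁ : ∀ x y → 2 * x * (10 * y) ≡ 20 * x * y
     l₁ = solve-∀

   a<2^a : a < 2 ^ a
   a<2^a = n<2^n a

   h₄ : 2 * 2 ^ a * h + k₀ ≤ N
   h₄ = ≤-trans (+-monoʳ-≤ (2 * 2 ^ a * h) (≤-trans (m≤m+n k₀ h) (<⇒≤ a<2^a))) (≤-trans (+-cert (2 ^ a) (l (2 ^ a) b)) (≤-trans room₂ (≤-trans (n≤1+n L) (n≤1+n (suc L)))))
     where
     l : ∀ x b → (6 * b + 2) * x ≡ 2 * x * (3 * b) + x + x
     l = solve-∀

   k₀<N : k₀ < N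
   k₀<N = ≤-<-trans (m≤m+n k₀ h) (<-≤-trans a<2^a (≤-trans 2^a≤L (≤-trans (n≤1+n L) (n≤1+n (suc L)))))

   +m≡ : + m ≡ + 2 ℤ.* (+ a ℤ.* + a) ℤ.+ + a
   +m≡ = cong (ℤ._+ + a) (cast-product 2 a a)

   +M≡ : + M ≡ + 2 ℤ.* (+ m ℤ.+ + a ℤ.+ 1ℤ)
   +M≡ = ℤ.pos-* 2 (m + a + 1)

   biclique : BicliqueIn D a
   biclique = bicliqueIn D (+<+ (s≤s z≤n)) k₀ h m M (+<+ (≤-trans (≤-trans (s≤s z≤n) 26≤a) (m≤n+m a (2 * (a * a))))) +M≡ (≤-cert (+ 2) (+≤+ z≤n) (room-identity (+ a) (+ m) (+ M) +m≡ +M≡))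
     (subst (ℤ._< + N) (cast-product 4 a a) (+<+ 4a²<N)) (subst (ℤ._≤ + N) (ℤ.pos-* a M) (+≤+ (≤-trans aM≤L (≤-trans (n≤1+n L) (n≤1+n (suc L))))))
     (subst (ℤ._≤ + L) (trans (ℤ.pos-* (2 * 2 ^ k₀) M) (cong (ℤ._* + M) (trans (ℤ.pos-* 2 (2 ^ k₀)) (cong (+ 2 ℤ.*_) (pw k₀))))) (+≤+ h₃))
     (≤-move {y = + k₀} (subst (λ z → z ℤ.+ + k₀ ℤ.≤ + N) (trans (ℤ.pos-* (2 * 2 ^ a) h) (cong (ℤ._* + h) (trans (ℤ.pos-* 2 (2 ^ a)) (cong (+ 2 ℤ.*_) (pw a))))) (+≤+ h₄)))
     (ℤ.suc[i]≤j⇒i<j {0ℤ} {+ N ℤ.- + k₀} (≤-move {1ℤ} {+ k₀} {+ N} (+≤+ k₀<N)))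

-- The Paley series and its indices

module PaleySeries where
 open import Defs hiding (Injective)
 open Characters
 open Universality using (module SquareField)
 open Subfields using (module Frobenius)
 open LineModels using (LineModel; module Lines)
 open Designs
 open CyclePatterns using (CyclePattern)
 open Thresholds using (one-stage; two-stage; biclique)
 open Bicliques using (BicliqueIn)
 open Realisations
 open Extensions using (module PaleyExtension)
 open CompleteInvariants using (induced-index; complete-index)
 open Pancyclicity using (path-⊑-cycle; ⊑-trans; ⊑-size; module Rook)
 open Search
 open Estimates
 open import Data.Nat.Base using (pred; NonZero; >-nonZero; _+_; _*_; _∸_; _^_; _≤_; _<_; _/_; _%_)
 open import Data.Nat.Properties
 open import Data.Nat.Combinatorics using (_C_)
 open import Data.Nat.DivMod using (m≡m%n+[m/n]*n; m*n/n≡m)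
 open import Data.Nat.Primality using (Prime; prime⇒nonTrivial)
 open import Data.Nat.Tactic.RingSolver using (solve-∀)

 IsOdd : ℕ → Set
 IsOdd x = ∃ λ c → x ≡ suc (2 * c)

 odd-* : ∀ {x y} → IsOdd x → IsOdd y → IsOdd (x * y)
 odd-* (c , refl) (d , refl) = c + d + 2 * (c * d) , l c d
   where
   l : ∀ c d → suc (2 * c) * suc (2 * d) ≡ suc (2 * (c + d + 2 * (c * d)))
   l = solve-∀

 odd-^ : ∀ {x} → IsOdd x → ∀ k → IsOdd (x ^ k)
 odd-^ o zero = 0 , refl
 odd-^ o (suc k) = odd-* o (odd-^ o k)

 odd-% : ∀ x → x % 2 ≡ 1 → IsOdd x
 odd-% x e = x / 2 , trans (m≡m%n+[m/n]*n x 2) (trans (cong (_+ x / 2 * 2) e) (cong suc (*-comm (x / 2) 2)))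

 -- r³ ∸ 1 = (r ∸ 1)(r² + r + 1), and the second factor is odd.
 odd-quotient : ∀ {r} → IsOdd r → ∀ j → ∃ λ t → pred (r ^ (3 ^ j)) ≡ pred r * suc (2 * t)
 odd-quotient {r} o zero = 0 , trans (cong pred (*-identityʳ r)) (sym (*-identityʳ (pred r)))
 odd-quotient {r} o (suc j) with t , e ← odd-quotient o j with h , e' ← odd-^ o (3 ^ j) = t + u + 2 * (t * u) ,
     trans (cong pred (trans (cong (r ^_) (*-comm 3 (3 ^ j))) (trans (sym (^-*-assoc r (3 ^ j) 3)) (cong (_^ 3) e')))) (trans (cong pred (l₁ h)) (trans (cong (_* suc (2 * u)) (trans (sym (cong pred e')) e)) (l₂ (pred r) t u)))
   where
   u : ℕ
   u = h * (2 * h + 3) + 1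
   l₁ : ∀ h → suc (2 * h) * (suc (2 * h) * (suc (2 * h) * 1)) ≡ suc (2 * h * suc (2 * (h * (2 * h + 3) + 1)))
   l₁ = solve-∀
   l₂ : ∀ r t u → r * suc (2 * t) * suc (2 * u) ≡ r * suc (2 * (t + u + 2 * (t * u)))
   l₂ = solve-∀

 half-double : ∀ H → 2 * H / 2 ≡ H
 half-double H = trans (cong (_/ 2) (*-comm 2 H)) (m*n/n≡m H 2)

 2∸≥ : ∀ H → 2 ≤ H → H ≤ 2 * H ∸ 2
 2∸≥ (suc zero) (s≤s ())
 2∸≥ (suc (suc y)) _ = +-cert y (l y)
   where
   l : ∀ y → 2 * suc (suc y) ∸ 2 ≡ suc (suc y) + y
   l y = trans (cong (_∸ 2) (l' y)) refl
     where
     l' : ∀ y → 2 * suc (suc y) ≡ suc (suc (suc (suc y) + y))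
     l' = solve-∀

 -- How much room the hypothesis of (2a) leaves in P_s for bipartite graphs with sides of size a.
 record Room (a b L : ℕ) : Set where
   field
     26≤a : 26 ≤ a
     a≤ : a ≤ 2 ^ b
     3b≤a : 3 * b ≤ a
     room₁ : 176 * 2 ^ a ≤ L
     room₂ : (6 * b + 2) * 2 ^ a ≤ L
     room₃ : ∀ k → k ≤ 1024 → k ≤ a → 10 * (k * 2 ^ k) ≤ L

 module _ (H : ℕ) (13≤H : 13 ≤ H) where
   2H : ℕ
   2H = 2 * H

   26≤2H : 26 ≤ 2H
   26≤2H = *-monoʳ-≤ 2 13≤H

   bits : ∃ λ b → 2H ≤ 2 ^ b × 2 ^ b ≤ 2 * 2H
   bits = binary-length 2H (≤-trans (s≤s z≤n) 26≤2H)

   b : ℕ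
   b = proj₁ bits

   3b≤2H : 3 * b ≤ 2H
   3b≤2H = *-cancelˡ-≤ 2 (≤-trans (≤-reflexive (l b)) (≤-trans (6x≤2^x b (exponent-≥ b 4 (proj₁ (proj₂ bits)) (≤-trans (by {17} {26}) 26≤2H))) (proj₂ (proj₂ bits))))
     where
     l : ∀ b → 2 * (3 * b) ≡ 6 * (b * 1)
     l = solve-∀

   2^a≤ : 2 ^ 2H ≤ (2H ∸ 2) * central H
   2^a≤ = ≤-trans (≤-reflexive (4^≡ H)) (≤-trans (4^≤ H (≤-trans by 13≤H)) (*-monoˡ-≤ (central H) (2∸≥ H (≤-trans by 13≤H))))

   -- The factor 2^16 covers all constants. Half of it is spent on the passage from `suc L` to L,
   -- and 32768 remains.
   room-gap : ∀ L → 2H < 64000 → 2 ^ (2H + 16) ≤ suc L → Room 2H b L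
   room-gap L small h = record { 26≤a = 26≤2H ; a≤ = proj₁ (proj₂ bits) ; 3b≤a = 3b≤2H ; room₁ = ≤-trans (*-monoˡ-≤ (2 ^ 2H) (by {176} {32768})) big ; room₂ = ≤-trans (*-monoˡ-≤ (2 ^ 2H) 6b+2≤) big
       ; room₃ = λ k k≤ k≤a → ≤-trans (≤-reflexive (sym (*-assoc 10 k (2 ^ k)))) (≤-trans (*-mono-≤ (≤-trans (*-monoʳ-≤ 10 k≤) (by {10240} {32768})) (^-monoʳ-≤ 2 k≤a)) big) }
     where
     big : 32768 * 2 ^ 2H ≤ L
     big = ≤-pred (≤-trans (step (2 ^ 2H) (m^n>0 2 2H)) (≤-trans (≤-reflexive (sym (trans (^-distribˡ-+-* 2 2H 16) (*-comm (2 ^ 2H) (2 ^ 16))))) h))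
       where
       step : ∀ x → 1 ≤ x → suc (32768 * x) ≤ 65536 * x
       step x 1≤x = ≤-trans (+-monoˡ-≤ (32768 * x) (≤-trans 1≤x (m≤n*m x 32768))) (≤-reflexive (sym (*-distribʳ-+ x 32768 32768)))
     b≤16 : b ≤ 16
     b≤16 with b ≤? 16
     ... | yes q = q
     ... | no q = ⊥-elim (<⇒≱ (*-monoʳ-< 2 small) (≤-trans (by {2 * 64000} {2 ^ 17}) (≤-trans (^-monoʳ-≤ 2 (≰⇒> q)) (proj₂ (proj₂ bits)))))
     6b+2≤ : 6 * b + 2 ≤ 32768
     6b+2≤ = ≤-trans (+-monoˡ-≤ 2 (*-monoʳ-≤ 6 b≤16)) (by {98} {32768})

   -- `large-multiple` is applied with z = 176 and with z = 6 b + 2, which is logarithmic in a and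
   -- hence far below √a. In `room₃` the exponent k is at most 1024, far below a.
   room-large : ∀ L → 63999 ≤ 2H → (2H ∸ 2) * central H ≤ L → Room 2H b L
   room-large L large h = record { 26≤a = 26≤2H ; a≤ = proj₁ (proj₂ bits) ; 3b≤a = 3b≤2H ; room₁ = room₁ ; room₂ = ≤-trans (large-multiple H (6 * b + 2) (≤-trans by 13≤H) z≤) h
       ; room₃ = λ k k≤ _ → ≤-trans (≤-reflexive (sym (*-assoc 10 k (2 ^ k)))) (≤-trans (*-monoˡ-≤ (2 ^ k) (≤-trans (*-monoʳ-≤ 10 k≤) (by {10240} {2 ^ 14}))) (≤-trans (≤-reflexive (sym (^-distribˡ-+-* 2 14 k)))
           (≤-trans (^-monoʳ-≤ 2 (≤-trans (+-monoʳ-≤ 14 k≤) (≤-trans (by {1038} {63999}) large))) (≤-trans (m≤n*m (2 ^ 2H) 176) room₁)))) }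
     where
     room₁ : 176 * 2 ^ 2H ≤ L
     room₁ = ≤-trans (large-multiple H 176 (≤-trans by 13≤H) (≤-trans (by {61956} {63999}) large)) h
     16≤b : 16 ≤ b
     16≤b = exponent-≥ b 15 (proj₁ (proj₂ bits)) (≤-trans (by {32769} {63999}) large)
     z≤ : 2 * ((6 * b + 2) * (6 * b + 2)) + 4 ≤ 2H
     z≤ = *-cancelˡ-≤ 2 (≤-trans (poly b 16≤b) (≤-trans (197x²≤2^x b 16≤b) (proj₂ (proj₂ bits))))
       where
       poly : ∀ b → 16 ≤ b → 2 * (2 * ((6 * b + 2) * (6 * b + 2)) + 4) ≤ 197 * (b * (b * 1))
       poly b h = ≤-trans (≤-reflexive (l₁ b)) (≤-trans (+-monoʳ-≤ (144 * (b * b)) (≤-trans (+-monoʳ-≤ (96 * b) (≤-trans (by {24} {6 * 16}) (*-monoʳ-≤ 6 h))) (≤-trans (≤-reflexive (l₂ b)) (≤-trans (≤-trans (*-monoˡ-≤ b (by {102} {7 * 16})) (≤-trans (≤-reflexive (*-assoc 7 16 b)) (*-monoʳ-≤ 7 (*-monoˡ-≤ b h)))) (*-monoˡ-≤ (b * b) (by {7} {53})))))) (≤-reflexive (l₃ b)))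
         where
         l₁ : ∀ b → 2 * (2 * ((6 * b + 2) * (6 * b + 2)) + 4) ≡ 144 * (b * b) + (96 * b + 24)
         l₁ = solve-∀
         l₂ : ∀ b → 96 * b + 6 * b ≡ 102 * b
         l₂ = solve-∀
         l₃ : ∀ b → 144 * (b * b) + 53 * (b * b) ≡ 197 * (b * (b * 1))
         l₃ = solve-∀

 module Series (q : ℕ) (oq : OddPrimePower q) (F : (n : ℕ) → FieldOn ((q ^ 2) ^ (3 ^ n))) where
   p e : ℕ
   p = proj₁ oq
   e = proj₁ (proj₂ (proj₂ (proj₂ oq)))

   pp : Prime p
   pp = proj₁ (proj₂ oq)

   1≤e : 1 ≤ e
   1≤e = proj₁ (proj₂ (proj₂ (proj₂ (proj₂ oq))))

   q≡ : q ≡ p ^ e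
   q≡ = proj₂ (proj₂ (proj₂ (proj₂ (proj₂ oq))))

   p-odd : IsOdd p
   p-odd = odd-% p (proj₁ (proj₂ (proj₂ oq)))

   3≤p : 3 ≤ p
   3≤p = go p-odd (Data.Nat.Base.nonTrivial⇒n>1 p {{prime⇒nonTrivial pp}})
     where
     import Data.Nat.Base
     go : IsOdd p → 1 < p → 3 ≤ p
     go (zero , e) h = ⊥-elim (<⇒≢ h (sym e))
     go (suc c , e) _ = subst (3 ≤_) (sym e) (s≤s (*-monoʳ-≤ 2 {1} {suc c} (s≤s z≤n)))

   3≤q : 3 ≤ q
   3≤q = subst (3 ≤_) (sym q≡) (≤-trans 3≤p (≤-trans (≤-reflexive (sym (*-identityʳ p))) (^-monoʳ-≤ p {{>-nonZero (≤-trans (s≤s z≤n) 3≤p)}} 1≤e)))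

   instance
     q≢0 : NonZero q
     q≢0 = >-nonZero (≤-trans (s≤s z≤n) 3≤q)

   n : ℕ → ℕ
   n s = q ^ (3 ^ s)

   opaque
     n-odd : ∀ s → IsOdd (n s)
     n-odd s = odd-^ (subst IsOdd (sym q≡) (odd-^ p-odd e)) (3 ^ s)

   c : ℕ → ℕ
   c s = proj₁ (n-odd s)

   n≡ : ∀ s → n s ≡ suc (2 * c s)
   n≡ s = proj₂ (n-odd s)

   3≤n : ∀ s → 3 ≤ n s
   3≤n s = ≤-trans 3≤q (≤-trans (≤-reflexive (sym (*-identityʳ q))) (^-monoʳ-≤ q (m^n>0 3 s)))

   1≤c : ∀ s → 1 ≤ c s
   1≤c s = go (c s) (subst (3 ≤_) (n≡ s) (3≤n s))
     where
     go : ∀ c → 3 ≤ suc (2 * c) → 1 ≤ c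
     go zero (s≤s ())
     go (suc c) _ = s≤s z≤n

   27≤n : ∀ s → 1 ≤ s → 27 ≤ n s
   27≤n s 1≤s = ≤-trans (^-monoˡ-≤ 3 3≤q) (^-monoʳ-≤ q (^-monoʳ-≤ 3 1≤s))

   r : ℕ → ℕ
   r s = (q ^ 2) ^ (3 ^ s)

   square-power : ∀ x k → (x ^ 2) ^ k ≡ x ^ k * x ^ k
   square-power x k = trans (^-*-assoc x 2 k) (trans (^-distribˡ-+-* x k (k + 0)) (cong (λ z → x ^ k * x ^ z) (+-identityʳ k)))

   r≡ : ∀ s → r s ≡ n s * n s
   r≡ s = square-power q (3 ^ s)

   r≡′ : ∀ s → r s ≡ q ^ (2 * 3 ^ s)
   r≡′ s = ^-*-assoc q 2 (3 ^ s)

   n≡p^ : ∀ s → n s ≡ p ^ (e * 3 ^ s)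
   n≡p^ s = trans (cong (_^ (3 ^ s)) q≡) (^-*-assoc p e (3 ^ s))

   E : ℕ → ℕ
   E s = e * 3 ^ s + e * 3 ^ s

   r≡p^ : ∀ s → r s ≡ p ^ E s
   r≡p^ s = trans (r≡ s) (trans (cong₂ _*_ (n≡p^ s) (n≡p^ s)) (sym (^-distribˡ-+-* p (e * 3 ^ s) (e * 3 ^ s))))

   P : ℕ → Graph
   P s = Paley (F s)

   module Level (s : ℕ) where
     open FieldChar (F s) using (_⊕_) renaming (_^_ to _^ᶠ_)

     frobenius : ∀ x y → (x ⊕ y) ^ᶠ n s ≡ (x ^ᶠ n s) ⊕ (y ^ᶠ n s)
     frobenius x y = subst (λ k → (x ⊕ y) ^ᶠ k ≡ (x ^ᶠ k) ⊕ (y ^ᶠ k)) (sym (n≡p^ s)) (Frobenius.frob (F s) pp (E s) (r≡p^ s) (e * 3 ^ s) x y)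

     L : ℕ
     L = 2 * c s

     model : LineModel (F s) (suc (suc L)) L
     model = Lines.lineModel (F s) (n s) (c s) (1≤c s) (n≡ s) (r≡ s) frobenius

     design : Design (suc (suc L)) L
     design = LineModel.design model

     universal : ∀ G → IsSimple G → 2 ^ size G ≤ n s → G ⊑ᵢ P s
     universal = SquareField.universal (F s) (n s) (c s) (n≡ s) (r≡ s)

     cycles : ∀ k → 3 ≤ k → k ≤ r s → Cycle k ⊑ P s
     cycles = Rook.cycle-⊑ (F s) (n s) (c s) (1≤c s) (n≡ s) (r≡ s) frobenius

     open Realise (F s) (n s) (c s) (n≡ s) (r≡ s) model

     module _ {a b} (room : Room a b L) where
       open Room room

       2^a≤L : 2 ^ a ≤ L
       2^a≤L = ≤-trans (m≤n*m (2 ^ a) 176) room₁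

       pattern-cycle : ∀ m → 2 ≤ m → CyclePattern design m → Cycle (2 * suc m) ⊑ᵢ P s
       pattern-cycle m 2≤m = CycleOf.cycle-embed 2≤m

       -- Three ranges. Up to k = 13 the greedy embedding works, since 2k ≤ 26 ≤ a; up to 1024 a
       -- factor 10 k is affordable and every pair can be kept alive; beyond that the two-stage
       -- method is used, which asks only for the constant 176.
       even-cycle : ∀ k → 2 ≤ k → k ≤ a → Cycle (2 * k) ⊑ᵢ P s
       even-cycle (suc m) 2≤k k≤a with suc m ≤? 13 | suc m ≤? 1024
       ... | yes q | _ = universal (Cycle (2 * suc m)) (cycle-simple (2 * suc m) (≤-trans 2≤k (m≤n*m (suc m) 2))) (≤-trans (^-monoʳ-≤ 2 (≤-trans (*-monoʳ-≤ 2 q) 26≤a)) (≤-trans 2^a≤L (subst (L ≤_) (sym (n≡ s)) (n≤1+n L))))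
       ... | no q | yes q' = pattern-cycle m (≤-trans (by {2} {13}) (≤-pred (≰⇒> q))) (one-stage design (s≤s z≤n) m (≰⇒> q) (room₃ (suc m) q' k≤a))
       ... | no q | no q' = pattern-cycle m (≤-trans (by {2} {13}) (≤-pred (≰⇒> q))) (two-stage design (s≤s z≤n) m (≰⇒> q') (≤-trans (*-monoʳ-≤ 176 (^-monoʳ-≤ 2 k≤a)) room₁))

       bicliques : BicliqueIn design a
       bicliques = subst (BicliqueIn design) a≡ (biclique design (a ∸ 3 * b) b (subst (26 ≤_) (sym a≡) 26≤a) (subst (_≤ 2 ^ b) (sym a≡) a≤) (subst (λ z → 176 * 2 ^ z ≤ L) (sym a≡) room₁) (subst (λ z → (6 * b + 2) * 2 ^ z ≤ L) (sym a≡) room₂))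
         where
         a≡ : a ∸ 3 * b + 3 * b ≡ a
         a≡ = m∸n+n≡m 3b≤a

       complete-bipartite : ∀ k₁ k₂ → k₁ ≤ a → k₂ ≤ a → K k₁ k₂ ⊑ᵢ P s
       complete-bipartite k₁ k₂ h₁ h₂ = BicliqueOf.K-embed bicliques k₁ k₂ h₁ h₂

       paths : ∀ l → l < 2 * a → Path l ⊑ᵢ P s
       paths l h = ⊑ᵢ-trans {Path l} {Cycle (2 * a)} {P s} (path-in-cycle l (2 * a) h) (even-cycle a (≤-trans by 26≤a) ≤-refl)

   open Level using (universal; cycles)

   extension : ∀ m k → m ≤ k → P m ⊑ᵢ P k
   extension m k m≤k = PaleyExtension.paley-⊑ᵢ (F m) (F k) pp (E m) (E k) (r≡p^ m) (r≡p^ k) (proj₁ quotient) (trans (cong pred r-tower) (proj₂ quotient)) (n m) (c m) (n≡ m) (r≡ m) (n k) (c k) (n≡ k) (r≡ k)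
     where
     quotient : ∃ λ t → pred (r m ^ (3 ^ (k ∸ m))) ≡ pred (r m) * suc (2 * t)
     quotient = odd-quotient (subst IsOdd (sym (r≡ m)) (odd-* (n-odd m) (n-odd m))) (k ∸ m)
     r-tower : r k ≡ r m ^ (3 ^ (k ∸ m))
     r-tower = trans (cong (λ z → (q ^ 2) ^ (3 ^ z)) (sym (m∸n+n≡m m≤k))) (tower (q ^ 2) m (k ∸ m))

   induced-universal : InducedUniversal P
   induced-universal = (λ G sG → suc (size G) , s≤s z≤n , universal (suc (size G)) G sG (small (size G))) , λ m k _ → extension m k
     where
     small : ∀ k → 2 ^ k ≤ q ^ (3 ^ suc k)
     small k = ≤-trans (^-monoˡ-≤ k (≤-trans (by {2} {3}) 3≤q)) (^-monoʳ-≤ q (≤-trans (<⇒≤ (n<2^n k)) (≤-trans (^-monoˡ-≤ k (by {2} {3})) (m≤n*m (3 ^ k) 3))))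

   -- The greedy embedding needs 2^k ≤ n. For k ≥ 5 the hypothesis gives n ≥ 4 · 2^(k-2); for k ≤ 4
   -- the fact that s ≥ 1 gives n ≥ 27 > 2^4.
   invariant : ∀ k s → CeilLog3Logq q ((k ∸ 1) * 2 ^ (k ∸ 2)) s → IP≤ P k s
   invariant k s ((1≤s , h) , _) = complete-index P k s 1≤s λ G sG G≤k → universal s G sG (≤-trans (^-monoʳ-≤ 2 G≤k) (bound k h))
     where
     bound : ∀ k → (k ∸ 1) * 2 ^ (k ∸ 2) ≤ n s → 2 ^ k ≤ n s
     bound k h with k ≤? 4
     ... | yes q' = ≤-trans (^-monoʳ-≤ 2 q') (≤-trans (by {16} {27}) (27≤n s 1≤s))
     ... | no q' = ≤-trans (≤-reflexive (trans (cong (2 ^_) (sym (m+[n∸m]≡n (≤-trans (by {2} {5}) (≰⇒> q'))))) (^-distribˡ-+-* 2 2 (k ∸ 2)))) (≤-trans (*-monoˡ-≤ (2 ^ (k ∸ 2)) (∸-monoˡ-≤ 1 (≰⇒> q'))) h)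

   module Bipartite (m k₁ k₂ : ℕ) (1≤m : 1 ≤ m) (low : n (m ∸ 1) ∸ 1 ≤ k₁) (k₁≤k₂ : k₁ ≤ k₂) (high : k₂ ≤ n m ∸ 1) where
     Q H a : ℕ
     Q = n m
     H = c m
     a = 2 * H

     Q∸1 : Q ∸ 1 ≡ a
     Q∸1 = cong (_∸ 1) (n≡ m)

     k₂≤a : k₂ ≤ a
     k₂≤a = subst (k₂ ≤_) Q∸1 high

     k₁≤a : k₁ ≤ a
     k₁≤a = ≤-trans k₁≤k₂ k₂≤a

     2≤k₁ : 2 ≤ k₁
     2≤k₁ = ≤-trans (∸-monoˡ-≤ 1 (3≤n (m ∸ 1))) low

     13≤H : 13 ≤ H
     13≤H = *-cancelˡ-≤ 2 (≤-pred (subst (27 ≤_) (n≡ m) (27≤n m 1≤m)))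

     binomial : (Q ∸ 1) C ((Q ∸ 1) / 2) ≡ central H
     binomial = trans (cong (λ z → z C (z / 2)) Q∸1) (cong (a C_) (half-double H))

     module Even (s : ℕ) (1≤s : 1 ≤ s) (h : (Q ∸ 3) * ((Q ∸ 1) C ((Q ∸ 1) / 2)) + 3 ≤ n s) where
       L : ℕ
       L = 2 * c s

       h' : (a ∸ 2) * central H + 3 ≤ n s
       h' = subst₂ (λ x y → x * y + 3 ≤ n s) (cong (_∸ 3) (n≡ m)) binomial h

       room : Room a (b H 13≤H) L
       room with Q <? 64000
       ... | yes small = room-gap H 13≤H L (≤-trans (n≤1+n (suc a)) (subst (_≤ 64000) (cong suc (n≡ m)) small)) (subst₂ (λ x y → 2 ^ (x + 16) ≤ y) Q∸1 (n≡ s) (exceptional q m s 3≤q 1≤m small (subst (λ x → 2 ^ x < n s) (sym Q∸1) (<-≤-trans (≤-<-trans (2^a≤ H 13≤H) (subst (((a ∸ 2) * central H) <_) (+-comm 3 _) (s≤s (≤-trans (n≤1+n _) (n≤1+n _))))) h'))))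
       ... | no large = room-large H 13≤H L (≤-pred (subst (64000 ≤_) (n≡ m) (≮⇒≥ large))) (≤-pred (≤-trans (≤-trans (+-monoˡ-≤ ((a ∸ 2) * central H) (by {1} {3})) (≤-reflexive (+-comm 3 ((a ∸ 2) * central H)))) (subst ((a ∸ 2) * central H + 3 ≤_) (n≡ s) h')))

       index : ∀ G → (G ≡ K k₁ k₂) ⊎ (G ≡ Cycle (2 * k₁)) ⊎ (G ≡ Path (k₁ + k₂ ∸ 1)) → Σ ℕ λ t → (t ≤ s) × InducedIndex P G t
       index _ (inj₁ refl) = induced-index P (K k₁ k₂) s 1≤s (Level.complete-bipartite s room k₁ k₂ k₁≤a k₂≤a)
       index _ (inj₂ (inj₁ refl)) = induced-index P (Cycle (2 * k₁)) s 1≤s (Level.even-cycle s room k₁ 2≤k₁ k₁≤a)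
       index _ (inj₂ (inj₂ refl)) = induced-index P (Path (k₁ + k₂ ∸ 1)) s 1≤s (Level.paths s room (k₁ + k₂ ∸ 1) (≤-trans (≤-reflexive (m+[n∸m]≡n (≤-trans (≤-trans (by {1} {2}) 2≤k₁) (m≤m+n k₁ k₂)))) (≤-trans (+-mono-≤ k₁≤a k₂≤a) (≤-reflexive (cong (λ z → a + z) (sym (+-identityʳ a)))))))

     -- The factor 2^Q makes n at least 2^(Q+a), and the cycle has at most Q + a vertices, so the
     -- greedy embedding suffices.
     odd-cycle : ∀ s → 1 ≤ s → 2 ^ Q * (Q ∸ 2) * ((Q ∸ 1) C ((Q ∸ 1) / 2)) + 3 ≤ n s → Σ ℕ λ t → (t ≤ s) × InducedIndex P (Cycle (2 * k₁ + 1)) t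
     odd-cycle s 1≤s h = induced-index P (Cycle (2 * k₁ + 1)) s 1≤s (universal s (Cycle (2 * k₁ + 1)) (cycle-simple (2 * k₁ + 1) (≤-trans (≤-trans 2≤k₁ (m≤n*m k₁ 2)) (m≤m+n (2 * k₁) 1))) bound)
       where
       2^a≤′ : 2 ^ a ≤ (Q ∸ 2) * central H
       2^a≤′ = ≤-trans (2^a≤ H 13≤H) (*-monoˡ-≤ (central H) (subst (λ z → a ∸ 2 ≤ z ∸ 2) (sym (n≡ m)) (∸-monoˡ-≤ 2 (n≤1+n a))))
       size≤ : 2 * k₁ + 1 ≤ Q + a
       size≤ = ≤-trans (+-monoˡ-≤ 1 (*-monoʳ-≤ 2 k₁≤a)) (≤-reflexive (trans (l a) (cong (_+ a) (sym (n≡ m)))))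
         where
         l : ∀ a → 2 * a + 1 ≡ suc a + a
         l = solve-∀
       bound : 2 ^ (2 * k₁ + 1) ≤ n s
       bound = ≤-trans (^-monoʳ-≤ 2 size≤) (≤-trans (≤-reflexive (^-distribˡ-+-* 2 Q a)) (≤-trans (*-monoʳ-≤ (2 ^ Q) 2^a≤′) (≤-trans (≤-reflexive (trans (sym (*-assoc (2 ^ Q) (Q ∸ 2) (central H))) (cong (2 ^ Q * (Q ∸ 2) *_) (sym binomial)))) (≤-trans (m≤m+n _ 3) h))))

   -- P_s has q^(2·3^s) vertices. Counting vertices gives the lower bound, and pancyclicity attains
   -- it for the cycle and the path at the same level.
   subgraph-index : ∀ k → 3 ≤ k → Σ ℕ λ t → Index P (Cycle k) t × Index P (Path k) t × CeilLog3HalfLogq q k t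
   subgraph-index k 3≤k = t , ((1≤t , cycle) , λ s (1≤s , h) → min s (1≤s , fits s (⊑-size {Cycle k} {P s} h))) , ((1≤t , ⊑-trans {Path k} {Cycle k} {P t} (path-⊑-cycle k) cycle) , λ s (1≤s , h) → min s (1≤s , fits s (⊑-size {Path k} {P s} h))) , ((1≤t , k≤) , min)
     where
     fits : ∀ s → k ≤ r s → k ≤ q ^ (2 * 3 ^ s)
     fits s = subst (k ≤_) (r≡′ s)
     exists : k ≤ q ^ (2 * 3 ^ k)
     exists = ≤-trans (<⇒≤ (n<2^n k)) (≤-trans (^-monoˡ-≤ k (≤-trans (by {2} {3}) 3≤q)) (^-monoʳ-≤ q (≤-trans (<⇒≤ (n<2^n k)) (≤-trans (^-monoˡ-≤ k (by {2} {3})) (m≤n*m (3 ^ k) 2)))))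
     opaque
       found : ∃ λ t → t ≤ k × (1 ≤ t × k ≤ q ^ (2 * 3 ^ t)) × (∀ s → (1 ≤ s × k ≤ q ^ (2 * 3 ^ s)) → t ≤ s)
       found = least (λ s → (1 ≤ s) × (k ≤ q ^ (2 * 3 ^ s))) (λ s → (1 ≤? s) ×-dec (k ≤? q ^ (2 * 3 ^ s))) k (≤-trans (by {1} {3}) 3≤k , exists)
     t : ℕ
     t = proj₁ found
     1≤t : 1 ≤ t
     1≤t = proj₁ (proj₁ (proj₂ (proj₂ found)))
     k≤ : k ≤ q ^ (2 * 3 ^ t)
     k≤ = proj₂ (proj₁ (proj₂ (proj₂ found)))
     min : ∀ s → (1 ≤ s × k ≤ q ^ (2 * 3 ^ s)) → t ≤ s
     min = proj₂ (proj₂ (proj₂ found))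
     cycle : Cycle k ⊑ P t
     cycle = cycles t k 3≤k (subst (k ≤_) (sym (r≡′ t)) k≤)

open import Defs
open import Data.Nat using (ℕ; _+_; _*_; _∸_; _^_; _≤_; _/_)
open import Data.Nat.Combinatorics using (_C_)
open import Data.Product using (Σ; _×_)
open import Data.Sum using (_⊎_)
open import Relation.Binary.PropositionalEquality using (_≡_)
open PaleySeries using (module Series)

theorem1p12 : (q : ℕ) → OddPrimePower q →
    (F : (n : ℕ) → FieldOn ((q ^ 2) ^ (3 ^ n))) →
    let P = λ n → Paley (F n) in
    InducedUniversal P
    × (∀ k s → CeilLog3Logq q ((k ∸ 1) * 2 ^ (k ∸ 2)) s → IP≤ P k s)
    × (∀ m k₁ k₂ → 1 ≤ m → q ^ (3 ^ (m ∸ 1)) ∸ 1 ≤ k₁ → k₁ ≤ k₂ → k₂ ≤ q ^ (3 ^ m) ∸ 1 →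
        let Q = q ^ (3 ^ m) in
        (∀ s → CeilLog3Logq q ((Q ∸ 3) * ((Q ∸ 1) C ((Q ∸ 1) / 2)) + 3) s →
          ∀ G → (G ≡ K k₁ k₂) ⊎ (G ≡ Cycle (2 * k₁)) ⊎ (G ≡ Path (k₁ + k₂ ∸ 1)) →
          Σ ℕ λ t → (t ≤ s) × InducedIndex P G t)
        × (∀ s → CeilLog3Logq q (2 ^ Q * (Q ∸ 2) * ((Q ∸ 1) C ((Q ∸ 1) / 2)) + 3) s →
          Σ ℕ λ t → (t ≤ s) × InducedIndex P (Cycle (2 * k₁ + 1)) t))
    × (∀ k → 3 ≤ k → Σ ℕ λ t →
        Index P (Cycle k) t × Index P (Path k) t × CeilLog3HalfLogq q k t)
theorem1p12 q oq F = Series.induced-universal q oq F , Series.invariant q oq F ,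
    (λ m k₁ k₂ 1≤m low k₁≤k₂ high →
      (λ s ((1≤s , h) , _) → Series.Bipartite.Even.index q oq F m k₁ k₂ 1≤m low k₁≤k₂ high s 1≤s h) ,
      λ s ((1≤s , h) , _) → Series.Bipartite.odd-cycle q oq F m k₁ k₂ 1≤m low k₁≤k₂ high s 1≤s h) ,
    Series.subgraph-index q oq F
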